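{- Let $\Delta$ be the strongly regular graph with parameters $(105,32,4,12)$, and let $(\hat\Delta,\theta_1)$ be a connected triple cover of $\Delta$ such that $\hat\Delta$ is distance-regular. Then there is no double cover $(\Gamma,\theta_2)$ of $\hat\Delta$ such that $(\Gamma,\theta_1\circ\theta_2)$ is a distance-regular antipodal $6$-cover of $\Delta$ (i.e., no distance-regular antipodal $6$-cover of $\Delta$ is a double cover of $\hat\Delta$).
   Context: Up to isomorphism there is a unique strongly regular graph with parameters $(105,32,4,12)$ (equivalently, distance-regular with intersection array $\{32,27;1,12\}$); this is $\Delta$. Graphs are regarded as abstract 2-dimensional simplicial complexes whose 0-, 1-, 2-simplices are vertices, edges and triangles. A cover of a graph $\Gamma$ is a pair $(\tilde\Gamma,\theta)$ with $\theta:V(\tilde\Gamma)\to V(\Gamma)$ surjective such that each fibre $\theta^{ -1}(v)$ is a coclique, the union of two distinct fibres over non-adjacent vertices is a coclique, two fibres over an edge induce a perfect matching, and three fibres over a triangle induce a disjoint union of triangles. An $r$-cover has all fibres of size $r$ (double cover: $r=2$, triple cover: $r=3$). For a non-complete graph, an antipodal $r$-cover is a connected $r$-cover $\tilde\Gamma$ in which "equal or at maximum distance (the diameter of $\tilde\Gamma$)" is an equivalence relation on $V(\tilde\Gamma)$ whose classes are exactly the fibres. -}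

module Defs where

open import Data.Nat using (ℕ; zero; suc; _+_)
open import Data.Bool using (Bool; true; false; _∧_; _∨_; not; if_then_else_; T)
open import Data.Fin using (Fin; _≟_)
import Data.Fin as F
open import Data.Product using (Σ; _×_; _,_; ∃; ∃-syntax)
open import Data.Sum using (_⊎_)
open import Function using (_∘_)
open import Relation.Nullary using (¬_)
open import Relation.Nullary.Decidable using (⌊_⌋)
open import Relation.Binary.PropositionalEquality using (_≡_; _≢_)

record Graph (n : ℕ) : Set where
  field
    adj   : Fin n → Fin n → Bool
    sym   : ∀ u v → adj u v ≡ adj v u
    irrefl : ∀ u → adj u u ≡ false
open Graph public

_==_ : ∀ {n} → Fin n → Fin n → Bool
a == b = ⌊ a ≟ b ⌋

count : ∀ {n} → (Fin n → Bool) → ℕ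
count {zero}  p = 0
count {suc n} p = (if p F.zero then 1 else 0) + count (p ∘ F.suc)

anyF : ∀ {n} → (Fin n → Bool) → Bool
anyF {zero}  p = false
anyF {suc n} p = p F.zero ∨ anyF (p ∘ F.suc)

reach : ∀ {n} → Graph n → ℕ → Fin n → Fin n → Bool
reach G zero    u v = u == v
reach G (suc k) u v = reach G k u v ∨ anyF (λ w → reach G k u w ∧ adj G w v)

distIs : ∀ {n} → Graph n → ℕ → Fin n → Fin n → Bool
distIs G zero    u v = reach G zero u v
distIs G (suc k) u v = reach G (suc k) u v ∧ not (reach G k u v)

Connected : ∀ {n} → Graph n → Set
Connected {n} G = ∀ u v → T (reach G n u v)

HasDiameter : ∀ {n} → Graph n → ℕ → Set
HasDiameter G D = (∀ u v → T (reach G D u v)) × (∃[ u ] ∃[ v ] T (distIs G D u v))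

DistanceRegular : ∀ {n} → Graph n → Set
DistanceRegular G =
  Connected G ×
  (Σ (ℕ → ℕ) λ b → Σ (ℕ → ℕ) λ c →
    (∀ i u v → T (distIs G i u v) →
       count (λ w → adj G v w ∧ distIs G (suc i) u w) ≡ b i) ×
    (∀ i u v → T (distIs G (suc i) u v) →
       count (λ w → adj G v w ∧ distIs G i u w) ≡ c (suc i)))

IsSRG : ∀ {n} → Graph n → ℕ → ℕ → ℕ → ℕ → Set
IsSRG {n} G v k l m =
  (n ≡ v) ×
  (∀ u → count (adj G u) ≡ k) ×
  (∀ x y → T (adj G x y) → count (λ w → adj G x w ∧ adj G y w) ≡ l) ×
  (∀ x y → x ≢ y → adj G x y ≡ false → count (λ w → adj G x w ∧ adj G y w) ≡ m)

IsCover : ∀ {m n} → Graph m → Graph n → (Fin m → Fin n) → Set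
IsCover {m} {n} C B θ =
  (∀ a → ∃[ x ] θ x ≡ a) ×
  (∀ x y → θ x ≡ θ y → adj C x y ≡ false) ×
  (∀ x y → θ x ≢ θ y → adj B (θ x) (θ y) ≡ false → adj C x y ≡ false) ×
  -- two fibres over an edge {a,b} induce a perfect matching:
  -- every vertex of the union has exactly one neighbour in the union
  (∀ a b → T (adj B a b) → ∀ x → (θ x ≡ a ⊎ θ x ≡ b) →
     count (λ y → adj C x y ∧ (θ y == a ∨ θ y == b)) ≡ 1) ×
  -- three fibres over a triangle {a,b,c} induce a disjoint union of triangles:
  -- every vertex x of the union has exactly two neighbours y ≠ z in the
  -- union, and these are adjacent (so x lies in a triangle component)
  (∀ a b c → T (adj B a b) → T (adj B b c) → T (adj B a c) →
     let inU = λ (y : Fin m) → θ y == a ∨ θ y == b ∨ θ y == c in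
     ∀ x → T (inU x) →
       ∃[ y ] ∃[ z ] (y ≢ z × T (inU y) × T (inU z) ×
         T (adj C x y) × T (adj C x z) × T (adj C y z) ×
         (∀ w → T (inU w) → T (adj C x w) → w ≡ y ⊎ w ≡ z)))

IsRCover : ∀ {m n} → ℕ → Graph m → Graph n → (Fin m → Fin n) → Set
IsRCover r C B θ = IsCover C B θ × (∀ a → count (λ x → θ x == a) ≡ r)

IsAntipodalRCover : ∀ {m n} → ℕ → Graph m → Graph n → (Fin m → Fin n) → Set
IsAntipodalRCover r C B θ =
  IsRCover r C B θ × Connected C ×
  Σ ℕ λ D → HasDiameter C D ×
    (∀ x y → ((x ≡ y ⊎ T (distIs C D x y)) → θ x ≡ θ y) ×
             (θ x ≡ θ y → (x ≡ y ⊎ T (distIs C D x y))))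

{-# OPTIONS --safe #-}
-- There is no distance-regular antipodal 6-cover Γ of Δ at all, whether or not it factors through Δ̂.
--
-- Let G be the Gram matrix of the projections of the vertices of Δ to the complement of a vertex u in the eigenspace
-- of −10. Comparing traces shows that certain vectors have norm zero, so that G is determined by its
-- columns over the local graph of u, and that this local graph is the incidence graph of a biaffine plane of order 4.
-- That plane is unique, and the possible traces of the vertices at distance 2 from u on it can be enumerated; this
-- identifies Δ with the graph on the flags of PG(2,4) in which (p,l) and (q,k) are adjacent if p ≠ q, l ≠ k and
-- p lies on k or q lies on l.
--
-- In Γ, two vertices over nonadjacent flags with a common neighbour have exactly c₂ of them. Twelve paths of length 2 lead
-- from a vertex to the fibre over a nonadjacent flag. If they reach all six vertices of the fibre then c₂ = 2;
-- otherwise some vertex of the fibre has distance at least 3, and either the antipodal classes are too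
-- short or b₂ = 0. Finally c₂ = 2 is refuted by a finite case distinction: starting
-- with a triangle, any two neighbours of a vertex over nonadjacent flags have a second common neighbour, and no two vertices
-- over nonadjacent flags may have three.
module Submission where

-- The eigenspace of -10 has dimension 20, so `G` has rank 19. On the local graph of `u`, with
-- adjacency matrix `B`, it is 32 - 16 `B` + J. The incidence graph of a biaffine plane of order 4
-- has eigenvalues 4, 2, 0, -2, -4 with multiplicities 1, 12, 6, 12, 1, and 32 - 16 `B` + J vanishes
-- just for the first two: on these 32 vertices it already has the full rank 6 + 12 + 1. This
-- expected spectrum dictates the test vectors and their coefficients. Eigenvalues never occur in
-- the proof; a nonnegative integer measuring the deviation is attached to every vertex, and these
-- integers add up to 0. The refutation of c₂ = 2 rests on complete bipartite subgraphs. An edge of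
-- Δ joins flags (p, l) and (q, k) with, say, p on k; then the flags (p, l′), l′ ≠ k, and (q′, k),
-- q′ ≠ p, form a K₄,₄. Above it, second common neighbours colour the pairs of four vertices with
-- three colours, properly because there is no third common neighbour, and K₄ has six such
-- colourings. The three edges of a triangle give three K₄,₄, whose colourings turn out to be
-- incompatible.

-- Finite sums, inner products and symmetric matrices over the integers.

module LinearAlgebra where
  open import Data.Nat as ℕ using (ℕ; zero; suc)
  open import Data.Integer.Properties using () renaming (_≟_ to _≟ℤ_)
  open import Data.Fin.Properties using (any?)
  open import Relation.Nullary.Decidable using (¬?; decidable-stable)
  open import Data.Integer using (ℤ; +_; -_; _+_; _*_; _-_; _≤_; -[1+_]; +≤+; 0ℤ; 1ℤ)
  open import Data.Integer.Properties hiding (_≟_)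
  open import Data.Integer.Tactic.RingSolver using (solve-∀)
  open import Data.Fin using (Fin; zero; suc; _≟_)
  open import Data.Product using (_×_; _,_; ∃-syntax)
  open import Data.Sum using (_⊎_; inj₁; inj₂)
  open import Function using (_∘_)
  open import Relation.Nullary using (yes; no; contradiction)
  open import Relation.Binary.PropositionalEquality
  import Algebra.Properties.CommutativeMonoid.Sum as CMSum
  import Algebra.Properties.Semiring.Sum as SRSum

  private
    module S = CMSum +-0-commutativeMonoid
    module R = SRSum +-*-semiring

  -- Finite sums are opaque: otherwise unification unfolds them down to ℕ.
  opaque
    sum : ∀ {n} → (Fin n → ℤ) → ℤ
    sum = S.sum

    sum-[] : (f : Fin 0 → ℤ) → sum f ≡ 0ℤ
    sum-[] f = refl

    sum-∷ : ∀ {n} (f : Fin (suc n) → ℤ) → sum f ≡ f zero + sum (f ∘ suc)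
    sum-∷ f = refl

    sum-cong : ∀ {n} {f g : Fin n → ℤ} → (∀ i → f i ≡ g i) → sum f ≡ sum g
    sum-cong = S.sum-cong-≗

    ∑-distrib-+ : ∀ {n} (f g : Fin n → ℤ) → sum (λ i → f i + g i) ≡ sum f + sum g
    ∑-distrib-+ = S.∑-distrib-+

    ∑-comm : ∀ {m n} (f : Fin m → Fin n → ℤ) → sum (λ i → sum (f i)) ≡ sum (λ j → sum (λ i → f i j))
    ∑-comm = S.∑-comm

    *-distribˡ-sum : ∀ {n} x (f : Fin n → ℤ) → x * sum f ≡ sum (λ i → x * f i)
    *-distribˡ-sum = R.*-distribˡ-sum

    *-distribʳ-sum : ∀ {n} x (f : Fin n → ℤ) → sum f * x ≡ sum (λ i → f i * x)
    *-distribʳ-sum = R.*-distribʳ-sum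

  0≤sq : ∀ i → 0ℤ ≤ i * i
  0≤sq (+ zero) = +≤+ ℕ.z≤n
  0≤sq (+ suc n) = +≤+ ℕ.z≤n
  0≤sq -[1+ n ] = +≤+ ℕ.z≤n

  0≤+ : ∀ {i j} → 0ℤ ≤ i → 0ℤ ≤ j → 0ℤ ≤ i + j
  0≤+ p q = +-mono-≤ p q

  0≤* : ∀ {i j} → 0ℤ ≤ i → 0ℤ ≤ j → 0ℤ ≤ i * j
  0≤* {+ m} {+ n} p q = subst (0ℤ ≤_) (pos-* m n) (+≤+ ℕ.z≤n)

  nonneg-+≡0 : ∀ {i j} → 0ℤ ≤ i → 0ℤ ≤ j → i + j ≡ 0ℤ → i ≡ 0ℤ × j ≡ 0ℤ
  nonneg-+≡0 {+ zero} {+ n} p q e = refl , e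

  sq≡0 : ∀ i → i * i ≡ 0ℤ → i ≡ 0ℤ
  sq≡0 i e with i*j≡0⇒i≡0∨j≡0 i e
  ... | inj₁ p = p
  ... | inj₂ p = p

  sum-nonneg : ∀ {n} (f : Fin n → ℤ) → (∀ i → 0ℤ ≤ f i) → 0ℤ ≤ sum f
  sum-nonneg {zero} f p = ≤-reflexive (sym (sum-[] f))
  sum-nonneg {suc n} f p = subst (0ℤ ≤_) (sym (sum-∷ f)) (0≤+ (p zero) (sum-nonneg (f ∘ suc) (p ∘ suc)))

  sum-mono : ∀ {n} (f g : Fin n → ℤ) → (∀ i → f i ≤ g i) → sum f ≤ sum g
  sum-mono {zero} f g p = ≤-reflexive (trans (sum-[] f) (sym (sum-[] g)))
  sum-mono {suc n} f g p = subst₂ _≤_ (sym (sum-∷ f)) (sym (sum-∷ g)) (+-mono-≤ (p zero) (sum-mono (f ∘ suc) (g ∘ suc) (p ∘ suc)))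

  sum≡0⇒≡0 : ∀ {n} (f : Fin n → ℤ) → (∀ i → 0ℤ ≤ f i) → sum f ≡ 0ℤ → ∀ i → f i ≡ 0ℤ
  sum≡0⇒≡0 {suc n} f p e i with nonneg-+≡0 (p zero) (sum-nonneg (f ∘ suc) (p ∘ suc)) (trans (sym (sum-∷ f)) e)
  sum≡0⇒≡0 f p e zero | q , r = q
  sum≡0⇒≡0 f p e (suc i) | q , r = sum≡0⇒≡0 (f ∘ suc) (p ∘ suc) r i

  δ : ∀ {n} → Fin n → Fin n → ℤ
  δ zero zero = 1ℤ
  δ zero (suc j) = 0ℤ
  δ (suc i) zero = 0ℤ
  δ (suc i) (suc j) = δ i j

  δ-refl : ∀ {n} (i : Fin n) → δ i i ≡ 1ℤ
  δ-refl zero = refl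
  δ-refl (suc i) = δ-refl i

  δ-≢ : ∀ {n} {i j : Fin n} → i ≢ j → δ i j ≡ 0ℤ
  δ-≢ {i = zero} {zero} p = contradiction refl p
  δ-≢ {i = zero} {suc j} p = refl
  δ-≢ {i = suc i} {zero} p = refl
  δ-≢ {i = suc i} {suc j} p = δ-≢ (p ∘ cong suc)

  δ-sym : ∀ {n} (i j : Fin n) → δ i j ≡ δ j i
  δ-sym zero zero = refl
  δ-sym zero (suc j) = refl
  δ-sym (suc i) zero = refl
  δ-sym (suc i) (suc j) = δ-sym i j

  δ-subst : ∀ {n} (f : Fin n → ℤ) i j → δ i j * f j ≡ δ i j * f i
  δ-subst f i j with i ≟ j
  ... | yes refl = refl
  ... | no p rewrite δ-≢ p = refl

  sum-0 : ∀ n → sum {n} (λ _ → 0ℤ) ≡ 0ℤ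
  sum-0 zero = sum-[] _
  sum-0 (suc n) = trans (sum-∷ _) (trans (+-identityˡ _) (sum-0 n))

  sum-δ : ∀ {n} (i : Fin n) (f : Fin n → ℤ) → sum (λ j → δ i j * f j) ≡ f i
  sum-δ {suc n} zero f = trans (sum-∷ _) (trans (cong₂ _+_ (*-identityˡ (f zero)) (sum-0 n)) (+-identityʳ (f zero)))
  sum-δ {suc n} (suc i) f = trans (sum-∷ _) (trans (+-identityˡ _) (sum-δ i (f ∘ suc)))

  sum-scale : ∀ {n} c (f : Fin n → ℤ) → sum (λ i → c * f i) ≡ c * sum f
  sum-scale c f = sym (*-distribˡ-sum c f)

  sum-scaleʳ : ∀ {n} c (f : Fin n → ℤ) → sum (λ i → f i * c) ≡ sum f * c
  sum-scaleʳ c f = sym (*-distribʳ-sum c f)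

  ⟨_,_⟩ : ∀ {n} → (Fin n → ℤ) → (Fin n → ℤ) → ℤ
  ⟨ f , g ⟩ = sum (λ i → f i * g i)

  ⟨⟩-cong : ∀ {n} {f f′ g g′ : Fin n → ℤ} → (∀ i → f i ≡ f′ i) → (∀ i → g i ≡ g′ i) → ⟨ f , g ⟩ ≡ ⟨ f′ , g′ ⟩
  ⟨⟩-cong p q = sum-cong (λ i → cong₂ _*_ (p i) (q i))

  ⟨⟩-comm : ∀ {n} (f g : Fin n → ℤ) → ⟨ f , g ⟩ ≡ ⟨ g , f ⟩
  ⟨⟩-comm f g = sum-cong (λ i → *-comm (f i) (g i))

  sum-lin : ∀ {n} a b (f g : Fin n → ℤ) → sum (λ i → a * f i + b * g i) ≡ a * sum f + b * sum g
  sum-lin a b f g = trans (∑-distrib-+ (λ i → a * f i) (λ i → b * g i)) (cong₂ _+_ (sum-scale a f) (sum-scale b g))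

  private
    lin-pw : ∀ a b x y z → (a * x + b * y) * z ≡ a * (x * z) + b * (y * z)
    lin-pw = solve-∀

  ⟨⟩-linˡ : ∀ {n} a b (f g h : Fin n → ℤ) → ⟨ (λ i → a * f i + b * g i) , h ⟩ ≡ a * ⟨ f , h ⟩ + b * ⟨ g , h ⟩
  ⟨⟩-linˡ a b f g h = trans (sum-cong (λ i → lin-pw a b (f i) (g i) (h i))) (sum-lin a b (λ i → f i * h i) (λ i → g i * h i))

  ⟨⟩-linʳ : ∀ {n} a b (f g h : Fin n → ℤ) → ⟨ h , (λ i → a * f i + b * g i) ⟩ ≡ a * ⟨ h , f ⟩ + b * ⟨ h , g ⟩
  ⟨⟩-linʳ a b f g h =
    trans (⟨⟩-comm h _) (trans (⟨⟩-linˡ a b f g h) (cong₂ _+_ (cong (a *_) (⟨⟩-comm f h)) (cong (b *_) (⟨⟩-comm g h))))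

  infixr 8 _∙_
  _∙_ : ∀ {n} → (Fin n → Fin n → ℤ) → (Fin n → ℤ) → (Fin n → ℤ)
  (M ∙ f) i = ⟨ M i , f ⟩

  ∙-cong : ∀ {n} (M : Fin n → Fin n → ℤ) {f g} → (∀ i → f i ≡ g i) → ∀ i → (M ∙ f) i ≡ (M ∙ g) i
  ∙-cong M p i = sum-cong (λ j → cong (M i j *_) (p j))

  ∙-lin : ∀ {n} (M : Fin n → Fin n → ℤ) a b f g i → (M ∙ (λ j → a * f j + b * g j)) i ≡ a * (M ∙ f) i + b * (M ∙ g) i
  ∙-lin M a b f g i = ⟨⟩-linʳ a b f g (M i)

  ⟨⟩-∙ : ∀ {n} (M : Fin n → Fin n → ℤ) f g → ⟨ f , M ∙ g ⟩ ≡ ⟨ (λ j → sum (λ i → f i * M i j)) , g ⟩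
  ⟨⟩-∙ M f g = begin
    sum (λ i → f i * sum (λ j → M i j * g j))     ≡⟨ sum-cong (λ i → *-distribˡ-sum (f i) (λ j → M i j * g j)) ⟩
    sum (λ i → sum (λ j → f i * (M i j * g j)))   ≡⟨ ∑-comm (λ i j → f i * (M i j * g j)) ⟩
    sum (λ j → sum (λ i → f i * (M i j * g j)))   ≡⟨ sum-cong (λ j → sum-cong (λ i → sym (*-assoc (f i) (M i j) (g j)))) ⟩
    sum (λ j → sum (λ i → f i * M i j * g j))     ≡⟨ sum-cong (λ j → sum-scaleʳ (g j) (λ i → f i * M i j)) ⟩
    sum (λ j → sum (λ i → f i * M i j) * g j)     ∎
    where open ≡-Reasoning

  Symmetric : ∀ {n} → (Fin n → Fin n → ℤ) → Set
  Symmetric M = ∀ i j → M i j ≡ M j i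

  ⟨⟩-sym : ∀ {n} (M : Fin n → Fin n → ℤ) → Symmetric M → ∀ f g → ⟨ f , M ∙ g ⟩ ≡ ⟨ M ∙ f , g ⟩
  ⟨⟩-sym M s f g = trans (⟨⟩-∙ M f g) (sum-cong (λ j → cong (_* g j) (sum-cong (λ i → trans (*-comm (f i) (M i j)) (cong (_* f i) (s i j))))))

  opaque
    unfolding sum

    sum₄ : (f : Fin 4 → ℤ) → sum f ≡ f zero + (f (suc zero) + (f (suc (suc zero)) + (f (suc (suc (suc zero))) + 0ℤ)))
    sum₄ f = refl

    sum₅ : (f : Fin 5 → ℤ) → sum f ≡
      f zero + (f (suc zero) + (f (suc (suc zero)) + (f (suc (suc (suc zero))) + (f (suc (suc (suc (suc zero)))) + 0ℤ))))
    sum₅ f = refl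

  ≤-sum : ∀ {n} (f : Fin n → ℤ) → (∀ i → 0ℤ ≤ f i) → ∀ i → f i ≤ sum f
  ≤-sum f p i = subst (_≤ sum f) (sum-δ i f)
    (sum-mono (λ j → δ i j * f j) f (λ j → le j))
    where
    le : ∀ j → δ i j * f j ≤ f j
    le j with i ≟ j
    ... | yes refl = ≤-reflexive (trans (cong (_* f i) (δ-refl i)) (*-identityˡ (f i)))
    ... | no q rewrite δ-≢ q = p j

  ≤-sum₂ : ∀ {n} (f : Fin n → ℤ) → (∀ i → 0ℤ ≤ f i) → ∀ i j → i ≢ j → f i + f j ≤ sum f
  ≤-sum₂ f p i j i≢j = subst (_≤ sum f)
    (trans (∑-distrib-+ _ _) (cong₂ _+_ (sum-δ i f) (sum-δ j f)))
    (sum-mono (λ k → δ i k * f k + δ j k * f k) f le)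
    where
    le : ∀ k → δ i k * f k + δ j k * f k ≤ f k
    le k with i ≟ k | j ≟ k
    ... | yes refl | yes refl = contradiction refl i≢j
    ... | yes refl | no q rewrite δ-refl i | δ-≢ q = ≤-reflexive (trans (+-identityʳ _) (*-identityˡ (f i)))
    ... | no q | yes refl rewrite δ-refl j | δ-≢ q = ≤-reflexive (trans (+-identityˡ _) (*-identityˡ (f j)))
    ... | no q | no r rewrite δ-≢ q | δ-≢ r = p k

  sum-zero : ∀ {n} (f : Fin n → ℤ) → (∀ i → f i ≡ 0ℤ) → sum f ≡ 0ℤ
  sum-zero {n} f p = trans (sum-cong p) (sum-0 n)

  sum-witness : ∀ {n} (f : Fin n → ℤ) → sum f ≢ 0ℤ → ∃[ i ] f i ≢ 0ℤ
  sum-witness f p with any? (λ i → ¬? (f i ≟ℤ 0ℤ))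
  ... | yes q = q
  ... | no q = contradiction (sum-zero f (λ i → decidable-stable (f i ≟ℤ 0ℤ) (λ r → q (i , r)))) p

  sum-01 : ∀ {n} (f : Fin n → ℤ) → (∀ i → f i ≡ 0ℤ ⊎ f i ≡ 1ℤ) →
    (∀ i j → f i ≡ 1ℤ → f j ≡ 1ℤ → i ≡ j) → sum f ≡ 0ℤ ⊎ sum f ≡ 1ℤ
  sum-01 f v uniq with any? (λ i → f i ≟ℤ 1ℤ)
  ... | no q = inj₁ (sum-zero f z)
    where
    z : ∀ i → f i ≡ 0ℤ
    z i with v i
    ... | inj₁ e = e
    ... | inj₂ e = contradiction (i , e) q
  ... | yes (i , e) = inj₂ (trans (sum-cong pw) (trans (sum-δ i (λ _ → 1ℤ)) refl))
    where
    pw : ∀ j → f j ≡ δ i j * 1ℤ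
    pw j with i ≟ j
    ... | yes refl rewrite δ-refl i = e
    ... | no r rewrite δ-≢ r with v j
    ...   | inj₁ z = z
    ...   | inj₂ o = contradiction (uniq i j e o) r

  sum-of-rows : ∀ {n k} (F : Fin k → Fin n → ℤ) (g : Fin n → ℤ) →
    ⟨ (λ w → sum (λ i → F i w)) , g ⟩ ≡ sum (λ i → ⟨ F i , g ⟩)
  sum-of-rows F g = trans (sum-cong (λ w → *-distribʳ-sum (g w) (λ i → F i w))) (∑-comm (λ w i → F i w * g w))

  -- No integer lies strictly between 1 and 2. This is the integrality that turns a count of
  -- neighbours into the exclusion of small subgraphs.
  0≤[i-1][i-2] : ∀ i → 0ℤ ≤ i * i + (- + 3 * i + + 2)
  0≤[i-1][i-2] (+ 0) = +≤+ ℕ.z≤n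
  0≤[i-1][i-2] (+ 1) = +≤+ ℕ.z≤n
  0≤[i-1][i-2] (+ suc (suc k)) = subst (0ℤ ≤_) (eq (+ k)) (0≤* {+ suc k} {+ k} (+≤+ ℕ.z≤n) (+≤+ ℕ.z≤n))
    where
    eq : ∀ x → (1ℤ + x) * x ≡ (+ 2 + x) * (+ 2 + x) + (- + 3 * (+ 2 + x) + + 2)
    eq = solve-∀
  0≤[i-1][i-2] -[1+ k ] = subst (0ℤ ≤_) (eq (+ k)) (0≤* {+ suc (suc k)} {+ suc (suc (suc k))} (+≤+ ℕ.z≤n) (+≤+ ℕ.z≤n))
    where
    eq : ∀ x → (+ 2 + x) * (+ 3 + x) ≡ (- (1ℤ + x)) * (- (1ℤ + x)) + (- + 3 * (- (1ℤ + x)) + + 2)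
    eq = solve-∀

-- The eigenspace of -10 and the local graph of a vertex.

module StronglyRegular where
  open LinearAlgebra
  open import Data.Nat as ℕ using (ℕ; zero; suc)
  open import Data.Integer using (ℤ; +_; -_; _+_; _*_; _-_; _≤_; +≤+; 0ℤ; 1ℤ)
  open import Data.Integer.Properties using () renaming (_≟_ to _≟ℤ_)
  open import Data.Integer.Properties hiding (_≟_)
  open import Data.Integer.Tactic.RingSolver using (solve-∀)
  open import Data.Fin using (Fin; zero; suc; _≟_)
  open import Data.Product using (_×_; _,_; proj₁; proj₂; ∃-syntax)
  open import Data.Empty using (⊥; ⊥-elim)
  open import Data.Sum using (_⊎_; inj₁; inj₂)
  open import Function using (_∘_)
  open import Relation.Nullary using (yes; no; contradiction)
  open import Relation.Binary.PropositionalEquality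
  open ≡-Reasoning

  module Geometry {n : ℕ} (a : Fin n → Fin n → ℤ)
    (a-sym : Symmetric a)
    (a-01 : ∀ i j → a i j ≡ 0ℤ ⊎ a i j ≡ 1ℤ)
    (a-irr : ∀ i → a i i ≡ 0ℤ)
    (a-deg : ∀ i → sum (a i) ≡ + 32)
    (a-sq : ∀ i j → ⟨ a i , a j ⟩ ≡ + 12 + (+ 20 * δ i j + - + 8 * a i j))
    (size : sum {n} (λ _ → 1ℤ) ≡ + 105)
    where

    one : Fin n → ℤ
    one _ = 1ℤ

    -- 84 times the orthogonal projection onto the eigenspace of -10: the matrix 14 - 7A + 2J is 14
    -- - 224 + 210 = 0 on the all-one vector, 0 on the eigenspace of 2, and 14 + 70 on that of -10.
    M : Fin n → Fin n → ℤ
    M i k = + 14 * δ i k + 1ℤ * (- + 7 * a i k + + 2 * one k)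

    ⟨⟩-one : ∀ f → ⟨ f , one ⟩ ≡ sum f
    ⟨⟩-one f = sum-cong (λ i → *-identityʳ (f i))

    private
      ar1 : ∀ d x → + 14 * (+ 14 * d + 1ℤ * (- + 7 * x + + 2 * 1ℤ)) +
         1ℤ * (- + 7 * (+ 14 * x + 1ℤ * (- + 7 * (+ 12 + (+ 20 * d + - + 8 * x)) + + 2 * + 32))
               + + 2 * (+ 14 * 1ℤ + 1ℤ * (- + 7 * + 32 + + 2 * + 105)))
         ≡ + 84 * (+ 14 * d + 1ℤ * (- + 7 * x + + 2 * 1ℤ))
      ar1 = solve-∀

    M-row : ∀ f j → ⟨ f , M j ⟩ ≡ + 14 * f j + 1ℤ * (- + 7 * ⟨ f , a j ⟩ + + 2 * sum f)
    M-row f j = begin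
      ⟨ f , M j ⟩ ≡⟨ ⟨⟩-linʳ (+ 14) 1ℤ (δ j) (λ k → - + 7 * a j k + + 2 * one k) f ⟩
      + 14 * ⟨ f , δ j ⟩ + 1ℤ * ⟨ f , (λ k → - + 7 * a j k + + 2 * one k) ⟩
        ≡⟨ cong₂ (λ s t → + 14 * s + 1ℤ * t) (trans (⟨⟩-comm f (δ j)) (sum-δ j f))
             (trans (⟨⟩-linʳ (- + 7) (+ 2) (a j) one f) (cong (λ s → - + 7 * ⟨ f , a j ⟩ + + 2 * s) (⟨⟩-one f))) ⟩
      + 14 * f j + 1ℤ * (- + 7 * ⟨ f , a j ⟩ + + 2 * sum f) ∎

    M² : ∀ i j → ⟨ M i , M j ⟩ ≡ + 84 * M i j
    M² i j = begin
      ⟨ M i , M j ⟩ ≡⟨ ⟨⟩-linˡ (+ 14) 1ℤ (δ i) (λ k → - + 7 * a i k + + 2 * one k) (M j) ⟩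
      + 14 * ⟨ δ i , M j ⟩ + 1ℤ * ⟨ (λ k → - + 7 * a i k + + 2 * one k) , M j ⟩
        ≡⟨ cong₂ (λ s t → + 14 * s + 1ℤ * t) (sum-δ i (M j)) (⟨⟩-linˡ (- + 7) (+ 2) (a i) one (M j)) ⟩
      + 14 * M j i + 1ℤ * (- + 7 * ⟨ a i , M j ⟩ + + 2 * ⟨ one , M j ⟩)
        ≡⟨ cong₂ (λ s t → + 14 * s + 1ℤ * t) M-ji
             (cong₂ (λ s t → - + 7 * s + + 2 * t) a-row one-row) ⟩
      _ ≡⟨ ar1 (δ i j) (a i j) ⟩
      + 84 * M i j ∎
      where
      M-ji : M j i ≡ M i j
      M-ji = cong₂ (λ s t → + 14 * s + 1ℤ * (- + 7 * t + + 2 * 1ℤ)) (δ-sym j i) (a-sym j i)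
      a-row : ⟨ a i , M j ⟩ ≡ + 14 * a i j + 1ℤ * (- + 7 * (+ 12 + (+ 20 * δ i j + - + 8 * a i j)) + + 2 * + 32)
      a-row = trans (M-row (a i) j) (cong₂ (λ s t → + 14 * a i j + 1ℤ * (- + 7 * s + + 2 * t)) (a-sq i j) (a-deg i))
      one-row : ⟨ one , M j ⟩ ≡ + 14 * 1ℤ + 1ℤ * (- + 7 * + 32 + + 2 * + 105)
      one-row = trans (M-row one j) (cong₂ (λ s t → + 14 * 1ℤ + 1ℤ * (- + 7 * s + + 2 * t))
        (trans (⟨⟩-comm one (a j)) (trans (⟨⟩-one (a j)) (a-deg j))) size)

    M-sym : Symmetric M
    M-sym i j = cong₂ (λ s t → + 14 * s + 1ℤ * (- + 7 * t + + 2 * 1ℤ)) (δ-sym i j) (a-sym i j)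

    private
      -- Here `f w` counts the neighbours of `w` among the chosen vertices, so ⟨f, f⟩ is the sum of
      -- all inner products of their rows; 210 is twice the number of vertices.
      Σ-Q : ∀ {k} (s : Fin k → Fin n) → let f = λ w → sum (λ i → a (s i) w) in
        sum (λ w → f w * f w + (- + 3 * f w + + 2)) ≡
        sum (λ i → sum (λ j → ⟨ a (s i) , a (s j) ⟩)) + (- + 3 * sum (λ (_ : Fin k) → + 32) + + 210)
      Σ-Q s = begin
        sum (λ w → f w * f w + (- + 3 * f w + + 2))
          ≡⟨ ∑-distrib-+ (λ w → f w * f w) (λ w → - + 3 * f w + + 2) ⟩
        ⟨ f , f ⟩ + sum (λ w → - + 3 * f w + + 2 * one w)
          ≡⟨ cong₂ _+_ ff (trans (sum-lin (- + 3) (+ 2) f one) (cong₂ (λ p q → - + 3 * p + + 2 * q) f1 size)) ⟩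
        _ ∎
        where
        f : Fin n → ℤ
        f w = sum (λ i → a (s i) w)
        ff : ⟨ f , f ⟩ ≡ sum (λ i → sum (λ j → ⟨ a (s i) , a (s j) ⟩))
        ff = trans (sum-of-rows (λ i → a (s i)) f)
          (sum-cong (λ i → trans (⟨⟩-comm (a (s i)) f) (trans (sum-of-rows (λ j → a (s j)) (a (s i)))
            (sum-cong (λ j → ⟨⟩-comm (a (s j)) (a (s i)))))))
        f1 : sum f ≡ sum (λ i → + 32)
        f1 = trans (∑-comm (λ w i → a (s i) w)) (sum-cong (λ i → a-deg (s i)))

    adj⇒≢ : ∀ {i j} → a i j ≡ 1ℤ → i ≢ j
    adj⇒≢ {i} e refl = contradiction (trans (sym e) (a-irr i)) (λ ())

    private
      ip-refl : ∀ i → ⟨ a i , a i ⟩ ≡ + 32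
      ip-refl i = trans (a-sq i i) (cong₂ (λ s t → + 12 + (+ 20 * s + - + 8 * t)) (δ-refl i) (a-irr i))

      ip-adj : ∀ {i j} → a i j ≡ 1ℤ → ⟨ a i , a j ⟩ ≡ + 4
      ip-adj {i} {j} e = trans (a-sq i j) (cong₂ (λ s t → + 12 + (+ 20 * s + - + 8 * t)) (δ-≢ (adj⇒≢ e)) e)

      ip-non : ∀ {i j} → i ≢ j → a i j ≡ 0ℤ → ⟨ a i , a j ⟩ ≡ + 12
      ip-non {i} {j} p e = trans (a-sq i j) (cong₂ (λ s t → + 12 + (+ 20 * s + - + 8 * t)) (δ-≢ p) e)

      flip : ∀ {i j x} → a i j ≡ x → a j i ≡ x
      flip {i} {j} e = trans (a-sym j i) e

    -- For f(w) the number of neighbours of w in a 4-clique, Σ (f−1)(f−2) = 2,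
    -- but each vertex of the clique already contributes 2.
    K₄-free : ∀ {p q r s} → a p q ≡ 1ℤ → a p r ≡ 1ℤ → a p s ≡ 1ℤ → a q r ≡ 1ℤ → a q s ≡ 1ℤ → a r s ≡ 1ℤ → ⊥
    K₄-free {p} {q} {r} {s} pq pr ps qr qs rs = contradiction (subst₂ _≤_ lo hi ineq) (λ { (+≤+ (ℕ.s≤s (ℕ.s≤s ()))) })
      where
      v : Fin 4 → Fin n
      v zero = p
      v (suc zero) = q
      v (suc (suc zero)) = r
      v (suc (suc (suc zero))) = s
      f : Fin n → ℤ
      f w = sum (λ i → a (v i) w)
      ineq : _ ≤ _
      ineq = ≤-sum₂ (λ w → f w * f w + (- + 3 * f w + + 2)) (λ w → 0≤[i-1][i-2] (f w)) p q (adj⇒≢ pq)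
      fp : f p ≡ + 3
      fp = trans (sum₄ _) (cong₂ _+_ (a-irr p) (cong₂ _+_ (flip pq) (cong₂ _+_ (flip pr) (cong (_+ 0ℤ) (flip ps)))))
      fq : f q ≡ + 3
      fq = trans (sum₄ _) (cong₂ _+_ pq (cong₂ _+_ (a-irr q) (cong₂ _+_ (flip qr) (cong (_+ 0ℤ) (flip qs)))))
      lo : (f p * f p + (- + 3 * f p + + 2)) + (f q * f q + (- + 3 * f q + + 2)) ≡ + 4
      lo rewrite fp | fq = refl
      row : ∀ i {A B C D} → ⟨ a (v i) , a p ⟩ ≡ A → ⟨ a (v i) , a q ⟩ ≡ B → ⟨ a (v i) , a r ⟩ ≡ C → ⟨ a (v i) , a s ⟩ ≡ D →
        sum (λ j → ⟨ a (v i) , a (v j) ⟩) ≡ A + (B + (C + (D + 0ℤ)))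
      row i A B C D = trans (sum₄ _) (cong₂ _+_ A (cong₂ _+_ B (cong₂ _+_ C (cong (_+ 0ℤ) D))))
      hi : sum (λ w → f w * f w + (- + 3 * f w + + 2)) ≡ + 2
      hi = trans (Σ-Q v) (cong₂ (λ x y → x + (- + 3 * y + + 210))
        (trans (sum₄ _) (cong₂ _+_ (row zero (ip-refl p) (ip-adj pq) (ip-adj pr) (ip-adj ps))
          (cong₂ _+_ (row (suc zero) (ip-adj (flip pq)) (ip-refl q) (ip-adj qr) (ip-adj qs))
          (cong₂ _+_ (row (suc (suc zero)) (ip-adj (flip pr)) (ip-adj (flip qr)) (ip-refl r) (ip-adj rs))
          (cong (_+ 0ℤ) (row (suc (suc (suc zero))) (ip-adj (flip ps)) (ip-adj (flip qs)) (ip-adj (flip rs)) (ip-refl s)))))))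
        (sum₄ _))

    -- Same count for a 4-wheel; here the hub contributes 6.
    W₄-free : ∀ {u p q r s} → a u p ≡ 1ℤ → a u q ≡ 1ℤ → a u r ≡ 1ℤ → a u s ≡ 1ℤ →
      a p q ≡ 1ℤ → a q r ≡ 1ℤ → a r s ≡ 1ℤ → a s p ≡ 1ℤ → p ≢ r → q ≢ s → ⊥
    W₄-free {u} {p} {q} {r} {s} up uq ur us pq qr rs sp p≢r q≢s =
      contradiction (subst₂ _≤_ lo hi (≤-sum (λ w → f w * f w + (- + 3 * f w + + 2)) (λ w → 0≤[i-1][i-2] (f w)) u))
        (λ { (+≤+ (ℕ.s≤s (ℕ.s≤s ()))) })
      where
      v : Fin 5 → Fin n
      v zero = u
      v (suc zero) = p
      v (suc (suc zero)) = q
      v (suc (suc (suc zero))) = r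
      v (suc (suc (suc (suc zero)))) = s
      f : Fin n → ℤ
      f w = sum (λ i → a (v i) w)
      -- A chord of the rim would complete a 4-clique with the hub.
      pr : a p r ≡ 0ℤ
      pr with a-01 p r
      ... | inj₁ e = e
      ... | inj₂ e = ⊥-elim (K₄-free up uq ur pq e qr)
      qs : a q s ≡ 0ℤ
      qs with a-01 q s
      ... | inj₁ e = e
      ... | inj₂ e = ⊥-elim (K₄-free uq ur us qr e rs)
      fu : f u ≡ + 4
      fu = trans (sum₅ _) (cong₂ _+_ (a-irr u) (cong₂ _+_ (flip up) (cong₂ _+_ (flip uq) (cong₂ _+_ (flip ur) (cong (_+ 0ℤ) (flip us))))))
      lo : f u * f u + (- + 3 * f u + + 2) ≡ + 6
      lo rewrite fu = refl
      row : ∀ i {A B C D E} → ⟨ a (v i) , a u ⟩ ≡ E → ⟨ a (v i) , a p ⟩ ≡ A → ⟨ a (v i) , a q ⟩ ≡ B → ⟨ a (v i) , a r ⟩ ≡ C → ⟨ a (v i) , a s ⟩ ≡ D →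
        sum (λ j → ⟨ a (v i) , a (v j) ⟩) ≡ E + (A + (B + (C + (D + 0ℤ))))
      row i E A B C D = trans (sum₅ _) (cong₂ _+_ E (cong₂ _+_ A (cong₂ _+_ B (cong₂ _+_ C (cong (_+ 0ℤ) D)))))
      hi : sum (λ w → f w * f w + (- + 3 * f w + + 2)) ≡ + 2
      hi = trans (Σ-Q v) (cong₂ (λ x y → x + (- + 3 * y + + 210))
        (trans (sum₅ _) (cong₂ _+_ (row zero (ip-refl u) (ip-adj up) (ip-adj uq) (ip-adj ur) (ip-adj us))
          (cong₂ _+_ (row (suc zero) (ip-adj (flip up)) (ip-refl p) (ip-adj pq) (ip-non p≢r pr) (ip-adj (flip sp)))
          (cong₂ _+_ (row (suc (suc zero)) (ip-adj (flip uq)) (ip-adj (flip pq)) (ip-refl q) (ip-adj qr) (ip-non q≢s qs))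
          (cong₂ _+_ (row (suc (suc (suc zero))) (ip-adj (flip ur)) (ip-non (p≢r ∘ sym) (flip pr)) (ip-adj (flip qr)) (ip-refl r) (ip-adj rs))
          (cong (_+ 0ℤ) (row (suc (suc (suc (suc zero)))) (ip-adj (flip us)) (ip-adj sp) (ip-non (q≢s ∘ sym) (flip qs)) (ip-adj (flip rs)) (ip-refl s))))))))
        (sum₅ _))

    module At (u : Fin n) where

      α : Fin n → ℤ
      α = a u

      m : Fin n → ℤ
      m = M u

      -- G is the Gram matrix of the projections of the vertices onto the
      -- orthogonal complement of u in the eigenspace of −10, scaled to be integral.
      G : Fin n → Fin n → ℤ
      G i j = + 32 * δ i j + (- + 16 * a i j + (+ 4 + (+ 2 * (α i + α j) + (- + 4 * (δ u i + δ u j) +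
        (- + 7 * (α i * α j) + (+ 14 * (α i * δ u j + δ u i * α j) + - + 28 * (δ u i * δ u j)))))))

      G-sym : Symmetric G
      G-sym i j rewrite δ-sym i j | a-sym i j = ar (δ j i) (a j i) (α i) (α j) (δ u i) (δ u j)
        where
        ar : ∀ d x ai aj di dj →
          + 32 * d + (- + 16 * x + (+ 4 + (+ 2 * (ai + aj) + (- + 4 * (di + dj) +
          (- + 7 * (ai * aj) + (+ 14 * (ai * dj + di * aj) + - + 28 * (di * dj))))))) ≡
          + 32 * d + (- + 16 * x + (+ 4 + (+ 2 * (aj + ai) + (- + 4 * (dj + di) +
          (- + 7 * (aj * ai) + (+ 14 * (aj * di + dj * ai) + - + 28 * (dj * di)))))))
        ar = solve-∀

      private
        7G : ∀ i j → + 7 * G i j ≡ + 16 * M i j + (- m i) * m j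
        7G i j = ar (δ i j) (a i j) (α i) (α j) (δ u i) (δ u j)
          where
          ar : ∀ d x ai aj di dj →
            + 7 * (+ 32 * d + (- + 16 * x + (+ 4 + (+ 2 * (ai + aj) + (- + 4 * (di + dj) +
            (- + 7 * (ai * aj) + (+ 14 * (ai * dj + di * aj) + - + 28 * (di * dj)))))))) ≡
            + 16 * (+ 14 * d + 1ℤ * (- + 7 * x + + 2 * 1ℤ)) +
            (- (+ 14 * di + 1ℤ * (- + 7 * ai + + 2 * 1ℤ))) * (+ 14 * dj + 1ℤ * (- + 7 * aj + + 2 * 1ℤ))
          ar = solve-∀

        m-u : m u ≡ + 16
        m-u = cong₂ (λ s t → + 14 * s + 1ℤ * (- + 7 * t + + 2 * 1ℤ)) (δ-refl u) (a-irr u)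

        row : ∀ i j → ⟨ (λ k → + 7 * G i k) , (λ k → + 7 * G j k) ⟩ ≡ + 1344 * (+ 7 * G i j)
        row i j = begin
          ⟨ (λ k → + 7 * G i k) , (λ k → + 7 * G j k) ⟩
            ≡⟨ sum-cong (λ k → cong₂ _*_ (7G i k) (7G j k)) ⟩
          ⟨ (λ k → + 16 * M i k + (- m i) * m k) , (λ k → + 16 * M j k + (- m j) * m k) ⟩
            ≡⟨ ⟨⟩-linˡ (+ 16) (- m i) (M i) m _ ⟩
          + 16 * ⟨ M i , (λ k → + 16 * M j k + (- m j) * m k) ⟩ + (- m i) * ⟨ m , (λ k → + 16 * M j k + (- m j) * m k) ⟩
            ≡⟨ cong₂ (λ s t → + 16 * s + (- m i) * t) (⟨⟩-linʳ (+ 16) (- m j) (M j) m (M i)) (⟨⟩-linʳ (+ 16) (- m j) (M j) m m) ⟩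
          + 16 * (+ 16 * ⟨ M i , M j ⟩ + (- m j) * ⟨ M i , m ⟩) + (- m i) * (+ 16 * ⟨ m , M j ⟩ + (- m j) * ⟨ m , m ⟩)
            ≡⟨ cong₂ (λ s t → + 16 * s + (- m i) * t)
                 (cong₂ (λ s t → + 16 * s + (- m j) * t) (M² i j) (trans (M² i u) (cong (+ 84 *_) (M-sym i u))))
                 (cong₂ (λ s t → + 16 * s + (- m j) * t) (M² u j) (trans (M² u u) (cong (+ 84 *_) m-u))) ⟩
          + 16 * (+ 16 * (+ 84 * M i j) + (- m j) * (+ 84 * m i)) + (- m i) * (+ 16 * (+ 84 * m j) + (- m j) * (+ 84 * + 16))
            ≡⟨ ar (M i j) (m i) (m j) ⟩
          + 1344 * (+ 16 * M i j + (- m i) * m j)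
            ≡⟨ cong (+ 1344 *_) (sym (7G i j)) ⟩
          + 1344 * (+ 7 * G i j) ∎
          where
          ar : ∀ x p q → + 16 * (+ 16 * (+ 84 * x) + (- q) * (+ 84 * p)) + (- p) * (+ 16 * (+ 84 * q) + (- q) * (+ 84 * + 16))
            ≡ + 1344 * (+ 16 * x + (- p) * q)
          ar = solve-∀

      -- 16M - m mᵀ is 16 · 84 = 1344 times a projection, hence `G` is 1344 / 7 = 192 times that
      -- projection.
      G² : ∀ i j → ⟨ G i , G j ⟩ ≡ + 192 * G i j
      G² i j = *-cancelˡ-≡ (+ 49) _ _ (begin
        + 49 * ⟨ G i , G j ⟩ ≡⟨ sym (sum-scale (+ 49) _) ⟩
        sum (λ k → + 49 * (G i k * G j k)) ≡⟨ sum-cong (λ k → ar (G i k) (G j k)) ⟩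
        ⟨ (λ k → + 7 * G i k) , (λ k → + 7 * G j k) ⟩ ≡⟨ row i j ⟩
        + 1344 * (+ 7 * G i j) ≡⟨ ar′ (G i j) ⟩
        + 49 * (+ 192 * G i j) ∎)
        where
        ar : ∀ x y → + 49 * (x * y) ≡ (+ 7 * x) * (+ 7 * y)
        ar = solve-∀
        ar′ : ∀ x → + 1344 * (+ 7 * x) ≡ + 49 * (+ 192 * x)
        ar′ = solve-∀

      G∙G∙ : ∀ f i → (G ∙ (G ∙ f)) i ≡ + 192 * (G ∙ f) i
      G∙G∙ f i = begin
        ⟨ G i , G ∙ f ⟩ ≡⟨ ⟨⟩-∙ G (G i) f ⟩
        ⟨ (λ j → ⟨ G i , (λ k → G k j) ⟩) , f ⟩
          ≡⟨ sum-cong (λ j → cong (_* f j) (trans (sum-cong (λ k → cong (G i k *_) (G-sym k j))) (G² i j))) ⟩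
        sum (λ j → + 192 * G i j * f j) ≡⟨ sum-cong (λ j → *-assoc (+ 192) (G i j) (f j)) ⟩
        sum (λ j → + 192 * (G i j * f j)) ≡⟨ sum-scale (+ 192) _ ⟩
        + 192 * (G ∙ f) i ∎

      ⟨G,G⟩ : ∀ f g → ⟨ G ∙ f , G ∙ g ⟩ ≡ + 192 * ⟨ f , G ∙ g ⟩
      ⟨G,G⟩ f g = begin
        ⟨ G ∙ f , G ∙ g ⟩ ≡⟨ sym (⟨⟩-sym G G-sym f (G ∙ g)) ⟩
        ⟨ f , G ∙ (G ∙ g) ⟩ ≡⟨ sum-cong (λ i → trans (cong (f i *_) (G∙G∙ g i)) (ar (f i) ((G ∙ g) i))) ⟩
        sum (λ i → + 192 * (f i * (G ∙ g) i)) ≡⟨ sum-scale (+ 192) _ ⟩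
        + 192 * ⟨ f , G ∙ g ⟩ ∎
        where
        ar : ∀ x y → x * (+ 192 * y) ≡ + 192 * (x * y)
        ar = solve-∀

      -- 192 ⟨f, G f⟩ is the sum of the squares of the entries of G f. In `G-null` the same identity
      -- makes a vector of norm zero a null vector.
      G-nonneg : ∀ f → 0ℤ ≤ ⟨ f , G ∙ f ⟩
      G-nonneg f = *-cancelˡ-≤-pos 0ℤ _ (+ 192)
        (subst (0ℤ ≤_) (⟨G,G⟩ f f) (sum-nonneg _ (λ i → 0≤sq ((G ∙ f) i))))

      G-null : ∀ f → ⟨ f , G ∙ f ⟩ ≡ 0ℤ → ∀ i → (G ∙ f) i ≡ 0ℤ
      G-null f e i = sq≡0 _ (sum≡0⇒≡0 _ (λ j → 0≤sq ((G ∙ f) j)) (trans (⟨G,G⟩ f f) (cong (+ 192 *_) e)) i)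

      α-01 : ∀ x → α x ≡ 0ℤ ⊎ α x ≡ 1ℤ
      α-01 x = a-01 u x

      -- The adjacency matrix of the local graph of u.
      B : Fin n → Fin n → ℤ
      B x y = α x * (a x y * α y)

      B-sym : Symmetric B
      B-sym x y rewrite a-sym x y = ar (α x) (a y x) (α y)
        where
        ar : ∀ p q r → p * (q * r) ≡ r * (q * p)
        ar = solve-∀

      B-off : ∀ {x} → α x ≡ 0ℤ → ∀ y → B x y ≡ 0ℤ
      B-off e y rewrite e = refl

      B-on : ∀ {x y} → α x ≡ 1ℤ → α y ≡ 1ℤ → B x y ≡ a x y
      B-on {x} {y} p q rewrite p | q = trans (*-identityˡ _) (*-identityʳ _)

      B-01 : ∀ x y → B x y ≡ 0ℤ ⊎ B x y ≡ 1ℤ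
      B-01 x y with α-01 x | α-01 y | a-01 x y
      ... | inj₁ p | _ | _ = inj₁ (B-off p y)
      ... | inj₂ p | inj₁ q | _ = inj₁ (trans (B-sym x y) (B-off q x))
      ... | inj₂ p | inj₂ q | inj₁ r = inj₁ (trans (B-on p q) r)
      ... | inj₂ p | inj₂ q | inj₂ r = inj₂ (trans (B-on p q) r)

      0≢1 : ∀ {ℓ} {A : Set ℓ} {x : ℤ} → x ≡ 0ℤ → x ≡ 1ℤ → A
      0≢1 p q = contradiction (trans (sym p) q) (λ ())

      B⇒α : ∀ {x y} → B x y ≡ 1ℤ → α x ≡ 1ℤ
      B⇒α {x} {y} e with α-01 x
      ... | inj₁ p = 0≢1 (B-off p y) e
      ... | inj₂ p = p

      B-flip : ∀ {x y} → B x y ≡ 1ℤ → B y x ≡ 1ℤ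
      B-flip {x} {y} e = trans (B-sym y x) e

      B⇒a : ∀ {x y} → B x y ≡ 1ℤ → a x y ≡ 1ℤ
      B⇒a e = trans (sym (B-on (B⇒α e) (B⇒α (B-flip e)))) e

      Supp : (Fin n → ℤ) → Set
      Supp f = ∀ x → α x ≡ 0ℤ → f x ≡ 0ℤ

      private
        0* : ∀ {x} y → x ≡ 0ℤ → x * y ≡ 0ℤ
        0* y refl = refl
        *0 : ∀ x {y} → y ≡ 0ℤ → x * y ≡ 0ℤ
        *0 x refl = *-zeroʳ x

      B∙-supp : ∀ f → Supp (B ∙ f)
      B∙-supp f x p = sum-zero _ (λ y → 0* (f y) (B-off p y))

      α⇒≢u : ∀ {x} → α x ≡ 1ℤ → u ≢ x
      α⇒≢u = adj⇒≢

      B-deg : ∀ {x} → α x ≡ 1ℤ → sum (B x) ≡ + 4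
      B-deg {x} p = begin
        sum (B x) ≡⟨ sum-cong (λ y → trans (cong (_* (a x y * α y)) p) (*-identityˡ _)) ⟩
        ⟨ a x , a u ⟩ ≡⟨ a-sq x u ⟩
        + 12 + (+ 20 * δ x u + - + 8 * a x u)
          ≡⟨ cong₂ (λ s t → + 12 + (+ 20 * s + - + 8 * t)) (δ-≢ (α⇒≢u p ∘ sym)) (trans (a-sym x u) p) ⟩
        + 4 ∎

      -- Restricted to the local graph, `G` is the matrix 32 - 16B + J, so that its quadratic form
      -- reduces to walk counts in `B`.
      G-on : ∀ {x y} → α x ≡ 1ℤ → α y ≡ 1ℤ → G x y ≡ + 32 * δ x y + 1ℤ * (- + 16 * B x y + 1ℤ)
      G-on {x} {y} p q rewrite p | q | δ-≢ (α⇒≢u p) | δ-≢ (α⇒≢u q) = ar (δ x y) (a x y)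
        where
        ar : ∀ d s → + 32 * d + (- + 16 * s + + 1) ≡ + 32 * d + 1ℤ * (- + 16 * (1ℤ * (s * 1ℤ)) + 1ℤ)
        ar = solve-∀

      G∙-on : ∀ {x} g → Supp g → α x ≡ 1ℤ → (G ∙ g) x ≡ + 32 * g x + 1ℤ * (- + 16 * (B ∙ g) x + 1ℤ * sum g)
      G∙-on {x} g s p = begin
        sum (λ y → G x y * g y) ≡⟨ sum-cong pw ⟩
        sum (λ y → + 32 * (δ x y * g y) + 1ℤ * (- + 16 * (B x y * g y) + 1ℤ * g y))
          ≡⟨ sum-lin (+ 32) 1ℤ (λ y → δ x y * g y) (λ y → - + 16 * (B x y * g y) + 1ℤ * g y) ⟩
        + 32 * sum (λ y → δ x y * g y) + 1ℤ * sum (λ y → - + 16 * (B x y * g y) + 1ℤ * g y)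
          ≡⟨ cong₂ (λ k l → + 32 * k + 1ℤ * l) (sum-δ x g) (sum-lin (- + 16) 1ℤ (λ y → B x y * g y) g) ⟩
        + 32 * g x + 1ℤ * (- + 16 * (B ∙ g) x + 1ℤ * sum g) ∎
        where
        ar : ∀ d b z → (+ 32 * d + 1ℤ * (- + 16 * b + 1ℤ)) * z ≡ + 32 * (d * z) + 1ℤ * (- + 16 * (b * z) + 1ℤ * z)
        ar = solve-∀
        ar0 : ∀ d b → + 32 * (d * 0ℤ) + 1ℤ * (- + 16 * (b * 0ℤ) + 1ℤ * 0ℤ) ≡ 0ℤ
        ar0 = solve-∀
        pw : ∀ y → G x y * g y ≡ + 32 * (δ x y * g y) + 1ℤ * (- + 16 * (B x y * g y) + 1ℤ * g y)
        pw y with α-01 y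
        ... | inj₁ q rewrite s y q = trans (*-zeroʳ (G x y)) (sym (ar0 (δ x y) (B x y)))
        ... | inj₂ q = trans (cong (_* g y) (G-on p q)) (ar (δ x y) (B x y) (g y))

      quad : (f g : Fin n → ℤ) → ℤ
      quad f g = + 32 * ⟨ f , g ⟩ + 1ℤ * (- + 16 * ⟨ f , B ∙ g ⟩ + sum g * sum f)

      ⟨f,G∙g⟩ : ∀ f g → Supp f → Supp g → ⟨ f , G ∙ g ⟩ ≡ quad f g
      ⟨f,G∙g⟩ f g sf sg = begin
        ⟨ f , G ∙ g ⟩ ≡⟨ sum-cong pw ⟩
        ⟨ f , (λ x → + 32 * g x + 1ℤ * (- + 16 * (B ∙ g) x + sum g * one x)) ⟩
          ≡⟨ ⟨⟩-linʳ (+ 32) 1ℤ g (λ x → - + 16 * (B ∙ g) x + sum g * one x) f ⟩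
        + 32 * ⟨ f , g ⟩ + 1ℤ * ⟨ f , (λ x → - + 16 * (B ∙ g) x + sum g * one x) ⟩
          ≡⟨ cong (λ k → + 32 * ⟨ f , g ⟩ + 1ℤ * k) (trans (⟨⟩-linʳ (- + 16) (sum g) (B ∙ g) one f)
               (cong (λ k → - + 16 * ⟨ f , B ∙ g ⟩ + sum g * k) (⟨⟩-one f))) ⟩
        quad f g ∎
        where
        pw : ∀ x → f x * (G ∙ g) x ≡ f x * (+ 32 * g x + 1ℤ * (- + 16 * (B ∙ g) x + sum g * one x))
        pw x with α-01 x
        ... | inj₁ q rewrite sf x q = refl
        ... | inj₂ q = cong (f x *_) (trans (G∙-on g sg q) (cong (λ k → + 32 * g x + 1ℤ * (- + 16 * (B ∙ g) x + k)) (*-comm 1ℤ (sum g))))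

      B-supp : ∀ x → Supp (B x)
      B-supp x y p = trans (B-sym x y) (B-off p x)

      α-supp : Supp α
      α-supp x p = p

      sum-B∙ : ∀ f → Supp f → sum (B ∙ f) ≡ + 4 * sum f
      sum-B∙ f s = begin
        sum (B ∙ f) ≡⟨ sum-cong (λ x → sym (*-identityˡ ((B ∙ f) x))) ⟩
        ⟨ one , B ∙ f ⟩ ≡⟨ ⟨⟩-sym B B-sym one f ⟩
        ⟨ B ∙ one , f ⟩ ≡⟨ sum-cong pw ⟩
        sum (λ x → + 4 * f x) ≡⟨ sum-scale (+ 4) f ⟩
        + 4 * sum f ∎
        where
        pw : ∀ x → (B ∙ one) x * f x ≡ + 4 * f x
        pw x with α-01 x
        ... | inj₁ q rewrite s x q = *-zeroʳ ((B ∙ one) x)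
        ... | inj₂ q = cong (_* f x) (trans (⟨⟩-one (B x)) (B-deg q))

      -- With `u` added, a triangle of the local graph becomes a 4-clique; in `□-free` a quadrangle
      -- becomes a wheel with hub `u`.
      △-free : ∀ {x y z} → B x y ≡ 1ℤ → B y z ≡ 1ℤ → B x z ≡ 1ℤ → ⊥
      △-free xy yz xz = K₄-free (B⇒α xy) (B⇒α yz) (B⇒α (B-flip yz)) (B⇒a xy) (B⇒a xz) (B⇒a yz)

      □-free : ∀ {x y p q} → x ≢ y → B x p ≡ 1ℤ → B x q ≡ 1ℤ → B y p ≡ 1ℤ → B y q ≡ 1ℤ → p ≡ q
      □-free {x} {y} {p} {q} x≢y xp xq yp yq with p ≟ q
      ... | yes e = e
      ... | no p≢q = ⊥-elim (W₄-free (B⇒α xp) (B⇒α (B-flip xp)) (B⇒α yp) (B⇒α (B-flip xq))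
        (B⇒a xp) (B⇒a (B-flip yp)) (B⇒a yq) (B⇒a (B-flip xq)) x≢y p≢q)

      B*B-01 : ∀ x y p → B x p * B y p ≡ 0ℤ ⊎ B x p * B y p ≡ 1ℤ
      B*B-01 x y p with B-01 x p | B-01 y p
      ... | inj₁ e | _ = inj₁ (0* _ e)
      ... | inj₂ e | inj₁ e′ = inj₁ (*0 (B x p) e′)
      ... | inj₂ e | inj₂ e′ rewrite e | e′ = inj₂ refl

      B*B-1 : ∀ {x y p} → B x p * B y p ≡ 1ℤ → B x p ≡ 1ℤ × B y p ≡ 1ℤ
      B*B-1 {x} {y} {p} e with B-01 x p | B-01 y p
      ... | inj₁ z | _ = 0≢1 (0* (B y p) z) e
      ... | inj₂ o | inj₁ z = 0≢1 (*0 (B x p) z) e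
      ... | inj₂ o | inj₂ o′ = o , o′

      B² : Fin n → Fin n → ℤ
      B² x y = ⟨ B x , B y ⟩

      B²-witness : ∀ {x y} → B² x y ≢ 0ℤ → ∃[ p ] B x p ≡ 1ℤ × B y p ≡ 1ℤ
      B²-witness {x} {y} ne with sum-witness (λ p → B x p * B y p) ne
      ... | p , q with B*B-01 x y p
      ...   | inj₁ z = contradiction z q
      ...   | inj₂ o = p , B*B-1 o

      B²-01 : ∀ {x y} → x ≢ y → B² x y ≡ 0ℤ ⊎ B² x y ≡ 1ℤ
      B²-01 {x} {y} x≢y = sum-01 _ (B*B-01 x y) (λ p q e e′ →
        □-free x≢y (proj₁ (B*B-1 e)) (proj₁ (B*B-1 e′)) (proj₂ (B*B-1 e)) (proj₂ (B*B-1 e′)))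

      B²-refl : ∀ {x} → α x ≡ 1ℤ → B² x x ≡ + 4
      B²-refl {x} p = trans (sum-cong sq) (B-deg p)
        where
        sq : ∀ y → B x y * B x y ≡ B x y
        sq y with B-01 x y
        ... | inj₁ e rewrite e = refl
        ... | inj₂ e rewrite e = refl

      B²-adj : ∀ {x y} → B x y ≡ 1ℤ → B² x y ≡ 0ℤ
      B²-adj {x} {y} e with B² x y ≟ℤ 0ℤ
      ... | yes z = z
      ... | no nz with B²-witness nz
      ...   | p , xp , yp = ⊥-elim (△-free e yp xp)

-- The local graph has no pentagons, and a trace computation forces vectors of norm zero.

module TraceIdentity where
  open LinearAlgebra
  open StronglyRegular
  open import Data.Nat as ℕ using (ℕ; zero; suc)
  open import Data.Integer using (ℤ; +_; -_; _+_; _*_; _-_; _≤_; +≤+; 0ℤ; 1ℤ)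
  open import Data.Integer.Properties using () renaming (_≟_ to _≟ℤ_)
  open import Data.Integer.Properties hiding (_≟_)
  open import Data.Integer.Tactic.RingSolver using (solve-∀)
  open import Data.Fin using (Fin; zero; suc; _≟_)
  open import Data.Fin.Properties using (any?)
  open import Data.Product using (_×_; _,_; proj₁; proj₂)
  open import Data.Empty using (⊥; ⊥-elim)
  open import Data.Sum using (_⊎_; inj₁; inj₂)
  open import Function using (_∘_)
  open import Relation.Nullary using (yes; no; contradiction)
  open import Relation.Binary.PropositionalEquality
  open ≡-Reasoning

  private
    collect₁ : ∀ g a c d f h → + 768 * (+ 768 * g + - 1ℤ * a) + - 1ℤ * (+ 768 * a + - 1ℤ * (+ 32 * c + 1ℤ * (- + 16 * d + 0ℤ * 0ℤ))) + + 8 * (+ 8 * f + + 2 * h)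
       ≡ + 589824 * g + (- + 1536 * a + (+ 32 * c + (- + 16 * d + (+ 64 * f + + 16 * h))))
    collect₁ = solve-∀
    -- The error term `E` enters with factor 8 in order that m₅ cancels: its sum over all vertices
    -- would involve the number of hexagons of the local graph, which is not known yet.
    collect₂ : ∀ m₀ m₁ m₂ m₃ m₄ m₅ → 
                  - + 1536 * (+ 24 * m₀ + 1ℤ * (+ 8 * m₁ + 1ℤ * m₂))
                 + (+ 32 * (+ 24 * (+ 24 * m₀ + 1ℤ * (+ 8 * m₁ + 1ℤ * m₂)) + 1ℤ * (+ 8 * (+ 24 * m₁ + 1ℤ * (+ 8 * m₂ + 1ℤ * m₃)) + 1ℤ * (+ 24 * m₂ + 1ℤ * (+ 8 * m₃ + 1ℤ * m₄))))
                 + (- + 16 * (+ 24 * (+ 24 * m₁ + 1ℤ * (+ 8 * m₂ + 1ℤ * m₃)) + 1ℤ * (+ 8 * (+ 24 * m₂ + 1ℤ * (+ 8 * m₃ + 1ℤ * m₄)) + 1ℤ * (+ 24 * m₃ + 1ℤ * (+ 8 * m₄ + 1ℤ * m₅))))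
                 + (+ 64 * (+ 2 * (+ 2 * m₂ + 1ℤ * m₃) + 1ℤ * (+ 2 * m₃ + 1ℤ * m₄)) + + 16 * (+ 2 * (+ 2 * m₃ + 1ℤ * m₄) + 1ℤ * (+ 2 * m₄ + 1ℤ * m₅)))))
       ≡ 1ℤ * (- + 18432 * m₀ + 1ℤ * (- + 9216 * m₁ + 1ℤ * (- + 3840 * m₂ + 1ℤ * (- + 960 * m₃ + - + 96 * m₄))))
    collect₂ = solve-∀

    cong₅ : ∀ (F : ℤ → ℤ → ℤ → ℤ → ℤ → ℤ) {a a′ b b′ c c′ d d′ e e′} →
      a ≡ a′ → b ≡ b′ → c ≡ c′ → d ≡ d′ → e ≡ e′ → F a b c d e ≡ F a′ b′ c′ d′ e′
    cong₅ F refl refl refl refl refl = refl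

  module Trace {n : ℕ} (a : Fin n → Fin n → ℤ)
    (a-sym : Symmetric a)
    (a-01 : ∀ i j → a i j ≡ 0ℤ ⊎ a i j ≡ 1ℤ)
    (a-irr : ∀ i → a i i ≡ 0ℤ)
    (a-deg : ∀ i → sum (a i) ≡ + 32)
    (a-sq : ∀ i j → ⟨ a i , a j ⟩ ≡ + 12 + (+ 20 * δ i j + - + 8 * a i j))
    (size : sum {n} (λ _ → 1ℤ) ≡ + 105)
    (u : Fin n)
    where

    open Geometry a a-sym a-01 a-irr a-deg a-sq size
    open At u

    ⟨⟩-lin₃ : ∀ c d e (f g h k : Fin n → ℤ) →
      ⟨ (λ x → c * f x + 1ℤ * (d * g x + e * h x)) , k ⟩ ≡ c * ⟨ f , k ⟩ + 1ℤ * (d * ⟨ g , k ⟩ + e * ⟨ h , k ⟩)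
    ⟨⟩-lin₃ c d e f g h k = trans (⟨⟩-linˡ c 1ℤ f (λ x → d * g x + e * h x) k)
      (cong (λ z → c * ⟨ f , k ⟩ + 1ℤ * z) (⟨⟩-linˡ d e g h k))

    -- A pentagon r in the local graph would make 12 r + 5 B r a vector of negative norm.
    private
      module Pentagon (s : Fin 5 → Fin n) (αs : ∀ i → α (s i) ≡ 1ℤ)
        (c : Fin 5 → Fin 5 → ℤ) (Bs : ∀ i j → B (s i) (s j) ≡ c i j)
        (δs : ∀ i j → δ (s i) (s j) ≡ δ i j)
        (l : Fin 5 → Fin 5 → ℤ) (lB² : ∀ i j → l i j ≤ B² (s i) (s j))
        (c-total : sum (λ i → sum (c i)) ≡ + 10) (l-total : sum (λ i → sum (l i)) ≡ + 30)
        (c-row : ∀ i → sum (c i) ≡ + 2)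
        where

        r : Fin n → ℤ
        r x = sum (λ i → δ (s i) x)

        ⟨r,_⟩ : ∀ f → ⟨ r , f ⟩ ≡ sum (λ i → f (s i))
        ⟨r, f ⟩ = trans (sum-of-rows (λ i → δ (s i)) f) (sum-cong (λ i → sum-δ (s i) f))

        r′ : Fin n → ℤ
        r′ = B ∙ r

        r′-at : ∀ x → r′ x ≡ sum (λ i → B x (s i))
        r′-at x = trans (⟨⟩-comm (B x) r) ⟨r, B x ⟩

        r-supp : Supp r
        r-supp x p = sum-zero _ (λ i → δ-≢ (λ e → 0≢1 (trans (cong α e) p) (αs i)))

        ρ₀ : ⟨ r , r ⟩ ≡ + 5
        ρ₀ = trans ⟨r, r ⟩ (trans (sum-cong (λ j → trans (sum-cong (λ i → δs i j)) (one-δ j))) (sum₅ _))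
          where
          one-δ : ∀ (j : Fin 5) → sum (λ i → δ i j) ≡ 1ℤ
          one-δ j = trans (sum-cong (λ i → trans (δ-sym i j) (sym (*-identityʳ (δ j i))))) (sum-δ j (λ _ → 1ℤ))

        ρ₁ : ⟨ r , r′ ⟩ ≡ + 10
        ρ₁ = trans ⟨r, r′ ⟩ (trans (sum-cong (λ i → trans (r′-at (s i)) (sum-cong (Bs i)))) c-total)

        -- In a pentagon each vertex has 4 neighbours and any two nonadjacent vertices have at least
        -- one in common: 5 · 4 + 10 · 1.
        ρ₂ : + 30 ≤ ⟨ r′ , r′ ⟩
        ρ₂ = subst₂ _≤_ l-total (sym eq) (sum-mono _ _ (λ i → sum-mono _ _ (λ j → lB² i j)))
          where
          eq : ⟨ r′ , r′ ⟩ ≡ sum (λ i → sum (λ j → B² (s i) (s j)))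
          eq = trans (sym (⟨⟩-sym B B-sym r r′)) (trans ⟨r, B ∙ r′ ⟩ (sum-cong (λ i →
            trans (⟨⟩-sym B B-sym (B (s i)) r) (trans (⟨⟩-comm (B ∙ B (s i)) r)
            (trans ⟨r, B ∙ B (s i) ⟩ (sum-cong (λ j → ⟨⟩-comm (B (s j)) (B (s i)))))))))

        B≥0 : ∀ x y → 0ℤ ≤ B x y
        B≥0 x y with B-01 x y
        ... | inj₁ e = ≤-reflexive (sym e)
        ... | inj₂ e = subst (0ℤ ≤_) (sym e) (+≤+ ℕ.z≤n)

        -- Each vertex of the pentagon has exactly two neighbours on it, so these entries are 0
        -- there and nonnegative elsewhere. Nonnegativity of ⟨d, B d⟩ then bounds ⟨r′, B r′⟩ below
        -- by 4 ⟨r′, r′⟩ - 40.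
        d : Fin n → ℤ
        d x = 1ℤ * r′ x + - + 2 * r x

        d≥0 : ∀ x → 0ℤ ≤ d x
        d≥0 x with any? (λ i → s i ≟ x)
        ... | yes (i , refl) = ≤-reflexive (sym (cong₂ (λ p q → 1ℤ * p + - + 2 * q)
                (trans (r′-at (s i)) (trans (sum-cong (Bs i)) (c-row i)))
                (trans (sum-cong (λ j → trans (δs j i) (trans (δ-sym j i) (sym (*-identityʳ _))))) (sum-δ i (λ _ → 1ℤ)))))
        ... | no ne rewrite sum-zero (λ i → δ (s i) x) (λ i → δ-≢ (λ e → ne (i , e))) =
                subst (0ℤ ≤_) (ar (r′ x)) (subst (0ℤ ≤_) (sym (r′-at x)) (sum-nonneg _ (λ i → B≥0 x (s i))))
          where
          ar : ∀ z → z ≡ 1ℤ * z + - + 2 * 0ℤ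
          ar = solve-∀

        ρ₃-expand : ⟨ d , B ∙ d ⟩ ≡ ⟨ r′ , B ∙ r′ ⟩ + (- + 4 * ⟨ r′ , r′ ⟩ + + 40)
        ρ₃-expand = begin
          ⟨ d , B ∙ d ⟩ ≡⟨ ⟨⟩-linˡ 1ℤ (- + 2) r′ r (B ∙ d) ⟩
          1ℤ * ⟨ r′ , B ∙ d ⟩ + - + 2 * ⟨ r , B ∙ d ⟩
            ≡⟨ cong₂ (λ p q → 1ℤ * p + - + 2 * q) (split r′) (split r) ⟩
          1ℤ * (1ℤ * ⟨ r′ , B ∙ r′ ⟩ + - + 2 * ⟨ r′ , r′ ⟩) + - + 2 * (1ℤ * ⟨ r , B ∙ r′ ⟩ + - + 2 * ⟨ r , r′ ⟩)
            ≡⟨ cong₂ (λ p q → 1ℤ * (1ℤ * ⟨ r′ , B ∙ r′ ⟩ + - + 2 * ⟨ r′ , r′ ⟩) + - + 2 * (1ℤ * p + - + 2 * q))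
                 (⟨⟩-sym B B-sym r r′) ρ₁ ⟩
          _ ≡⟨ ar ⟨ r′ , B ∙ r′ ⟩ ⟨ r′ , r′ ⟩ ⟩
          _ ∎
          where
          split : ∀ f → ⟨ f , B ∙ d ⟩ ≡ 1ℤ * ⟨ f , B ∙ r′ ⟩ + - + 2 * ⟨ f , r′ ⟩
          split f = trans (sum-cong (λ x → cong (f x *_) (∙-lin B 1ℤ (- + 2) r′ r x))) (⟨⟩-linʳ 1ℤ (- + 2) (B ∙ r′) r′ f)
          ar : ∀ p q → 1ℤ * (1ℤ * p + - + 2 * q) + - + 2 * (1ℤ * q + - + 2 * + 10) ≡ p + (- + 4 * q + + 40)
          ar = solve-∀

        ρ₃ : 0ℤ ≤ ⟨ r′ , B ∙ r′ ⟩ + (- + 4 * ⟨ r′ , r′ ⟩ + + 40)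
        ρ₃ = subst (0ℤ ≤_) ρ₃-expand (sum-nonneg _ (λ x → 0≤* (d≥0 x) (sum-nonneg _ (λ y → 0≤* (B≥0 x y) (d≥0 y)))))

        -- With the weights 12 and 5 the two lower bounds suffice: the norm is at most 64000 - 1120
        -- ρ - 400 (4 ρ - 40) = 80000 - 2720 ρ for ρ = ⟨r′, r′⟩, and ρ ≥ 30 makes this at most
        -- -1600.
        z : Fin n → ℤ
        z x = + 12 * r x + + 5 * r′ x

        z-supp : Supp z
        z-supp x p rewrite r-supp x p | B∙-supp r x p = refl

        sum-r : sum r ≡ + 5
        sum-r = trans (sym (⟨⟩-one r)) (trans ⟨r, one ⟩ (sum₅ _))

        sum-r′ : sum r′ ≡ + 20
        sum-r′ = trans (sum-B∙ r r-supp) (cong (+ 4 *_) sum-r)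

        norm : ⟨ z , G ∙ z ⟩ ≡ + 64000 + (- + 1120 * ⟨ r′ , r′ ⟩ + - + 400 * ⟨ r′ , B ∙ r′ ⟩)
        norm = begin
          ⟨ z , G ∙ z ⟩ ≡⟨ ⟨f,G∙g⟩ z z z-supp z-supp ⟩
          quad z z ≡⟨ cong₃ (λ p q t → + 32 * p + 1ℤ * (- + 16 * q + t * t)) zz zBz sz ⟩
          _ ≡⟨ ar ⟨ r′ , r′ ⟩ ⟨ r′ , B ∙ r′ ⟩ ⟩
          _ ∎
          where
          cong₃ : ∀ (f : ℤ → ℤ → ℤ → ℤ) {p p′ q q′ t t′} → p ≡ p′ → q ≡ q′ → t ≡ t′ → f p q t ≡ f p′ q′ t′
          cong₃ f refl refl refl = refl
          zz : ⟨ z , z ⟩ ≡ + 12 * (+ 12 * + 5 + + 5 * + 10) + + 5 * (+ 12 * + 10 + + 5 * ⟨ r′ , r′ ⟩)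
          zz = trans (⟨⟩-linˡ (+ 12) (+ 5) r r′ z) (cong₂ (λ p q → + 12 * p + + 5 * q)
            (trans (⟨⟩-linʳ (+ 12) (+ 5) r r′ r) (cong₂ (λ p q → + 12 * p + + 5 * q) ρ₀ ρ₁))
            (trans (⟨⟩-linʳ (+ 12) (+ 5) r r′ r′) (cong (λ p → + 12 * p + + 5 * ⟨ r′ , r′ ⟩) (trans (⟨⟩-comm r′ r) ρ₁))))
          split : ∀ f → ⟨ f , B ∙ z ⟩ ≡ + 12 * ⟨ f , r′ ⟩ + + 5 * ⟨ f , B ∙ r′ ⟩
          split f = trans (sum-cong (λ x → cong (f x *_) (∙-lin B (+ 12) (+ 5) r r′ x))) (⟨⟩-linʳ (+ 12) (+ 5) r′ (B ∙ r′) f)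
          zBz : ⟨ z , B ∙ z ⟩ ≡ + 12 * (+ 12 * + 10 + + 5 * ⟨ r′ , r′ ⟩) + + 5 * (+ 12 * ⟨ r′ , r′ ⟩ + + 5 * ⟨ r′ , B ∙ r′ ⟩)
          zBz = trans (⟨⟩-linˡ (+ 12) (+ 5) r r′ (B ∙ z)) (cong₂ (λ p q → + 12 * p + + 5 * q)
            (trans (split r) (cong₂ (λ p q → + 12 * p + + 5 * q) ρ₁ (⟨⟩-sym B B-sym r r′))) (split r′))
          sz : sum z ≡ + 160
          sz = trans (sum-lin (+ 12) (+ 5) r r′) (cong₂ (λ p q → + 12 * p + + 5 * q) sum-r sum-r′)
          ar : ∀ p q → + 32 * (+ 12 * (+ 12 * + 5 + + 5 * + 10) + + 5 * (+ 12 * + 10 + + 5 * p)) +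
            1ℤ * (- + 16 * (+ 12 * (+ 12 * + 10 + + 5 * p) + + 5 * (+ 12 * p + + 5 * q)) + + 160 * + 160)
            ≡ + 64000 + (- + 1120 * p + - + 400 * q)
          ar = solve-∀

        absurd : ⊥
        absurd = contradiction (subst (0ℤ ≤_) (ar ⟨ r′ , r′ ⟩ ⟨ r′ , B ∙ r′ ⟩)
            (0≤+ (0≤+ (subst (0ℤ ≤_) norm (G-nonneg z)) (0≤* {+ 400} (+≤+ ℕ.z≤n) ρ₃))
              (0≤* {+ 2720} (+≤+ ℕ.z≤n) (i≤j⇒0≤j-i ρ₂)))) (λ ())
          where
          ar : ∀ p q → + 64000 + (- + 1120 * p + - + 400 * q) + + 400 * (q + (- + 4 * p + + 40)) + + 2720 * (p + - + 30)
            ≡ - + 1600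
          ar = solve-∀

      pentagon-free : ∀ {x p y z q} → B x p ≡ 1ℤ → B p y ≡ 1ℤ → B y z ≡ 1ℤ → B z q ≡ 1ℤ → B q x ≡ 1ℤ → ⊥
      pentagon-free {x} {p} {y} {z} {q} xp py yz zq qx = Pentagon.absurd s αs c Bs δs l lB² c-total l-total c-row
        where
        s : Fin 5 → Fin n
        s zero = x
        s (suc zero) = p
        s (suc (suc zero)) = y
        s (suc (suc (suc zero))) = z
        s (suc (suc (suc (suc zero)))) = q
        nxt : Fin 5 → Fin 5
        nxt zero = suc zero
        nxt (suc zero) = suc (suc zero)
        nxt (suc (suc zero)) = suc (suc (suc zero))
        nxt (suc (suc (suc zero))) = suc (suc (suc (suc zero)))
        nxt (suc (suc (suc (suc zero)))) = zero
        step : ∀ i → B (s i) (s (nxt i)) ≡ 1ℤ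
        step zero = xp
        step (suc zero) = py
        step (suc (suc zero)) = yz
        step (suc (suc (suc zero))) = zq
        step (suc (suc (suc (suc zero)))) = qx
        αs : ∀ i → α (s i) ≡ 1ℤ
        αs i = B⇒α (step i)
        -- The position of two vertices on the pentagon up to rotation; adjacency, equality and the
        -- bound on common neighbours depend on nothing else.
        data Rel : Fin 5 → Fin 5 → Set where
          same : ∀ {i} → Rel i i
          fwd : ∀ {i} → Rel i (nxt i)
          bwd : ∀ {i} → Rel (nxt i) i
          fwd² : ∀ {i} → Rel i (nxt (nxt i))
          bwd² : ∀ {i} → Rel (nxt (nxt i)) i
        rel : ∀ i j → Rel i j
        rel zero zero = same
        rel zero (suc zero) = fwd
        rel zero (suc (suc zero)) = fwd²
        rel zero (suc (suc (suc zero))) = bwd²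
        rel zero (suc (suc (suc (suc zero)))) = bwd
        rel (suc zero) zero = bwd
        rel (suc zero) (suc zero) = same
        rel (suc zero) (suc (suc zero)) = fwd
        rel (suc zero) (suc (suc (suc zero))) = fwd²
        rel (suc zero) (suc (suc (suc (suc zero)))) = bwd²
        rel (suc (suc zero)) zero = bwd²
        rel (suc (suc zero)) (suc zero) = bwd
        rel (suc (suc zero)) (suc (suc zero)) = same
        rel (suc (suc zero)) (suc (suc (suc zero))) = fwd
        rel (suc (suc zero)) (suc (suc (suc (suc zero)))) = fwd²
        rel (suc (suc (suc zero))) zero = fwd²
        rel (suc (suc (suc zero))) (suc zero) = bwd²
        rel (suc (suc (suc zero))) (suc (suc zero)) = bwd
        rel (suc (suc (suc zero))) (suc (suc (suc zero))) = same
        rel (suc (suc (suc zero))) (suc (suc (suc (suc zero)))) = fwd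
        rel (suc (suc (suc (suc zero)))) zero = fwd
        rel (suc (suc (suc (suc zero)))) (suc zero) = fwd²
        rel (suc (suc (suc (suc zero)))) (suc (suc zero)) = bwd²
        rel (suc (suc (suc (suc zero)))) (suc (suc (suc zero))) = bwd
        rel (suc (suc (suc (suc zero)))) (suc (suc (suc (suc zero)))) = same
        val : ∀ {i j} → Rel i j → ℤ
        val same = 0ℤ
        val fwd = 1ℤ
        val bwd = 1ℤ
        val fwd² = 0ℤ
        val bwd² = 0ℤ
        low : ∀ {i j} → Rel i j → ℤ
        low same = + 4
        low fwd = 0ℤ
        low bwd = 0ℤ
        low fwd² = 1ℤ
        low bwd² = 1ℤ
        dlt : ∀ {i j} → Rel i j → ℤ
        dlt same = 1ℤ
        dlt _ = 0ℤ
        far : ∀ i → B (s i) (s (nxt (nxt i))) ≡ 0ℤ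
        far i with B-01 (s i) (s (nxt (nxt i)))
        ... | inj₁ e = e
        ... | inj₂ e = ⊥-elim (△-free (step i) (step (nxt i)) e)
        far-≢ : ∀ i → s i ≢ s (nxt (nxt i))
        far-≢ zero e = △-free yz zq (subst (λ t → B t q ≡ 1ℤ) e (B-flip qx))
        far-≢ (suc zero) e = △-free zq qx (subst (λ t → B t x ≡ 1ℤ) e (B-flip xp))
        far-≢ (suc (suc zero)) e = △-free qx xp (subst (λ t → B t p ≡ 1ℤ) e (B-flip py))
        far-≢ (suc (suc (suc zero))) e = △-free xp py (subst (λ t → B t y ≡ 1ℤ) e (B-flip yz))
        far-≢ (suc (suc (suc (suc zero)))) e = △-free py yz (subst (λ t → B t z ≡ 1ℤ) e (B-flip zq))
        B-irr : ∀ t → B t t ≡ 0ℤ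
        B-irr t with B-01 t t
        ... | inj₁ e = e
        ... | inj₂ e = 0≢1 (a-irr t) (B⇒a e)
        c : Fin 5 → Fin 5 → ℤ
        c i j = val (rel i j)
        l : Fin 5 → Fin 5 → ℤ
        l i j = low (rel i j)
        valB : ∀ {i j} (t : Rel i j) → B (s i) (s j) ≡ val t
        valB (same {i}) = B-irr (s i)
        valB (fwd {i}) = step i
        valB (bwd {i}) = B-flip (step i)
        valB (fwd² {i}) = far i
        valB (bwd² {i}) = trans (B-sym (s (nxt (nxt i))) (s i)) (far i)
        Bs : ∀ i j → B (s i) (s j) ≡ c i j
        Bs i j = valB (rel i j)
        δ-rel : ∀ {i j} (t : Rel i j) → δ (s i) (s j) ≡ dlt t
        δ-rel (same {i}) = δ-refl (s i)
        δ-rel (fwd {i}) = δ-≢ (adj⇒≢ (B⇒a (step i)))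
        δ-rel (bwd {i}) = δ-≢ (adj⇒≢ (B⇒a (step i)) ∘ sym)
        δ-rel (fwd² {i}) = δ-≢ (far-≢ i)
        δ-rel (bwd² {i}) = δ-≢ (far-≢ i ∘ sym)
        dlt-δ : ∀ i j → dlt (rel i j) ≡ δ i j
        dlt-δ zero zero = refl
        dlt-δ zero (suc zero) = refl
        dlt-δ zero (suc (suc zero)) = refl
        dlt-δ zero (suc (suc (suc zero))) = refl
        dlt-δ zero (suc (suc (suc (suc zero)))) = refl
        dlt-δ (suc zero) zero = refl
        dlt-δ (suc zero) (suc zero) = refl
        dlt-δ (suc zero) (suc (suc zero)) = refl
        dlt-δ (suc zero) (suc (suc (suc zero))) = refl
        dlt-δ (suc zero) (suc (suc (suc (suc zero)))) = refl
        dlt-δ (suc (suc zero)) zero = refl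
        dlt-δ (suc (suc zero)) (suc zero) = refl
        dlt-δ (suc (suc zero)) (suc (suc zero)) = refl
        dlt-δ (suc (suc zero)) (suc (suc (suc zero))) = refl
        dlt-δ (suc (suc zero)) (suc (suc (suc (suc zero)))) = refl
        dlt-δ (suc (suc (suc zero))) zero = refl
        dlt-δ (suc (suc (suc zero))) (suc zero) = refl
        dlt-δ (suc (suc (suc zero))) (suc (suc zero)) = refl
        dlt-δ (suc (suc (suc zero))) (suc (suc (suc zero))) = refl
        dlt-δ (suc (suc (suc zero))) (suc (suc (suc (suc zero)))) = refl
        dlt-δ (suc (suc (suc (suc zero)))) zero = refl
        dlt-δ (suc (suc (suc (suc zero)))) (suc zero) = refl
        dlt-δ (suc (suc (suc (suc zero)))) (suc (suc zero)) = refl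
        dlt-δ (suc (suc (suc (suc zero)))) (suc (suc (suc zero))) = refl
        dlt-δ (suc (suc (suc (suc zero)))) (suc (suc (suc (suc zero)))) = refl
        δs : ∀ i j → δ (s i) (s j) ≡ δ i j
        δs i j = trans (δ-rel (rel i j)) (dlt-δ i j)
        common : ∀ i → 1ℤ ≤ B² (s i) (s (nxt (nxt i)))
        common i with B²-01 (far-≢ i)
        ... | inj₂ e = ≤-reflexive (sym e)
        ... | inj₁ e = ⊥-elim (0≢1 (sum≡0⇒≡0 (λ t → B (s i) t * B (s (nxt (nxt i))) t) nn e (s (nxt i))) (cong₂ _*_ (step i) (B-flip (step (nxt i)))))
          where
          nn : ∀ t → 0ℤ ≤ B (s i) t * B (s (nxt (nxt i))) t
          nn t with B*B-01 (s i) (s (nxt (nxt i))) t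
          ... | inj₁ e = ≤-reflexive (sym e)
          ... | inj₂ e = subst (0ℤ ≤_) (sym e) (+≤+ ℕ.z≤n)
        lowB : ∀ {i j} (t : Rel i j) → low t ≤ B² (s i) (s j)
        lowB (same {i}) = ≤-reflexive (sym (B²-refl (αs i)))
        lowB (fwd {i}) = ≤-reflexive (sym (B²-adj (step i)))
        lowB (bwd {i}) = ≤-reflexive (sym (B²-adj (B-flip (step i))))
        lowB (fwd² {i}) = common i
        lowB (bwd² {i}) = subst (1ℤ ≤_) (⟨⟩-comm (B (s i)) (B (s (nxt (nxt i))))) (common i)
        lB² : ∀ i j → l i j ≤ B² (s i) (s j)
        lB² i j = lowB (rel i j)
        l-row : ∀ i → sum (l i) ≡ + 6
        l-row zero = sum₅ _
        l-row (suc zero) = sum₅ _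
        l-row (suc (suc zero)) = sum₅ _
        l-row (suc (suc (suc zero))) = sum₅ _
        l-row (suc (suc (suc (suc zero)))) = sum₅ _
        c-row : ∀ i → sum (c i) ≡ + 2
        c-row zero = sum₅ _
        c-row (suc zero) = sum₅ _
        c-row (suc (suc zero)) = sum₅ _
        c-row (suc (suc (suc zero))) = sum₅ _
        c-row (suc (suc (suc (suc zero)))) = sum₅ _
        c-total : sum (λ i → sum (c i)) ≡ + 10
        c-total = trans (sum-cong c-row) (sum₅ _)
        l-total : sum (λ i → sum (l i)) ≡ + 30
        l-total = trans (sum-cong l-row) (sum₅ _)

    module _ where
      private
        e : Fin n → Fin n → ℤ
        e x y = α x * δ x y

        r₂ : Fin n → Fin n → ℤ
        r₂ x = B ∙ B x

        e-supp : ∀ x → Supp (e x)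
        e-supp x y p with x ≟ y
        ... | yes refl rewrite p = refl
        ... | no q rewrite δ-≢ q = *-zeroʳ (α x)

      -- The columns of G restricted to the local graph, and their images under B.
      v₀ v₁ v₂ v₃ : Fin n → Fin n → ℤ
      v₀ w x = α x * G x w
      v₁ w = B ∙ v₀ w
      v₂ w = B ∙ v₁ w
      v₃ w = B ∙ v₂ w

      v₀-supp : ∀ w → Supp (v₀ w)
      v₀-supp w x p = cong (_* G x w) p

      private
        v₀-G : ∀ w x → v₀ w x ≡ (G ∙ e x) w
        v₀-G w x = sym (begin
          sum (λ y → G w y * (α x * δ x y)) ≡⟨ sum-cong (λ y → ar (G w y) (α x) (δ x y)) ⟩
          sum (λ y → δ x y * (α x * G w y)) ≡⟨ sum-δ x (λ y → α x * G w y) ⟩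
          α x * G w x ≡⟨ cong (α x *_) (G-sym w x) ⟩
          v₀ w x ∎)
          where
          ar : ∀ g s d → g * (s * d) ≡ d * (s * g)
          ar = solve-∀

        Bα : ∀ x y → B x y * α y ≡ B x y
        Bα x y with α-01 y
        ... | inj₁ p = trans (cong (B x y *_) p) (trans (*-zeroʳ (B x y)) (sym (B-supp x y p)))
        ... | inj₂ p = trans (cong (B x y *_) p) (*-identityʳ (B x y))

        v₁-G : ∀ w x → v₁ w x ≡ (G ∙ B x) w
        v₁-G w x = sum-cong (λ y → trans (sym (*-assoc (B x y) (α y) (G y w)))
          (trans (cong (_* G y w) (Bα x y)) (trans (*-comm (B x y) (G y w)) (cong (_* B x y) (G-sym y w)))))

        v₂-G : ∀ w x → v₂ w x ≡ (G ∙ r₂ x) w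
        v₂-G w x = begin
          ⟨ B x , v₁ w ⟩ ≡⟨ sum-cong (λ y → cong (B x y *_) (trans (v₁-G w y) (⟨⟩-comm (G w) (B y)))) ⟩
          ⟨ B x , B ∙ G w ⟩ ≡⟨ ⟨⟩-sym B B-sym (B x) (G w) ⟩
          ⟨ B ∙ B x , G w ⟩ ≡⟨ ⟨⟩-comm (r₂ x) (G w) ⟩
          (G ∙ r₂ x) w ∎

        -- After exchanging the sums, the sum over `w` for fixed `x` is ⟨G p, G q⟩ = 192 ⟨p, G q⟩, a
        -- quantity of the local graph alone. There are 32 vertices `x`, and 192 · 32 = 6144.
        moment : ∀ (p q : Fin n → Fin n → ℤ) (P Q : Fin n → Fin n → ℤ) c →
          (∀ w x → P w x ≡ (G ∙ p x) w) → (∀ w x → Q w x ≡ (G ∙ q x) w) →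
          (∀ x → ⟨ p x , G ∙ q x ⟩ ≡ α x * c) → sum (λ w → ⟨ P w , Q w ⟩) ≡ + 6144 * c
        moment p q P Q c Pp Qq val = begin
          sum (λ w → sum (λ x → P w x * Q w x)) ≡⟨ ∑-comm (λ w x → P w x * Q w x) ⟩
          sum (λ x → sum (λ w → P w x * Q w x)) ≡⟨ sum-cong (λ x → sum-cong (λ w → cong₂ _*_ (Pp w x) (Qq w x))) ⟩
          sum (λ x → ⟨ G ∙ p x , G ∙ q x ⟩) ≡⟨ sum-cong (λ x → trans (⟨G,G⟩ (p x) (q x)) (trans (cong (+ 192 *_) (val x)) (ar (α x) c))) ⟩
          sum (λ x → α x * (+ 192 * c)) ≡⟨ sum-scaleʳ (+ 192 * c) α ⟩
          sum α * (+ 192 * c) ≡⟨ cong (_* (+ 192 * c)) (a-deg u) ⟩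
          + 32 * (+ 192 * c) ≡⟨ ar′ c ⟩
          + 6144 * c ∎
          where
          ar : ∀ s c → + 192 * (s * c) ≡ s * (+ 192 * c)
          ar = solve-∀
          ar′ : ∀ c → + 32 * (+ 192 * c) ≡ + 6144 * c
          ar′ = solve-∀

        on-α : ∀ {t : ℤ} x c → (α x ≡ 0ℤ → t ≡ 0ℤ) → (α x ≡ 1ℤ → t ≡ c) → t ≡ α x * c
        on-α x c z o with α-01 x
        ... | inj₁ p rewrite p = z refl
        ... | inj₂ p rewrite p = trans (o refl) (sym (*-identityˡ c))

        zero-row : ∀ (f g : Fin n → ℤ) → (∀ y → f y ≡ 0ℤ) → ⟨ f , g ⟩ ≡ 0ℤ
        zero-row f g z = sum-zero (λ y → f y * g y) (λ y → cong (_* g y) (z y))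

        r₂-at : ∀ x y → r₂ x y ≡ B² x y
        r₂-at x y = ⟨⟩-comm (B y) (B x)

        r₂-sum : ∀ x → α x ≡ 1ℤ → sum (r₂ x) ≡ + 16
        r₂-sum x p = trans (sum-B∙ (B x) (B-supp x)) (cong (+ 4 *_) (B-deg p))

        r₂-off : ∀ x → α x ≡ 0ℤ → ∀ y → r₂ x y ≡ 0ℤ
        r₂-off x p y = trans (r₂-at x y) (zero-row (B x) (B y) (B-off p))

        B-self : ∀ x → B x x ≡ 0ℤ
        B-self x with B-01 x x
        ... | inj₁ p = p
        ... | inj₂ p = 0≢1 (a-irr x) (B⇒a p)

        B*r₂ : ∀ x → ⟨ B x , r₂ x ⟩ ≡ 0ℤ
        B*r₂ x = sum-zero (λ y → B x y * r₂ x y) pw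
          where
          pw : ∀ y → B x y * r₂ x y ≡ 0ℤ
          pw y with B-01 x y
          ... | inj₁ p = cong (_* r₂ x y) p
          ... | inj₂ p = trans (cong (B x y *_) (trans (r₂-at x y) (B²-adj p))) (*-zeroʳ (B x y))

        -- The row of B² at `x` has the entry 4 at `x` and entries 0 or 1 with sum 12 elsewhere.
        r₂*r₂ : ∀ x → α x ≡ 1ℤ → ⟨ r₂ x , r₂ x ⟩ ≡ + 28
        r₂*r₂ x p = begin
          ⟨ r₂ x , r₂ x ⟩ ≡⟨ sum-cong pw ⟩
          sum (λ y → 1ℤ * r₂ x y + + 12 * (δ x y * 1ℤ)) ≡⟨ sum-lin 1ℤ (+ 12) (r₂ x) (λ y → δ x y * 1ℤ) ⟩
          1ℤ * sum (r₂ x) + + 12 * sum (λ y → δ x y * 1ℤ) ≡⟨ cong₂ (λ s t → 1ℤ * s + + 12 * t) (r₂-sum x p) (sum-δ x one) ⟩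
          + 28 ∎
          where
          pw : ∀ y → r₂ x y * r₂ x y ≡ 1ℤ * r₂ x y + + 12 * (δ x y * 1ℤ)
          pw y with x ≟ y
          ... | yes refl rewrite trans (r₂-at x x) (B²-refl p) | δ-refl x = refl
          ... | no q with B²-01 q
          ...   | inj₁ z rewrite trans (r₂-at x y) z | δ-≢ q = refl
          ...   | inj₂ o rewrite trans (r₂-at x y) o | δ-≢ q = refl

        -- A nonzero term would be a closed walk of length 5.
        r₂Br₂ : ∀ x → ⟨ r₂ x , B ∙ r₂ x ⟩ ≡ 0ℤ
        r₂Br₂ x = sum-zero (λ y → r₂ x y * (B ∙ r₂ x) y) (λ y → trans (*-distribˡ-sum (r₂ x y) (λ z → B y z * r₂ x z)) (sum-zero (λ z → r₂ x y * (B y z * r₂ x z)) (pw y)))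
          where
          pw : ∀ y z → r₂ x y * (B y z * r₂ x z) ≡ 0ℤ
          pw y z with r₂ x y ≟ℤ 0ℤ | r₂ x z ≟ℤ 0ℤ | B-01 y z
          ... | yes p | _ | _ = cong (_* (B y z * r₂ x z)) p
          ... | no _ | yes p | _ = trans (cong (r₂ x y *_) (trans (cong (B y z *_) p) (*-zeroʳ (B y z)))) (*-zeroʳ (r₂ x y))
          ... | no _ | no _ | inj₁ p = trans (cong (r₂ x y *_) (cong (_* r₂ x z) p)) (*-zeroʳ (r₂ x y))
          ... | no ny | no nz | inj₂ p with B²-witness (ny ∘ trans (r₂-at x y)) | B²-witness (nz ∘ trans (r₂-at x z))
          ...   | s , xs , ys | t , xt , zt = ⊥-elim (pentagon-free xs (B-flip ys) p zt (B-flip xt))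

        quad≡ : ∀ {f g : Fin n → ℤ} {i j k l} → ⟨ f , g ⟩ ≡ i → ⟨ f , B ∙ g ⟩ ≡ j → sum g ≡ k → sum f ≡ l →
          quad f g ≡ + 32 * i + 1ℤ * (- + 16 * j + k * l)
        quad≡ refl refl refl refl = refl

        -- `k₀` to `k₄` are the diagonal entries of 32 Bⁿ - 16 Bⁿ⁺¹ + J Bⁿ for n = 0 to 4. The
        -- powers B⁰ to B⁵ have diagonal entries 1, 0, 4, 0, 28, 0, and J Bⁿ contributes 4ⁿ.
        k₀ : ∀ x → ⟨ e x , G ∙ e x ⟩ ≡ α x * + 33
        k₀ x = on-α x (+ 33) (λ p → zero-row (e x) (G ∙ e x) (λ y → cong (_* δ x y) p)) on
          where
          on : α x ≡ 1ℤ → ⟨ e x , G ∙ e x ⟩ ≡ + 33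
          on p = begin
            ⟨ e x , G ∙ e x ⟩ ≡⟨ sum-cong (λ y → cong₂ _*_ (trans (cong (_* δ x y) p) (*-identityˡ (δ x y))) (sym (v₀-G y x))) ⟩
            sum (λ y → δ x y * v₀ y x) ≡⟨ sum-δ x (λ y → v₀ y x) ⟩
            α x * G x x ≡⟨ cong₂ _*_ p (trans (G-on p p) (cong₂ (λ s t → + 32 * s + 1ℤ * (- + 16 * t + 1ℤ)) (δ-refl x) (B-self x))) ⟩
            + 33 ∎

        k₁ : ∀ x → ⟨ e x , G ∙ B x ⟩ ≡ α x * - + 60
        k₁ x = on-α x (- + 60) (λ p → zero-row (e x) (G ∙ B x) (λ y → cong (_* δ x y) p)) on
          where
          on : α x ≡ 1ℤ → ⟨ e x , G ∙ B x ⟩ ≡ - + 60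
          on p = begin
            ⟨ e x , G ∙ B x ⟩ ≡⟨ sum-cong (λ y → cong (_* (G ∙ B x) y) (trans (cong (_* δ x y) p) (*-identityˡ (δ x y)))) ⟩
            sum (λ y → δ x y * (G ∙ B x) y) ≡⟨ sum-δ x (G ∙ B x) ⟩
            (G ∙ B x) x ≡⟨ G∙-on (B x) (B-supp x) p ⟩
            + 32 * B x x + 1ℤ * (- + 16 * B² x x + 1ℤ * sum (B x))
              ≡⟨ cong₂ (λ s t → + 32 * s + 1ℤ * t) (B-self x) (cong₂ (λ s t → - + 16 * s + 1ℤ * t) (B²-refl p) (B-deg p)) ⟩
            - + 60 ∎

        k₂ : ∀ x → ⟨ B x , G ∙ B x ⟩ ≡ α x * + 144
        k₂ x = on-α x (+ 144) (λ p → zero-row (B x) (G ∙ B x) (B-off p)) (λ p →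
          trans (⟨f,G∙g⟩ (B x) (B x) (B-supp x) (B-supp x))
            (quad≡ {B x} {B x} (B²-refl p) (B*r₂ x) (B-deg p) (B-deg p)))

        k₃ : ∀ x → ⟨ B x , G ∙ r₂ x ⟩ ≡ α x * - + 384
        k₃ x = on-α x (- + 384) (λ p → zero-row (B x) (G ∙ r₂ x) (B-off p)) (λ p →
          trans (⟨f,G∙g⟩ (B x) (r₂ x) (B-supp x) (B∙-supp (B x)))
            (quad≡ {B x} {r₂ x} (B*r₂ x) (trans (⟨⟩-sym B B-sym (B x) (r₂ x)) (r₂*r₂ x p)) (r₂-sum x p) (B-deg p)))

        k₄ : ∀ x → ⟨ r₂ x , G ∙ r₂ x ⟩ ≡ α x * + 1152
        k₄ x = on-α x (+ 1152) (λ p → zero-row (r₂ x) (G ∙ r₂ x) (r₂-off x p)) (λ p →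
          trans (⟨f,G∙g⟩ (r₂ x) (r₂ x) (B∙-supp (B x)) (B∙-supp (B x)))
            (quad≡ {r₂ x} {r₂ x} (r₂*r₂ x p) (r₂Br₂ x) (r₂-sum x p) (r₂-sum x p)))

        -- The diagonal entry is 0 at `u`, 33 at its 32 neighbours and 36 at the other 72 vertices;
        -- the total is 192 · 19.
        G-trace : sum (λ w → G w w) ≡ + 3648
        G-trace = begin
          sum (λ w → G w w) ≡⟨ sum-cong pw ⟩
          sum (λ w → + 36 * one w + 1ℤ * (- + 3 * α w + - + 36 * (δ u w * 1ℤ)))
            ≡⟨ trans (sum-lin (+ 36) 1ℤ one (λ w → - + 3 * α w + - + 36 * (δ u w * 1ℤ)))
                 (cong₂ (λ s t → + 36 * s + 1ℤ * t) size (trans (sum-lin (- + 3) (- + 36) α (λ w → δ u w * 1ℤ))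
                   (cong₂ (λ s t → - + 3 * s + - + 36 * t) (a-deg u) (sum-δ u one)))) ⟩
          + 3648 ∎
          where
          pw : ∀ w → G w w ≡ + 36 * one w + 1ℤ * (- + 3 * α w + - + 36 * (δ u w * 1ℤ))
          pw w with α-01 w
          ... | inj₂ p rewrite p | δ-≢ (α⇒≢u p) | δ-refl w | a-irr w = refl
          ... | inj₁ p with u ≟ w
          ...   | yes refl rewrite p | δ-refl u = refl
          ...   | no q rewrite p | δ-≢ q | δ-refl w | a-irr w = refl

        -- In the eigenspace the neighbours of `u` add up to -10 times `u`, which `G` projects to
        -- zero; hence `α` has norm zero.
        sum-v₀ : ∀ w → sum (v₀ w) ≡ 0ℤ
        sum-v₀ w = trans (sum-cong (λ x → trans (*-comm (α x) (G x w)) (cong (_* α x) (G-sym x w)))) (G-null α null w)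
          where
          αα : ⟨ α , α ⟩ ≡ + 32
          αα = trans (a-sq u u) (cong₂ (λ s t → + 12 + (+ 20 * s + - + 8 * t)) (δ-refl u) (a-irr u))
          αBα : ⟨ α , B ∙ α ⟩ ≡ + 128
          αBα = trans (sum-cong (λ x → on-α x (+ 4) (λ p → cong (_* (B ∙ α) x) p)
            (λ p → trans (cong₂ _*_ p (trans (sum-cong (Bα x)) (B-deg p))) refl)))
            (trans (sum-scaleʳ (+ 4) α) (cong (_* + 4) (a-deg u)))
          null : ⟨ α , G ∙ α ⟩ ≡ 0ℤ
          null = trans (⟨f,G∙g⟩ α α α-supp α-supp) (quad≡ {α} {α} αα αBα (a-deg u) (a-deg u))

      opaque
        -- The polynomial 24 + 8μ + μ² takes the values 768 / (32 - 16μ) at μ = 0, -2, -4, so q /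
        -- 768 should express the projection of `w` by those of the local graph, and `Y` should be a
        -- null vector. The polynomial 2μ + μ² vanishes at 0 and -2, so `t` should lie in the
        -- eigenspace of -4, that is, change sign along every edge.
        q t Y : Fin n → Fin n → ℤ
        q w x = + 24 * v₀ w x + 1ℤ * (+ 8 * v₁ w x + 1ℤ * v₂ w x)
        t w x = + 2 * v₁ w x + 1ℤ * v₂ w x
        Y w x = + 768 * δ w x + - 1ℤ * q w x

        q-at : ∀ w x → q w x ≡ + 24 * v₀ w x + 1ℤ * (+ 8 * v₁ w x + 1ℤ * v₂ w x)
        q-at w x = refl

        t-at : ∀ w x → t w x ≡ + 2 * v₁ w x + 1ℤ * v₂ w x
        t-at w x = refl

        Y-at : ∀ w x → Y w x ≡ + 768 * δ w x + - 1ℤ * q w x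
        Y-at w x = refl

      opaque
        -- Measures how far `t w` is from changing sign along the edge from `x` to `y`.
        ε : Fin n → Fin n → Fin n → ℤ
        ε w x y = B x y * ((t w x + t w y) * (t w x + t w y))

        ε-at : ∀ w x y → ε w x y ≡ B x y * ((t w x + t w y) * (t w x + t w y))
        ε-at w x y = refl

      ε≥0 : ∀ w x y → 0ℤ ≤ ε w x y
      ε≥0 w x y with B-01 x y
      ... | inj₁ p = ≤-reflexive (sym (trans (ε-at w x y) (cong (_* ((t w x + t w y) * (t w x + t w y))) p)))
      ... | inj₂ p = subst (0ℤ ≤_) (sym (trans (ε-at w x y) (trans (cong (_* ((t w x + t w y) * (t w x + t w y))) p) (*-identityˡ _)))) (0≤sq (t w x + t w y))

      E : Fin n → ℤ
      E w = sum (λ x → sum (ε w x))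

      private
        module W (w : Fin n) where
          -- By symmetry of `B` these are ⟨v₀, Bᵏ v₀⟩ for k = 0 to 5, in terms of which all
          -- quadratic expressions below are written.
          m₀ m₁ m₂ m₃ m₄ m₅ : ℤ
          m₀ = ⟨ v₀ w , v₀ w ⟩
          m₁ = ⟨ v₀ w , v₁ w ⟩
          m₂ = ⟨ v₁ w , v₁ w ⟩
          m₃ = ⟨ v₁ w , v₂ w ⟩
          m₄ = ⟨ v₂ w , v₂ w ⟩
          m₅ = ⟨ v₂ w , v₃ w ⟩

          m₂′ : ⟨ v₀ w , v₂ w ⟩ ≡ m₂
          m₂′ = ⟨⟩-sym B B-sym (v₀ w) (v₁ w)
          m₃′ : ⟨ v₀ w , v₃ w ⟩ ≡ m₃
          m₃′ = ⟨⟩-sym B B-sym (v₀ w) (v₂ w)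
          m₄′ : ⟨ v₁ w , v₃ w ⟩ ≡ m₄
          m₄′ = ⟨⟩-sym B B-sym (v₁ w) (v₂ w)

          q·_ : ∀ k → ⟨ q w , k ⟩ ≡ + 24 * ⟨ v₀ w , k ⟩ + 1ℤ * (+ 8 * ⟨ v₁ w , k ⟩ + 1ℤ * ⟨ v₂ w , k ⟩)
          q· k = trans (sum-cong (λ x → cong (_* k x) (q-at w x))) (⟨⟩-lin₃ (+ 24) (+ 8) 1ℤ (v₀ w) (v₁ w) (v₂ w) k)

          qv : ⟨ q w , v₀ w ⟩ ≡ + 24 * m₀ + 1ℤ * (+ 8 * m₁ + 1ℤ * m₂)
          qv = trans (q· v₀ w) (cong₂ (λ i j → + 24 * m₀ + 1ℤ * (+ 8 * i + 1ℤ * j)) (⟨⟩-comm (v₁ w) (v₀ w)) (trans (⟨⟩-comm (v₂ w) (v₀ w)) m₂′))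

          vq₁ : ⟨ v₁ w , q w ⟩ ≡ + 24 * m₁ + 1ℤ * (+ 8 * m₂ + 1ℤ * m₃)
          vq₁ = trans (⟨⟩-comm (v₁ w) (q w)) (trans (q· v₁ w) (cong (λ j → + 24 * m₁ + 1ℤ * (+ 8 * m₂ + 1ℤ * j)) (⟨⟩-comm (v₂ w) (v₁ w))))

          vq₂ : ⟨ v₂ w , q w ⟩ ≡ + 24 * m₂ + 1ℤ * (+ 8 * m₃ + 1ℤ * m₄)
          vq₂ = trans (⟨⟩-comm (v₂ w) (q w)) (trans (q· v₂ w) (cong (λ i → + 24 * i + 1ℤ * (+ 8 * m₃ + 1ℤ * m₄)) m₂′))

          vq₃ : ⟨ q w , v₃ w ⟩ ≡ + 24 * m₃ + 1ℤ * (+ 8 * m₄ + 1ℤ * m₅)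
          vq₃ = trans (q· v₃ w) (cong₂ (λ i j → + 24 * i + 1ℤ * (+ 8 * j + 1ℤ * m₅)) m₃′ m₄′)

          qq : ⟨ q w , q w ⟩ ≡ + 24 * (+ 24 * m₀ + 1ℤ * (+ 8 * m₁ + 1ℤ * m₂)) +
            1ℤ * (+ 8 * (+ 24 * m₁ + 1ℤ * (+ 8 * m₂ + 1ℤ * m₃)) + 1ℤ * (+ 24 * m₂ + 1ℤ * (+ 8 * m₃ + 1ℤ * m₄)))
          qq = trans (q· q w) (cong₂ (λ i j → + 24 * i + 1ℤ * j) (trans (⟨⟩-comm (v₀ w) (q w)) qv)
            (cong₂ (λ i j → + 8 * i + 1ℤ * j) vq₁ vq₂))

          Bq : ∀ x → (B ∙ q w) x ≡ + 24 * v₁ w x + 1ℤ * (+ 8 * v₂ w x + 1ℤ * v₃ w x)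
          Bq x = trans (∙-cong B (q-at w) x) (trans (∙-lin B (+ 24) 1ℤ (v₀ w) (λ y → + 8 * v₁ w y + 1ℤ * v₂ w y) x)
            (cong (λ k → + 24 * v₁ w x + 1ℤ * k) (∙-lin B (+ 8) 1ℤ (v₁ w) (v₂ w) x)))

          qBq : ⟨ q w , B ∙ q w ⟩ ≡ + 24 * (+ 24 * m₁ + 1ℤ * (+ 8 * m₂ + 1ℤ * m₃)) +
            1ℤ * (+ 8 * (+ 24 * m₂ + 1ℤ * (+ 8 * m₃ + 1ℤ * m₄)) + 1ℤ * (+ 24 * m₃ + 1ℤ * (+ 8 * m₄ + 1ℤ * m₅)))
          qBq = trans (⟨⟩-comm (q w) (B ∙ q w)) (trans (sum-cong (λ x → cong (_* q w x) (Bq x)))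
            (trans (⟨⟩-lin₃ (+ 24) (+ 8) 1ℤ (v₁ w) (v₂ w) (v₃ w) (q w)) (cong₂ (λ i j → + 24 * i + 1ℤ * j) vq₁
              (cong₂ (λ i j → + 8 * i + 1ℤ * j) vq₂ (trans (⟨⟩-comm (v₃ w) (q w)) vq₃)))))

          q-supp : Supp (q w)
          q-supp x p = trans (q-at w x) (cong₂ (λ i j → + 24 * i + 1ℤ * j) (v₀-supp w x p) (cong₂ (λ i j → + 8 * i + 1ℤ * j) (B∙-supp (v₀ w) x p) (B∙-supp (v₁ w) x p)))

          sum-q : sum (q w) ≡ 0ℤ
          sum-q = trans (sum-cong (q-at w)) (trans (sum-lin (+ 24) 1ℤ (v₀ w) (λ y → + 8 * v₁ w y + 1ℤ * v₂ w y))
            (cong₂ (λ i j → + 24 * i + 1ℤ * j) (sum-v₀ w) (trans (sum-lin (+ 8) 1ℤ (v₁ w) (v₂ w)) (cong₂ (λ i j → + 8 * i + 1ℤ * j) s₁ s₂))))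
            where
            s₁ : sum (v₁ w) ≡ 0ℤ
            s₁ = trans (sum-B∙ (v₀ w) (v₀-supp w)) (cong (+ 4 *_) (sum-v₀ w))
            s₂ : sum (v₂ w) ≡ 0ℤ
            s₂ = trans (sum-B∙ (v₁ w) (B∙-supp (v₀ w))) (cong (+ 4 *_) s₁)

          qGq : ⟨ q w , G ∙ q w ⟩ ≡ + 32 * ⟨ q w , q w ⟩ + 1ℤ * (- + 16 * ⟨ q w , B ∙ q w ⟩ + 0ℤ * 0ℤ)
          qGq = trans (⟨f,G∙g⟩ (q w) (q w) q-supp q-supp) (quad≡ {q w} {q w} refl refl sum-q sum-q)

          ⟨q,G⟩ : ⟨ q w , G w ⟩ ≡ ⟨ q w , v₀ w ⟩
          ⟨q,G⟩ = sum-cong pw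
            where
            pw : ∀ x → q w x * G w x ≡ q w x * v₀ w x
            pw x with α-01 x
            ... | inj₁ p rewrite q-supp x p = refl
            ... | inj₂ p = cong (q w x *_) (trans (G-sym w x) (trans (sym (*-identityˡ (G x w))) (cong (_* G x w) (sym p))))

          ⟨f,Y⟩ : ∀ f → ⟨ Y w , f ⟩ ≡ + 768 * f w + - 1ℤ * ⟨ q w , f ⟩
          ⟨f,Y⟩ f = trans (sum-cong (λ x → cong (_* f x) (Y-at w x))) (trans (⟨⟩-linˡ (+ 768) (- 1ℤ) (δ w) (q w) f) (cong (λ k → + 768 * k + - 1ℤ * ⟨ q w , f ⟩) (sum-δ w f)))

          G∙Y : ∀ x → (G ∙ Y w) x ≡ + 768 * G x w + - 1ℤ * (G ∙ q w) x
          G∙Y x = trans (⟨⟩-comm (G x) (Y w)) (trans (⟨f,Y⟩ (G x)) (cong (λ k → + 768 * G x w + - 1ℤ * k) (⟨⟩-comm (q w) (G x))))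

          norm-Y : ⟨ Y w , G ∙ Y w ⟩ ≡ + 768 * (+ 768 * G w w + - 1ℤ * ⟨ q w , v₀ w ⟩) +
            - 1ℤ * (+ 768 * ⟨ q w , v₀ w ⟩ + - 1ℤ * ⟨ q w , G ∙ q w ⟩)
          norm-Y = trans (⟨f,Y⟩ (G ∙ Y w)) (cong₂ (λ i j → + 768 * i + - 1ℤ * j)
            (trans (G∙Y w) (cong (λ k → + 768 * G w w + - 1ℤ * k) (trans (⟨⟩-comm (G w) (q w)) ⟨q,G⟩)))
            (trans (sum-cong (λ x → cong (q w x *_) (G∙Y x))) (trans (⟨⟩-linʳ (+ 768) (- 1ℤ) (λ x → G x w) (G ∙ q w) (q w))
              (cong (λ k → + 768 * k + - 1ℤ * ⟨ q w , G ∙ q w ⟩) (trans (sum-cong (λ x → cong (q w x *_) (G-sym x w))) ⟨q,G⟩)))))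

          t-supp : Supp (t w)
          t-supp x p = trans (t-at w x) (cong₂ (λ i j → + 2 * i + 1ℤ * j) (B∙-supp (v₀ w) x p) (B∙-supp (v₁ w) x p))

          t·_ : ∀ k → ⟨ t w , k ⟩ ≡ + 2 * ⟨ v₁ w , k ⟩ + 1ℤ * ⟨ v₂ w , k ⟩
          t· k = trans (sum-cong (λ x → cong (_* k x) (t-at w x))) (⟨⟩-linˡ (+ 2) 1ℤ (v₁ w) (v₂ w) k)

          Bt : ∀ x → (B ∙ t w) x ≡ + 2 * v₂ w x + 1ℤ * v₃ w x
          Bt x = trans (∙-cong B (t-at w) x) (∙-lin B (+ 2) 1ℤ (v₁ w) (v₂ w) x)

          tt : ⟨ t w , t w ⟩ ≡ + 2 * (+ 2 * m₂ + 1ℤ * m₃) + 1ℤ * (+ 2 * m₃ + 1ℤ * m₄)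
          tt = trans (t· t w) (cong₂ (λ i j → + 2 * i + 1ℤ * j)
            (trans (⟨⟩-comm (v₁ w) (t w)) (trans (t· v₁ w) (cong (λ i → + 2 * m₂ + 1ℤ * i) (⟨⟩-comm (v₂ w) (v₁ w)))))
            (trans (⟨⟩-comm (v₂ w) (t w)) (t· v₂ w)))

          tBt : ⟨ t w , B ∙ t w ⟩ ≡ + 2 * (+ 2 * m₃ + 1ℤ * m₄) + 1ℤ * (+ 2 * m₄ + 1ℤ * m₅)
          tBt = trans (sum-cong (λ x → cong (t w x *_) (Bt x))) (trans (⟨⟩-linʳ (+ 2) 1ℤ (v₂ w) (v₃ w) (t w))
            (cong₂ (λ i j → + 2 * i + 1ℤ * j) (t· v₂ w) (trans (t· v₃ w) (cong (λ i → + 2 * i + 1ℤ * m₅) m₄′))))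

          E-expand : E w ≡ + 8 * ⟨ t w , t w ⟩ + + 2 * ⟨ t w , B ∙ t w ⟩
          E-expand = begin
            E w ≡⟨ sum-cong row ⟩
            sum (λ x → + 4 * (t w x * t w x) + 1ℤ * (+ 2 * (t w x * (B ∙ t w) x) + 1ℤ * (B ∙ t²) x))
              ≡⟨ trans (sum-lin (+ 4) 1ℤ (λ x → t w x * t w x) (λ x → + 2 * (t w x * (B ∙ t w) x) + 1ℤ * (B ∙ t²) x))
                   (cong (λ k → + 4 * ⟨ t w , t w ⟩ + 1ℤ * k) (trans (sum-lin (+ 2) 1ℤ (λ x → t w x * (B ∙ t w) x) (B ∙ t²))
                     (cong (λ k → + 2 * ⟨ t w , B ∙ t w ⟩ + 1ℤ * k) (sum-B∙ t² (λ x p → cong (λ k → k * k) (t-supp x p)))))) ⟩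
            + 4 * ⟨ t w , t w ⟩ + 1ℤ * (+ 2 * ⟨ t w , B ∙ t w ⟩ + 1ℤ * (+ 4 * ⟨ t w , t w ⟩))
              ≡⟨ ar ⟨ t w , t w ⟩ ⟨ t w , B ∙ t w ⟩ ⟩
            + 8 * ⟨ t w , t w ⟩ + + 2 * ⟨ t w , B ∙ t w ⟩ ∎
            where
            t² : Fin n → ℤ
            t² x = t w x * t w x
            ar : ∀ i j → + 4 * i + 1ℤ * (+ 2 * j + 1ℤ * (+ 4 * i)) ≡ + 8 * i + + 2 * j
            ar = solve-∀
            ar₂ : ∀ b p s → b * ((p + s) * (p + s)) ≡ p * p * b + 1ℤ * (+ 2 * p * (b * s) + 1ℤ * (b * (s * s)))
            ar₂ = solve-∀
            ar₃ : ∀ p z k → p * p * + 4 + 1ℤ * (+ 2 * p * z + 1ℤ * k) ≡ + 4 * (p * p) + 1ℤ * (+ 2 * (p * z) + 1ℤ * k)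
            ar₃ = solve-∀
            row : ∀ x → sum (ε w x) ≡
              + 4 * (t w x * t w x) + 1ℤ * (+ 2 * (t w x * (B ∙ t w) x) + 1ℤ * (B ∙ t²) x)
            row x with α-01 x
            ... | inj₁ p = trans (sum-zero (ε w x) (λ y → trans (ε-at w x y) (cong (_* ((t w x + t w y) * (t w x + t w y))) (B-off p y))))
                  (sym (cong₂ (λ i j → + 4 * (i * i) + 1ℤ * (+ 2 * (i * (B ∙ t w) x) + 1ℤ * j)) (t-supp x p)
                    (sum-zero (λ y → B x y * t² y) (λ y → cong (_* t² y) (B-off p y)))))
            ... | inj₂ p = begin
              sum (ε w x) ≡⟨ sum-cong (λ y → trans (ε-at w x y) (ar₂ (B x y) (t w x) (t w y))) ⟩
              sum (λ y → t w x * t w x * B x y + 1ℤ * (+ 2 * t w x * (B x y * t w y) + 1ℤ * (B x y * t² y)))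
                ≡⟨ trans (sum-lin (t w x * t w x) 1ℤ (B x) (λ y → + 2 * t w x * (B x y * t w y) + 1ℤ * (B x y * t² y)))
                     (cong₂ (λ i j → t w x * t w x * i + 1ℤ * j) (B-deg p) (sum-lin (+ 2 * t w x) 1ℤ (λ y → B x y * t w y) (λ y → B x y * t² y))) ⟩
              t w x * t w x * + 4 + 1ℤ * (+ 2 * t w x * (B ∙ t w) x + 1ℤ * (B ∙ t²) x) ≡⟨ ar₃ (t w x) ((B ∙ t w) x) ((B ∙ t²) x) ⟩
              _ ∎

          opaque
            R₄ R₃ R₂ R₁ R : ℤ
            R₄ = - + 960 * m₃ + - + 96 * m₄
            R₃ = - + 3840 * m₂ + 1ℤ * R₄
            R₂ = - + 9216 * m₁ + 1ℤ * R₃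
            R₁ = - + 18432 * m₀ + 1ℤ * R₂
            R = + 589824 * G w w + 1ℤ * R₁

            R₄-at : R₄ ≡ - + 960 * m₃ + - + 96 * m₄
            R₄-at = refl
            R₃-at : R₃ ≡ - + 3840 * m₂ + 1ℤ * R₄
            R₃-at = refl
            R₂-at : R₂ ≡ - + 9216 * m₁ + 1ℤ * R₃
            R₂-at = refl
            R₁-at : R₁ ≡ - + 18432 * m₀ + 1ℤ * R₂
            R₁-at = refl
            R-at : R ≡ + 589824 * G w w + 1ℤ * R₁
            R-at = refl
            R-all : R ≡ + 589824 * G w w + 1ℤ * (- + 18432 * m₀ + 1ℤ * (- + 9216 * m₁ + 1ℤ * (- + 3840 * m₂ + 1ℤ * (- + 960 * m₃ + - + 96 * m₄))))
            R-all = refl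

          R-split : ⟨ Y w , G ∙ Y w ⟩ + + 8 * E w ≡ R
          R-split = trans (cong₂ (λ i j → i + + 8 * j) norm-Y E-expand)
            (trans (cong (λ b → + 768 * (+ 768 * G w w + - 1ℤ * ⟨ q w , v₀ w ⟩) + - 1ℤ * (+ 768 * ⟨ q w , v₀ w ⟩ + - 1ℤ * b)
               + + 8 * (+ 8 * ⟨ t w , t w ⟩ + + 2 * ⟨ t w , B ∙ t w ⟩)) qGq)
            (trans (collect₁ (G w w) ⟨ q w , v₀ w ⟩ ⟨ q w , q w ⟩ ⟨ q w , B ∙ q w ⟩ ⟨ t w , t w ⟩ ⟨ t w , B ∙ t w ⟩)
            (trans (cong (λ k → + 589824 * G w w + k) (trans
              (cong₅ (λ a c d f h → - + 1536 * a + (+ 32 * c + (- + 16 * d + (+ 64 * f + + 16 * h)))) qv qq qBq tt tBt)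
              (collect₂ m₀ m₁ m₂ m₃ m₄ m₅)))
            (sym R-all))))

          E≥0 : 0ℤ ≤ E w
          E≥0 = sum-nonneg (λ x → sum (ε w x)) (λ x → sum-nonneg (ε w x) (ε≥0 w x))

          R≥0 : 0ℤ ≤ R
          R≥0 = subst (0ℤ ≤_) R-split (0≤+ (G-nonneg (Y w)) (0≤* {+ 8} (+≤+ ℕ.z≤n) E≥0))

        combine : ∀ a b (f g h : Fin n → ℤ) {A B} → (∀ i → h i ≡ a * f i + b * g i) → sum f ≡ A → sum g ≡ B → sum h ≡ a * A + b * B
        combine a b f g h e refl refl = trans (sum-cong e) (sum-lin a b f g)

        -- The traces balance exactly: 589824 · 3648 = 6144 · 350208. Each `R` is a sum of two
        -- nonnegative terms, so all these terms vanish.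
        ΣR : sum W.R ≡ 0ℤ
        ΣR = combine (+ 589824) 1ℤ (λ w → G w w) W.R₁ W.R W.R-at G-trace
          (combine (- + 18432) 1ℤ W.m₀ W.R₂ W.R₁ W.R₁-at (moment e e v₀ v₀ (+ 33) v₀-G v₀-G k₀)
          (combine (- + 9216) 1ℤ W.m₁ W.R₃ W.R₂ W.R₂-at (moment e B v₀ v₁ (- + 60) v₀-G v₁-G k₁)
          (combine (- + 3840) 1ℤ W.m₂ W.R₄ W.R₃ W.R₃-at (moment B B v₁ v₁ (+ 144) v₁-G v₁-G k₂)
          (combine (- + 960) (- + 96) W.m₃ W.m₄ W.R₄ W.R₄-at (moment B r₂ v₁ v₂ (- + 384) v₁-G v₂-G k₃)
            (moment r₂ r₂ v₂ v₂ (+ 1152) v₂-G v₂-G k₄)))))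

        both-zero : ∀ w → ⟨ Y w , G ∙ Y w ⟩ ≡ 0ℤ × + 8 * E w ≡ 0ℤ
        both-zero w = nonneg-+≡0 (G-nonneg (Y w)) (0≤* {+ 8} (+≤+ ℕ.z≤n) (W.E≥0 w))
          (trans (W.R-split w) (sum≡0⇒≡0 W.R W.R≥0 ΣR w))

      t-alternates : ∀ w {x y} → B x y ≡ 1ℤ → t w x + t w y ≡ 0ℤ
      t-alternates w {x} {y} xy = sq≡0 (t w x + t w y) (trans (sym (*-identityˡ ((t w x + t w y) * (t w x + t w y))))
        (trans (cong (_* ((t w x + t w y) * (t w x + t w y))) (sym xy)) (trans (sym (ε-at w x y)) ε≡0)))
        where
        E≡0 : E w ≡ 0ℤ
        E≡0 = *-cancelˡ-≡ (+ 8) (E w) 0ℤ (proj₂ (both-zero w))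
        ε≡0 : ε w x y ≡ 0ℤ
        ε≡0 = sum≡0⇒≡0 (ε w x) (ε≥0 w x) (sum≡0⇒≡0 (λ x′ → sum (ε w x′)) (λ x′ → sum-nonneg (ε w x′) (ε≥0 w x′)) E≡0 x) y

      -- This is G Y = 0 read at `w′`. As `q w` is supported on the local graph, only the part of
      -- column `w′` there enters.
      G-determined : ∀ w w′ → + 768 * G w′ w ≡ ⟨ q w , v₀ w′ ⟩
      G-determined w w′ = begin
        + 768 * G w′ w ≡⟨ ar (G w′ w) ((G ∙ q w) w′) ⟩
        + 768 * G w′ w + - 1ℤ * (G ∙ q w) w′ + (G ∙ q w) w′ ≡⟨ cong (_+ (G ∙ q w) w′) (sym (W.G∙Y w w′)) ⟩
        (G ∙ Y w) w′ + (G ∙ q w) w′ ≡⟨ cong₂ _+_ (G-null (Y w) (proj₁ (both-zero w)) w′) (⟨⟩-comm (G w′) (q w)) ⟩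
        0ℤ + ⟨ q w , G w′ ⟩ ≡⟨ +-identityˡ ⟨ q w , G w′ ⟩ ⟩
        ⟨ q w , G w′ ⟩ ≡⟨ sum-cong pw ⟩
        ⟨ q w , v₀ w′ ⟩ ∎
        where
        ar : ∀ i j → + 768 * i ≡ + 768 * i + - 1ℤ * j + j
        ar = solve-∀
        pw : ∀ x → q w x * G w′ x ≡ q w x * v₀ w′ x
        pw x with α-01 x
        ... | inj₁ p rewrite W.q-supp w x p = refl
        ... | inj₂ p = cong (q w x *_) (trans (G-sym w′ x) (trans (sym (*-identityˡ (G x w′))) (cong (_* G x w′) (sym p))))

      q-off : ∀ w x → α x ≡ 0ℤ → q w x ≡ 0ℤ
      q-off w = W.q-supp w

      Σq : ∀ w → sum (q w) ≡ 0ℤ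
      Σq w = W.sum-q w

-- Biaffine planes of order 4: bipartition and parallelism.

module BiaffinePlane where
  open LinearAlgebra
  open import Data.Nat as ℕ using (ℕ; zero; suc)
  open import Data.Integer using (ℤ; +_; -_; _+_; _*_; _-_; _≤_; +≤+; 0ℤ; 1ℤ)
  open import Data.Integer.Properties using () renaming (_≟_ to _≟ℤ_)
  open import Data.Integer.Properties hiding (_≟_)
  open import Data.Integer.Tactic.RingSolver using (solve-∀)
  open import Data.Fin using (Fin; zero; suc; _≟_)
  open import Data.Fin.Properties using (any?)
  open import Data.Product using (_×_; _,_; proj₁; proj₂; ∃-syntax; Σ)
  open import Data.Sum using (_⊎_; inj₁; inj₂)
  open import Relation.Nullary.Decidable using (decidable-stable)
  open import Relation.Nullary using (yes; no; contradiction; ¬_)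
  open import Relation.Binary.PropositionalEquality
  open ≡-Reasoning

  -- The indicator `f` minus the indicator of the image of `e` is nonnegative and has sum 0.
  exhausts : ∀ {n k} (f : Fin n → ℤ) → (∀ i → f i ≡ 0ℤ ⊎ f i ≡ 1ℤ) → (e : Fin k → Fin n) →
    (∀ i j → e i ≡ e j → i ≡ j) → (∀ i → f (e i) ≡ 1ℤ) → sum f ≡ sum {k} (λ _ → 1ℤ) →
    ∀ x → f x ≡ 1ℤ → ∃[ i ] e i ≡ x
  exhausts {n} {k} f v e inj fe tot x fx with any? (λ i → e i ≟ x)
  ... | yes r = r
  ... | no r = contradiction (trans (sym fx) (trans (sym gx) (sum≡0⇒≡0 g g≥0 Σg x))) (λ ())
    where
    g : Fin n → ℤ
    g y = 1ℤ * f y + - 1ℤ * sum (λ i → δ (e i) y)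
    Σδ : sum (λ y → sum (λ i → δ (e i) y)) ≡ sum {k} (λ _ → 1ℤ)
    Σδ = trans (∑-comm (λ y i → δ (e i) y)) (sum-cong (λ i → trans (sum-cong (λ y → sym (*-identityʳ (δ (e i) y)))) (sum-δ (e i) (λ _ → 1ℤ))))
    Σg : sum g ≡ 0ℤ
    Σg = trans (sum-lin 1ℤ (- 1ℤ) f (λ y → sum (λ i → δ (e i) y))) (trans (cong₂ (λ s t → 1ℤ * s + - 1ℤ * t) tot Σδ) (ar (sum {k} (λ _ → 1ℤ))))
      where
      ar : ∀ z → 1ℤ * z + - 1ℤ * z ≡ 0ℤ
      ar = solve-∀
    at : ∀ i → sum (λ j → δ (e j) (e i)) ≡ 1ℤ
    at i = trans (sum-cong pw) (sum-δ i (λ _ → 1ℤ))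
      where
      pw : ∀ j → δ (e j) (e i) ≡ δ i j * 1ℤ
      pw j with i ≟ j
      ... | yes refl rewrite δ-refl (e i) | δ-refl i = refl
      ... | no q rewrite δ-≢ q = δ-≢ (λ r → q (sym (inj j i r)))
    gx : g x ≡ f x
    gx = trans (cong (λ s → 1ℤ * f x + - 1ℤ * s) (sum-zero (λ i → δ (e i) x) (λ i → δ-≢ (λ q → r (i , q))))) (ar (f x))
      where
      ar : ∀ z → 1ℤ * z + - 1ℤ * 0ℤ ≡ z
      ar = solve-∀
    g≥0 : ∀ y → 0ℤ ≤ g y
    g≥0 y with any? (λ i → e i ≟ y)
    ... | yes (i , refl) rewrite at i | fe i = ≤-refl
    ... | no q rewrite sum-zero (λ i → δ (e i) y) (λ i → δ-≢ (λ s → q (i , s))) with v y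
    ...   | inj₁ z rewrite z = ≤-refl
    ...   | inj₂ o rewrite o = +≤+ ℕ.z≤n

  Enumeration : ∀ {n} → ℕ → (Fin n → ℤ) → Set
  Enumeration {n} k f = Σ (Fin k → Fin n) λ e → (∀ i j → e i ≡ e j → i ≡ j) × (∀ i → f (e i) ≡ 1ℤ)

  enumerate : ∀ {n} k (f : Fin n → ℤ) → (∀ i → f i ≡ 0ℤ ⊎ f i ≡ 1ℤ) → sum f ≡ + k → Enumeration k f
  enumerate zero f v s = (λ ()) , (λ ()) , (λ ())
  enumerate {n} (suc k) f v s with sum-witness f (λ z → contradiction (trans (sym z) s) (λ ()))
  ... | x , fx≢0 = step (enumerate k g gv Σg)
    where
    fx : f x ≡ 1ℤ
    fx with v x
    ... | inj₁ z = contradiction z fx≢0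
    ... | inj₂ o = o
    g : Fin n → ℤ
    g y = 1ℤ * f y + - 1ℤ * (δ x y * 1ℤ)
    gv : ∀ y → g y ≡ 0ℤ ⊎ g y ≡ 1ℤ
    gv y with x ≟ y
    ... | yes refl rewrite fx | δ-refl x = inj₁ refl
    ... | no q rewrite δ-≢ q with v y
    ...   | inj₁ z rewrite z = inj₁ refl
    ...   | inj₂ o rewrite o = inj₂ refl
    Σg : sum g ≡ + k
    Σg = trans (sum-lin 1ℤ (- 1ℤ) f (λ y → δ x y * 1ℤ)) (trans (cong₂ (λ p q → 1ℤ * p + - 1ℤ * q) s (sum-δ x (λ _ → 1ℤ))) (ar (+ k)))
      where
      ar : ∀ z → 1ℤ * (1ℤ + z) + - 1ℤ * 1ℤ ≡ z
      ar = solve-∀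
    g⇒ : ∀ y → g y ≡ 1ℤ → x ≢ y × f y ≡ 1ℤ
    g⇒ y gy with x ≟ y
    ... | yes refl rewrite fx | δ-refl x = contradiction gy (λ ())
    ... | no q rewrite δ-≢ q = q , trans (ar (f y)) gy
      where
      ar : ∀ z → z ≡ 1ℤ * z + - 1ℤ * (0ℤ * 1ℤ)
      ar = solve-∀
    step : Enumeration k g → Enumeration (suc k) f
    step (e , inj , ge) = e′ , inj′ , fe′
      where
      e′ : Fin (suc k) → Fin n
      e′ zero = x
      e′ (suc i) = e i
      inj′ : ∀ i j → e′ i ≡ e′ j → i ≡ j
      inj′ zero zero _ = refl
      inj′ zero (suc j) q = contradiction q (proj₁ (g⇒ (e j) (ge j)))
      inj′ (suc i) zero q = contradiction (sym q) (proj₁ (g⇒ (e i) (ge i)))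
      inj′ (suc i) (suc j) q = cong suc (inj i j q)
      fe′ : ∀ i → f (e′ i) ≡ 1ℤ
      fe′ zero = fx
      fe′ (suc i) = proj₂ (g⇒ (e i) (ge i))

  -- The axioms of a biaffine plane of order 4, in terms of its incidence graph.
  record Biaffine {n : ℕ} (B : Fin n → Fin n → ℤ) : Set where
    field
      B-01 : ∀ x y → B x y ≡ 0ℤ ⊎ B x y ≡ 1ℤ
      B-sym : Symmetric B
      B-deg : ∀ {x y} → B x y ≡ 1ℤ → sum (B x) ≡ + 4
      □-free : ∀ {x y p q} → x ≢ y → B x p ≡ 1ℤ → B x q ≡ 1ℤ → B y p ≡ 1ℤ → B y q ≡ 1ℤ → p ≡ q
      B²-adj : ∀ {x y} → B x y ≡ 1ℤ → ⟨ B x , B y ⟩ ≡ 0ℤ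
      B²-01 : ∀ {x y} → x ≢ y → ⟨ B x , B y ⟩ ≡ 0ℤ ⊎ ⟨ B x , B y ⟩ ≡ 1ℤ
      -- the number of walks of length 3
      B³-edge : ∀ {x y z s} → B x s ≡ 1ℤ → B y z ≡ 1ℤ →
        ⟨ B y , (λ p → ⟨ B x , B p ⟩) ⟩ + ⟨ B z , (λ p → ⟨ B x , B p ⟩) ⟩ ≡ + 3 + + 4 * (B x y + B x z)

  module Coordinates {n : ℕ} {B : Fin n → Fin n → ℤ} (bi : Biaffine B) where
    open Biaffine bi

    -- `T` is the matrix B³ - 4B, for which `B³-edge` says that T x y + T x z = 3 on an edge from
    -- `y` to `z`. Since T x x = 0, it alternates between 0 and 3 along walks from `x`; this
    -- replaces the parity of the distance.
    B² T : Fin n → Fin n → ℤ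
    B² x y = ⟨ B x , B y ⟩
    T x y = ⟨ B y , B² x ⟩ + - + 4 * B x y

    infix 4 _~_ _∥_
    -- Incidence and the absence of a common neighbour. For two distinct points the latter means
    -- that no line joins them, for two distinct lines that they are parallel.
    _~_ _∥_ : Fin n → Fin n → Set
    x ~ y = B x y ≡ 1ℤ
    x ∥ y = B² x y ≡ 0ℤ

    ~-sym : ∀ {x y} → x ~ y → y ~ x
    ~-sym {x} {y} e = trans (B-sym y x) e

    ∥-sym : ∀ {x y} → x ∥ y → y ∥ x
    ∥-sym {x} {y} e = trans (⟨⟩-comm (B y) (B x)) e

    0≢1 : ∀ {ℓ} {A : Set ℓ} {x : ℤ} → x ≡ 0ℤ → x ≡ 1ℤ → A
    0≢1 p q = contradiction (trans (sym p) q) (λ ())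

    ≁ : ∀ {x y} → ¬ (x ~ y) → B x y ≡ 0ℤ
    ≁ {x} {y} ne with B-01 x y
    ... | inj₁ e = e
    ... | inj₂ e = contradiction e ne

    B*B-01 : ∀ x y p → B x p * B y p ≡ 0ℤ ⊎ (x ~ p × y ~ p)
    B*B-01 x y p with B-01 x p | B-01 y p
    ... | inj₁ e | _ = inj₁ (cong (_* B y p) e)
    ... | inj₂ e | inj₁ e′ = inj₁ (trans (cong (B x p *_) e′) (*-zeroʳ (B x p)))
    ... | inj₂ e | inj₂ e′ = inj₂ (e , e′)

    ∥⇒ : ∀ {x y p} → x ∥ y → x ~ p → ¬ (y ~ p)
    ∥⇒ {x} {y} {p} e xp yp = 0≢1 (sum≡0⇒≡0 (λ t → B x t * B y t) nn e p) (cong₂ _*_ xp yp)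
      where
      nn : ∀ t → 0ℤ ≤ B x t * B y t
      nn t with B*B-01 x y t
      ... | inj₁ z = ≤-reflexive (sym z)
      ... | inj₂ (s , r) rewrite s | r = +≤+ ℕ.z≤n

    opaque
      meet : ∀ {x y} → ¬ (x ∥ y) → ∃[ p ] x ~ p × y ~ p
      meet {x} {y} ne with sum-witness (λ p → B x p * B y p) ne
      ... | p , q with B*B-01 x y p
      ...   | inj₁ z = contradiction z q
      ...   | inj₂ r = p , r

    ∥-stable : ∀ x y → ¬ ¬ (x ∥ y) → x ∥ y
    ∥-stable x y = decidable-stable (B² x y ≟ℤ 0ℤ)

    T-refl : ∀ {x} → T x x ≡ 0ℤ
    T-refl {x} = cong₂ (λ s t → s + - + 4 * t) (sum-zero (λ p → B x p * B² x p) pw) (≁ self)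
      where
      pw : ∀ p → B x p * B² x p ≡ 0ℤ
      pw p with B-01 x p
      ... | inj₁ z = cong (_* B² x p) z
      ... | inj₂ o = trans (cong (B x p *_) (B²-adj o)) (*-zeroʳ (B x p))
      self : ¬ (x ~ x)
      self o = ∥⇒ (B²-adj o) o o

    T-step : ∀ {x y z s} → x ~ s → y ~ z → T x y + T x z ≡ + 3
    T-step {x} {y} {z} xs yz = trans (ar ⟨ B y , B² x ⟩ ⟨ B z , B² x ⟩ (B x y) (B x z)) (trans (cong (_+ - + 4 * (B x y + B x z)) (B³-edge xs yz)) (ar′ (B x y + B x z)))
      where
      ar : ∀ a b c d → (a + - + 4 * c) + (b + - + 4 * d) ≡ a + b + - + 4 * (c + d)
      ar = solve-∀
      ar′ : ∀ c → + 3 + + 4 * c + - + 4 * c ≡ + 3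
      ar′ = solve-∀

    T-sym : ∀ x y → T x y ≡ T y x
    T-sym x y = cong₂ (λ s t → s + - + 4 * t) eq (B-sym x y)
      where
      eq : ⟨ B y , B² x ⟩ ≡ ⟨ B x , B² y ⟩
      eq = begin
        ⟨ B y , B² x ⟩ ≡⟨ sum-cong (λ p → cong (B y p *_) (⟨⟩-comm (B x) (B p))) ⟩
        ⟨ B y , B ∙ B x ⟩ ≡⟨ ⟨⟩-sym B B-sym (B y) (B x) ⟩
        ⟨ B ∙ B y , B x ⟩ ≡⟨ ⟨⟩-comm (B ∙ B y) (B x) ⟩
        ⟨ B x , B ∙ B y ⟩ ≡⟨ sum-cong (λ p → cong (B x p *_) (⟨⟩-comm (B p) (B y))) ⟩
        ⟨ B x , B² y ⟩ ∎

    Even Odd : Fin n → Fin n → Set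
    Even x y = T x y ≡ 0ℤ
    Odd x y = T x y ≡ + 3

    even→odd : ∀ {x y z s} → x ~ s → Even x y → y ~ z → Odd x z
    even→odd {x} {y} {z} xs e yz = trans (sym (+-identityˡ (T x z))) (trans (cong (_+ T x z) (sym e)) (T-step xs yz))

    odd→even : ∀ {x y z s} → x ~ s → Odd x y → y ~ z → Even x z
    odd→even {x} {y} {z} xs e yz = trans (ar (T x z)) (cong (_+ - + 3) (trans (cong (_+ T x z) (sym e)) (T-step xs yz)))
      where
      ar : ∀ t → t ≡ + 3 + t + - + 3
      ar = solve-∀

    even⇒≁ : ∀ {x y} → Even x y → ¬ (x ~ y)
    even⇒≁ {x} {y} e xy = contradiction (trans (sym e) (even→odd xy (T-refl {x}) xy)) (λ ())

    odd⇒≢ : ∀ {x y z} → Odd x z → Even x y → y ≢ z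
    odd⇒≢ o e refl = contradiction (trans (sym e) o) (λ ())

    -- A vertex at odd distance from x and not adjacent to x has exactly one
    -- neighbour with no common neighbour with x.
    private
      module A (x q : Fin n) {s : Fin n} (qs : q ~ s) (o : Odd x q) (xq : ¬ (x ~ q)) where
        φ : Fin n → ℤ
        φ p = 1ℤ * B q p + - 1ℤ * (B q p * B² x p)

        Σφ : sum φ ≡ 1ℤ
        Σφ = trans (sum-lin 1ℤ (- 1ℤ) (B q) (λ p → B q p * B² x p)) (cong₂ (λ c d → 1ℤ * c + - 1ℤ * d) (B-deg qs) three)
          where
          three : ⟨ B q , B² x ⟩ ≡ + 3
          three = trans (ar ⟨ B q , B² x ⟩) (trans (cong (λ b → ⟨ B q , B² x ⟩ + - + 4 * b) (sym (≁ xq))) o)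
            where
            ar : ∀ c → c ≡ c + - + 4 * 0ℤ
            ar = solve-∀

        case : ∀ p → φ p ≡ 0ℤ ⊎ (φ p ≡ 1ℤ × q ~ p × x ∥ p)
        case p with B-01 q p
        ... | inj₁ z rewrite z = inj₁ refl
        ... | inj₂ qp with B²-01 {x} {p} (λ { refl → xq (~-sym qp) })
        ...   | inj₁ z = inj₂ (trans (cong₂ (λ c d → 1ℤ * c + - 1ℤ * (c * d)) qp z) refl , qp , z)
        ...   | inj₂ w = inj₁ (cong₂ (λ c d → 1ℤ * c + - 1ℤ * (c * d)) qp w)

        φ≥0 : ∀ p → 0ℤ ≤ φ p
        φ≥0 p with case p
        ... | inj₁ z = ≤-reflexive (sym z)
        ... | inj₂ (w , _) rewrite w = +≤+ ℕ.z≤n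

        exists : ∃[ p ] q ~ p × x ∥ p
        exists with sum-witness φ (λ z → contradiction (trans (sym z) Σφ) (λ ()))
        ... | p , ne with case p
        ...   | inj₁ z = contradiction z ne
        ...   | inj₂ (_ , r) = p , r

        one : ∀ {p} → q ~ p → x ∥ p → φ p ≡ 1ℤ
        one qp xp = cong₂ (λ c d → 1ℤ * c + - 1ℤ * (c * d)) qp xp

        unique : ∀ {p p′} → q ~ p → x ∥ p → q ~ p′ → x ∥ p′ → p ≡ p′
        unique {p} {p′} a b c d with p ≟ p′
        ... | yes e = e
        ... | no ne = contradiction (subst₂ _≤_ (cong₂ _+_ (one a b) (one c d)) Σφ (≤-sum₂ φ φ≥0 p p′ ne)) (λ { (+≤+ (ℕ.s≤s ())) })

    opaque
      parallel : ∀ {x q s} → q ~ s → Odd x q → ¬ (x ~ q) → ∃[ p ] q ~ p × x ∥ p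
      parallel {x} {q} = A.exists x q

    parallel-unique : ∀ {x q p p′} → Odd x q → ¬ (x ~ q) → q ~ p → x ∥ p → q ~ p′ → x ∥ p′ → p ≡ p′
    parallel-unique {x} {q} o ne qp = A.unique x q qp o ne qp

    opaque
      nbrs : ∀ {x s} → x ~ s → Enumeration 4 (B x)
      nbrs {x} xs = enumerate 4 (B x) (B-01 x) (B-deg xs)

    nbrs-complete : ∀ {x} (e : Fin 4 → Fin n) → (∀ i j → e i ≡ e j → i ≡ j) → (∀ i → x ~ e i) → ∀ y → x ~ y → ∃[ i ] e i ≡ y
    nbrs-complete {x} e inj xe = exhausts (B x) (B-01 x) e inj xe (trans (B-deg (xe zero)) (sym (sum₄ _)))

-- Naming points and lines by the pencils of a class of pairwise unjoined points.

module PencilNames where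
  open LinearAlgebra
  open BiaffinePlane
  open import Data.Bool using (Bool; true; false; not)
  open import Data.Nat as ℕ using (ℕ; zero; suc)
  open import Data.Integer using (ℤ; 1ℤ)
  open import Data.Integer.Properties using () renaming (_≟_ to _≟ℤ_)
  open import Data.Fin using (Fin; zero; suc; _≟_; punchIn)
  open import Data.Fin.Properties using (punchInᵢ≢i; punchIn-injective)
  open import Data.Product using (_×_; _,_; proj₁; proj₂; ∃-syntax; Σ)
  open import Data.Empty using (⊥; ⊥-elim)
  open import Data.Sum using (_⊎_; inj₁; inj₂; [_,_]′)
  open import Function using (_∘_)
  open import Relation.Nullary.Decidable using (decidable-stable)
  open import Relation.Nullary using (yes; no; contradiction; ¬_)
  open import Relation.Binary.PropositionalEquality

  pattern 0F = zero
  pattern 1F = suc zero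
  pattern 2F = suc (suc zero)
  pattern 3F = suc (suc (suc zero))

  -- The two permutations of three elements without fixed point.
  rot : Bool → Fin 3 → Fin 3
  rot true 0F = 1F
  rot true 1F = 2F
  rot true 2F = 0F
  rot false 0F = 2F
  rot false 1F = 0F
  rot false 2F = 1F

  derangement : (f : Fin 3 → Fin 3) → (∀ i → f i ≢ i) → (∀ i j → f i ≡ f j → i ≡ j) → Σ Bool λ s → ∀ i → f i ≡ rot s i
  derangement f d inj = go (f 0F) (f 1F) (f 2F) refl refl refl
    where
    go : ∀ a b c → f 0F ≡ a → f 1F ≡ b → f 2F ≡ c → Σ Bool λ s → ∀ i → f i ≡ rot s i
    go 0F _ _ p _ _ = contradiction p (d 0F)
    go 1F 1F _ _ q _ = contradiction q (d 1F)
    go 1F 0F 0F _ q r = contradiction (inj 1F 2F (trans q (sym r))) (λ ())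
    go 1F 0F 1F p _ r = contradiction (inj 0F 2F (trans p (sym r))) (λ ())
    go 1F _ 2F _ _ r = contradiction r (d 2F)
    go 1F 2F 0F p q r = true , λ { 0F → p ; 1F → q ; 2F → r }
    go 1F 2F 1F p _ r = contradiction (inj 0F 2F (trans p (sym r))) (λ ())
    go 2F 1F _ _ q _ = contradiction q (d 1F)
    go 2F 2F _ p q _ = contradiction (inj 0F 1F (trans p (sym q))) (λ ())
    go 2F 0F 0F _ q r = contradiction (inj 1F 2F (trans q (sym r))) (λ ())
    go 2F 0F 1F p q r = false , λ { 0F → p ; 1F → q ; 2F → r }
    go 2F 0F 2F _ _ r = contradiction r (d 2F)

  parity : Bool → Fin 4 → Bool
  parity s 0F = s
  parity s 1F = not s
  parity s 2F = s
  parity s 3F = not s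

  -- Index `k` stands for the line `ℓ k`, on which the lines of a new pencil are rotated against
  -- those of the first. The hypothesis says that a line of one pencil does not meet a line of the
  -- other on two of the `ℓ k`. Of the 16 sign patterns it leaves the two alternating ones.
  orientation : (s : Fin 4 → Bool) →
    (∀ k k′ i i′ → k ≢ k′ → punchIn k i ≡ punchIn k′ i′ → punchIn k (rot (s k) i) ≡ punchIn k′ (rot (s k′) i′) → ⊥) →
    ∀ k → s k ≡ parity (s 0F) k
  orientation s bad = go (s 0F) (s 1F) (s 2F) (s 3F) refl refl refl refl
    where
    bad′ : ∀ k k′ i i′ {b b′} → s k ≡ b → s k′ ≡ b′ → k ≢ k′ → punchIn k i ≡ punchIn k′ i′ → punchIn k (rot b i) ≡ punchIn k′ (rot b′ i′) → ⊥
    bad′ k k′ i i′ refl refl = bad k k′ i i′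
    go : ∀ a b c d → s 0F ≡ a → s 1F ≡ b → s 2F ≡ c → s 3F ≡ d → ∀ k → s k ≡ parity (s 0F) k
    go a b c d p q r t with a | b | c | d
    ... | true | true | true | true = ⊥-elim (bad′ 2F 3F 0F 0F r t (λ ()) refl refl)
    ... | true | true | true | false = ⊥-elim (bad′ 1F 3F 0F 0F q t (λ ()) refl refl)
    ... | true | true | false | true = ⊥-elim (bad′ 0F 3F 0F 1F p t (λ ()) refl refl)
    ... | true | true | false | false = ⊥-elim (bad′ 1F 3F 0F 0F q t (λ ()) refl refl)
    ... | true | false | true | true = ⊥-elim (bad′ 2F 3F 0F 0F r t (λ ()) refl refl)
    ... | true | false | false | true = ⊥-elim (bad′ 1F 2F 0F 0F q r (λ ()) refl refl)
    ... | true | false | false | false = ⊥-elim (bad′ 1F 2F 0F 0F q r (λ ()) refl refl)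
    ... | false | true | true | true = ⊥-elim (bad′ 2F 3F 0F 0F r t (λ ()) refl refl)
    ... | false | true | true | false = ⊥-elim (bad′ 1F 3F 0F 0F q t (λ ()) refl refl)
    ... | false | true | false | false = ⊥-elim (bad′ 1F 3F 0F 0F q t (λ ()) refl refl)
    ... | false | false | true | true = ⊥-elim (bad′ 2F 3F 0F 0F r t (λ ()) refl refl)
    ... | false | false | true | false = ⊥-elim (bad′ 0F 2F 0F 1F p r (λ ()) refl refl)
    ... | false | false | false | true = ⊥-elim (bad′ 1F 2F 0F 0F q r (λ ()) refl refl)
    ... | false | false | false | false = ⊥-elim (bad′ 1F 2F 0F 0F q r (λ ()) refl refl)
    ... | true | false | true | false = λ { 0F → refl ; 1F → trans q (cong not (sym p)) ; 2F → trans r (sym p) ; 3F → trans t (cong not (sym p)) }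
    ... | false | true | false | true = λ { 0F → refl ; 1F → trans q (cong not (sym p)) ; 2F → trans r (sym p) ; 3F → trans t (cong not (sym p)) }

  module Named {n : ℕ} {B : Fin n → Fin n → ℤ} (bi : Biaffine B)
    (x₀ : Fin n) (ℓ : Fin 4 → Fin n) (ℓ-inj : ∀ i j → ℓ i ≡ ℓ j → i ≡ j) (x₀ℓ : ∀ i → B x₀ (ℓ i) ≡ 1ℤ)
    where
    open Biaffine bi
    open Coordinates bi

    meet-unique : ∀ {x y p q} → x ≢ y → x ~ p → y ~ p → x ~ q → y ~ q → p ≡ q
    meet-unique ne xp yp xq yq = □-free ne xp xq yp yq

    -- The lines through a point z parallel to x₀; the i-th one is parallel to ℓ i.
    module Pencil (z : Fin n) (x₀∥z : x₀ ∥ z) (ez : Even x₀ z) (m : Fin n) (zm : z ~ m) where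
      base-∥ : x₀ ∥ z
      base-∥ = x₀∥z

      base-even : Even x₀ z
      base-even = ez

      z≁ℓ : ∀ i → ¬ (z ~ ℓ i)
      z≁ℓ i = ∥⇒ x₀∥z (x₀ℓ i)

      ℓ-odd : ∀ i → Odd (ℓ i) z
      ℓ-odd i = trans (T-sym (ℓ i) z) (even→odd zm (trans (T-sym z x₀) ez) (x₀ℓ i))

      private
        opaque
          par : ∀ i → ∃[ q ] z ~ q × ℓ i ∥ q
          par i = parallel zm (ℓ-odd i) (z≁ℓ i ∘ ~-sym)

      q : Fin 4 → Fin n
      q i = proj₁ (par i)

      zq : ∀ i → z ~ q i
      zq i = proj₁ (proj₂ (par i))

      ℓ∥q : ∀ i → ℓ i ∥ q i
      ℓ∥q i = proj₂ (proj₂ (par i))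

      q-unique : ∀ i {r} → z ~ r → ℓ i ∥ r → r ≡ q i
      q-unique i zr lr = parallel-unique (ℓ-odd i) (z≁ℓ i ∘ ~-sym) zr lr (zq i) (ℓ∥q i)

      x₀≁ : ∀ {r} → z ~ r → ¬ (x₀ ~ r)
      x₀≁ zr xr = ∥⇒ x₀∥z xr zr

      -- Seen from the other side: only one line through `x₀` is parallel to `q i`.
      q-inj : ∀ i k → q i ≡ q k → i ≡ k
      q-inj i k e = ℓ-inj i k (parallel-unique
        (trans (T-sym (q i) x₀) (even→odd (x₀ℓ i) ez (zq i))) (x₀≁ (zq i) ∘ ~-sym)
        (x₀ℓ i) (∥-sym (ℓ∥q i)) (x₀ℓ k) (∥-sym (subst (ℓ k ∥_) (sym e) (ℓ∥q k))))

      meets : ∀ {i k} → i ≢ k → ¬ (ℓ i ∥ q k)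
      meets {i} {k} ne p = ne (sym (q-inj k i (q-unique i (zq k) p)))

      q-complete : ∀ y → z ~ y → ∃[ i ] q i ≡ y
      q-complete = nbrs-complete q q-inj zq

    other : ∀ {x s} → x ~ s → ∀ y → ∃[ p ] x ~ p × p ≢ y
    other xs y with nbrs xs
    ... | e , inj , xe with e 0F ≟ y
    ...   | no ne = e 0F , xe 0F , ne
    ...   | yes refl = e 1F , xe 1F , λ eq → contradiction (inj 1F 0F eq) (λ ())

    private
      opaque
        -- A line `m` through a point of `ℓ 0F` other than `x₀`, and different from `ℓ 0F`, misses
        -- `x₀`; it therefore has a unique point not joined to `x₀`, which becomes `z₁`.
        p*-data : ∃[ p ] ℓ 0F ~ p × p ≢ x₀
        p*-data = other (~-sym (x₀ℓ 0F)) x₀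
      p* : Fin n
      p* = proj₁ p*-data
      opaque
        m-data : ∃[ m ] p* ~ m × m ≢ ℓ 0F
        m-data = other (~-sym (proj₁ (proj₂ p*-data))) (ℓ 0F)
      m : Fin n
      m = proj₁ m-data
      p*m : p* ~ m
      p*m = proj₁ (proj₂ m-data)
      x₀m-odd : Odd x₀ m
      x₀m-odd = even→odd (x₀ℓ 0F) (odd→even (x₀ℓ 0F) (even→odd (x₀ℓ 0F) T-refl (x₀ℓ 0F)) (proj₁ (proj₂ p*-data))) p*m
      x₀≁m : ¬ (x₀ ~ m)
      x₀≁m x₀m = proj₂ (proj₂ m-data) (meet-unique (proj₂ (proj₂ p*-data)) p*m x₀m (~-sym (proj₁ (proj₂ p*-data))) (x₀ℓ 0F))
      opaque
        z₁-data : ∃[ z ] m ~ z × x₀ ∥ z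
        z₁-data = parallel (~-sym p*m) x₀m-odd x₀≁m

    z₁ : Fin n
    z₁ = proj₁ z₁-data

    module P₁ = Pencil z₁ (proj₂ (proj₂ z₁-data)) (odd→even (x₀ℓ 0F) x₀m-odd (proj₁ (proj₂ z₁-data))) m (~-sym (proj₁ (proj₂ z₁-data)))

    private
      opaque
        p-data : ∀ i k → ∃[ p ] ℓ i ~ p × P₁.q (punchIn i k) ~ p
        p-data i k = meet (P₁.meets (λ e → punchInᵢ≢i i k (sym e)))

    -- A point of `ℓ i` other than `x₀` gets its name from the line through `z₁` on which it lies;
    -- `punchIn i` omits the line parallel to `ℓ i`.
    p : Fin 4 → Fin 3 → Fin n
    p i k = proj₁ (p-data i k)

    ℓp : ∀ i k → ℓ i ~ p i k
    ℓp i k = proj₁ (proj₂ (p-data i k))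

    q₁p : ∀ i k → P₁.q (punchIn i k) ~ p i k
    q₁p i k = proj₂ (proj₂ (p-data i k))

    p≢x₀ : ∀ i k → p i k ≢ x₀
    p≢x₀ i k e = P₁.x₀≁ (P₁.zq (punchIn i k)) (~-sym (subst (P₁.q (punchIn i k) ~_) e (q₁p i k)))

    p-inj : ∀ i k k′ → p i k ≡ p i k′ → k ≡ k′
    p-inj i k k′ e with k ≟ k′
    ... | yes r = r
    ... | no ne = ⊥-elim (P₁.z≁ℓ i (~-sym (subst (ℓ i ~_) (meet-unique
      (λ r → ne (punchIn-injective i k k′ (P₁.q-inj _ _ r))) (q₁p i k) (subst (P₁.q (punchIn i k′) ~_) (sym e) (q₁p i k′)) (~-sym (P₁.zq _)) (~-sym (P₁.zq _))) (ℓp i k))))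

    ℓ-points : ∀ i y → ℓ i ~ y → y ≡ x₀ ⊎ (∃[ k ] y ≡ p i k)
    ℓ-points i y ly with nbrs-complete e inj le y ly
      where
      e : Fin 4 → Fin n
      e 0F = x₀
      e (suc k) = p i k
      inj : ∀ j k → e j ≡ e k → j ≡ k
      inj 0F 0F _ = refl
      inj 0F (suc k) r = contradiction (sym r) (p≢x₀ i k)
      inj (suc k) 0F r = contradiction r (p≢x₀ i k)
      inj (suc j) (suc k) r = cong suc (p-inj i j k r)
      le : ∀ j → ℓ i ~ e j
      le 0F = ~-sym (x₀ℓ i)
      le (suc k) = ℓp i k
    ... | 0F , r = inj₁ (sym r)
    ... | suc k , r = inj₂ (k , sym r)

    p-across : ∀ i k i′ k′ → p i k ≡ p i′ k′ → i ≡ i′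
    p-across i k i′ k′ e with i ≟ i′
    ... | yes r = r
    ... | no ne = contradiction (meet-unique (ne ∘ ℓ-inj i i′) (ℓp i k) (subst (ℓ i′ ~_) (sym e) (ℓp i′ k′)) (~-sym (x₀ℓ i)) (~-sym (x₀ℓ i′))) (p≢x₀ i k)

    -- The line through p 0 0 parallel to ℓ t (t = 2, 3) leads to a further point parallel to x₀.
    module Second (t : Fin 2) where
      t′ : Fin 4
      t′ = suc (suc t)

      p₀ : Fin n
      p₀ = p 0F 0F

      private
        p₀-even : Even x₀ p₀
        p₀-even = odd→even (x₀ℓ 0F) (even→odd (x₀ℓ 0F) T-refl (x₀ℓ 0F)) (ℓp 0F 0F)
        p₀≁ℓ : ¬ (p₀ ~ ℓ t′)
        p₀≁ℓ r = contradiction (p-across 0F 0F t′ _ (proj₂ (aux (ℓ-points t′ p₀ (~-sym r))))) (λ ())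
          where
          aux : p₀ ≡ x₀ ⊎ (∃[ k ] p₀ ≡ p t′ k) → ∃[ k ] p₀ ≡ p t′ k
          aux (inj₁ e) = contradiction e (p≢x₀ 0F 0F)
          aux (inj₂ e) = e
        odd : Odd (ℓ t′) p₀
        odd = trans (T-sym (ℓ t′) p₀) (even→odd (~-sym (ℓp 0F 0F)) (trans (T-sym p₀ x₀) p₀-even) (x₀ℓ t′))
        opaque
          r-data : ∃[ r ] p₀ ~ r × ℓ t′ ∥ r
          r-data = parallel (~-sym (ℓp 0F 0F)) odd (p₀≁ℓ ∘ ~-sym)

      r : Fin n
      r = proj₁ r-data
      p₀r : p₀ ~ r
      p₀r = proj₁ (proj₂ r-data)
      ℓ∥r : ℓ t′ ∥ r
      ℓ∥r = proj₂ (proj₂ r-data)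
      x₀≁r : ¬ (x₀ ~ r)
      x₀≁r x₀r = ∥⇒ ℓ∥r (~-sym (x₀ℓ t′)) (~-sym x₀r)
      private
        r-odd : Odd x₀ r
        r-odd = even→odd (x₀ℓ 0F) p₀-even p₀r
        opaque
          z-data : ∃[ z ] r ~ z × x₀ ∥ z
          z-data = parallel (~-sym p₀r) r-odd x₀≁r

      z : Fin n
      z = proj₁ z-data
      rz : r ~ z
      rz = proj₁ (proj₂ z-data)
      x₀∥z : x₀ ∥ z
      x₀∥z = proj₂ (proj₂ z-data)

      open module P = Pencil z x₀∥z (odd→even (x₀ℓ 0F) r-odd rz) r (~-sym rz) public

      r≡q : r ≡ q t′
      r≡q = q-unique t′ (~-sym rz) ℓ∥r

      -- Otherwise `r` would be the line `P₁.q 1F` that joins `p 0F 0F` to `z₁`, and that line is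
      -- not parallel to `ℓ t′`.
      z≢z₁ : z ≢ z₁
      z≢z₁ e = P₁.meets {t′} {1F} (λ ()) (subst (ℓ t′ ∥_) (meet-unique p₀≢z₁ p₀r (~-sym (subst (r ~_) e rz)) (~-sym (q₁p 0F 0F)) (P₁.zq 1F)) ℓ∥r)
        where
        p₀≢z₁ : p₀ ≢ z₁
        p₀≢z₁ e = P₁.z≁ℓ 0F (~-sym (subst (ℓ 0F ~_) e (ℓp 0F 0F)))

      -- A line through both would have two points not joined to `x₀`.
      z∥z₁ : z ∥ z₁
      z∥z₁ = ∥-stable z z₁ (λ ne → share (meet ne))
        where
        share : ¬ (∃[ s ] z ~ s × z₁ ~ s)
        share (s , zs , z₁s) = z≢z₁ (parallel-unique (even→odd (x₀ℓ 0F) (odd→even (x₀ℓ 0F) r-odd rz) zs) (x₀≁ zs) (~-sym zs) x₀∥z (~-sym z₁s) (proj₂ (proj₂ z₁-data)))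

      -- The lines q i and P₁.q i are parallel.
      q∥q₁ : ∀ i s → q i ~ s → ¬ (P₁.q i ~ s)
      q∥q₁ i s qs q₁s = ∥⇒ z∥z₁ (zq i) (subst (z₁ ~_) (sym (parallel-unique
        (even→odd (~-sym (x₀ℓ i)) (odd→even (~-sym (x₀ℓ i)) (ℓ-odd i) (zq i)) qs ) (λ ls → ∥⇒ (ℓ∥q i) ls qs)
        (~-sym qs) (ℓ∥q i) (~-sym q₁s) (P₁.ℓ∥q i))) (P₁.zq i))

      private
        opaque
          σ-data : ∀ k i → ∃[ m ] q (punchIn k i) ~ p k m
          σ-data k i = pick (meet (meets {k} {punchIn k i} (λ e → punchInᵢ≢i k i (sym e))))
            where
            pick : ∃[ s ] ℓ k ~ s × q (punchIn k i) ~ s → ∃[ m ] q (punchIn k i) ~ p k m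
            pick (s , ls , qs) = [ (λ e → ⊥-elim (x₀≁ (zq (punchIn k i)) (~-sym (subst (q (punchIn k i) ~_) e qs)))) ,
              (λ { (m , e) → m , subst (q (punchIn k i) ~_) e qs }) ]′ (ℓ-points k s ls)

      -- Compares the two pencils on `ℓ k`: the i-th relevant line through `z` meets `ℓ k` where the
      -- line with index σ k i through `z₁` does. By `q∥q₁` this has no fixed point.
      σ : Fin 4 → Fin 3 → Fin 3
      σ k i = proj₁ (σ-data k i)

      qσ : ∀ k i → q (punchIn k i) ~ p k (σ k i)
      qσ k i = proj₂ (σ-data k i)

      private
        q-p-inj : ∀ {i i′ k m} → q i ~ p k m → q i′ ~ p k m → i ≡ i′
        q-p-inj {i} {i′} {k} {m} a b = decidable-stable (i ≟ i′) (λ ne → z≁ℓ k (~-sym (subst (ℓ k ~_)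
          (meet-unique (λ e → ne (q-inj i i′ e)) a b (~-sym (zq i)) (~-sym (zq i′))) (ℓp k m))))

        q₀₀ : q t′ ~ p 0F 0F
        q₀₀ = subst (_~ p₀) r≡q (~-sym p₀r)

        opaque
          bits : ∀ k → Σ Bool λ s → ∀ i → σ k i ≡ rot s i
          bits k = derangement (σ k)
            (λ i e → q∥q₁ (punchIn k i) (p k i) (subst (λ m → q (punchIn k i) ~ p k m) e (qσ k i)) (q₁p k i))
            (λ i j e → punchIn-injective k i j (q-p-inj (qσ k i) (subst (λ m → q (punchIn k j) ~ p k m) (sym e) (qσ k j))))

        s : Fin 4 → Bool
        s k = proj₁ (bits k)

        -- A line through `z` and a line through `z₁` are distinct and have at most one common
        -- point, but here they would meet both on `ℓ k` and on `ℓ k′`.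
        bad : ∀ k k′ i i′ → k ≢ k′ → punchIn k i ≡ punchIn k′ i′ → punchIn k (rot (s k) i) ≡ punchIn k′ (rot (s k′) i′) → ⊥
        bad k k′ i i′ ne e f = ne (p-across k _ k′ _ (meet-unique qq₁ (qσ k i) c (subst (_~ p k′ (σ k′ i′)) (cong q (sym e)) (qσ k′ i′)) d))
          where
          b : Fin 4
          b = punchIn k (σ k i)
          c : P₁.q b ~ p k (σ k i)
          c = q₁p k (σ k i)
          d : P₁.q b ~ p k′ (σ k′ i′)
          d = subst (λ j → P₁.q j ~ p k′ (σ k′ i′)) (sym (trans (cong (punchIn k) (proj₂ (bits k) i)) (trans f (cong (punchIn k′) (sym (proj₂ (bits k′) i′)))))) (q₁p k′ (σ k′ i′))
          qq₁ : q (punchIn k i) ≢ P₁.q b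
          qq₁ r = ∥⇒ z∥z₁ (zq (punchIn k i)) (subst (z₁ ~_) (sym r) (P₁.zq b))

      s₀ : Bool
      s₀ = s 0F

      line : ∀ k i → q (punchIn k i) ~ p k (rot (parity s₀ k) i)
      line k i = subst (λ m → q (punchIn k i) ~ p k m) (trans (proj₂ (bits k) i) (cong (λ b → rot b i) (orientation s bad k))) (qσ k i)

      -- The line `q t′` was constructed to pass through `p 0F 0F`. This decides between the two
      -- rotations, and the two values of `t` decide differently.
      s₀-at : rot s₀ (suc t) ≡ 0F
      s₀-at = trans (sym (proj₂ (bits 0F) (suc t))) (p-inj 0F _ _ (meet-unique ℓ≢q (ℓp 0F _) (qσ 0F (suc t)) (ℓp 0F 0F) q₀₀))
        where
        ℓ≢q : ℓ 0F ≢ q t′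
        ℓ≢q e = x₀≁ (zq t′) (subst (x₀ ~_) e (x₀ℓ 0F))

-- The standard biaffine plane and its copy in every biaffine plane of order 4.

module PlaneCoordinates where
  open LinearAlgebra
  open BiaffinePlane
  open PencilNames
  open import Data.Bool using (Bool; true; false; if_then_else_)
  open import Data.Nat as ℕ using (ℕ; suc)
  open import Data.Integer using (ℤ; 0ℤ; 1ℤ)
  open import Data.Fin using (Fin; suc; _≟_; punchIn; punchOut)
  open import Data.Fin.Properties using (any?; punchInᵢ≢i; punchIn-injective; punchIn-punchOut)
  open import Data.Product using (_×_; _,_; proj₁; proj₂; ∃-syntax; Σ)
  open import Data.Product.Properties using (≡-dec)
  open import Data.Empty using (⊥-elim)
  open import Function using (_∘_)
  open import Relation.Nullary using (yes; no; contradiction; ¬_; Dec)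
  open import Relation.Nullary.Decidable using (decidable-stable; ⌊_⌋)
  open import Relation.Binary.PropositionalEquality

  Coord : Set
  Coord = Fin 4 × Fin 4

  -- The rotations belonging to the pencils through `z₁` and the two further points: none, and the
  -- two alternating patterns left by `orientation`.
  twist : Fin 3 → Fin 4 → Fin 3 → Fin 3
  twist 0F k i = i
  twist 1F k i = rot (parity false k) i
  twist 2F k i = rot (parity true k) i

  -- The four points on a line of the standard biaffine plane.
  points : Coord → Fin 4 → Coord
  points (j , i) 0F = j , 0F
  points (0F , i) (suc k) = i , suc k
  points (suc j , i) (suc k) = punchIn i k , suc (twist j (punchIn i k) (punchOut {i = punchIn i k} {j = i} (punchInᵢ≢i i k)))

  _≟c_ : (x y : Coord) → Dec (x ≡ y)
  _≟c_ = ≡-dec _≟_ _≟_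

  incident? : ∀ x y → Dec (∃[ s ] points y s ≡ x)
  incident? x y = any? (λ s → points y s ≟c x)

  bit : Bool → ℤ
  bit b = if b then 1ℤ else 0ℤ

  points-inj : ∀ y s t → points y s ≡ points y t → s ≡ t
  points-inj y 0F 0F _ = refl
  points-inj (0F , i) 0F (suc t) e = contradiction (cong proj₂ e) (λ ())
  points-inj (suc j , i) 0F (suc t) e = contradiction (cong proj₂ e) (λ ())
  points-inj (0F , i) (suc s) 0F e = contradiction (cong proj₂ e) (λ ())
  points-inj (suc j , i) (suc s) 0F e = contradiction (cong proj₂ e) (λ ())
  points-inj (0F , i) (suc s) (suc t) e = cong proj₂ e
  points-inj (suc j , i) (suc s) (suc t) e = cong suc (punchIn-injective i s t (cong proj₁ e))

  module Plane {n : ℕ} {B : Fin n → Fin n → ℤ} (bi : Biaffine B)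
    (x₀ : Fin n) (ℓ : Fin 4 → Fin n) (ℓ-inj : ∀ i j → ℓ i ≡ ℓ j → i ≡ j) (x₀ℓ : ∀ i → B x₀ (ℓ i) ≡ 1ℤ)
    where
    open Biaffine bi
    open Coordinates bi
    open Named bi x₀ ℓ ℓ-inj x₀ℓ

    module S₂ = Second 0F
    module S₃ = Second 1F

    Z : Fin 4 → Fin n
    Z 0F = x₀
    Z 1F = z₁
    Z 2F = S₂.z
    Z 3F = S₃.z

    Q : Fin 4 → Fin 4 → Fin n
    Q 0F = ℓ
    Q 1F = P₁.q
    Q 2F = S₂.q
    Q 3F = S₃.q

    P : Coord → Fin n
    P (j , 0F) = Z j
    P (i , suc k) = p i k

    L : Coord → Fin n
    L (j , i) = Q j i

    ZQ : ∀ j i → Z j ~ Q j i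
    ZQ 0F = x₀ℓ
    ZQ 1F = P₁.zq
    ZQ 2F = S₂.zq
    ZQ 3F = S₃.zq

    s₂≡false : S₂.s₀ ≡ false
    s₂≡false = aux S₂.s₀ S₂.s₀-at
      where
      aux : ∀ b → rot b 1F ≡ 0F → b ≡ false
      aux false _ = refl

    s₃≡true : S₃.s₀ ≡ true
    s₃≡true = aux S₃.s₀ S₃.s₀-at
      where
      aux : ∀ b → rot b 2F ≡ 0F → b ≡ true
      aux true _ = refl

    Qp : ∀ j k i → Q (suc j) (punchIn k i) ~ p k (twist j k i)
    Qp 0F k i = q₁p k i
    Qp 1F k i = subst (λ b → S₂.q (punchIn k i) ~ p k (rot (parity b k) i)) s₂≡false (S₂.line k i)
    Qp 2F k i = subst (λ b → S₃.q (punchIn k i) ~ p k (rot (parity b k) i)) s₃≡true (S₃.line k i)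

    LP : ∀ y s → L y ~ P (points y s)
    LP (j , i) 0F = ~-sym (ZQ j i)
    LP (0F , i) (suc k) = ℓp i k
    LP (suc j , i) (suc k) = subst (λ i′ → Q (suc j) i′ ~ P (points (suc j , i) (suc k)))
      (punchIn-punchOut (punchInᵢ≢i i k)) (Qp j (punchIn i k) (punchOut {i = punchIn i k} {j = i} (punchInᵢ≢i i k)))

    Z-even : ∀ j → Even x₀ (Z j)
    Z-even 0F = T-refl
    Z-even 1F = P₁.base-even
    Z-even 2F = S₂.base-even
    Z-even 3F = S₃.base-even

    x₀-odd : ∀ y → Odd x₀ (L y)
    x₀-odd (j , i) = even→odd (x₀ℓ 0F) (Z-even j) (ZQ j i)

    x₀-even : ∀ x → Even x₀ (P x)
    x₀-even (j , 0F) = Z-even j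
    x₀-even (i , suc k) = odd→even (x₀ℓ 0F) (x₀-odd (0F , i)) (ℓp i k)

    x₀∥Z : ∀ j → x₀ ∥ Z (suc j)
    x₀∥Z 0F = P₁.base-∥
    x₀∥Z 1F = S₂.base-∥
    x₀∥Z 2F = S₃.base-∥

    Z≁ℓ : ∀ j i → ¬ (Z (suc j) ~ ℓ i)
    Z≁ℓ j i = ∥⇒ (x₀∥Z j) (x₀ℓ i)

    -- If the points agreed, the line from `p 0F 0F` to them would be parallel both to `ℓ 2F` and to
    -- `ℓ 3F`.
    z₂≢z₃ : S₂.z ≢ S₃.z
    z₂≢z₃ e = contradiction (S₃.q-inj 2F 3F (trans (sym (S₃.q-unique 2F (~-sym (subst (S₂.r ~_) e S₂.rz)) S₂.ℓ∥r))
      (trans (meet-unique p₀≢z S₂.p₀r (~-sym (subst (S₂.r ~_) e S₂.rz)) S₃.p₀r (~-sym S₃.rz)) S₃.r≡q))) (λ ())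
      where
      p₀≢z : p 0F 0F ≢ S₃.z
      p₀≢z r = Z≁ℓ 2F 0F (~-sym (subst (ℓ 0F ~_) r (ℓp 0F 0F)))

    Z₁-distinct : ∀ i j → i ≢ j → Z (suc i) ≢ Z (suc j)
    Z₁-distinct 0F 0F ne = contradiction refl ne
    Z₁-distinct 0F 1F _ e = S₂.z≢z₁ (sym e)
    Z₁-distinct 0F 2F _ e = S₃.z≢z₁ (sym e)
    Z₁-distinct 1F 0F _ e = S₂.z≢z₁ e
    Z₁-distinct 1F 1F ne = contradiction refl ne
    Z₁-distinct 1F 2F _ e = z₂≢z₃ e
    Z₁-distinct 2F 0F _ e = S₃.z≢z₁ e
    Z₁-distinct 2F 1F _ e = z₂≢z₃ (sym e)
    Z₁-distinct 2F 2F ne = contradiction refl ne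

    Z∥Z : ∀ i j → i ≢ j → Z i ∥ Z j
    Z∥Z 0F 0F ne = contradiction refl ne
    Z∥Z 0F (suc j) _ = x₀∥Z j
    Z∥Z (suc i) 0F _ = ∥-sym (x₀∥Z i)
    Z∥Z (suc i) (suc j) ne = ∥-stable (Z (suc i)) (Z (suc j)) (λ np → share (meet np))
      where
      share : ¬ (∃[ s ] Z (suc i) ~ s × Z (suc j) ~ s)
      share (s , zs , z′s) = Z₁-distinct i j (λ e → ne (cong suc e))
        (parallel-unique (even→odd (x₀ℓ 0F) (Z-even (suc i)) zs) (λ xs → ∥⇒ (x₀∥Z i) xs zs) (~-sym zs) (x₀∥Z i) (~-sym z′s) (x₀∥Z j))

    Z-inj : ∀ i j → Z i ≡ Z j → i ≡ j
    Z-inj i j e = decidable-stable (i ≟ j) (λ ne → ∥⇒ (Z∥Z i j ne) (ZQ i 0F) (subst (_~ Q i 0F) e (ZQ i 0F)))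

    Z≢p : ∀ j i k → Z j ≢ p i k
    Z≢p 0F i k e = p≢x₀ i k (sym e)
    Z≢p (suc j) i k e = Z≁ℓ j i (~-sym (subst (ℓ i ~_) (sym e) (ℓp i k)))

    P-inj : ∀ x y → P x ≡ P y → x ≡ y
    P-inj (i , 0F) (j , 0F) e = cong (_, 0F) (Z-inj i j e)
    P-inj (i , 0F) (j , suc k) e = contradiction e (Z≢p i j k)
    P-inj (i , suc k) (j , 0F) e = contradiction (sym e) (Z≢p j i k)
    P-inj (i , suc k) (j , suc k′) e with p-across i k j k′ e
    ... | refl = cong (λ t → i , suc t) (p-inj i k k′ e)

    Q-inj : ∀ j i i′ → Q j i ≡ Q j i′ → i ≡ i′
    Q-inj 0F = ℓ-inj
    Q-inj 1F = P₁.q-inj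
    Q-inj 2F = S₂.q-inj
    Q-inj 3F = S₃.q-inj

    L-inj : ∀ x y → L x ≡ L y → x ≡ y
    L-inj (j , i) (j′ , i′) e = go (j ≟ j′)
      where
      go : Dec (j ≡ j′) → (j , i) ≡ (j′ , i′)
      go (yes refl) = cong (j ,_) (Q-inj j i i′ e)
      go (no ne) = ⊥-elim (∥⇒ (Z∥Z j j′ ne) (ZQ j i) (subst (Z j′ ~_) (sym e) (ZQ j′ i′)))

    P≢L : ∀ x y → P x ≢ L y
    P≢L x y e = contradiction (trans (sym (x₀-even x)) (trans (cong (T x₀) e) (x₀-odd y))) (λ ())

    PP : ∀ x y → B (P x) (P y) ≡ 0ℤ
    PP x y = ≁ (λ xy → contradiction (trans (sym (x₀-even y)) (even→odd (x₀ℓ 0F) (x₀-even x) xy)) (λ ()))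

    LL : ∀ x y → B (L x) (L y) ≡ 0ℤ
    LL x y = ≁ (λ xy → contradiction (trans (sym (x₀-odd y)) (odd→even (x₀ℓ 0F) (x₀-odd x) xy)) (λ ()))

    -- `LP` supplies four points on each line. A line has only four points, so there are no further
    -- incidences.
    PL : ∀ x y → B (P x) (L y) ≡ bit ⌊ incident? x y ⌋
    PL x y with incident? x y
    ... | yes (s , refl) = ~-sym (LP y s)
    ... | no ne = ≁ (λ xy → found (nbrs-complete (P ∘ points y) (λ s t e → points-inj y s t (P-inj _ _ e)) (LP y) (P x) (~-sym xy)))
      where
      found : ¬ (∃[ s ] P (points y s) ≡ P x)
      found (s , e) = ne (s , P-inj _ _ e)

    -- Coordinates (false , x) are points and (true , y) are lines.
    E : Bool × Coord → Fin n
    E (false , x) = P x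
    E (true , y) = L y

    E-inj : ∀ x y → E x ≡ E y → x ≡ y
    E-inj (false , x) (false , y) e = cong (false ,_) (P-inj x y e)
    E-inj (false , x) (true , y) e = contradiction e (P≢L x y)
    E-inj (true , x) (false , y) e = contradiction (sym e) (P≢L y x)
    E-inj (true , x) (true , y) e = cong (true ,_) (L-inj x y e)

    E-nbr : ∀ x → ∃[ s ] E x ~ s
    E-nbr (false , (j , 0F)) = Q j 0F , ZQ j 0F
    E-nbr (false , (i , suc k)) = ℓ i , ~-sym (ℓp i k)
    E-nbr (true , (j , i)) = Z j , ~-sym (ZQ j i)

  joined : Bool × Coord → Bool × Coord → Bool
  joined (false , x) (false , y) = false
  joined (false , x) (true , y) = ⌊ incident? x y ⌋
  joined (true , x) (false , y) = ⌊ incident? y x ⌋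
  joined (true , x) (true , y) = false

  module _ {n : ℕ} {B : Fin n → Fin n → ℤ} (bi : Biaffine B) {x₀ s : Fin n} (x₀s : B x₀ s ≡ 1ℤ) where
    open Biaffine bi
    open Coordinates bi

    -- Every biaffine plane of order 4 contains a copy of the standard one.
    coordinatize : Σ (Bool × Coord → Fin n) λ E → (∀ x y → E x ≡ E y → x ≡ y) ×
      (∀ x → ∃[ t ] B (E x) t ≡ 1ℤ) × (∀ x y → B (E x) (E y) ≡ bit (joined x y))
    coordinatize = go (nbrs x₀s)
      where
      go : Enumeration 4 (B x₀) → _
      go (ℓ , inj , x₀ℓ) = E , E-inj , E-nbr , table
        where
        open Plane bi x₀ ℓ inj x₀ℓ
        table : ∀ x y → B (E x) (E y) ≡ bit (joined x y)
        table (false , x) (false , y) = PP x y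
        table (false , x) (true , y) = PL x y
        table (true , x) (false , y) = trans (B-sym (L x) (P y)) (PL y x)
        table (true , x) (true , y) = LL x y

-- Consequences for the local graph and for the traces of other vertices on it.

module LocalGraph where
  open LinearAlgebra
  open StronglyRegular
  open TraceIdentity
  open BiaffinePlane
  open import Data.Nat as ℕ using (ℕ)
  open import Data.Integer using (ℤ; +_; -_; _+_; _*_; _-_; 0ℤ; 1ℤ)
  open import Data.Integer.Properties using () renaming (_≟_ to _≟ℤ_)
  open import Data.Integer.Properties hiding (_≟_)
  open import Data.Integer.Tactic.RingSolver using (solve-∀)
  open import Data.Fin using (Fin; _≟_)
  open import Data.Product using (_,_)
  open import Data.Empty using (⊥-elim)
  open import Data.Sum using (_⊎_; inj₁; inj₂; [_,_]′)
  open import Relation.Nullary using (yes; no)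
  open import Relation.Binary.PropositionalEquality
  open ≡-Reasoning

  private
    -- Both sides of the conclusion are scaled by 256 = 768 / 3.
    solve-gram : ∀ X qc qv Σq g d k → qc ≡ - + 16 * X + + 432 * + 12 → qv ≡ - + 16 * qc + + 6 * Σq → Σq ≡ 0ℤ →
      + 768 * g ≡ qv → g ≡ + 32 * d + (- + 16 * k + + 4) → X ≡ + 336 + (+ 96 * d + - + 48 * k)
    solve-gram X .(- + 16 * X + + 432 * + 12) .(- + 16 * (- + 16 * X + + 432 * + 12) + + 6 * 0ℤ) .0ℤ .(+ 32 * d + (- + 16 * k + + 4)) d k refl refl refl e refl =
      *-cancelˡ-≡ (+ 256) _ _ (trans (ar₁ X) (trans (cong (_+ + 82944) (sym e)) (ar₂ d k)))
      where
      ar₁ : ∀ x → + 256 * x ≡ (- + 16 * (- + 16 * x + + 432 * + 12) + + 6 * 0ℤ) + + 82944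
      ar₁ = solve-∀
      ar₂ : ∀ d k → + 768 * (+ 32 * d + (- + 16 * k + + 4)) + + 82944 ≡ + 256 * (+ 336 + (+ 96 * d + - + 48 * k))
      ar₂ = solve-∀

  module Consequences {n : ℕ} (a : Fin n → Fin n → ℤ)
    (a-sym : Symmetric a)
    (a-01 : ∀ i j → a i j ≡ 0ℤ ⊎ a i j ≡ 1ℤ)
    (a-irr : ∀ i → a i i ≡ 0ℤ)
    (a-deg : ∀ i → sum (a i) ≡ + 32)
    (a-sq : ∀ i j → ⟨ a i , a j ⟩ ≡ + 12 + (+ 20 * δ i j + - + 8 * a i j))
    (size : sum {n} (λ _ → 1ℤ) ≡ + 105)
    (u : Fin n)
    where

    open Geometry a a-sym a-01 a-irr a-deg a-sq size
    open At u
    open Trace a a-sym a-01 a-irr a-deg a-sq size u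

    private
      B∙-on : ∀ {f g : Fin n → ℤ} → (∀ p → α p ≡ 1ℤ → f p ≡ g p) → ∀ y → (B ∙ f) y ≡ (B ∙ g) y
      B∙-on {f} {g} e y = sum-cong pw
        where
        pw : ∀ p → B y p * f p ≡ B y p * g p
        pw p with α-01 p
        ... | inj₁ z rewrite B-supp y p z = refl
        ... | inj₂ o = cong (B y p *_) (e p o)

      B∙one : ∀ {y} → α y ≡ 1ℤ → (B ∙ one) y ≡ + 4
      B∙one {y} p = trans (⟨⟩-one (B y)) (B-deg p)

      -- the effect of B on c·f + d·1 at a vertex of the local graph
      B∙-affine : ∀ c d f {y} → α y ≡ 1ℤ → (B ∙ (λ p → c * f p + d * one p)) y ≡ c * (B ∙ f) y + d * + 4
      B∙-affine c d f {y} p = trans (∙-lin B c d f one y) (cong (λ k → c * (B ∙ f) y + d * k) (B∙one p))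

    module Inside (x : Fin n) (αx : α x ≡ 1ℤ) where
      private
        w₁ : ∀ {y} → α y ≡ 1ℤ → v₁ x y ≡ + 32 * B x y + 1ℤ * (- + 16 * B² x y + + 4)
        w₁ {y} p = begin
          (B ∙ v₀ x) y ≡⟨ B∙-on {v₀ x} {λ s → + 32 * (δ x s) + 1ℤ * (- + 16 * B x s + 1ℤ * one s)} at y ⟩
          (B ∙ (λ s → + 32 * δ x s + 1ℤ * (- + 16 * B x s + 1ℤ * one s))) y
            ≡⟨ ∙-lin B (+ 32) 1ℤ (δ x) (λ s → - + 16 * B x s + 1ℤ * one s) y ⟩
          + 32 * (B ∙ δ x) y + 1ℤ * (B ∙ (λ s → - + 16 * B x s + 1ℤ * one s)) y
            ≡⟨ cong₂ (λ k l → + 32 * k + 1ℤ * l)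
                 (trans (⟨⟩-comm (B y) (δ x)) (trans (sum-δ x (B y)) (B-sym y x)))
                 (trans (B∙-affine (- + 16) 1ℤ (B x) p) (cong (λ k → - + 16 * k + + 4) (⟨⟩-comm (B y) (B x)))) ⟩
          + 32 * B x y + 1ℤ * (- + 16 * B² x y + + 4) ∎
          where
          at : ∀ s → α s ≡ 1ℤ → v₀ x s ≡ + 32 * δ x s + 1ℤ * (- + 16 * B x s + 1ℤ * one s)
          at s q = trans (cong (_* G s x) q) (trans (*-identityˡ (G s x)) (trans (G-on q αx)
            (cong₂ (λ k l → + 32 * k + 1ℤ * (- + 16 * l + 1ℤ)) (δ-sym s x) (B-sym s x))))

        w₂ : ∀ {y} → α y ≡ 1ℤ → v₂ x y ≡ + 32 * B² x y + 1ℤ * (- + 16 * ⟨ B y , B² x ⟩ + + 16)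
        w₂ {y} p = begin
          (B ∙ v₁ x) y ≡⟨ B∙-on {v₁ x} {λ s → + 32 * B x s + 1ℤ * (- + 16 * B² x s + + 4 * one s)} (λ s q → w₁ q) y ⟩
          (B ∙ (λ s → + 32 * B x s + 1ℤ * (- + 16 * B² x s + + 4 * one s))) y
            ≡⟨ ∙-lin B (+ 32) 1ℤ (B x) (λ s → - + 16 * B² x s + + 4 * one s) y ⟩
          + 32 * (B ∙ B x) y + 1ℤ * (B ∙ (λ s → - + 16 * B² x s + + 4 * one s)) y
            ≡⟨ cong₂ (λ k l → + 32 * k + 1ℤ * l) (⟨⟩-comm (B y) (B x)) (B∙-affine (- + 16) (+ 4) (B² x) p) ⟩
          + 32 * B² x y + 1ℤ * (- + 16 * ⟨ B y , B² x ⟩ + + 16) ∎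

        tv : ∀ {y} → α y ≡ 1ℤ → t x y ≡ + 64 * B x y + (- + 16 * ⟨ B y , B² x ⟩ + + 24)
        tv {y} p = trans (t-at x y) (trans (cong₂ (λ k l → + 2 * k + 1ℤ * l) (w₁ p) (w₂ p)) (ar (B x y) (B² x y) ⟨ B y , B² x ⟩))
          where
          ar : ∀ b c d → + 2 * (+ 32 * b + 1ℤ * (- + 16 * c + + 4)) + 1ℤ * (+ 32 * c + 1ℤ * (- + 16 * d + + 16)) ≡ + 64 * b + (- + 16 * d + + 24)
          ar = solve-∀

      -- On the local graph `t x` is 64 B - 16 B³ + 24 in row `x`, and it changes sign along the
      -- edge.
      B³-edge : ∀ {y z} → B y z ≡ 1ℤ → ⟨ B y , B² x ⟩ + ⟨ B z , B² x ⟩ ≡ + 3 + + 4 * (B x y + B x z)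
      B³-edge {y} {z} yz = *-cancelˡ-≡ (+ 16) _ _ (begin
        + 16 * (⟨ B y , B² x ⟩ + ⟨ B z , B² x ⟩) ≡⟨ ar₁ (B x y) (B x z) ⟨ B y , B² x ⟩ ⟨ B z , B² x ⟩ ⟩
        (+ 48 + + 64 * (B x y + B x z)) + - ((+ 64 * B x y + (- + 16 * ⟨ B y , B² x ⟩ + + 24)) + (+ 64 * B x z + (- + 16 * ⟨ B z , B² x ⟩ + + 24)))
          ≡⟨ cong (λ k → (+ 48 + + 64 * (B x y + B x z)) + - k)
               (trans (cong₂ _+_ (sym (tv (B⇒α yz))) (sym (tv (B⇒α (B-flip yz))))) (t-alternates x yz)) ⟩
        (+ 48 + + 64 * (B x y + B x z)) + 0ℤ ≡⟨ ar₂ (B x y + B x z) ⟩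
        + 16 * (+ 3 + + 4 * (B x y + B x z)) ∎)
        where
        ar₁ : ∀ b c d e → + 16 * (d + e) ≡ (+ 48 + + 64 * (b + c)) + - ((+ 64 * b + (- + 16 * d + + 24)) + (+ 64 * c + (- + 16 * e + + 24)))
        ar₁ = solve-∀
        ar₂ : ∀ b → (+ 48 + + 64 * b) + 0ℤ ≡ + 16 * (+ 3 + + 4 * b)
        ar₂ = solve-∀

    biaffine : Biaffine B
    biaffine = record
      { B-01 = B-01
      ; B-sym = B-sym
      ; B-deg = λ xy → B-deg (B⇒α xy)
      ; □-free = □-free
      ; B²-adj = B²-adj
      ; B²-01 = B²-01
      ; B³-edge = λ {x} xs yz → Inside.B³-edge x (B⇒α xs) yz
      }

    -- The trace on the local graph of a vertex w at distance 2 from u.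
    trace : Fin n → Fin n → ℤ
    trace w x = α x * a w x

    trace-supp : ∀ w → Supp (trace w)
    trace-supp w x p = cong (_* a w x) p

    trace-on : ∀ w {x} → α x ≡ 1ℤ → trace w x ≡ a w x
    trace-on w {x} p = trans (cong (_* a w x) p) (*-identityˡ (a w x))

    private
      gval : (d k ai aj di dj : ℤ) → ℤ
      gval d k ai aj di dj = + 32 * d + (- + 16 * k + (+ 4 + (+ 2 * (ai + aj) + (- + 4 * (di + dj) +
        (- + 7 * (ai * aj) + (+ 14 * (ai * dj + di * aj) + - + 28 * (di * dj)))))))

      G-eval : ∀ x w {d k ai aj di dj} → δ x w ≡ d → a x w ≡ k → α x ≡ ai → α w ≡ aj → δ u x ≡ di → δ u w ≡ dj → G x w ≡ gval d k ai aj di dj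
      G-eval x w refl refl refl refl refl refl = refl

      G-outside : ∀ {x w} → α x ≡ 0ℤ → α w ≡ 0ℤ → u ≢ x → u ≢ w → G x w ≡ + 32 * δ x w + (- + 16 * a x w + + 4)
      G-outside {x} {w} p q ux uw = G-eval x w refl refl p q (δ-≢ ux) (δ-≢ uw)

      Σtrace : ∀ w → α w ≡ 0ℤ → u ≢ w → sum (trace w) ≡ + 12
      Σtrace w αw u≢w = trans (a-sq u w) (cong₂ (λ s t → + 12 + (+ 20 * s + - + 8 * t)) (δ-≢ u≢w) αw)

      v₀-outside : ∀ w → α w ≡ 0ℤ → u ≢ w → ∀ {y} → α y ≡ 1ℤ → v₀ w y ≡ - + 16 * trace w y + + 6 * 1ℤ
      v₀-outside w αw u≢w {y} p = trans (cong (_* G y w) p) (trans (*-identityˡ (G y w))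
        (trans (G-eval y w (δ-≢ (λ e → 0≢1 (trans (cong α e) αw) p)) (a-sym y w) p αw (δ-≢ (α⇒≢u p)) (δ-≢ u≢w))
        (trans (+-identityˡ (- + 16 * a w y + + 6 * 1ℤ)) (cong (λ k → - + 16 * k + + 6 * 1ℤ) (sym (trace-on w p))))))

    module Outside (w : Fin n) (αw : α w ≡ 0ℤ) (u≢w : u ≢ w) where
      c i j : Fin n → ℤ
      c = trace w
      i = B ∙ c
      j = B ∙ i

      Σc : sum c ≡ + 12
      Σc = Σtrace w αw u≢w

      private
        w₀ : ∀ {y} → α y ≡ 1ℤ → v₀ w y ≡ - + 16 * c y + + 6 * 1ℤ
        w₀ = v₀-outside w αw u≢w

        w₁ : ∀ {y} → α y ≡ 1ℤ → v₁ w y ≡ - + 16 * i y + + 24 * 1ℤ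
        w₁ {y} p = trans (B∙-on {v₀ w} {λ s → - + 16 * c s + + 6 * one s} (λ s q → w₀ q) y) (B∙-affine (- + 16) (+ 6) c p)

        w₂ : ∀ {y} → α y ≡ 1ℤ → v₂ w y ≡ - + 16 * j y + + 96
        w₂ {y} p = trans (B∙-on {v₁ w} {λ s → - + 16 * i s + + 24 * one s} (λ s q → w₁ q) y) (B∙-affine (- + 16) (+ 24) i p)

        tv : ∀ {y} → α y ≡ 1ℤ → t w y ≡ - + 16 * (+ 2 * i y + j y) + + 144
        tv {y} p = trans (t-at w y) (trans (cong₂ (λ k l → + 2 * k + 1ℤ * l) (w₁ p) (w₂ p)) (ar (i y) (j y)))
          where
          ar : ∀ b c → + 2 * (- + 16 * b + + 24 * 1ℤ) + 1ℤ * (- + 16 * c + + 96) ≡ - + 16 * (+ 2 * b + c) + + 144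
          ar = solve-∀

      -- The entries of `G` between `w` and the local graph are 6 - 16 c, whence t = 144 - 16 (2i +
      -- j). Its sign change along an edge gives the sum 288 / 16 = 18.
      edge-sum : ∀ {y z} → B y z ≡ 1ℤ → (+ 2 * i y + j y) + (+ 2 * i z + j z) ≡ + 18
      edge-sum {y} {z} yz = *-cancelˡ-≡ (+ 16) _ _ (trans (ar (+ 2 * i y + j y) (+ 2 * i z + j z)) (cong (λ k → + 288 + - k)
        (trans (cong₂ _+_ (sym (tv (B⇒α yz))) (sym (tv (B⇒α (B-flip yz))))) (t-alternates w yz))))
        where
        ar : ∀ b d → + 16 * (b + d) ≡ + 288 + - ((- + 16 * b + + 144) + (- + 16 * d + + 144))
        ar = solve-∀

      -- Two adjacent vertices of the local graph of u and w span no quadrangle with u and w.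
      induced-matching : ∀ {y z z′} → c y ≡ 1ℤ → B y z ≡ 1ℤ → B y z′ ≡ 1ℤ → c z ≡ 1ℤ → c z′ ≡ 1ℤ → z ≡ z′
      induced-matching {y} {z} {z′} cy yz yz′ cz cz′ with z ≟ z′
      ... | yes e = e
      ... | no ne = ⊥-elim (W₄-free {y} {u} {z} {w} {z′} (trans (a-sym y u) αy) (B⇒a yz) (trans (a-sym y w) (wa y αy cy)) (B⇒a yz′)
          (α-of z cz) (trans (a-sym z w) (wa z (α-of z cz) cz)) (wa z′ (α-of z′ cz′) cz′) (trans (a-sym z′ u) (α-of z′ cz′)) u≢w ne)
        where
        α-of : ∀ x → c x ≡ 1ℤ → α x ≡ 1ℤ
        α-of x e with α-01 x
        ... | inj₁ q = 0≢1 (trace-supp w x q) e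
        ... | inj₂ q = q
        αy : α y ≡ 1ℤ
        αy = α-of y cy
        wa : ∀ x → α x ≡ 1ℤ → c x ≡ 1ℤ → a w x ≡ 1ℤ
        wa x p e = trans (sym (trace-on w p)) e

      -- Equates `G-determined` with the entry 32δ - 16a + 4 of `G` outside the local graph. Traces
      -- paired with the weight 24 + 8B + B² thus tell equal, adjacent and other vertices apart, by
      -- the values 432, 288 and 336.
      adjacency : ∀ w′ → α w′ ≡ 0ℤ → u ≢ w′ →
        + 24 * ⟨ c , trace w′ ⟩ + 1ℤ * (+ 8 * ⟨ i , trace w′ ⟩ + 1ℤ * ⟨ j , trace w′ ⟩) ≡ + 336 + (+ 96 * δ w′ w + - + 48 * a w′ w)
      adjacency w′ αw′ u≢w′ = solve-gram _ ⟨ q w , c′ ⟩ ⟨ q w , v₀ w′ ⟩ (sum (q w)) (G w′ w) (δ w′ w) (a w′ w)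
        qc′ gram (Σq w) (G-determined w w′) (G-outside αw′ αw u≢w′ u≢w)
        where
        c′ : Fin n → ℤ
        c′ = trace w′
        Σc′ : sum c′ ≡ + 12
        Σc′ = Σtrace w′ αw′ u≢w′
        y₀ : Fin n → ℤ
        y₀ y = + 24 * c y + 1ℤ * (+ 8 * i y + 1ℤ * j y)
        qv : ∀ {y} → α y ≡ 1ℤ → q w y ≡ - + 16 * y₀ y + + 432 * 1ℤ
        qv {y} p = trans (q-at w y) (trans (cong₂ (λ k l → + 24 * k + 1ℤ * l) (w₀ p) (cong₂ (λ k l → + 8 * k + 1ℤ * l) (w₁ p) (w₂ p))) (ar (c y) (i y) (j y)))
          where
          ar : ∀ c i j → + 24 * (- + 16 * c + + 6 * 1ℤ) + 1ℤ * (+ 8 * (- + 16 * i + + 24 * 1ℤ) + 1ℤ * (- + 16 * j + + 96)) ≡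
            - + 16 * (+ 24 * c + 1ℤ * (+ 8 * i + 1ℤ * j)) + + 432 * 1ℤ
          ar = solve-∀
        qc′ : ⟨ q w , c′ ⟩ ≡ - + 16 * (+ 24 * ⟨ c , c′ ⟩ + 1ℤ * (+ 8 * ⟨ i , c′ ⟩ + 1ℤ * ⟨ j , c′ ⟩)) + + 432 * + 12
        qc′ = trans (sum-cong pw) (trans (⟨⟩-linˡ (- + 16) (+ 432) y₀ one c′)
            (cong₂ (λ k l → - + 16 * k + + 432 * l) (⟨⟩-lin₃ (+ 24) (+ 8) 1ℤ c i j c′) (trans (⟨⟩-comm one c′) (trans (⟨⟩-one c′) Σc′))))
          where
          pw : ∀ y → q w y * c′ y ≡ (- + 16 * y₀ y + + 432 * one y) * c′ y
          pw y = [ (λ z → trans (cong (q w y *_) (trace-supp w′ y z)) (trans (*-zeroʳ (q w y)) (sym (trans (cong ((- + 16 * y₀ y + + 432 * one y) *_) (trace-supp w′ y z)) (*-zeroʳ (- + 16 * y₀ y + + 432 * one y))))))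
                 , (λ o → cong (_* c′ y) (qv o)) ]′ (α-01 y)
        gram : ⟨ q w , v₀ w′ ⟩ ≡ - + 16 * ⟨ q w , c′ ⟩ + + 6 * sum (q w)
        gram = trans (sum-cong pw) (trans (⟨⟩-linʳ (- + 16) (+ 6) c′ one (q w)) (cong (λ l → - + 16 * ⟨ q w , c′ ⟩ + + 6 * l) (⟨⟩-one (q w))))
          where
          pw : ∀ y → q w y * v₀ w′ y ≡ q w y * (- + 16 * c′ y + + 6 * one y)
          pw y = [ (λ z → trans (cong (_* v₀ w′ y) (q-off w y z)) (sym (cong (_* (- + 16 * c′ y + + 6 * one y)) (q-off w y z))))
                 , (λ o → cong (q w y *_) (v₀-outside w′ αw′ u≢w′ o)) ]′ (α-01 y)

-- The flags of PG(2,4), the enumeration of possible traces and the check of their pairings.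

module Flags where
  open PencilNames using (0F; 1F; 2F; 3F)
  open import Data.Bool using (Bool; true; false; not; if_then_else_; _∧_; _∨_; T; T?; _xor_)
  open import Data.Bool.Properties using (T-∧)
  open import Data.Nat as ℕ using (ℕ; zero; suc; _+_; _*_; _∸_; _^_; _≡ᵇ_; _≤ᵇ_)
  open import Data.Nat.DivMod using (_/_; _%_)
  open import Data.Nat.Properties using (m^n≢0; ≡ᵇ⇒≡; ≤∧≢⇒<)
  open import Data.Fin using (Fin; zero; suc; toℕ)
  open import Data.Product using (_×_; _,_; proj₁; proj₂)
  open import Data.List using (List; []; _∷_; filter; cartesianProduct)
  open import Data.Bool.ListAction using (all)
  open import Data.List.Membership.Propositional using (_∈_)
  open import Data.List.Membership.Propositional.Properties using (∈-cartesianProduct⁺; ∈-filter⁺)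
  open import Data.List.Relation.Unary.Any using (here; there)
  open import Data.List.Relation.Unary.All as All using (All)
  open import Data.List.Relation.Unary.All.Properties using (all⁺)
  open import Data.Unit using (tt)
  open import Function using (_∘_)
  open import Function.Bundles using (Equivalence)
  open import Relation.Nullary using (yes; no)
  open import Relation.Binary.PropositionalEquality

  -- The field with four elements, with addition ⊕ and multiplication ⊗.
  _⊕_ _⊗_ : Fin 4 → Fin 4 → Fin 4
  0F ⊕ y = y
  x ⊕ 0F = x
  1F ⊕ 1F = 0F
  1F ⊕ 2F = 3F
  1F ⊕ 3F = 2F
  2F ⊕ 1F = 3F
  2F ⊕ 2F = 0F
  2F ⊕ 3F = 1F
  3F ⊕ 1F = 2F
  3F ⊕ 2F = 1F
  3F ⊕ 3F = 0F
  0F ⊗ y = 0F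
  x ⊗ 0F = 0F
  1F ⊗ y = y
  x ⊗ 1F = x
  2F ⊗ 2F = 3F
  2F ⊗ 3F = 1F
  3F ⊗ 2F = 1F
  3F ⊗ 3F = 2F

  _==₄_ : Fin 4 → Fin 4 → Bool
  i ==₄ j = toℕ i ≡ᵇ toℕ j

  -- (false , x , y) is the point (x , y) and (true , m , c) the line y = m x + c.
  Vertex : Set
  Vertex = Bool × Fin 4 × Fin 4

  -- In characteristic 2 the equation y = m x + c also reads c = y + m x, so one formula serves
  -- points and lines alike and `inc` is symmetric.
  foot : Fin 4 → Fin 4 → Fin 4 → Fin 4
  foot x y m = y ⊕ (m ⊗ x)

  inc same : Vertex → Vertex → Bool
  inc (b , x , y) (b′ , m , c) = (b xor b′) ∧ (c ==₄ foot x y m)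
  same (b , x , y) (b′ , x′ , y′) = not (b xor b′) ∧ ((x ==₄ x′) ∧ (y ==₄ y′))

  all₂ : (Bool → Bool) → Bool
  all₂ p = p false ∧ p true

  all₄ : (Fin 4 → Bool) → Bool
  all₄ p = p 0F ∧ (p 1F ∧ (p 2F ∧ p 3F))

  allV : (Vertex → Bool) → Bool
  allV p = all₂ λ b → all₄ λ x → all₄ λ y → p (b , x , y)

  ∧-elim : ∀ {x y} → T (x ∧ y) → T x × T y
  ∧-elim = Equivalence.to T-∧

  ∧-intro : ∀ {x y} → T x → T y → T (x ∧ y)
  ∧-intro p q = Equivalence.from T-∧ (p , q)

  all₂-sound : ∀ p → T (all₂ p) → ∀ b → T (p b)
  all₂-sound p t false = proj₁ (∧-elim {p false} t)
  all₂-sound p t true = proj₂ (∧-elim {p false} t)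

  all₄-sound : ∀ p → T (all₄ p) → ∀ i → T (p i)
  all₄-sound p t 0F = proj₁ (∧-elim {p 0F} t)
  all₄-sound p t 1F = proj₁ (∧-elim {p 1F} (proj₂ (∧-elim {p 0F} t)))
  all₄-sound p t 2F = proj₁ (∧-elim {p 2F} (proj₂ (∧-elim {p 1F} (proj₂ (∧-elim {p 0F} t)))))
  all₄-sound p t 3F = proj₂ (∧-elim {p 2F} (proj₂ (∧-elim {p 1F} (proj₂ (∧-elim {p 0F} t)))))

  all₄-complete : ∀ p → (∀ i → T (p i)) → T (all₄ p)
  all₄-complete p t = ∧-intro {p 0F} (t 0F) (∧-intro {p 1F} (t 1F) (∧-intro {p 2F} (t 2F) (t 3F)))

  allV-sound : ∀ p → T (allV p) → ∀ v → T (p v)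
  allV-sound p t (b , x , y) = all₄-sound (λ y → p (b , x , y)) (all₄-sound (λ x → all₄ λ y → p (b , x , y)) (all₂-sound (λ b → all₄ λ x → all₄ λ y → p (b , x , y)) t b) x) y

  infixr 2 _⇒ᵇ_
  _⇒ᵇ_ : Bool → Bool → Bool
  b ⇒ᵇ c = if b then c else true

  ⇒ᵇ-elim : ∀ {b c} → T (b ⇒ᵇ c) → T b → T c
  ⇒ᵇ-elim {true} t _ = t

  nb : Bool → ℕ
  nb b = if b then 1 else 0

  index : ∀ {A : Set} → A → List A → ℕ → A
  index d [] _ = d
  index d (x ∷ xs) zero = x
  index d (x ∷ xs) (suc n) = index d xs n

  testBit : ℕ → ℕ → Bool
  testBit r j = (r / (2 ^ j)) ⦃ m^n≢0 2 j ⦄ % 2 ≡ᵇ 1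

  data Point : Set where
    P∞ : Point
    S : Fin 4 → Point
    Af : Fin 4 → Fin 4 → Point

  data Line : Set where
    L∞ : Line
    V : Fin 4 → Line
    N : Fin 4 → Fin 4 → Line

  _on_ : Point → Line → Bool
  P∞ on L∞ = true
  P∞ on V x = true
  P∞ on N m c = false
  S m on L∞ = true
  S m on V x = false
  S m on N m′ c = m ==₄ m′
  Af x y on L∞ = false
  Af x y on V x′ = x ==₄ x′
  Af x y on N m c = c ==₄ foot x y m

  _==ₚ_ : Point → Point → Bool
  P∞ ==ₚ P∞ = true
  S m ==ₚ S m′ = m ==₄ m′
  Af x y ==ₚ Af x′ y′ = (x ==₄ x′) ∧ (y ==₄ y′)
  _ ==ₚ _ = false

  _==ₗ_ : Line → Line → Bool
  L∞ ==ₗ L∞ = true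
  V x ==ₗ V x′ = x ==₄ x′
  N m c ==ₗ N m′ c′ = (m ==₄ m′) ∧ (c ==₄ c′)
  _ ==ₗ _ = false

  -- The flags of the projective plane of order 4.
  data Code : Set where
    ∞ : Code
    pt ln : Fin 4 → Fin 4 → Code
    fl : Fin 4 → Fin 4 → Fin 4 → Code
    vt sl : Fin 4 → Code

  -- The base flag `∞` consists of the vertical point at infinity and the line at infinity. Its
  -- neighbours are the affine points with their vertical lines (`pt`) and the nonvertical lines
  -- with their points at infinity (`ln`): the points and lines of the biaffine plane in `Vertex`.
  point : Code → Point
  point ∞ = P∞
  point (pt x y) = Af x y
  point (ln m c) = S m
  point (fl x y m) = Af x y
  point (vt x) = P∞
  point (sl m) = S m

  line : Code → Line
  line ∞ = L∞
  line (pt x y) = V x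
  line (ln m c) = N m c
  line (fl x y m) = N m (foot x y m)
  line (vt x) = V x
  line (sl m) = L∞

  adjF : Point → Line → Point → Line → Bool
  adjF p l q k = (not (p ==ₚ q) ∧ not (l ==ₗ k)) ∧ ((p on k) ∨ (q on l))

  adjC : Code → Code → Bool
  adjC c d = adjF (point c) (line c) (point d) (line d)

  codeV : Vertex → Code
  codeV (false , x , y) = pt x y
  codeV (true , m , c) = ln m c

  maskC : Code → Vertex → Bool
  maskC d v = adjC d (codeV v)

  allFar : (Code → Bool) → Bool
  allFar p = all₄ (λ x → p (vt x) ∧ (p (sl x) ∧ (all₄ λ y → all₄ λ m → p (fl x y m))))

  -- The 64 + 4 + 4 flags that are neither `∞` nor adjacent to it.
  data Far : Code → Set where
    fl : ∀ x y m → Far (fl x y m)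
    vt : ∀ x → Far (vt x)
    sl : ∀ m → Far (sl m)

  private
    allFar-at : ∀ p → T (allFar p) → ∀ x → T (p (vt x) ∧ (p (sl x) ∧ (all₄ λ y → all₄ λ m → p (fl x y m))))
    allFar-at p = all₄-sound (λ x → p (vt x) ∧ (p (sl x) ∧ (all₄ λ y → all₄ λ m → p (fl x y m))))

  allFar-sound : ∀ p → T (allFar p) → ∀ {c} → Far c → T (p c)
  allFar-sound p t (fl x y m) = all₄-sound (λ m → p (fl x y m)) (all₄-sound (λ y → all₄ λ m → p (fl x y m))
    (proj₂ (∧-elim {p (sl x)} (proj₂ (∧-elim {p (vt x)} (allFar-at p t x))))) y) m
  allFar-sound p t (vt x) = proj₁ (∧-elim {p (vt x)} (allFar-at p t x))
  allFar-sound p t (sl x) = proj₁ (∧-elim {p (sl x)} (proj₂ (∧-elim {p (vt x)} (allFar-at p t x))))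

  all< : ℕ → (ℕ → Bool) → Bool
  all< zero p = true
  all< (suc n) p = p n ∧ all< n p

  all<-sound : ∀ n p → T (all< n p) → ∀ i → i ℕ.< n → T (p i)
  all<-sound (suc n) p t i i<n with i ℕ.≟ n
  ... | yes refl = proj₁ (∧-elim {p n} t)
  ... | no ne = all<-sound n p (proj₂ (∧-elim {p n} t)) i (≤∧≢⇒< (ℕ.s≤s⁻¹ i<n) ne)

  Four : Set
  Four = Bool × Bool × Bool × Bool

  get : Four → Fin 4 → Bool
  get (a , b , c , d) 0F = a
  get (a , b , c , d) 1F = b
  get (a , b , c , d) 2F = c
  get (a , b , c , d) 3F = d

  all₁₆ : (Four → Bool) → Bool
  all₁₆ p = all₂ λ a → all₂ λ b → all₂ λ c → all₂ λ d → p (a , b , c , d)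

  all₁₆-sound : ∀ p → T (all₁₆ p) → ∀ v → T (p v)
  all₁₆-sound p t (a , b , c , d) = all₂-sound (λ d → p (a , b , c , d)) (all₂-sound (λ c → all₂ λ d → p (a , b , c , d))
    (all₂-sound (λ b → all₂ λ c → all₂ λ d → p (a , b , c , d)) (all₂-sound (λ a → all₂ λ b → all₂ λ c → all₂ λ d → p (a , b , c , d)) t a) b) c) d

  fours : List Four
  fours = cartesianProduct bools (cartesianProduct bools (cartesianProduct bools bools))
    where
    bools : List Bool
    bools = false ∷ true ∷ []

  ∈-fours : ∀ v → v ∈ fours
  ∈-fours (a , b , c , d) = ∈-cartesianProduct⁺ (∈b a) (∈-cartesianProduct⁺ (∈b b) (∈-cartesianProduct⁺ (∈b c) (∈b d)))
    where
    ∈b : ∀ b → b ∈ (false ∷ true ∷ [])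
    ∈b false = here refl
    ∈b true = there (here refl)

  fitting : (Four → Bool) → List Four
  fitting ok = filter (T? ∘ ok) fours

  fitting-sound : ∀ ok k → T (all k (fitting ok)) → ∀ v → T (ok v) → T (k v)
  fitting-sound ok k t v okv = All.lookup (all⁺ k (fitting ok) t) (∈-filter⁺ (T? ∘ ok) (∈-fours v) okv)

  Σ₄ : (Fin 4 → ℕ) → ℕ
  Σ₄ g = g 0F + (g 1F + (g 2F + (g 3F + 0)))

  #₄ : (Fin 4 → Bool) → ℕ
  #₄ h = nb (h 0F) + (nb (h 1F) + (nb (h 2F) + (nb (h 3F) + 0)))

  -- The condition on the number i of neighbours in a trace of a vertex of the local graph
  -- whose side and parallel class meet the trace in 12 − t and s vertices; b tells whether it is in the trace.
  fits : (t s i : ℕ) → Bool → Bool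
  fits t s i b = (4 * i + 8 * nb b ≡ᵇ t + 2 * s) ∧ (b ⇒ᵇ (i ≤ᵇ 1))

  any₅ : (ℕ → Bool) → Bool
  any₅ f = f 0 ∨ (f 1 ∨ (f 2 ∨ (f 3 ∨ f 4)))

  -- A test of one parallel class before anything on the other side has been chosen; the number of
  -- neighbours in the trace is then free between 0 and 4.
  plausible : ℕ → Four → Bool
  plausible t l = all₄ λ r → any₅ λ i → fits t (#₄ (get l)) i (get l r)

  Half : Set
  Half = Fin 4 → Four

  half : Four → Four → Four → Four → Half
  half a b c d 0F = a
  half a b c d 1F = b
  half a b c d 2F = c
  half a b c d 3F = d

  degree : Half → Fin 4 → Fin 4 → ℕ
  degree other x y = #₄ λ m → get (other m) (foot x y m)

  -- The class size is handed to `go` as an argument, so that its value is shared by the four tests.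
  classFits : ℕ → (n₀ n₁ n₂ n₃ : ℕ) → Four → Bool
  classFits t n₀ n₁ n₂ n₃ (a , b , c , d) = go (#₄ (get (a , b , c , d)))
    where
    go : ℕ → Bool
    go s = fits t s n₀ a ∧ (fits t s n₁ b ∧ (fits t s n₂ c ∧ fits t s n₃ d))

  classOK : ℕ → Half → Fin 4 → Four → Bool
  classOK t other x = classFits t (degree other x 0F) (degree other x 1F) (degree other x 2F) (degree other x 3F)

  size : Half → ℕ
  size h = Σ₄ λ x → #₄ (get (h x))

  ∀Half : List Four → List Four → List Four → List Four → (Half → Bool) → Bool
  ∀Half as bs cs ds p = all (λ a → all (λ b → all (λ c → all (λ d → p (half a b c d)) ds) cs) bs) as

  eqb : Bool → Bool → Bool
  eqb a b = not (a xor b)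

  ∀Half-sound : ∀ p q r s k → T (∀Half (fitting p) (fitting q) (fitting r) (fitting s) k) →
    ∀ a b c d → T (p a) → T (q b) → T (r c) → T (s d) → T (k (half a b c d))
  ∀Half-sound p q r s k t a b c d pa qb rc sd = fitting-sound s (λ d → k (half a b c d))
    (fitting-sound r (λ c → all (λ d → k (half a b c d)) (fitting s))
    (fitting-sound q (λ b → all (λ c → all (λ d → k (half a b c d)) (fitting s)) (fitting r))
    (fitting-sound p (λ a → all (λ b → all (λ c → all (λ d → k (half a b c d)) (fitting s)) (fitting r)) (fitting q)) t a pa) b qb) c rc) d sd

  mem : Half → Half → Vertex → Bool
  mem p l (false , x , y) = get (p x) y
  mem p l (true , x , y) = get (l x) y

  Σᵥ : (Vertex → ℕ) → ℕ
  Σᵥ g = (Σ₄ λ x → Σ₄ λ y → g (false , x , y)) + (Σ₄ λ x → Σ₄ λ y → g (true , x , y))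

  #class : (Vertex → Bool) → Bool → Fin 4 → ℕ
  #class f b x = #₄ λ y → f (b , x , y)

  #side : (Vertex → Bool) → Bool → ℕ
  #side f b = Σ₄ (#class f b)

  -- For a trace this is 24 times its indicator plus 8 times the number of neighbours plus the
  -- number of walks of length 2, rewritten by means of side and class sizes (`weight-value`).
  weight : (Vertex → Bool) → Vertex → ℕ
  weight f (b , x , y) = 12 * nb (f (b , x , y)) + (2 * #side f (not b) + (#side f b + 3 * #class f b x))

  dot : (Vertex → ℕ) → (Vertex → Bool) → ℕ
  dot w f = Σᵥ λ v → if f v then w v else 0

  any< : ℕ → (ℕ → Bool) → Bool
  any< zero p = false
  any< (suc n) p = p n ∨ any< n p

  anyFar : (Code → Bool) → Bool
  anyFar p = not (allFar (not ∘ p))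

  known : Half → Half → Bool
  known p l = anyFar λ d → allV λ v → eqb (maskC d v) (mem p l v)

  -- The norm 432 of a trace with `q` lines and 12 - q points; `s` stands for the sum of the squared
  -- class sizes, which is at most 144 / 3 = 48.
  normOK : ℕ → Bool
  normOK q = any< 49 λ s → 3 * s + 2 * (q * (12 ∸ q)) ≡ᵇ 144

  -- Once the lines of a trace are fixed, the numbers of neighbours of all points are known, and
  -- each class of points is filtered by itself. The lines can be tested only when all points are
  -- chosen.
  pointsOK : ℕ → Half → Bool
  pointsOK q l = ∀Half (fitting (classOK q l 0F)) (fitting (classOK q l 1F)) (fitting (classOK q l 2F)) (fitting (classOK q l 3F)) λ p →
    (size p ≡ᵇ 12 ∸ q) ⇒ᵇ (all₄ λ x → classOK (12 ∸ q) p x (l x)) ⇒ᵇ known p l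

  linesOK : ℕ → List Four → Bool
  linesOK q ls = ∀Half ls ls ls ls λ l → (size l ≡ᵇ q) ⇒ᵇ pointsOK q l

  classify : ℕ → Bool
  classify q = normOK q ⇒ᵇ linesOK q (fitting (plausible (12 ∸ q)))

  linesOK-sound : ∀ q ok → T (linesOK q (fitting ok)) → ∀ a b c d → T (ok a) → T (ok b) → T (ok c) → T (ok d) →
    T (size (half a b c d) ≡ᵇ q) → T (pointsOK q (half a b c d))
  linesOK-sound q ok t a b c d pa pb pc pd e = ⇒ᵇ-elim {size (half a b c d) ≡ᵇ q} (∀Half-sound ok ok ok ok (λ l → (size l ≡ᵇ q) ⇒ᵇ pointsOK q l) t a b c d pa pb pc pd) e

  classify-sound : ∀ q → T (classify q) → T (normOK q) → T (linesOK q (fitting (plausible (12 ∸ q))))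
  classify-sound q = ⇒ᵇ-elim {normOK q}

  _==C_ : Code → Code → Bool
  c ==C d = (point c ==ₚ point d) ∧ (line c ==ₗ line d)

  -- Functions stored as data, so that evaluation shares their values.
  Quad : Set → Set
  Quad A = A × A × A × A

  quad : ∀ {A : Set} → (Fin 4 → A) → Quad A
  quad g = g 0F , g 1F , g 2F , g 3F

  pick : ∀ {A : Set} → Quad A → Fin 4 → A
  pick (a , b , c , d) 0F = a
  pick (a , b , c , d) 1F = b
  pick (a , b , c , d) 2F = c
  pick (a , b , c , d) 3F = d

  pick-quad : ∀ {A : Set} (g : Fin 4 → A) i → pick (quad g) i ≡ g i
  pick-quad g 0F = refl
  pick-quad g 1F = refl
  pick-quad g 2F = refl
  pick-quad g 3F = refl

  total : Quad ℕ → ℕ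
  total (a , b , c , d) = a + (b + (c + (d + 0)))

  Tab : Set → Set
  Tab A = Quad (Quad A) × Quad (Quad A)

  tab : ∀ {A : Set} → (Vertex → A) → Tab A
  tab f = quad (λ x → quad λ y → f (false , x , y)) , quad (λ x → quad λ y → f (true , x , y))

  look : ∀ {A : Set} → Tab A → Vertex → A
  look (p , l) (false , x , y) = pick (pick p x) y
  look (p , l) (true , x , y) = pick (pick l x) y

  look-tab : ∀ {A : Set} (f : Vertex → A) v → look (tab f) v ≡ f v
  look-tab f (false , x , y) = trans (cong (λ z → pick z y) (pick-quad (λ x → quad λ y → f (false , x , y)) x)) (pick-quad (λ y → f (false , x , y)) y)
  look-tab f (true , x , y) = trans (cong (λ z → pick z y) (pick-quad (λ x → quad λ y → f (true , x , y)) x)) (pick-quad (λ y → f (true , x , y)) y)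

  Masks : Set
  Masks = Quad (Tab Bool × Tab Bool × Quad (Quad (Tab Bool)))

  private
    cell : Fin 4 → Fin 4 → Fin 4 → Tab Bool
    cell x y m = tab (maskC (fl x y m))

    column : Fin 4 → Tab Bool × Tab Bool × Quad (Quad (Tab Bool))
    column x = tab (maskC (vt x)) , tab (maskC (sl x)) , quad λ y → quad (cell x y)

  mask : Masks → Code → Tab Bool
  mask ms (vt x) = proj₁ (pick ms x)
  mask ms (sl x) = proj₁ (proj₂ (pick ms x))
  mask ms (fl x y m) = pick (pick (proj₂ (proj₂ (pick ms x))) y) m
  mask ms _ = tab λ _ → false

  -- The value 336 + 96δ - 48a with the subtracted term moved to the left, so as to stay in the
  -- natural numbers.
  gramEntry : Tab ℕ → Code → Code → Tab Bool → Bool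
  gramEntry w d d′ f = dot (look w) (look f) + 48 * nb (adjC d′ d) ≡ᵇ 336 + 96 * nb (d′ ==C d)

  gramRow : Masks → Code → Tab ℕ → Bool
  gramRow ms d w = allFar λ d′ → gramEntry w d d′ (mask ms d′)

  weightOf : Quad ℕ → Quad ℕ → Tab Bool → Vertex → ℕ
  weightOf p l t (false , x , y) = 12 * nb (look t (false , x , y)) + (2 * total l + (total p + 3 * pick p x))
  weightOf p l t (true , x , y) = 12 * nb (look t (true , x , y)) + (2 * total p + (total l + 3 * pick l x))

  weights : Tab Bool → Tab ℕ
  weights t = go (quad (#class (look t) false)) (quad (#class (look t) true))
    where
    go : Quad ℕ → Quad ℕ → Tab ℕ
    go p l = tab (weightOf p l t)

  weights-correct : ∀ t v → look (weights t) v ≡ weight (look t) v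
  weights-correct t (false , x , y) = trans (look-tab (weightOf (quad (#class (look t) false)) (quad (#class (look t) true)) t) (false , x , y)) (cong (λ k → 12 * nb (look t (false , x , y)) + (2 * #side (look t) true + (#side (look t) false + 3 * k)))
    (pick-quad (#class (look t) false) x))
  weights-correct t (true , x , y) = trans (look-tab (weightOf (quad (#class (look t) false)) (quad (#class (look t) true)) t) (true , x , y)) (cong (λ k → 12 * nb (look t (true , x , y)) + (2 * #side (look t) false + (#side (look t) true + 3 * k)))
    (pick-quad (#class (look t) true) x))

  gram : Masks → Bool
  gram ms = allFar λ d → gramRow ms d (weights (mask ms d))

  gram-sound : ∀ ms → T (gram ms) → ∀ {d d′} → Far d → Far d′ →
    dot (look (weights (mask ms d))) (look (mask ms d′)) + 48 * nb (adjC d′ d) ≡ 336 + 96 * nb (d′ ==C d)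
  gram-sound ms t {d} {d′} fd fd′ = ≡ᵇ⇒≡ _ _ (allFar-sound (λ d′ → gramEntry (weights (mask ms d)) d d′ (mask ms d′))
    (allFar-sound (λ d → gramRow ms d (weights (mask ms d))) t fd) fd′)

  -- Opaque, lest the 72 masks be expanded and the check of gram-masks be repeated elsewhere.
  opaque
    masks : Masks
    masks = quad column

    mask-masks : ∀ {c} → Far c → mask masks c ≡ tab (maskC c)
    mask-masks (fl x y m) = trans (cong (λ z → pick (pick (proj₂ (proj₂ z)) y) m) (pick-quad column x))
      (trans (cong (λ z → pick z m) (pick-quad (λ y → quad (cell x y)) y)) (pick-quad (cell x y) m))
    mask-masks (vt x) = cong proj₁ (pick-quad column x)
    mask-masks (sl x) = cong (λ z → proj₁ (proj₂ z)) (pick-quad column x)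

    gram-masks : T (gram masks)
    gram-masks = tt

  classification : T (all< 13 classify)
  classification = tt

-- Counting neighbours and walks in a subset of the biaffine plane.

module TraceCounts where
  open LinearAlgebra
  open StronglyRegular
  open BiaffinePlane
  open PencilNames using (0F; 1F; 2F; 3F)
  open PlaneCoordinates
  open LocalGraph
  open Flags
  open import Data.Bool using (Bool; true; false; not; if_then_else_; _∧_; T; _xor_)
  open import Data.Bool.Properties using () renaming (_≟_ to _≟b_)
  open import Data.Nat as ℕ using (ℕ; zero; suc; _≡ᵇ_)
  import Data.Nat.Properties as ℕP
  open import Data.Nat.Tactic.RingSolver using () renaming (solve-∀ to solve-∀ℕ)
  open import Data.Integer using (ℤ; +_; _+_; _*_)
  open import Data.Integer.Properties using (pos-+)
  open import Data.Fin using (Fin; zero; suc; remQuot; combine)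
  open import Data.Fin.Properties using (toℕ-injective; combine-remQuot)
  open import Data.Product using (_×_; _,_; proj₁; proj₂)
  open import Data.Product.Properties using (≡-dec)
  open import Data.Unit using (tt)
  open import Function using (_∘_)
  open import Relation.Nullary using (yes; no)
  open import Relation.Nullary.Decidable using (⌊_⌋)
  open import Relation.Binary.PropositionalEquality

  -- Translates the coordinates over the field with four elements to those of PlaneCoordinates.
  label : Vertex → Bool × Coord
  label (false , 0F , 0F) = false , 0F , 0F
  label (false , 0F , 1F) = false , 1F , 0F
  label (false , 0F , 2F) = false , 2F , 0F
  label (false , 0F , 3F) = false , 3F , 0F
  label (false , 1F , 0F) = false , 0F , 1F
  label (false , 1F , 1F) = false , 1F , 1F
  label (false , 1F , 2F) = false , 2F , 3F
  label (false , 1F , 3F) = false , 3F , 3F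
  label (false , 2F , 0F) = false , 0F , 3F
  label (false , 2F , 1F) = false , 3F , 1F
  label (false , 2F , 2F) = false , 1F , 2F
  label (false , 2F , 3F) = false , 2F , 2F
  label (false , 3F , 0F) = false , 0F , 2F
  label (false , 3F , 1F) = false , 2F , 1F
  label (false , 3F , 2F) = false , 3F , 2F
  label (false , 3F , 3F) = false , 1F , 3F
  label (true , m , c) = true , c , m

  private
    T⇒≡ : ∀ {b} → T b → b ≡ true
    T⇒≡ {true} _ = refl

    ≡⇒T : ∀ {b} → b ≡ true → T b
    ≡⇒T refl = tt

    T-not : ∀ {b} → T (not b) → b ≡ false
    T-not {false} _ = refl

    eqb-sound : ∀ {b c} → T (eqb b c) → b ≡ c
    eqb-sound {false} {false} _ = refl
    eqb-sound {true} {true} _ = refl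

    eqb-refl : ∀ b → T (eqb b b)
    eqb-refl false = tt
    eqb-refl true = tt

    ==₄-sound : ∀ {i j} → T (i ==₄ j) → i ≡ j
    ==₄-sound t = toℕ-injective (ℕP.≡ᵇ⇒≡ _ _ t)

    same-sound : ∀ v w → T (same v w) → v ≡ w
    same-sound (b , x , y) (b′ , x′ , y′) t with ∧-elim {not (b xor b′)} t
    ... | p , q with ∧-elim {x ==₄ x′} q
    ...   | r , s = cong₂ _,_ (eqb-sound p) (cong₂ _,_ (==₄-sound r) (==₄-sound s))

    _≟L_ : (x y : Bool × Coord) → Relation.Nullary.Dec (x ≡ y)
    _≟L_ = ≡-dec _≟b_ _≟c_

    label-injᵇ : T (allV λ v → allV λ w → ⌊ label v ≟L label w ⌋ ⇒ᵇ same v w)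
    label-injᵇ = tt

    joined-labelᵇ : T (allV λ v → allV λ w → eqb (joined (label v) (label w)) (inc v w))
    joined-labelᵇ = tt

  allV²-sound : ∀ (p : Vertex → Vertex → Bool) → T (allV λ v → allV (p v)) → ∀ v w → T (p v w)
  allV²-sound p t v = allV-sound (p v) (allV-sound (λ v → allV (p v)) t v)

  label-inj : ∀ v w → label v ≡ label w → v ≡ w
  label-inj v w e = same-sound v w (⇒ᵇ-elim {⌊ label v ≟L label w ⌋} (allV²-sound (λ v w → ⌊ label v ≟L label w ⌋ ⇒ᵇ same v w) label-injᵇ v w) dec)
    where
    dec : T ⌊ label v ≟L label w ⌋
    dec with label v ≟L label w
    ... | yes _ = tt
    ... | no ne = ne e

  joined-label : ∀ v w → joined (label v) (label w) ≡ inc v w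
  joined-label v w = eqb-sound (allV²-sound (λ v w → eqb (joined (label v) (label w)) (inc v w)) joined-labelᵇ v w)

  private
    toBool : Fin 2 → Bool
    toBool zero = false
    toBool (suc _) = true

    fromBool : Bool → Fin 2
    fromBool b = if b then suc zero else zero

    fromBool-toBool : ∀ i → fromBool (toBool i) ≡ i
    fromBool-toBool zero = refl
    fromBool-toBool (suc zero) = refl

  vert : Fin 32 → Vertex
  vert k = toBool (proj₁ (remQuot {2} 16 k)) , remQuot {4} 4 (proj₂ (remQuot {2} 16 k))

  vert⁻¹ : Vertex → Fin 32
  vert⁻¹ (b , x , y) = combine {2} {16} (fromBool b) (combine {4} {4} x y)

  vert⁻¹-vert : ∀ k → vert⁻¹ (vert k) ≡ k
  vert⁻¹-vert k = trans (cong₂ (combine {2} {16}) (fromBool-toBool (proj₁ (remQuot {2} 16 k))) (combine-remQuot {4} 4 (proj₂ (remQuot {2} 16 k)))) (combine-remQuot {2} 16 k)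

  vert-inj : ∀ k l → vert k ≡ vert l → k ≡ l
  vert-inj k l e = trans (sym (vert⁻¹-vert k)) (trans (cong vert⁻¹ e) (vert⁻¹-vert l))

  tot : ∀ n → (Fin n → ℕ) → ℕ
  tot zero g = 0
  tot (suc n) g = g zero ℕ.+ tot n (g ∘ suc)

  sum-tot : ∀ {n} (f : Fin n → ℤ) (g : Fin n → ℕ) → (∀ k → f k ≡ + g k) → sum f ≡ + tot n g
  sum-tot {zero} f g e = sum-[] f
  sum-tot {suc n} f g e = trans (sum-∷ f) (trans (cong₂ _+_ (e zero) (sum-tot (f ∘ suc) (g ∘ suc) (e ∘ suc))) (sym (pos-+ (g zero) (tot n (g ∘ suc)))))

  nbrsum : (Vertex → ℕ) → Vertex → ℕ
  nbrsum g (b , x , y) = Σ₄ λ c → g (not b , c , foot x y c)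

  -- For a concrete vertex `inc` evaluates, and `vert` lists the vertices of a side class by class,
  -- in the order in which `nbrsum` runs through them.
  on-nbrs : ∀ g v → tot 32 (λ k → if inc v (vert k) then g (vert k) else 0) ≡ nbrsum g v
  on-nbrs g (false , 0F , 0F) = refl
  on-nbrs g (false , 0F , 1F) = refl
  on-nbrs g (false , 0F , 2F) = refl
  on-nbrs g (false , 0F , 3F) = refl
  on-nbrs g (false , 1F , 0F) = refl
  on-nbrs g (false , 1F , 1F) = refl
  on-nbrs g (false , 1F , 2F) = refl
  on-nbrs g (false , 1F , 3F) = refl
  on-nbrs g (false , 2F , 0F) = refl
  on-nbrs g (false , 2F , 1F) = refl
  on-nbrs g (false , 2F , 2F) = refl
  on-nbrs g (false , 2F , 3F) = refl
  on-nbrs g (false , 3F , 0F) = refl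
  on-nbrs g (false , 3F , 1F) = refl
  on-nbrs g (false , 3F , 2F) = refl
  on-nbrs g (false , 3F , 3F) = refl
  on-nbrs g (true , 0F , 0F) = refl
  on-nbrs g (true , 0F , 1F) = refl
  on-nbrs g (true , 0F , 2F) = refl
  on-nbrs g (true , 0F , 3F) = refl
  on-nbrs g (true , 1F , 0F) = refl
  on-nbrs g (true , 1F , 1F) = refl
  on-nbrs g (true , 1F , 2F) = refl
  on-nbrs g (true , 1F , 3F) = refl
  on-nbrs g (true , 2F , 0F) = refl
  on-nbrs g (true , 2F , 1F) = refl
  on-nbrs g (true , 2F , 2F) = refl
  on-nbrs g (true , 2F , 3F) = refl
  on-nbrs g (true , 3F , 0F) = refl
  on-nbrs g (true , 3F , 1F) = refl
  on-nbrs g (true , 3F , 2F) = refl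
  on-nbrs g (true , 3F , 3F) = refl

  private
    assoc₄ : ∀ a b c d r → (a ℕ.+ (b ℕ.+ (c ℕ.+ (d ℕ.+ 0)))) ℕ.+ r ≡ a ℕ.+ (b ℕ.+ (c ℕ.+ (d ℕ.+ r)))
    assoc₄ = solve-∀ℕ

    flat₄ : (h : Fin 4 → Fin 4 → ℕ) → ∀ r → (Σ₄ λ x → Σ₄ (h x)) ℕ.+ r ≡
      h 0F 0F ℕ.+ (h 0F 1F ℕ.+ (h 0F 2F ℕ.+ (h 0F 3F ℕ.+ (h 1F 0F ℕ.+ (h 1F 1F ℕ.+ (h 1F 2F ℕ.+ (h 1F 3F ℕ.+
      (h 2F 0F ℕ.+ (h 2F 1F ℕ.+ (h 2F 2F ℕ.+ (h 2F 3F ℕ.+ (h 3F 0F ℕ.+ (h 3F 1F ℕ.+ (h 3F 2F ℕ.+ (h 3F 3F ℕ.+ r)))))))))))))))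
    flat₄ h r = trans (assoc₄ (Σ₄ (h 0F)) (Σ₄ (h 1F)) (Σ₄ (h 2F)) (Σ₄ (h 3F)) r) (row 0F (row 1F (row 2F (row 3F refl))))
      where
      row : ∀ x {s t} → s ≡ t → Σ₄ (h x) ℕ.+ s ≡ h x 0F ℕ.+ (h x 1F ℕ.+ (h x 2F ℕ.+ (h x 3F ℕ.+ t)))
      row x {s} refl = assoc₄ (h x 0F) (h x 1F) (h x 2F) (h x 3F) s

  tot-Σᵥ : ∀ g → tot 32 (g ∘ vert) ≡ Σᵥ g
  tot-Σᵥ g = sym (trans (cong ((Σ₄ λ x → Σ₄ λ y → g (false , x , y)) ℕ.+_) (sym (ℕP.+-identityʳ (Σ₄ λ x → Σ₄ λ y → g (true , x , y)))))
    (trans (flat₄ (λ x y → g (false , x , y)) ((Σ₄ λ x → Σ₄ λ y → g (true , x , y)) ℕ.+ 0)) (cong pre (flat₄ (λ x y → g (true , x , y)) 0))))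
    where
    h : Fin 4 → Fin 4 → ℕ
    h x y = g (false , x , y)
    pre : ℕ → ℕ
    pre r = h 0F 0F ℕ.+ (h 0F 1F ℕ.+ (h 0F 2F ℕ.+ (h 0F 3F ℕ.+ (h 1F 0F ℕ.+ (h 1F 1F ℕ.+ (h 1F 2F ℕ.+ (h 1F 3F ℕ.+
      (h 2F 0F ℕ.+ (h 2F 1F ℕ.+ (h 2F 2F ℕ.+ (h 2F 3F ℕ.+ (h 3F 0F ℕ.+ (h 3F 1F ℕ.+ (h 3F 2F ℕ.+ (h 3F 3F ℕ.+ r)))))))))))))))

  Σ₄-cong : ∀ {f g : Fin 4 → ℕ} → (∀ i → f i ≡ g i) → Σ₄ f ≡ Σ₄ g
  Σ₄-cong e = cong₂ ℕ._+_ (e 0F) (cong₂ ℕ._+_ (e 1F) (cong₂ ℕ._+_ (e 2F) (cong₂ ℕ._+_ (e 3F) refl)))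

  module Counting (m : Vertex → Bool) where
    deg deg₂ : Vertex → ℕ
    deg = nbrsum (nb ∘ m)
    deg₂ = nbrsum deg

    bits : Bool → Fin 4 → Four
    bits b x = m (b , x , 0F) , m (b , x , 1F) , m (b , x , 2F) , m (b , x , 3F)

    get-bits : ∀ b x y → get (bits b x) y ≡ m (b , x , y)
    get-bits b x 0F = refl
    get-bits b x 1F = refl
    get-bits b x 2F = refl
    get-bits b x 3F = refl

    Σ₄-+ : ∀ f g → Σ₄ (λ i → f i ℕ.+ g i) ≡ Σ₄ f ℕ.+ Σ₄ g
    Σ₄-+ f g = ar (f 0F) (f 1F) (f 2F) (f 3F) (g 0F) (g 1F) (g 2F) (g 3F)
      where
      ar : ∀ a b c d e f g h → (a ℕ.+ e) ℕ.+ ((b ℕ.+ f) ℕ.+ ((c ℕ.+ g) ℕ.+ ((d ℕ.+ h) ℕ.+ 0))) ≡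
        (a ℕ.+ (b ℕ.+ (c ℕ.+ (d ℕ.+ 0)))) ℕ.+ (e ℕ.+ (f ℕ.+ (g ℕ.+ (h ℕ.+ 0))))
      ar = solve-∀ℕ

    Σ₄-swap : ∀ (h : Fin 4 → Fin 4 → ℕ) → Σ₄ (λ i → Σ₄ λ j → h i j) ≡ Σ₄ (λ j → Σ₄ λ i → h i j)
    Σ₄-swap h = trans (Σ₄-+ (λ i → h i 0F) (λ i → h i 1F ℕ.+ (h i 2F ℕ.+ (h i 3F ℕ.+ 0)))) (cong (Σ₄ (λ i → h i 0F) ℕ.+_)
      (trans (Σ₄-+ (λ i → h i 1F) (λ i → h i 2F ℕ.+ (h i 3F ℕ.+ 0))) (cong (Σ₄ (λ i → h i 1F) ℕ.+_)
      (trans (Σ₄-+ (λ i → h i 2F) (λ i → h i 3F ℕ.+ 0)) (cong (Σ₄ (λ i → h i 2F) ℕ.+_) (Σ₄-+ (λ i → h i 3F) (λ i → 0)))))))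

    private
      lineᵇ : T (all₄ λ x → all₄ λ x′ → all₄ λ y → all₁₆ λ l →
        (Σ₄ λ c → nb (get l (foot c (foot x y c) x′))) ≡ᵇ (if x ==₄ x′ then 4 ℕ.* nb (get l y) else #₄ (get l)))
      lineᵇ = tt

      pencilᵇ : T (all₄ λ c → all₁₆ λ l → (Σ₄ λ y → nb (get l (foot 0F y c))) ≡ᵇ #₄ (get l))
      pencilᵇ = tt

    not-not : ∀ b → not (not b) ≡ b
    not-not false = refl
    not-not true = refl

    -- Of the 16 walks of length 2 from a vertex four return to it; the other twelve reach each
    -- vertex of the three other classes of its side once. `lineᵇ` checks this class by class.
    deg₂-count : ∀ b x y → deg₂ (b , x , y) ℕ.+ #class m b x ≡ 4 ℕ.* nb (m (b , x , y)) ℕ.+ #side m b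
    deg₂-count b x y = trans (cong (ℕ._+ #class m b x) (trans (Σ₄-swap (λ c x′ → nb (m (not (not b) , x′ , foot c (foot x y c) x′)))) (Σ₄-cong row))) (collect x)
      where
      row : ∀ x′ → (Σ₄ λ c → nb (m (not (not b) , x′ , foot c (foot x y c) x′))) ≡ (if x ==₄ x′ then 4 ℕ.* nb (m (b , x , y)) else #class m b x′)
      row x′ rewrite not-not b = trans (Σ₄-cong (λ c → cong nb (sym (get-bits b x′ (foot c (foot x y c) x′)))))
        (trans (ℕP.≡ᵇ⇒≡ _ _ (all₁₆-sound (λ l → (Σ₄ λ c → nb (get l (foot c (foot x y c) x′))) ≡ᵇ (if x ==₄ x′ then 4 ℕ.* nb (get l y) else #₄ (get l)))
          (all₄-sound (λ y → all₁₆ λ l → (Σ₄ λ c → nb (get l (foot c (foot x y c) x′))) ≡ᵇ (if x ==₄ x′ then 4 ℕ.* nb (get l y) else #₄ (get l)))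
          (all₄-sound (λ x′ → all₄ λ y → all₁₆ λ l → (Σ₄ λ c → nb (get l (foot c (foot x y c) x′))) ≡ᵇ (if x ==₄ x′ then 4 ℕ.* nb (get l y) else #₄ (get l)))
          (all₄-sound (λ x → all₄ λ x′ → all₄ λ y → all₁₆ λ l → (Σ₄ λ c → nb (get l (foot c (foot x y c) x′))) ≡ᵇ (if x ==₄ x′ then 4 ℕ.* nb (get l y) else #₄ (get l))) lineᵇ x) x′) y) (bits b x′)))
        (fin (x ==₄ x′) refl))
        where
        fin : ∀ e → x ==₄ x′ ≡ e → (if e then 4 ℕ.* nb (get (bits b x′) y) else #₄ (get (bits b x′))) ≡ (if e then 4 ℕ.* nb (m (b , x , y)) else #class m b x′)
        fin false _ = refl
        fin true e = cong (λ k → 4 ℕ.* nb k) (trans (get-bits b x′ y) (cong (λ z → m (b , z , y)) (sym (==₄-sound (≡⇒T e)))))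
      collect : ∀ x → (Σ₄ λ x′ → if x ==₄ x′ then 4 ℕ.* nb (m (b , x , y)) else #class m b x′) ℕ.+ #class m b x ≡ 4 ℕ.* nb (m (b , x , y)) ℕ.+ #side m b
      collect 0F = ar (4 ℕ.* nb (m (b , 0F , y))) (#class m b 0F) (#class m b 1F) (#class m b 2F) (#class m b 3F)
        where
        ar : ∀ h a b c d → (h ℕ.+ (b ℕ.+ (c ℕ.+ (d ℕ.+ 0)))) ℕ.+ a ≡ h ℕ.+ (a ℕ.+ (b ℕ.+ (c ℕ.+ (d ℕ.+ 0))))
        ar = solve-∀ℕ
      collect 1F = ar (4 ℕ.* nb (m (b , 1F , y))) (#class m b 0F) (#class m b 1F) (#class m b 2F) (#class m b 3F)
        where
        ar : ∀ h a b c d → (a ℕ.+ (h ℕ.+ (c ℕ.+ (d ℕ.+ 0)))) ℕ.+ b ≡ h ℕ.+ (a ℕ.+ (b ℕ.+ (c ℕ.+ (d ℕ.+ 0))))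
        ar = solve-∀ℕ
      collect 2F = ar (4 ℕ.* nb (m (b , 2F , y))) (#class m b 0F) (#class m b 1F) (#class m b 2F) (#class m b 3F)
        where
        ar : ∀ h a b c d → (a ℕ.+ (b ℕ.+ (h ℕ.+ (d ℕ.+ 0)))) ℕ.+ c ≡ h ℕ.+ (a ℕ.+ (b ℕ.+ (c ℕ.+ (d ℕ.+ 0))))
        ar = solve-∀ℕ
      collect 3F = ar (4 ℕ.* nb (m (b , 3F , y))) (#class m b 0F) (#class m b 1F) (#class m b 2F) (#class m b 3F)
        where
        ar : ∀ h a b c d → (a ℕ.+ (b ℕ.+ (c ℕ.+ (h ℕ.+ 0)))) ℕ.+ d ≡ h ℕ.+ (a ℕ.+ (b ℕ.+ (c ℕ.+ (d ℕ.+ 0))))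
        ar = solve-∀ℕ

    -- Every vertex of the opposite side is incident with exactly one vertex of the class.
    class-deg : ∀ b → (Σ₄ λ y → deg (b , 0F , y)) ≡ #side m (not b)
    class-deg b = trans (Σ₄-swap (λ y c → nb (m (not b , c , foot 0F y c)))) (Σ₄-cong λ c →
      trans (Σ₄-cong (λ y → cong nb (sym (get-bits (not b) c (foot 0F y c)))))
        (ℕP.≡ᵇ⇒≡ _ _ (all₁₆-sound (λ l → (Σ₄ λ y → nb (get l (foot 0F y c))) ≡ᵇ #₄ (get l)) (all₄-sound (λ c → all₁₆ λ l → (Σ₄ λ y → nb (get l (foot 0F y c))) ≡ᵇ #₄ (get l)) pencilᵇ c) (bits (not b) c))))

    -- A path through the line y = const, its point (1 , y) and the line of slope y through the origin joins (x , y) to the origin.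
    private
      pathᵇ : T (all₂ λ b → all₄ λ x → all₄ λ y → inc (b , x , y) (not b , 0F , y) ∧ (inc (b , 1F , y) (not b , 0F , y) ∧
        (inc (b , 1F , y) (not b , y , 0F) ∧ inc (b , 0F , 0F) (not b , y , 0F))))
      pathᵇ = tt

    module Regular (edge : ∀ v w → inc v w ≡ true → (2 ℕ.* deg v ℕ.+ deg₂ v) ℕ.+ (2 ℕ.* deg w ℕ.+ deg₂ w) ≡ 18) where
      height : Vertex → ℕ
      height v = 2 ℕ.* deg v ℕ.+ deg₂ v

      step : ∀ {v v′} w → inc v w ≡ true → inc v′ w ≡ true → height v ≡ height v′
      step {v} {v′} w p q = ℕP.+-cancelʳ-≡ (height w) (height v) (height v′) (trans (edge v w p) (sym (edge v′ w q)))

      height-const : ∀ b x y → height (b , x , y) ≡ height (b , 0F , 0F)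
      height-const b x y = trans (step {b , x , y} {b , 1F , y} (not b , 0F , y) (T⇒≡ (proj₁ p)) (T⇒≡ (proj₁ q))) (step {b , 1F , y} {b , 0F , 0F} (not b , y , 0F) (T⇒≡ (proj₁ r)) (T⇒≡ (proj₂ r)))
        where
        P : Bool → Fin 4 → Fin 4 → Bool
        P b x y = inc (b , x , y) (not b , 0F , y) ∧ (inc (b , 1F , y) (not b , 0F , y) ∧ (inc (b , 1F , y) (not b , y , 0F) ∧ inc (b , 0F , 0F) (not b , y , 0F)))
        p = ∧-elim {inc (b , x , y) (not b , 0F , y)} (all₄-sound (P b x) (all₄-sound (λ x → all₄ (P b x)) (all₂-sound (λ b → all₄ λ x → all₄ (P b x)) pathᵇ b) x) y)
        q = ∧-elim {inc (b , 1F , y) (not b , 0F , y)} (proj₂ p)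
        r = ∧-elim {inc (b , 1F , y) (not b , y , 0F)} (proj₂ q)

      -- The height is constant on a side, so it can be found by summing over one class, where
      -- `class-deg` and `deg₂-count` evaluate everything.
      height-value : ∀ b x y → 2 ℕ.* height (b , x , y) ≡ #side m (not b) ℕ.+ 2 ℕ.* #side m b
      height-value b x y = ℕP.*-cancelˡ-≡ _ _ 2 (begin
        2 ℕ.* (2 ℕ.* height (b , x , y)) ≡⟨ cong (λ k → 2 ℕ.* (2 ℕ.* k)) (height-const b x y) ⟩
        2 ℕ.* (2 ℕ.* H) ≡⟨ ℕP.+-cancelʳ-≡ (4 ℕ.* #class m b 0F) _ _ (begin
          2 ℕ.* (2 ℕ.* H) ℕ.+ 4 ℕ.* #class m b 0F ≡⟨ ar₁ H (#class m b 0F) ⟩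
          (Σ₄ λ y → H ℕ.+ #class m b 0F) ≡⟨ Σ₄-cong (λ y → cong (ℕ._+ #class m b 0F) (sym (height-const b 0F y))) ⟩
          (Σ₄ λ y → height (b , 0F , y) ℕ.+ #class m b 0F) ≡⟨ Σ₄-cong (λ y → trans (ℕP.+-assoc (2 ℕ.* deg (b , 0F , y)) (deg₂ (b , 0F , y)) (#class m b 0F)) (cong (2 ℕ.* deg (b , 0F , y) ℕ.+_) (deg₂-count b 0F y))) ⟩
          (Σ₄ λ y → 2 ℕ.* deg (b , 0F , y) ℕ.+ (4 ℕ.* nb (m (b , 0F , y)) ℕ.+ #side m b))
            ≡⟨ ar₂ (deg (b , 0F , 0F)) (deg (b , 0F , 1F)) (deg (b , 0F , 2F)) (deg (b , 0F , 3F)) (nb (m (b , 0F , 0F))) (nb (m (b , 0F , 1F))) (nb (m (b , 0F , 2F))) (nb (m (b , 0F , 3F))) (#side m b) ⟩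
          2 ℕ.* (Σ₄ λ y → deg (b , 0F , y)) ℕ.+ 4 ℕ.* #side m b ℕ.+ 4 ℕ.* #class m b 0F
            ≡⟨ cong (λ k → 2 ℕ.* k ℕ.+ 4 ℕ.* #side m b ℕ.+ 4 ℕ.* #class m b 0F) (class-deg b) ⟩
          2 ℕ.* #side m (not b) ℕ.+ 4 ℕ.* #side m b ℕ.+ 4 ℕ.* #class m b 0F ∎) ⟩
        2 ℕ.* #side m (not b) ℕ.+ 4 ℕ.* #side m b ≡⟨ ar₃ (#side m (not b)) (#side m b) ⟩
        2 ℕ.* (#side m (not b) ℕ.+ 2 ℕ.* #side m b) ∎)
        where
        open ≡-Reasoning
        H : ℕ
        H = height (b , 0F , 0F)
        ar₁ : ∀ h s → 2 ℕ.* (2 ℕ.* h) ℕ.+ 4 ℕ.* s ≡ (h ℕ.+ s) ℕ.+ ((h ℕ.+ s) ℕ.+ ((h ℕ.+ s) ℕ.+ ((h ℕ.+ s) ℕ.+ 0)))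
        ar₁ = solve-∀ℕ
        ar₂ : ∀ a b c d p q r s t → (2 ℕ.* a ℕ.+ (4 ℕ.* p ℕ.+ t)) ℕ.+ ((2 ℕ.* b ℕ.+ (4 ℕ.* q ℕ.+ t)) ℕ.+ ((2 ℕ.* c ℕ.+ (4 ℕ.* r ℕ.+ t)) ℕ.+ ((2 ℕ.* d ℕ.+ (4 ℕ.* s ℕ.+ t)) ℕ.+ 0))) ≡
          2 ℕ.* (a ℕ.+ (b ℕ.+ (c ℕ.+ (d ℕ.+ 0)))) ℕ.+ 4 ℕ.* t ℕ.+ 4 ℕ.* (p ℕ.+ (q ℕ.+ (r ℕ.+ (s ℕ.+ 0))))
        ar₂ = solve-∀ℕ
        ar₃ : ∀ s t → 2 ℕ.* s ℕ.+ 4 ℕ.* t ≡ 2 ℕ.* (s ℕ.+ 2 ℕ.* t)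
        ar₃ = solve-∀ℕ

      -- Eliminating `deg₂` between `deg₂-count` and `height-value` leaves the equation that `fits`
      -- tests.
      deg-value : ∀ b x y → 4 ℕ.* deg (b , x , y) ℕ.+ 8 ℕ.* nb (m (b , x , y)) ≡ #side m (not b) ℕ.+ 2 ℕ.* #class m b x
      deg-value b x y = ℕP.+-cancelʳ-≡ (2 ℕ.* #side m b) _ _ (go (deg (b , x , y)) (deg₂ (b , x , y)) (#class m b x) (nb (m (b , x , y))) (#side m b) (#side m (not b)) (deg₂-count b x y) (height-value b x y))
        where
        open ≡-Reasoning
        go : ∀ d d₂ c k s t → d₂ ℕ.+ c ≡ 4 ℕ.* k ℕ.+ s → 2 ℕ.* (2 ℕ.* d ℕ.+ d₂) ≡ t ℕ.+ 2 ℕ.* s → (4 ℕ.* d ℕ.+ 8 ℕ.* k) ℕ.+ 2 ℕ.* s ≡ (t ℕ.+ 2 ℕ.* c) ℕ.+ 2 ℕ.* s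
        go d d₂ c k s t e f = begin
          (4 ℕ.* d ℕ.+ 8 ℕ.* k) ℕ.+ 2 ℕ.* s ≡⟨ ar₁ d k s ⟩
          4 ℕ.* d ℕ.+ 2 ℕ.* (4 ℕ.* k ℕ.+ s) ≡⟨ cong (λ z → 4 ℕ.* d ℕ.+ 2 ℕ.* z) (sym e) ⟩
          4 ℕ.* d ℕ.+ 2 ℕ.* (d₂ ℕ.+ c) ≡⟨ ar₂ d d₂ c ⟩
          2 ℕ.* (2 ℕ.* d ℕ.+ d₂) ℕ.+ 2 ℕ.* c ≡⟨ cong (ℕ._+ 2 ℕ.* c) f ⟩
          (t ℕ.+ 2 ℕ.* s) ℕ.+ 2 ℕ.* c ≡⟨ ar₃ t s c ⟩
          (t ℕ.+ 2 ℕ.* c) ℕ.+ 2 ℕ.* s ∎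
          where
          ar₁ : ∀ d k s → (4 ℕ.* d ℕ.+ 8 ℕ.* k) ℕ.+ 2 ℕ.* s ≡ 4 ℕ.* d ℕ.+ 2 ℕ.* (4 ℕ.* k ℕ.+ s)
          ar₁ = solve-∀ℕ
          ar₂ : ∀ d d₂ c → 4 ℕ.* d ℕ.+ 2 ℕ.* (d₂ ℕ.+ c) ≡ 2 ℕ.* (2 ℕ.* d ℕ.+ d₂) ℕ.+ 2 ℕ.* c
          ar₂ = solve-∀ℕ
          ar₃ : ∀ t s c → (t ℕ.+ 2 ℕ.* s) ℕ.+ 2 ℕ.* c ≡ (t ℕ.+ 2 ℕ.* c) ℕ.+ 2 ℕ.* s
          ar₃ = solve-∀ℕ

      weight-value : ∀ v → 24 ℕ.* nb (m v) ℕ.+ (8 ℕ.* deg v ℕ.+ deg₂ v) ≡ weight m v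
      weight-value (b , x , y) = go (deg (b , x , y)) (deg₂ (b , x , y)) (#class m b x) (nb (m (b , x , y))) (#side m b) (#side m (not b)) (deg₂-count b x y) (deg-value b x y)
        where
        open ≡-Reasoning
        go : ∀ d d₂ c k s t → d₂ ℕ.+ c ≡ 4 ℕ.* k ℕ.+ s → 4 ℕ.* d ℕ.+ 8 ℕ.* k ≡ t ℕ.+ 2 ℕ.* c → 24 ℕ.* k ℕ.+ (8 ℕ.* d ℕ.+ d₂) ≡ 12 ℕ.* k ℕ.+ (2 ℕ.* t ℕ.+ (s ℕ.+ 3 ℕ.* c))
        go d d₂ c k s t e f = ℕP.+-cancelʳ-≡ c _ _ (begin
          24 ℕ.* k ℕ.+ (8 ℕ.* d ℕ.+ d₂) ℕ.+ c ≡⟨ ar₁ d d₂ k c ⟩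
          2 ℕ.* (4 ℕ.* d ℕ.+ 8 ℕ.* k) ℕ.+ 8 ℕ.* k ℕ.+ (d₂ ℕ.+ c) ≡⟨ cong₂ (λ z z′ → 2 ℕ.* z ℕ.+ 8 ℕ.* k ℕ.+ z′) f e ⟩
          2 ℕ.* (t ℕ.+ 2 ℕ.* c) ℕ.+ 8 ℕ.* k ℕ.+ (4 ℕ.* k ℕ.+ s) ≡⟨ ar₂ t c k s ⟩
          12 ℕ.* k ℕ.+ (2 ℕ.* t ℕ.+ (s ℕ.+ 3 ℕ.* c)) ℕ.+ c ∎)
          where
          ar₁ : ∀ d d₂ k c → 24 ℕ.* k ℕ.+ (8 ℕ.* d ℕ.+ d₂) ℕ.+ c ≡ 2 ℕ.* (4 ℕ.* d ℕ.+ 8 ℕ.* k) ℕ.+ 8 ℕ.* k ℕ.+ (d₂ ℕ.+ c)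
          ar₁ = solve-∀ℕ
          ar₂ : ∀ t c k s → 2 ℕ.* (t ℕ.+ 2 ℕ.* c) ℕ.+ 8 ℕ.* k ℕ.+ (4 ℕ.* k ℕ.+ s) ≡ 12 ℕ.* k ℕ.+ (2 ℕ.* t ℕ.+ (s ℕ.+ 3 ℕ.* c)) ℕ.+ c
          ar₂ = solve-∀ℕ

-- Identifying every vertex with a flag.

module Labelling where
  open LinearAlgebra
  open StronglyRegular
  open BiaffinePlane
  open PencilNames using (0F; 1F; 2F; 3F)
  open PlaneCoordinates
  open LocalGraph
  open Flags
  open TraceCounts
  open import Data.Bool using (Bool; true; false; not; if_then_else_; _∧_; T)
  open import Data.Bool.Properties using (T-≡; T-∨)
  open import Function.Bundles using (Equivalence)
  open import Data.Nat as ℕ using (ℕ; suc; _≡ᵇ_; _∸_)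
  import Data.Nat.Properties as ℕP
  open import Data.Nat.Tactic.RingSolver using () renaming (solve-∀ to solve-∀ℕ)
  open import Data.Integer using (ℤ; +_; -_; _+_; _*_; 0ℤ; 1ℤ)
  open import Data.Integer.Properties using (+-injective; pos-+; pos-*; *-identityˡ; *-identityʳ; *-zeroʳ)
  open import Data.Fin using (Fin; suc; _≟_; toℕ)
  open import Data.Product using (_×_; _,_; proj₁; proj₂; ∃-syntax; Σ)
  open import Data.Unit using (tt)
  open import Data.Sum using (_⊎_; inj₁; inj₂; [_,_]′)
  open import Function using (_∘_)
  open import Relation.Nullary using (yes; no; contradiction)
  open import Relation.Binary.PropositionalEquality

  eqb-sound : ∀ {b c} → T (eqb b c) → b ≡ c
  eqb-sound {false} {false} _ = refl
  eqb-sound {true} {true} _ = refl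

  any<-intro : ∀ k p i → i ℕ.< k → T (p i) → T (any< k p)
  any<-intro (suc k) p i i<k t with i ℕ.≟ k
  ... | yes refl = Equivalence.from T-∨ (inj₁ t)
  ... | no ne = Equivalence.from (T-∨ {p k}) (inj₂ (any<-intro k p i (ℕP.≤∧≢⇒< (ℕ.s≤s⁻¹ i<k) ne) t))

  any₅-intro : ∀ f k → k ℕ.≤ 4 → T (f k) → T (any₅ f)
  any₅-intro f 0 _ t = Equivalence.from T-∨ (inj₁ t)
  any₅-intro f 1 _ t = Equivalence.from (T-∨ {f 0}) (inj₂ (Equivalence.from T-∨ (inj₁ t)))
  any₅-intro f 2 _ t = Equivalence.from (T-∨ {f 0}) (inj₂ (Equivalence.from (T-∨ {f 1}) (inj₂ (Equivalence.from T-∨ (inj₁ t)))))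
  any₅-intro f 3 _ t = Equivalence.from (T-∨ {f 0}) (inj₂ (Equivalence.from (T-∨ {f 1}) (inj₂ (Equivalence.from (T-∨ {f 2}) (inj₂ (Equivalence.from T-∨ (inj₁ t)))))))
  any₅-intro f 4 _ t = Equivalence.from (T-∨ {f 0}) (inj₂ (Equivalence.from (T-∨ {f 1}) (inj₂ (Equivalence.from (T-∨ {f 2}) (inj₂ (Equivalence.from (T-∨ {f 3}) (inj₂ t)))))))
  any₅-intro f (suc (suc (suc (suc (suc k))))) (ℕ.s≤s (ℕ.s≤s (ℕ.s≤s (ℕ.s≤s ())))) t

  #₄≤4 : ∀ β → #₄ β ℕ.≤ 4
  #₄≤4 β = ℕP.+-mono-≤ (nb≤1 (β 0F)) (ℕP.+-mono-≤ (nb≤1 (β 1F)) (ℕP.+-mono-≤ (nb≤1 (β 2F)) (ℕP.+-mono-≤ (nb≤1 (β 3F)) ℕ.z≤n)))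
    where
    nb≤1 : ∀ b → nb b ℕ.≤ 1
    nb≤1 false = ℕ.z≤n
    nb≤1 true = ℕ.s≤s ℕ.z≤n

  at-most-one : ∀ (β : Fin 4 → Bool) → (∀ i j → β i ≡ true → β j ≡ true → i ≡ j) → T (#₄ β ℕ.≤ᵇ 1)
  at-most-one β inj = go (β 0F) (β 1F) (β 2F) (β 3F) refl refl refl refl
    where
    go : ∀ a b c d → β 0F ≡ a → β 1F ≡ b → β 2F ≡ c → β 3F ≡ d → T (nb a ℕ.+ (nb b ℕ.+ (nb c ℕ.+ (nb d ℕ.+ 0))) ℕ.≤ᵇ 1)
    go true true _ _ e f g h = contradiction (inj 0F 1F e f) (λ ())
    go true false true _ e f g h = contradiction (inj 0F 2F e g) (λ ())
    go true false false true e f g h = contradiction (inj 0F 3F e h) (λ ())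
    go true false false false e f g h = tt
    go false true true _ e f g h = contradiction (inj 1F 2F f g) (λ ())
    go false true false true e f g h = contradiction (inj 1F 3F f h) (λ ())
    go false true false false e f g h = tt
    go false false true true e f g h = contradiction (inj 2F 3F g h) (λ ())
    go false false true false e f g h = tt
    go false false false true e f g h = tt
    go false false false false e f g h = tt

  classFits-intro : ∀ t n₀ n₁ n₂ n₃ f → T (fits t (#₄ (get f)) n₀ (get f 0F)) → T (fits t (#₄ (get f)) n₁ (get f 1F)) →
    T (fits t (#₄ (get f)) n₂ (get f 2F)) → T (fits t (#₄ (get f)) n₃ (get f 3F)) → T (classFits t n₀ n₁ n₂ n₃ f)
  classFits-intro t n₀ n₁ n₂ n₃ f@(a , b , c , d) p q r s = ∧-intro {fits t (#₄ (get f)) n₀ a} p (∧-intro {fits t (#₄ (get f)) n₁ b} q (∧-intro {fits t (#₄ (get f)) n₂ c} r s))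

  private
    ∧-false : ∀ {x y} → x ∧ y ≡ false → x ≡ false ⊎ y ≡ false
    ∧-false {false} _ = inj₁ refl
    ∧-false {true} q = inj₂ q

    all₄-false : ∀ p → all₄ p ≡ false → ∃[ i ] p i ≡ false
    all₄-false p q = [ (λ r → 0F , r) , (λ q → [ (λ r → 1F , r) , (λ q → [ (λ r → 2F , r) , (λ r → 3F , r) ]′ (∧-false {p 2F} q)) ]′ (∧-false {p 1F} q)) ]′ (∧-false {p 0F} q)

    not-false : ∀ {b} → not b ≡ false → T b
    not-false {true} _ = tt

    T-not : ∀ {b} → T (not b) → b ≡ false
    T-not {false} _ = refl

  anyFar-elim : ∀ p → T (anyFar p) → ∃[ d ] (Far d × T (p d))
  anyFar-elim p t = go (all₄-false (λ x → not (p (vt x)) ∧ (not (p (sl x)) ∧ (all₄ λ y → all₄ λ m → not (p (fl x y m))))) (T-not t))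
    where
    go : ∃[ x ] not (p (vt x)) ∧ (not (p (sl x)) ∧ (all₄ λ y → all₄ λ m → not (p (fl x y m)))) ≡ false → ∃[ d ] (Far d × T (p d))
    go (x , q) = [ (λ r → vt x , vt x , not-false r) , (λ q → [ (λ r → sl x , sl x , not-false r) ,
        (λ q → cell (all₄-false (λ y → all₄ λ m → not (p (fl x y m))) q)) ]′ (∧-false {not (p (sl x))} q)) ]′ (∧-false {not (p (vt x))} q)
      where
      cell : ∃[ y ] (all₄ λ m → not (p (fl x y m))) ≡ false → ∃[ d ] (Far d × T (p d))
      cell (y , q) = (λ (m , r) → fl x y m , fl x y m , not-false r) (all₄-false (λ m → not (p (fl x y m))) q)

  private
    #class-cong : ∀ {f g} → (∀ v → f v ≡ g v) → ∀ b x → #class f b x ≡ #class g b x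
    #class-cong e b x = Σ₄-cong (λ y → cong nb (e (b , x , y)))

  weight-cong : ∀ {f g} → (∀ v → f v ≡ g v) → ∀ v → weight f v ≡ weight g v
  weight-cong e (b , x , y) = cong₂ (λ k l → 12 ℕ.* k ℕ.+ l) (cong nb (e (b , x , y))) (cong₂ (λ k l → 2 ℕ.* k ℕ.+ l) (Σ₄-cong (#class-cong e (not b)))
    (cong₂ (λ k l → k ℕ.+ 3 ℕ.* l) (Σ₄-cong (#class-cong e b)) (#class-cong e b x)))

  dot-cong : ∀ {w w′ f f′} → (∀ v → w v ≡ w′ v) → (∀ v → f v ≡ f′ v) → dot w f ≡ dot w′ f′
  dot-cong e d = cong₂ ℕ._+_ (Σ₄-cong λ x → Σ₄-cong λ y → cong₂ (λ b k → if b then k else 0) (d (false , x , y)) (e (false , x , y)))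
    (Σ₄-cong λ x → Σ₄-cong λ y → cong₂ (λ b k → if b then k else 0) (d (true , x , y)) (e (true , x , y)))

  module Labelled {n : ℕ} (adjacent : Fin n → Fin n → Bool) (a : Fin n → Fin n → ℤ) (a-bit : ∀ i j → a i j ≡ bit (adjacent i j))
    (a-sym : Symmetric a)
    (a-01 : ∀ i j → a i j ≡ 0ℤ ⊎ a i j ≡ 1ℤ)
    (a-irr : ∀ i → a i i ≡ 0ℤ)
    (a-deg : ∀ i → sum (a i) ≡ + 32)
    (a-sq : ∀ i j → ⟨ a i , a j ⟩ ≡ + 12 + (+ 20 * δ i j + - + 8 * a i j))
    (order : sum {n} (λ _ → 1ℤ) ≡ + 105)
    (u : Fin n)
    where

    open Geometry a a-sym a-01 a-irr a-deg a-sq order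
    open At u hiding (m)
    open Consequences a a-sym a-01 a-irr a-deg a-sq order u

    private
      B-edge : ∃[ x ] ∃[ s ] B x s ≡ 1ℤ
      B-edge = edge (sum-witness α (λ e → contradiction (trans (sym (a-deg u)) e) (λ ())))
        where
        edge : ∃[ x ] α x ≢ 0ℤ → ∃[ x ] ∃[ s ] B x s ≡ 1ℤ
        edge (x , ne) = x , go (sum-witness (B x) (λ e → contradiction (trans (sym (B-deg αx)) e) (λ ())))
          where
          αx : α x ≡ 1ℤ
          αx = [ (λ z → contradiction z ne) , (λ o → o) ]′ (α-01 x)
          go : ∃[ s ] B x s ≢ 0ℤ → ∃[ s ] B x s ≡ 1ℤ
          go (s , ne′) = s , [ (λ z → contradiction z ne′) , (λ o → o) ]′ (B-01 x s)

    opaque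
      frame : Σ (Bool × Coord → Fin n) λ E → (∀ x y → E x ≡ E y → x ≡ y) ×
        (∀ x → ∃[ t ] B (E x) t ≡ 1ℤ) × (∀ x y → B (E x) (E y) ≡ bit (joined x y))
      frame = coordinatize biaffine (proj₂ (proj₂ B-edge))

    E : Vertex → Fin n
    E v = proj₁ frame (label v)

    E-inj : ∀ v w → E v ≡ E w → v ≡ w
    E-inj v w e = label-inj v w (proj₁ (proj₂ frame) (label v) (label w) e)

    αE : ∀ v → α (E v) ≡ 1ℤ
    αE v = B⇒α (proj₂ (proj₁ (proj₂ (proj₂ frame)) (label v)))

    BE : ∀ v w → B (E v) (E w) ≡ bit (inc v w)
    BE v w = trans (proj₂ (proj₂ (proj₂ frame)) (label v) (label w)) (cong bit (joined-label v w))

    e : Fin 32 → Fin n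
    e k = E (vert k)

    e-inj : ∀ k l → e k ≡ e l → k ≡ l
    e-inj k l q = vert-inj k l (E-inj (vert k) (vert l) q)

    -- The coordinates name 32 distinct neighbours of `u`, and `u` has degree 32; hence the copy of
    -- the standard plane is the whole local graph.
    covered : ∀ x → α x ≡ 1ℤ → ∃[ k ] e k ≡ x
    covered = exhausts α α-01 e e-inj (λ k → αE (vert k)) (trans (a-deg u) (sym (sum-tot (λ _ → 1ℤ) (λ _ → 1) (λ _ → refl))))

    sum-on-Λ : ∀ (f : Fin n → ℤ) → Supp f → ∀ g → (∀ v → f (E v) ≡ + g v) → sum f ≡ + tot 32 (g ∘ vert)
    sum-on-Λ f s g fg = begin
      sum f ≡⟨ sum-cong spread ⟩
      sum (λ p → sum (λ k → δ (e k) p * f p)) ≡⟨ ∑-comm (λ p k → δ (e k) p * f p) ⟩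
      sum (λ k → sum (λ p → δ (e k) p * f p)) ≡⟨ sum-cong (λ k → sum-δ (e k) f) ⟩
      sum (λ k → f (e k)) ≡⟨ sum-tot (λ k → f (e k)) (g ∘ vert) (λ k → fg (vert k)) ⟩
      + tot 32 (g ∘ vert) ∎
      where
      open ≡-Reasoning
      δ-e : ∀ k₀ k → δ (e k) (e k₀) ≡ δ k₀ k
      δ-e k₀ k with k₀ ≟ k
      ... | yes refl = trans (δ-refl (e k)) (sym (δ-refl k))
      ... | no ne = trans (δ-≢ (λ q → ne (sym (e-inj k k₀ q)))) (sym (δ-≢ ne))
      spread : ∀ p → f p ≡ sum (λ k → δ (e k) p * f p)
      spread p = [ off , (λ o → on (covered p o)) ]′ (α-01 p)
        where
        off : α p ≡ 0ℤ → f p ≡ sum (λ k → δ (e k) p * f p)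
        off z = trans (s p z) (sym (sum-zero (λ k → δ (e k) p * f p) (λ k → trans (cong (δ (e k) p *_) (s p z)) (*-zeroʳ (δ (e k) p)))))
        on : ∃[ k ] e k ≡ p → f p ≡ sum (λ k → δ (e k) p * f p)
        on (k₀ , refl) = sym (trans (sum-cong (λ k → cong (_* f (e k₀)) (δ-e k₀ k))) (sum-δ k₀ (λ _ → f (e k₀))))

    bit-* : ∀ b k → bit b * + k ≡ + (if b then k else 0)
    bit-* false k = refl
    bit-* true k = *-identityˡ (+ k)

    bit-nb : ∀ b → bit b ≡ + nb b
    bit-nb false = refl
    bit-nb true = refl

    B∙-nbrsum : ∀ f g → (∀ v → f (E v) ≡ + g v) → ∀ v → (B ∙ f) (E v) ≡ + nbrsum g v
    B∙-nbrsum f g fg v = trans (sum-on-Λ (λ p → B (E v) p * f p) (λ p z → cong (_* f p) (B-supp (E v) p z)) (λ w → if inc v w then g w else 0)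
      (λ w → trans (cong₂ _*_ (BE v w) (fg w)) (bit-* (inc v w) (g w)))) (cong +_ (on-nbrs g v))

    module Far₁ (w : Fin n) (αw : α w ≡ 0ℤ) (u≢w : u ≢ w) where
      open Outside w αw u≢w

      m : Vertex → Bool
      m v = adjacent w (E v)

      open Counting m public

      cE : ∀ v → c (E v) ≡ + nb (m v)
      cE v = trans (trace-on w (αE v)) (trans (a-bit w (E v)) (bit-nb (m v)))

      iE : ∀ v → i (E v) ≡ + deg v
      iE = B∙-nbrsum c (nb ∘ m) cE

      jE : ∀ v → j (E v) ≡ + deg₂ v
      jE = B∙-nbrsum i deg iE

      edge : ∀ v v′ → inc v v′ ≡ true → (2 ℕ.* deg v ℕ.+ deg₂ v) ℕ.+ (2 ℕ.* deg v′ ℕ.+ deg₂ v′) ≡ 18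
      edge v v′ q = +-injective (trans (trans (pos-+ (2 ℕ.* deg v ℕ.+ deg₂ v) (2 ℕ.* deg v′ ℕ.+ deg₂ v′)) (cong₂ _+_ (half′ v) (half′ v′)))
        (edge-sum (trans (BE v v′) (cong bit q))))
        where
        half′ : ∀ v → + (2 ℕ.* deg v ℕ.+ deg₂ v) ≡ + 2 * i (E v) + j (E v)
        half′ v = trans (pos-+ (2 ℕ.* deg v) (deg₂ v)) (cong₂ _+_ (trans (pos-* 2 (deg v)) (cong (+ 2 *_) (sym (iE v)))) (sym (jE v)))

      open Regular edge public

      size₁₂ : #side m false ℕ.+ #side m true ≡ 12
      size₁₂ = +-injective (trans (cong +_ (sym (tot-Σᵥ (nb ∘ m)))) (trans (sym (sum-on-Λ c (trace-supp w) (nb ∘ m) cE)) Σc))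

      matched : ∀ v {v′ v″} → m v ≡ true → inc v v′ ≡ true → inc v v″ ≡ true → m v′ ≡ true → m v″ ≡ true → v′ ≡ v″
      matched v {v′} {v″} p q q′ r r′ = E-inj v′ v″ (induced-matching {E v} (on p) (trans (BE v v′) (cong bit q)) (trans (BE v v″) (cong bit q′)) (on r) (on r′))
        where
        on : ∀ {v} → m v ≡ true → c (E v) ≡ 1ℤ
        on {v} t = trans (cE v) (cong (λ b → + nb b) t)

    gram-value : ∀ w w′ (αw : α w ≡ 0ℤ) (αw′ : α w′ ≡ 0ℤ) (u≢w : u ≢ w) (u≢w′ : u ≢ w′) →
      + dot (weight (λ v → adjacent w (E v))) (λ v → adjacent w′ (E v)) ≡ + 336 + (+ 96 * δ w′ w + - + 48 * a w′ w)
    gram-value w w′ αw αw′ u≢w u≢w′ = trans (sym total′) (adjacency w′ αw′ u≢w′)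
      where
      open Outside w αw u≢w using (c; i; j; adjacency)
      open Far₁ w αw u≢w
      m′ : Vertex → Bool
      m′ v = adjacent w′ (E v)
      c′ : Fin n → ℤ
      c′ = trace w′
      y : Fin n → ℤ
      y p = + 24 * c p + 1ℤ * (+ 8 * i p + 1ℤ * j p)
      yE : ∀ v → y (E v) ≡ + weight m v
      yE v = trans (cong₂ (λ k l → + 24 * k + 1ℤ * l) (cE v) (cong₂ (λ k l → + 8 * k + 1ℤ * l) (iE v) (jE v)))
        (trans (pos (nb (m v)) (deg v) (deg₂ v)) (cong +_ (weight-value v)))
        where
        pos : ∀ k l h → + 24 * + k + 1ℤ * (+ 8 * + l + 1ℤ * + h) ≡ + (24 ℕ.* k ℕ.+ (8 ℕ.* l ℕ.+ h))
        pos k l h = sym (trans (pos-+ (24 ℕ.* k) (8 ℕ.* l ℕ.+ h)) (cong₂ _+_ (pos-* 24 k)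
          (trans (pos-+ (8 ℕ.* l) h) (trans (cong₂ _+_ (pos-* 8 l) (sym (*-identityˡ (+ h)))) (sym (*-identityˡ (+ 8 * + l + 1ℤ * + h)))))))
      total′ : + 24 * ⟨ c , c′ ⟩ + 1ℤ * (+ 8 * ⟨ i , c′ ⟩ + 1ℤ * ⟨ j , c′ ⟩) ≡ + dot (weight m) m′
      total′ = trans (sym (trans (⟨⟩-linˡ (+ 24) 1ℤ c (λ p → + 8 * i p + 1ℤ * j p) c′) (cong (λ z → + 24 * ⟨ c , c′ ⟩ + 1ℤ * z) (⟨⟩-linˡ (+ 8) 1ℤ i j c′))))
        (trans (sum-on-Λ (λ p → y p * c′ p) (λ p z → trans (cong (y p *_) (trace-supp w′ p z)) (*-zeroʳ (y p))) (λ v → if m′ v then weight m v else 0) pw)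
          (cong +_ (tot-Σᵥ (λ v → if m′ v then weight m v else 0))))
        where
        pw : ∀ v → y (E v) * c′ (E v) ≡ + (if m′ v then weight m v else 0)
        pw v = trans (cong₂ _*_ (yE v) (trans (trace-on w′ (αE v)) (a-bit w′ (E v)))) (at (m′ v) (weight m v))
          where
          at : ∀ b k → + k * bit b ≡ + (if b then k else 0)
          at false k = *-zeroʳ (+ k)
          at true k = *-identityʳ (+ k)

    module _ {w : Fin n} (αw : α w ≡ 0ℤ) (u≢w : u ≢ w) where
      open Far₁ w αw u≢w

      private
        P Q : ℕ
        P = #side m false
        Q = #side m true

        norm : dot (weight m) m ≡ 432
        norm = +-injective (trans (gram-value w w αw αw u≢w u≢w) (cong₂ (λ k l → + 336 + (+ 96 * k + - + 48 * l)) (δ-refl w) (a-irr w)))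

        class-norm : ∀ b x → (Σ₄ λ y → if m (b , x , y) then weight m (b , x , y) else 0) ≡
          #class m b x ℕ.* (12 ℕ.+ (2 ℕ.* #side m (not b) ℕ.+ (#side m b ℕ.+ 3 ℕ.* #class m b x)))
        class-norm b x = trans (Σ₄-cong (λ y → one-bit (m (b , x , y)))) (ar (nb (m (b , x , 0F))) (nb (m (b , x , 1F))) (nb (m (b , x , 2F))) (nb (m (b , x , 3F))) (12 ℕ.+ K))
          where
          K : ℕ
          K = 2 ℕ.* #side m (not b) ℕ.+ (#side m b ℕ.+ 3 ℕ.* #class m b x)
          one-bit : ∀ b → (if b then 12 ℕ.* nb b ℕ.+ K else 0) ≡ nb b ℕ.* (12 ℕ.+ K)
          one-bit false = refl
          one-bit true = sym (ℕP.+-identityʳ (12 ℕ.+ K))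
          ar : ∀ a b c d k → a ℕ.* k ℕ.+ (b ℕ.* k ℕ.+ (c ℕ.* k ℕ.+ (d ℕ.* k ℕ.+ 0))) ≡ (a ℕ.+ (b ℕ.+ (c ℕ.+ (d ℕ.+ 0)))) ℕ.* k
          ar = solve-∀ℕ

        S₂ : ℕ
        S₂ = (Σ₄ λ x → #class m false x ℕ.* #class m false x) ℕ.+ (Σ₄ λ x → #class m true x ℕ.* #class m true x)

        side-norm : ∀ b → (Σ₄ λ x → Σ₄ λ y → if m (b , x , y) then weight m (b , x , y) else 0) ≡
          #side m b ℕ.* (12 ℕ.+ (2 ℕ.* #side m (not b) ℕ.+ #side m b)) ℕ.+ 3 ℕ.* (Σ₄ λ x → #class m b x ℕ.* #class m b x)
        side-norm b = trans (Σ₄-cong (class-norm b)) (ar (#class m b 0F) (#class m b 1F) (#class m b 2F) (#class m b 3F) (2 ℕ.* #side m (not b)) (#side m b))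
          where
          ar : ∀ a b c d k l → a ℕ.* (12 ℕ.+ (k ℕ.+ (l ℕ.+ 3 ℕ.* a))) ℕ.+ (b ℕ.* (12 ℕ.+ (k ℕ.+ (l ℕ.+ 3 ℕ.* b))) ℕ.+ (c ℕ.* (12 ℕ.+ (k ℕ.+ (l ℕ.+ 3 ℕ.* c))) ℕ.+ (d ℕ.* (12 ℕ.+ (k ℕ.+ (l ℕ.+ 3 ℕ.* d))) ℕ.+ 0))) ≡
            (a ℕ.+ (b ℕ.+ (c ℕ.+ (d ℕ.+ 0)))) ℕ.* (12 ℕ.+ (k ℕ.+ l)) ℕ.+ 3 ℕ.* (a ℕ.* a ℕ.+ (b ℕ.* b ℕ.+ (c ℕ.* c ℕ.+ (d ℕ.* d ℕ.+ 0))))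
          ar = solve-∀ℕ

        -- The norm 432 with the contribution 12 (P + Q) + (P + Q)² = 288 removed, which depends
        -- only on P + Q = 12.
        squares : 3 ℕ.* S₂ ℕ.+ 2 ℕ.* (Q ℕ.* P) ≡ 144
        squares = ℕP.+-cancelʳ-≡ 288 _ _ (trans (cong (3 ℕ.* S₂ ℕ.+ 2 ℕ.* (Q ℕ.* P) ℕ.+_) (sym (cong (λ k → 12 ℕ.* k ℕ.+ k ℕ.* k) size₁₂)))
          (trans (ar P Q (Σ₄ λ x → #class m false x ℕ.* #class m false x) (Σ₄ λ x → #class m true x ℕ.* #class m true x))
          (trans (sym (cong₂ ℕ._+_ (side-norm false) (side-norm true))) norm)))
          where
          ar : ∀ p q s t → 3 ℕ.* (s ℕ.+ t) ℕ.+ 2 ℕ.* (q ℕ.* p) ℕ.+ (12 ℕ.* (p ℕ.+ q) ℕ.+ (p ℕ.+ q) ℕ.* (p ℕ.+ q)) ≡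
            (p ℕ.* (12 ℕ.+ (2 ℕ.* q ℕ.+ p)) ℕ.+ 3 ℕ.* s) ℕ.+ (q ℕ.* (12 ℕ.+ (2 ℕ.* p ℕ.+ q)) ℕ.+ 3 ℕ.* t)
          ar = solve-∀ℕ

        P≡ : P ≡ 12 ∸ Q
        P≡ = trans (sym (ℕP.m+n∸n≡m P Q)) (cong (_∸ Q) size₁₂)

        norm-ok : T (normOK Q)
        norm-ok = any<-intro 49 (λ s → 3 ℕ.* s ℕ.+ 2 ℕ.* (Q ℕ.* (12 ∸ Q)) ≡ᵇ 144) S₂
          (ℕ.s≤s (ℕP.*-cancelˡ-≤ 3 (subst (3 ℕ.* S₂ ℕ.≤_) squares (ℕP.m≤m+n (3 ℕ.* S₂) (2 ℕ.* (Q ℕ.* P))))))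
          (ℕP.≡⇒≡ᵇ _ _ (subst (λ k → 3 ℕ.* S₂ ℕ.+ 2 ℕ.* (Q ℕ.* k) ≡ 144) P≡ squares))

        inc-foot : ∀ b x y c → inc (b , x , y) (not b , c , foot x y c) ≡ true
        inc-foot false x y c = Equivalence.to T-≡ (ℕP.≡⇒≡ᵇ (toℕ (foot x y c)) _ refl)
        inc-foot true x y c = Equivalence.to T-≡ (ℕP.≡⇒≡ᵇ (toℕ (foot x y c)) _ refl)

        deg≤1 : ∀ b x y → m (b , x , y) ≡ true → T (deg (b , x , y) ℕ.≤ᵇ 1)
        deg≤1 b x y t = at-most-one (λ c → m (not b , c , foot x y c)) λ c c′ r r′ → cong (λ v → proj₁ (proj₂ v))
          (matched (b , x , y) t (inc-foot b x y c) (inc-foot b x y c′) r r′)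

        fitsV : ∀ b x y → T (fits (#side m (not b)) (#class m b x) (deg (b , x , y)) (m (b , x , y)))
        fitsV b x y = ∧-intro {4 ℕ.* deg (b , x , y) ℕ.+ 8 ℕ.* nb (m (b , x , y)) ≡ᵇ #side m (not b) ℕ.+ 2 ℕ.* #class m b x} (ℕP.≡⇒≡ᵇ _ _ (deg-value b x y)) (imp (m (b , x , y)) refl)
          where
          imp : ∀ k → m (b , x , y) ≡ k → T (k ⇒ᵇ (deg (b , x , y) ℕ.≤ᵇ 1))
          imp false _ = tt
          imp true r = deg≤1 b x y r

        halfOf : Bool → Half
        halfOf b = half (bits b 0F) (bits b 1F) (bits b 2F) (bits b 3F)

        get-half : ∀ b x y → get (halfOf b x) y ≡ m (b , x , y)
        get-half b 0F = get-bits b 0F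
        get-half b 1F = get-bits b 1F
        get-half b 2F = get-bits b 2F
        get-half b 3F = get-bits b 3F

        half-bits : ∀ b x → halfOf b x ≡ bits b x
        half-bits b 0F = refl
        half-bits b 1F = refl
        half-bits b 2F = refl
        half-bits b 3F = refl

        plausible-bits : ∀ x → T (plausible (12 ∸ Q) (bits true x))
        plausible-bits x = subst (λ t → T (plausible t (bits true x))) P≡ (all₄-complete (λ r → any₅ λ i → fits P (#class m true x) i (get (bits true x) r)) λ r →
          any₅-intro (λ i → fits P (#class m true x) i (get (bits true x) r)) (deg (true , x , r)) (#₄≤4 (λ c → m (false , c , foot x r c)))
            (subst (λ k → T (fits P (#class m true x) (deg (true , x , r)) k)) (sym (get-bits true x r)) (fitsV true x r)))

        degree-deg : ∀ b x y → degree (halfOf (not b)) x y ≡ deg (b , x , y)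
        degree-deg b x y = Σ₄-cong (λ c → cong nb (get-half (not b) c (foot x y c)))

        classOK-bits : ∀ b x → T (classOK (#side m (not b)) (halfOf (not b)) x (bits b x))
        classOK-bits b x = classFits-intro (#side m (not b)) (degree (halfOf (not b)) x 0F) (degree (halfOf (not b)) x 1F) (degree (halfOf (not b)) x 2F) (degree (halfOf (not b)) x 3F)
            (bits b x) (fitsY 0F) (fitsY 1F) (fitsY 2F) (fitsY 3F)
          where
          fitsY : ∀ y → T (fits (#side m (not b)) (#class m b x) (degree (halfOf (not b)) x y) (m (b , x , y)))
          fitsY y = subst (λ k → T (fits (#side m (not b)) (#class m b x) k (m (b , x , y)))) (sym (degree-deg b x y)) (fitsV b x y)

        Q<13 : Q ℕ.< 13
        Q<13 = ℕ.s≤s (subst (Q ℕ.≤_) size₁₂ (ℕP.m≤n+m Q P))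

        known-mask : T (known (halfOf false) (halfOf true))
        known-mask = ⇒ᵇ-elim {all₄ λ x → classOK (12 ∸ Q) (halfOf false) x (halfOf true x)} (⇒ᵇ-elim {size (halfOf false) ≡ᵇ 12 ∸ Q} points-done (ℕP.≡⇒≡ᵇ P (12 ∸ Q) P≡))
            (all₄-complete (λ x → classOK (12 ∸ Q) (halfOf false) x (halfOf true x)) λ x →
              subst₂ (λ t l → T (classOK t (halfOf false) x l)) P≡ (sym (half-bits true x)) (classOK-bits true x))
          where
          lines-done : T (pointsOK Q (halfOf true))
          lines-done = linesOK-sound Q (plausible (12 ∸ Q)) (classify-sound Q (all<-sound 13 classify classification Q Q<13) norm-ok)
            (bits true 0F) (bits true 1F) (bits true 2F) (bits true 3F) (plausible-bits 0F) (plausible-bits 1F) (plausible-bits 2F) (plausible-bits 3F) (ℕP.≡⇒≡ᵇ Q Q refl)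
          points-done : T ((size (halfOf false) ≡ᵇ 12 ∸ Q) ⇒ᵇ (all₄ λ x → classOK (12 ∸ Q) (halfOf false) x (halfOf true x)) ⇒ᵇ known (halfOf false) (halfOf true))
          points-done = ∀Half-sound (classOK Q (halfOf true) 0F) (classOK Q (halfOf true) 1F) (classOK Q (halfOf true) 2F) (classOK Q (halfOf true) 3F)
            (λ p → (size p ≡ᵇ 12 ∸ Q) ⇒ᵇ (all₄ λ x → classOK (12 ∸ Q) p x (halfOf true x)) ⇒ᵇ known p (halfOf true)) lines-done
            (bits false 0F) (bits false 1F) (bits false 2F) (bits false 3F) (classOK-bits false 0F) (classOK-bits false 1F) (classOK-bits false 2F) (classOK-bits false 3F)

      -- The enumeration in `classification` meets the counts just proved: a trace satisfying them
      -- is the trace of a flag.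
      far-code : ∃[ d ] (Far d × (∀ v → maskC d v ≡ m v))
      far-code = go (anyFar-elim (λ d → allV λ v → eqb (maskC d v) (mem (halfOf false) (halfOf true) v)) known-mask)
        where
        go : ∃[ d ] (Far d × T (allV λ v → eqb (maskC d v) (mem (halfOf false) (halfOf true) v))) → ∃[ d ] (Far d × (∀ v → maskC d v ≡ m v))
        go (d , fd , t) = d , fd , λ v → trans (eqb-sound (allV-sound (λ v → eqb (maskC d v) (mem (halfOf false) (halfOf true) v)) t v)) (mem-m v)
          where
          mem-m : ∀ v → mem (halfOf false) (halfOf true) v ≡ m v
          mem-m (false , x , y) = get-half false x y
          mem-m (true , x , y) = get-half true x y

    -- A vertex at distance 2 from `u` is tied to its flag only by its trace on the local graph.
    -- Adjacency of two such vertices is recovered from the pairing of their traces.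
    data Is : Code → Fin n → Set where
      base : Is ∞ u
      near : ∀ v → Is (codeV v) (E v)
      far : ∀ {w d} → α w ≡ 0ℤ → u ≢ w → Far d → (∀ v → maskC d v ≡ adjacent w (E v)) → Is d w

    code : ∀ w → ∃[ c ] Is c w
    code w with u ≟ w
    ... | yes refl = ∞ , base
    ... | no ne = [ (λ z → outside z (far-code z ne)) , (λ o → inside (covered w o)) ]′ (α-01 w)
      where
      outside : α w ≡ 0ℤ → ∃[ d ] (Far d × (∀ v → maskC d v ≡ adjacent w (E v))) → ∃[ c ] Is c w
      outside z (d , fd , q) = d , far z ne fd q
      inside : ∃[ k ] e k ≡ w → ∃[ c ] Is c w
      inside (k , q) = codeV (vert k) , subst (Is (codeV (vert k))) q (near (vert k))

    private
      ∞-nearᵇ : T (allV λ v → adjC ∞ (codeV v) ∧ adjC (codeV v) ∞)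
      ∞-nearᵇ = tt

      ∞-farᵇ : T (allFar λ d → not (adjC ∞ d) ∧ not (adjC d ∞))
      ∞-farᵇ = tt

      near-nearᵇ : T (allV λ v → allV λ w → eqb (adjC (codeV v) (codeV w)) (inc v w))
      near-nearᵇ = tt

      near-farᵇ : T (allFar λ d → allV λ v → eqb (adjC (codeV v) d) (maskC d v))
      near-farᵇ = tt

      true-of : ∀ {b} → T b → b ≡ true
      true-of = Equivalence.to T-≡

      false-of : ∀ {b} → T (not b) → b ≡ false
      false-of {false} _ = refl

      -- The same pairing `d` is expressed once by the vertices and once by their flags. The values
      -- 336, 288 and 432 distinguish the cases; a flag both equal and adjacent to itself would give
      -- 384.
      finish : ∀ d (x y : ℤ) k l → (x ≡ 0ℤ × y ≡ 0ℤ) ⊎ (x ≡ 0ℤ × y ≡ 1ℤ) ⊎ (x ≡ 1ℤ × y ≡ 0ℤ) →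
        + d ≡ + 336 + (+ 96 * x + - + 48 * y) → d ℕ.+ 48 ℕ.* nb k ≡ 336 ℕ.+ 96 ℕ.* nb l → y ≡ bit k
      finish d x y k l (inj₁ (refl , refl)) p q with +-injective p
      finish .336 x y false l (inj₁ (refl , refl)) p q | refl = refl
      finish .336 x y true false (inj₁ (refl , refl)) p () | refl
      finish .336 x y true true (inj₁ (refl , refl)) p () | refl
      finish d x y k l (inj₂ (inj₁ (refl , refl))) p q with +-injective p
      finish .288 x y true l (inj₂ (inj₁ (refl , refl))) p q | refl = refl
      finish .288 x y false false (inj₂ (inj₁ (refl , refl))) p () | refl
      finish .288 x y false true (inj₂ (inj₁ (refl , refl))) p () | refl
      finish d x y k l (inj₂ (inj₂ (refl , refl))) p q with +-injective p
      finish .432 x y false l (inj₂ (inj₂ (refl , refl))) p q | refl = refl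
      finish .432 x y true false (inj₂ (inj₂ (refl , refl))) p () | refl
      finish .432 x y true true (inj₂ (inj₂ (refl , refl))) p () | refl

      far-far : ∀ {w w′ d d′} → α w ≡ 0ℤ → u ≢ w → Far d → (∀ v → maskC d v ≡ adjacent w (E v)) →
        α w′ ≡ 0ℤ → u ≢ w′ → Far d′ → (∀ v → maskC d′ v ≡ adjacent w′ (E v)) → a w′ w ≡ bit (adjC d′ d)
      far-far {w} {w′} {d} {d′} αw uw fd q αw′ uw′ fd′ q′ = finish (dot (weight (λ v → adjacent w (E v))) (λ v → adjacent w′ (E v))) (δ w′ w) (a w′ w) (adjC d′ d) (d′ ==C d)
        cases (gram-value w w′ αw αw′ uw uw′) (trans (cong (ℕ._+ 48 ℕ.* nb (adjC d′ d)) (sym (dot-cong wt lk′))) entry)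
        where
        cases : (δ w′ w ≡ 0ℤ × a w′ w ≡ 0ℤ) ⊎ (δ w′ w ≡ 0ℤ × a w′ w ≡ 1ℤ) ⊎ (δ w′ w ≡ 1ℤ × a w′ w ≡ 0ℤ)
        cases with w′ ≟ w
        ... | yes refl = inj₂ (inj₂ (δ-refl w′ , a-irr w′))
        ... | no ne = [ (λ z → inj₁ (δ-≢ ne , z)) , (λ o → inj₂ (inj₁ (δ-≢ ne , o))) ]′ (a-01 w′ w)
        lk : ∀ v → look (mask masks d) v ≡ adjacent w (E v)
        lk v = trans (cong (λ t → look t v) (mask-masks fd)) (trans (look-tab (maskC d) v) (q v))
        lk′ : ∀ v → look (mask masks d′) v ≡ adjacent w′ (E v)
        lk′ v = trans (cong (λ t → look t v) (mask-masks fd′)) (trans (look-tab (maskC d′) v) (q′ v))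
        wt : ∀ v → look (weights (mask masks d)) v ≡ weight (λ v → adjacent w (E v)) v
        wt v = trans (weights-correct (mask masks d) v) (weight-cong lk v)
        entry : dot (look (weights (mask masks d))) (look (mask masks d′)) ℕ.+ 48 ℕ.* nb (adjC d′ d) ≡ 336 ℕ.+ 96 ℕ.* nb (d′ ==C d)
        entry = gram-sound masks gram-masks fd fd′

    Is-adjacent : ∀ {c d p q} → Is c p → Is d q → a p q ≡ bit (adjC c d)
    Is-adjacent base base = a-irr u
    Is-adjacent base (near v) = trans (αE v) (cong bit (sym (true-of (proj₁ (∧-elim {adjC ∞ (codeV v)} (allV-sound (λ v → adjC ∞ (codeV v) ∧ adjC (codeV v) ∞) ∞-nearᵇ v))))))
    Is-adjacent base (far {d = d} αw _ fd _) = trans αw (cong bit (sym (false-of (proj₁ (∧-elim {not (adjC ∞ d)} (allFar-sound (λ d → not (adjC ∞ d) ∧ not (adjC d ∞)) ∞-farᵇ fd))))))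
    Is-adjacent (near v) base = trans (a-sym (E v) u) (trans (αE v) (cong bit (sym (true-of (proj₂ (∧-elim {adjC ∞ (codeV v)} (allV-sound (λ v → adjC ∞ (codeV v) ∧ adjC (codeV v) ∞) ∞-nearᵇ v)))))))
    Is-adjacent (near v) (near w) = trans (sym (B-on (αE v) (αE w))) (trans (BE v w) (cong bit (sym (eqb-sound (allV²-sound (λ v w → eqb (adjC (codeV v) (codeV w)) (inc v w)) near-nearᵇ v w)))))
    Is-adjacent (near v) (far {w} {d} _ _ fd q) = trans (a-sym (E v) w) (trans (a-bit w (E v)) (cong bit (sym (trans
      (eqb-sound (allV-sound (λ v → eqb (adjC (codeV v) d) (maskC d v)) (allFar-sound (λ d → allV λ v → eqb (adjC (codeV v) d) (maskC d v)) near-farᵇ fd) v)) (q v)))))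
    Is-adjacent (far {w} {d} αw _ fd _) base = trans (a-sym w u) (trans αw (cong bit (sym (false-of (proj₂ (∧-elim {not (adjC ∞ d)} (allFar-sound (λ d → not (adjC ∞ d) ∧ not (adjC d ∞)) ∞-farᵇ fd)))))))
    Is-adjacent (far {w} _ _ _ q) (near v) = trans (a-bit w (E v)) (cong bit (sym (q v)))
    Is-adjacent (far αw uw fd q) (far αw′ uw′ fd′ q′) = far-far αw′ uw′ fd′ q′ αw uw fd q

-- Counting with Boolean predicates, and the isomorphism from Δ to the flag graph.

module Recognition where
  open import Defs hiding (sym)
  open LinearAlgebra
  open PlaneCoordinates using (bit)
  open Flags hiding (_==C_)
  open Flags using (_==C_)
  open TraceCounts
  open Labelling
  open import Data.Bool using (Bool; true; false; not; if_then_else_; _∧_; T)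
  open import Data.Bool.Properties using (T-≡; ∧-identityʳ; ∧-zeroʳ)
  open import Function.Bundles using (Equivalence)
  open import Data.Nat as ℕ using (ℕ; zero; suc; _≡ᵇ_)
  import Data.Nat.Properties as ℕP
  open import Data.Integer using (ℤ; +_; -_; _+_; _*_; 0ℤ; 1ℤ)
  open import Data.Integer.Properties using (pos-+)
  open import Data.Fin using (Fin; zero; suc; _≟_; toℕ; punchOut; join; splitAt; combine; remQuot)
  open import Data.Fin.Properties using (any?; pigeonhole; punchOut-injective; toℕ-injective; <⇒≢)
  open import Data.Product using (_×_; _,_; proj₁; proj₂; ∃-syntax; Σ)
  open import Data.Unit using (tt)
  open import Data.Sum using (_⊎_; inj₁; inj₂; [_,_]′)
  open import Function using (_∘_)
  open import Relation.Nullary using (yes; no; contradiction; Dec)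
  open import Relation.Nullary.Decidable using (decidable-stable; map′)
  open import Relation.Binary.PropositionalEquality

  unpack : ∀ {A B : Set} {P : A → Set} → Σ A P → (∀ x → P x → B) → B
  unpack (x , p) f = f x p

  T⇒≡ : ∀ {b} → T b → b ≡ true
  T⇒≡ = Equivalence.to T-≡

  ≡⇒T : ∀ {b} → b ≡ true → T b
  ≡⇒T = Equivalence.from T-≡

  ∧-true : ∀ {x y} → x ∧ y ≡ true → x ≡ true × y ≡ true
  ∧-true {true} p = refl , p

  ∧-both : ∀ {x y} → x ≡ true → y ≡ true → x ∧ y ≡ true
  ∧-both refl refl = refl

  ==-refl : ∀ {n} (i : Fin n) → (i == i) ≡ true
  ==-refl i with i ≟ i
  ... | yes _ = refl
  ... | no ne = contradiction refl ne

  ==⇒≡ : ∀ {n} {i j : Fin n} → (i == j) ≡ true → i ≡ j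
  ==⇒≡ {i = i} {j} q with i ≟ j
  ==⇒≡ q | yes e = e
  ==⇒≡ () | no _

  ≢⇒== : ∀ {n} {i j : Fin n} → i ≢ j → not (i == j) ≡ true
  ≢⇒== {i = i} {j} ne with i ≟ j
  ... | yes e = contradiction e ne
  ... | no _ = refl

  not-==⇒≢ : ∀ {n} {i j : Fin n} → not (i == j) ≡ true → i ≢ j
  not-==⇒≢ {i = i} q refl with i ≟ i
  not-==⇒≢ () refl | yes _
  ... | no ne = ne refl

  ==-suc : ∀ {n} (i j : Fin n) → (suc i == suc j) ≡ (i == j)
  ==-suc i j with i ≟ j
  ... | yes _ = refl
  ... | no _ = refl


  count-cong : ∀ {n} {p q : Fin n → Bool} → (∀ i → p i ≡ q i) → count p ≡ count q
  count-cong {zero} e = refl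
  count-cong {suc n} e = cong₂ ℕ._+_ (cong (λ b → if b then 1 else 0) (e zero)) (count-cong (λ i → e (suc i)))

  count-some : ∀ {n} (p : Fin n → Bool) → count p ≢ 0 → ∃[ i ] p i ≡ true
  count-some {zero} p ne = contradiction refl ne
  count-some {suc n} p ne = go (p zero) refl
    where
    go : ∀ b → p zero ≡ b → ∃[ i ] p i ≡ true
    go true q = zero , q
    go false q = unpack (count-some (λ i → p (suc i)) (λ r → ne (cong₂ ℕ._+_ (cong (λ b → if b then 1 else 0) q) r))) (λ i r → suc i , r)

  _∖_ : ∀ {n} → (Fin n → Bool) → Fin n → Fin n → Bool
  (p ∖ i) j = p j ∧ not (i == j)

  count-∖ : ∀ {n} (p : Fin n → Bool) i → p i ≡ true → count p ≡ suc (count (p ∖ i))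
  count-∖ {suc n} p zero q = cong₂ ℕ._+_ (cong (λ b → if b then 1 else 0) q)
    (trans (count-cong (λ j → sym (∧-identityʳ (p (suc j))))) (cong (λ b → (if b then 1 else 0) ℕ.+ count (λ j → p (suc j) ∧ true)) (sym (∧-zeroʳ (p zero)))))
  count-∖ {suc n} p (suc i) q = trans (cong₂ ℕ._+_ (cong (λ b → if b then 1 else 0) (sym (∧-identityʳ (p zero)))) (count-∖ (λ j → p (suc j)) i q))
    (trans (ℕP.+-suc (if p zero ∧ true then 1 else 0) (count ((λ j → p (suc j)) ∖ i))) (cong (λ c → suc ((if p zero ∧ true then 1 else 0) ℕ.+ c))
      (count-cong (λ j → cong (λ b → p (suc j) ∧ not b) (sym (==-suc i j))))))

  count-pos : ∀ {n} (p : Fin n → Bool) i → p i ≡ true → count p ≢ 0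
  count-pos p i q z = contradiction (trans (sym (count-∖ p i q)) z) (λ ())

  ∖-intro : ∀ {n} (p : Fin n → Bool) {i j} → p j ≡ true → i ≢ j → (p ∖ i) j ≡ true
  ∖-intro p q ne = ∧-both q (≢⇒== ne)

  count-unique : ∀ {n} (p : Fin n → Bool) → count p ≡ 1 → ∀ {i j} → p i ≡ true → p j ≡ true → i ≡ j
  count-unique p c {i} {j} pi pj = decidable-stable (i ≟ j) λ ne →
    count-pos (p ∖ i) j (∖-intro p pj ne) (ℕP.suc-injective (trans (sym (count-∖ p i pi)) c))

  count≥2 : ∀ {n} (p : Fin n → Bool) {i j} → p i ≡ true → p j ≡ true → i ≢ j → ∃[ c ] count p ≡ suc (suc c)
  count≥2 p {i} {j} pi pj ne = count ((p ∖ i) ∖ j) , trans (count-∖ p i pi) (cong suc (count-∖ (p ∖ i) j (∖-intro p pj ne)))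

  another : ∀ {n} (p : Fin n → Bool) {c} → count p ≡ suc (suc c) → ∀ {i} → p i ≡ true → ∃[ j ] (p j ≡ true × i ≢ j)
  another p c {i} pi = unpack (count-some (p ∖ i) (λ z → contradiction (ℕP.suc-injective (trans (sym c) (trans (count-∖ p i pi) (cong suc z)))) (λ ()))) (λ j q → j , proj₁ (∧-true q) , not-==⇒≢ (proj₂ (∧-true {p j} q)))

  record Listing {n} (p : Fin n → Bool) (k : ℕ) : Set where
    field
      at : Fin k → Fin n
      at-inj : ∀ i j → at i ≡ at j → i ≡ j
      at-p : ∀ i → p (at i) ≡ true
      at-all : ∀ x → p x ≡ true → ∃[ i ] at i ≡ x
  open Listing

  listing : ∀ {n} (p : Fin n → Bool) k → count p ≡ k → Listing p k
  listing p zero c = record { at = λ () ; at-inj = λ () ; at-p = λ () ; at-all = λ x q → contradiction c (count-pos p x q) }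
  listing p (suc k) c = go (count-some p (λ z → contradiction (trans (sym c) z) (λ ())))
    where
    go : ∃[ i ] p i ≡ true → Listing p (suc k)
    go (i , pi) = record { at = f ; at-inj = inj ; at-p = λ { zero → pi ; (suc s) → proj₁ (∧-true (at-p rest s)) } ; at-all = all′ }
      where
      rest : Listing (p ∖ i) k
      rest = listing (p ∖ i) k (ℕP.suc-injective (trans (sym (count-∖ p i pi)) c))
      f : Fin (suc k) → Fin _
      f zero = i
      f (suc s) = at rest s
      new : ∀ s → i ≢ at rest s
      new s = not-==⇒≢ (proj₂ (∧-true {p (at rest s)} (at-p rest s)))
      inj : ∀ s t → f s ≡ f t → s ≡ t
      inj zero zero _ = refl
      inj zero (suc t) e = contradiction e (new t)
      inj (suc s) zero e = contradiction (sym e) (new s)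
      inj (suc s) (suc t) e = cong suc (at-inj rest s t e)
      all′ : ∀ x → p x ≡ true → ∃[ s ] f s ≡ x
      all′ x q with i ≟ x
      ... | yes e = zero , e
      ... | no ne = unpack (at-all rest x (∖-intro p q ne)) (λ s e → suc s , e)

  sum-count : ∀ {n} (p : Fin n → Bool) → sum (λ i → bit (p i)) ≡ + count p
  sum-count {zero} p = sum-[] _
  sum-count {suc n} p = trans (sum-∷ (λ i → bit (p i))) (trans (cong₂ _+_ (b→ (p zero)) (sum-count (λ i → p (suc i)))) (sym (pos-+ (if p zero then 1 else 0) (count (λ i → p (suc i))))))
    where
    b→ : ∀ b → bit b ≡ + (if b then 1 else 0)
    b→ false = refl
    b→ true = refl


  -- A left inverse of taking point and line of a code; the values at pairs that are no flags are
  -- arbitrary.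
  decode : Point → Line → Code
  decode P∞ L∞ = ∞
  decode P∞ (V x) = vt x
  decode P∞ (N m c) = ∞
  decode (S m) L∞ = sl m
  decode (S m) (V x) = ∞
  decode (S m) (N _ c) = ln m c
  decode (Af x y) L∞ = ∞
  decode (Af x y) (V _) = pt x y
  decode (Af x y) (N m _) = fl x y m

  decode-code : ∀ c → decode (point c) (line c) ≡ c
  decode-code ∞ = refl
  decode-code (pt x y) = refl
  decode-code (ln m c) = refl
  decode-code (fl x y m) = refl
  decode-code (vt x) = refl
  decode-code (sl m) = refl

  private
    ==₄⇒≡ : ∀ i j → T (i ==₄ j) → i ≡ j
    ==₄⇒≡ i j t = toℕ-injective (ℕP.≡ᵇ⇒≡ (toℕ i) (toℕ j) t)

    ==ₚ⇒≡ : ∀ p q → T (p ==ₚ q) → p ≡ q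
    ==ₚ⇒≡ P∞ P∞ t = refl
    ==ₚ⇒≡ (S m) (S m′) t = cong S (==₄⇒≡ m m′ t)
    ==ₚ⇒≡ (Af x y) (Af x′ y′) t = cong₂ Af (==₄⇒≡ x x′ (proj₁ (∧-elim {x ==₄ x′} t))) (==₄⇒≡ y y′ (proj₂ (∧-elim {x ==₄ x′} t)))
    ==ₚ⇒≡ P∞ (S _) ()
    ==ₚ⇒≡ P∞ (Af _ _) ()
    ==ₚ⇒≡ (S _) P∞ ()
    ==ₚ⇒≡ (S _) (Af _ _) ()
    ==ₚ⇒≡ (Af _ _) P∞ ()
    ==ₚ⇒≡ (Af _ _) (S _) ()

    ==ₗ⇒≡ : ∀ p q → T (p ==ₗ q) → p ≡ q
    ==ₗ⇒≡ L∞ L∞ t = refl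
    ==ₗ⇒≡ (V m) (V m′) t = cong V (==₄⇒≡ m m′ t)
    ==ₗ⇒≡ (N x y) (N x′ y′) t = cong₂ N (==₄⇒≡ x x′ (proj₁ (∧-elim {x ==₄ x′} t))) (==₄⇒≡ y y′ (proj₂ (∧-elim {x ==₄ x′} t)))
    ==ₗ⇒≡ L∞ (V _) ()
    ==ₗ⇒≡ L∞ (N _ _) ()
    ==ₗ⇒≡ (V _) L∞ ()
    ==ₗ⇒≡ (V _) (N _ _) ()
    ==ₗ⇒≡ (N _ _) L∞ ()
    ==ₗ⇒≡ (N _ _) (V _) ()

  ==C⇒≡ : ∀ c d → T (c ==C d) → c ≡ d
  ==C⇒≡ c d t = trans (sym (decode-code c)) (trans (cong₂ decode (==ₚ⇒≡ (point c) (point d) (proj₁ (∧-elim {point c ==ₚ point d} t)))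
    (==ₗ⇒≡ (line c) (line d) (proj₂ (∧-elim {point c ==ₚ point d} t)))) (decode-code d))

  -- The numbering follows the splitting 105 = 16 + 16 + 64 + 4 + 4 + 1.
  num : Code → Fin 105
  num (pt x y) = join 16 89 (inj₁ (combine {4} {4} x y))
  num (ln x y) = join 16 89 (inj₂ (join 16 73 (inj₁ (combine {4} {4} x y))))
  num (fl x y m) = join 16 89 (inj₂ (join 16 73 (inj₂ (join 64 9 (inj₁ (combine {4} {16} x (combine {4} {4} y m)))))))
  num (vt x) = join 16 89 (inj₂ (join 16 73 (inj₂ (join 64 9 (inj₂ (join 4 5 (inj₁ x)))))))
  num (sl m) = join 16 89 (inj₂ (join 16 73 (inj₂ (join 64 9 (inj₂ (join 4 5 (inj₂ (join 4 1 (inj₁ m)))))))))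
  num ∞ = join 16 89 (inj₂ (join 16 73 (inj₂ (join 64 9 (inj₂ (join 4 5 (inj₂ (join 4 1 (inj₂ zero)))))))))

  nth : Fin 105 → Code
  nth i = [ pt′ , (λ i → [ ln′ , (λ i → [ fl′ , (λ i → [ vt , (λ i → [ sl , (λ _ → ∞) ]′ (splitAt 4 i)) ]′ (splitAt 4 i)) ]′ (splitAt 64 i)) ]′ (splitAt 16 i)) ]′ (splitAt 16 i)
    where
    pt′ ln′ : Fin 16 → Code
    pt′ i = pt (proj₁ (remQuot {4} 4 i)) (proj₂ (remQuot {4} 4 i))
    ln′ i = ln (proj₁ (remQuot {4} 4 i)) (proj₂ (remQuot {4} 4 i))
    fl′ : Fin 64 → Code
    fl′ i = fl (proj₁ (remQuot {4} 16 i)) (proj₁ (remQuot {4} 4 (proj₂ (remQuot {4} 16 i)))) (proj₂ (remQuot {4} 4 (proj₂ (remQuot {4} 16 i))))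

  allC : (Code → Bool) → Bool
  allC p = p ∞ ∧ (allV (λ v → p (codeV v)) ∧ allFar p)

  allC-sound : ∀ p → T (allC p) → ∀ c → T (p c)
  allC-sound p t = go
    where
    t₁ : T (allV (λ v → p (codeV v)) ∧ allFar p)
    t₁ = proj₂ (∧-elim {p ∞} t)
    v : ∀ w → T (p (codeV w))
    v = allV-sound (λ v → p (codeV v)) (proj₁ (∧-elim {allV (λ v → p (codeV v))} t₁))
    f : ∀ {c} → Far c → T (p c)
    f = allFar-sound p (proj₂ (∧-elim {allV (λ v → p (codeV v))} t₁))
    go : ∀ c → T (p c)
    go ∞ = proj₁ (∧-elim {p ∞} t)
    go (pt x y) = v (false , x , y)
    go (ln m c) = v (true , m , c)
    go (fl x y m) = f (fl x y m)
    go (vt x) = f (vt x)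
    go (sl m) = f (sl m)

  private
    nth-numᵇ : T (allC λ c → nth (num c) ==C c)
    nth-numᵇ = tt

  nth-num : ∀ c → nth (num c) ≡ c
  nth-num c = ==C⇒≡ (nth (num c)) c (allC-sound (λ c → nth (num c) ==C c) nth-numᵇ c)

  num-inj : ∀ c d → num c ≡ num d → c ≡ d
  num-inj c d e = trans (sym (nth-num c)) (trans (cong nth e) (nth-num d))

  _≟C_ : (c d : Code) → Dec (c ≡ d)
  c ≟C d = map′ (num-inj c d) (cong num) (num c ≟ num d)

  onto : ∀ {n} (f : Fin (suc n) → Fin (suc n)) → (∀ i j → f i ≡ f j → i ≡ j) → ∀ t → ∃[ i ] f i ≡ t
  onto {n} f inj t with any? (λ i → f i ≟ t)
  ... | yes r = r
  ... | no ne = contradiction (pigeonhole (ℕP.n<1+n n) (λ i → punchOut (avoid i)))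
      (λ (i , j , i<j , e) → <⇒≢ i<j (inj i j (punchOut-injective (avoid i) (avoid j) e)))
    where
    avoid : ∀ i → t ≢ f i
    avoid i e = ne (i , sym e)

  module SRG (Δ : Graph 105) (srg : IsSRG Δ 105 32 4 12) where
    a : Fin 105 → Fin 105 → ℤ
    a i j = bit (adj Δ i j)

    private
      deg = proj₁ (proj₂ srg)
      lam = proj₁ (proj₂ (proj₂ srg))
      mu = proj₂ (proj₂ (proj₂ srg))

      bit-∧ : ∀ b c → bit b * bit c ≡ bit (b ∧ c)
      bit-∧ false c = refl
      bit-∧ true false = refl
      bit-∧ true true = refl

      ∧-idem : ∀ b → b ∧ b ≡ b
      ∧-idem false = refl
      ∧-idem true = refl

      a-sym : Symmetric a
      a-sym i j = cong bit (Graph.sym Δ i j)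

      a-01 : ∀ i j → a i j ≡ 0ℤ ⊎ a i j ≡ 1ℤ
      a-01 i j with adj Δ i j
      ... | false = inj₁ refl
      ... | true = inj₂ refl

      a-irr : ∀ i → a i i ≡ 0ℤ
      a-irr i = cong bit (irrefl Δ i)

      a-deg : ∀ i → sum (a i) ≡ + 32
      a-deg i = trans (sum-count (adj Δ i)) (cong +_ (deg i))

      a-mul : ∀ i j → ⟨ a i , a j ⟩ ≡ + count (λ w → adj Δ i w ∧ adj Δ j w)
      a-mul i j = trans (sum-cong (λ w → bit-∧ (adj Δ i w) (adj Δ j w))) (sum-count (λ w → adj Δ i w ∧ adj Δ j w))

      a-sq : ∀ i j → ⟨ a i , a j ⟩ ≡ + 12 + (+ 20 * δ i j + - + 8 * a i j)
      a-sq i j with i ≟ j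
      ... | yes refl = trans (a-mul i i) (trans (cong +_ (trans (count-cong (λ w → ∧-idem (adj Δ i w))) (deg i)))
          (sym (cong₂ (λ d k → + 12 + (+ 20 * d + - + 8 * k)) (δ-refl i) (a-irr i))))
      ... | no ne = go (adj Δ i j) refl
        where
        go : ∀ b → adj Δ i j ≡ b → ⟨ a i , a j ⟩ ≡ + 12 + (+ 20 * δ i j + - + 8 * a i j)
        go true q = trans (a-mul i j) (trans (cong +_ (lam i j (≡⇒T q))) (sym (cong₂ (λ d k → + 12 + (+ 20 * d + - + 8 * k)) (δ-≢ ne) (cong bit q))))
        go false q = trans (a-mul i j) (trans (cong +_ (mu i j ne q)) (sym (cong₂ (λ d k → + 12 + (+ 20 * d + - + 8 * k)) (δ-≢ ne) (cong bit q))))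

      order : sum {105} (λ _ → 1ℤ) ≡ + 105
      order = sum-tot (λ _ → 1ℤ) (λ _ → 1) (λ _ → refl)

    open Labelled (adj Δ) a (λ _ _ → refl) a-sym a-01 a-irr a-deg a-sq order zero

    opaque
      φ : Fin 105 → Code
      φ v = proj₁ (code v)

      φ-a : ∀ v w → a v w ≡ bit (adjC (φ v) (φ w))
      φ-a v w = Is-adjacent (proj₂ (code v)) (proj₂ (code w))

    φ-adj : ∀ v w → adj Δ v w ≡ adjC (φ v) (φ w)
    φ-adj v w = bit-inj (adj Δ v w) (adjC (φ v) (φ w)) (φ-a v w)
      where
      bit-inj : ∀ b c → bit b ≡ bit c → b ≡ c
      bit-inj false false _ = refl
      bit-inj true true _ = refl

    -- Vertices with the same code have the same adjacency row and are nonadjacent, but the inner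
    -- product of a row with itself is 32 and that of the rows of distinct nonadjacent vertices is
    -- 12.
    φ-inj : ∀ v w → φ v ≡ φ w → v ≡ w
    φ-inj v w e = decidable-stable (v ≟ w) λ ne → contradiction (trans (sym (val v v (δ-refl v) (a-irr v))) (trans (⟨⟩-cong {f = a v} {a v} {a v} {a w} (λ _ → refl) same-row) (val v w (δ-≢ ne) (trans (sym (same-row′)) (a-irr v))))) (λ ())
      where
      same-row : ∀ x → a v x ≡ a w x
      same-row x = trans (φ-a v x) (trans (cong (λ c → bit (adjC c (φ x))) e) (sym (φ-a w x)))
      same-row′ : a v v ≡ a v w
      same-row′ = trans (φ-a v v) (trans (cong (λ c → bit (adjC (φ v) c)) e) (sym (φ-a v w)))
      val : ∀ x y {d k} → δ x y ≡ d → a x y ≡ k → ⟨ a x , a y ⟩ ≡ + 12 + (+ 20 * d + - + 8 * k)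
      val x y p q = trans (a-sq x y) (cong₂ (λ d k → + 12 + (+ 20 * d + - + 8 * k)) p q)

    φ-onto : ∀ c → ∃[ v ] φ v ≡ c
    φ-onto c = unpack (onto (num ∘ φ) (λ i j q → φ-inj i j (num-inj (φ i) (φ j) q)) (num c)) (λ v q → v , num-inj (φ v) c q)

-- Distance-regular antipodal 6-covers have c₂ = 2.

module Covers where
  open import Defs hiding (sym)
  open PencilNames using (0F; 1F; 2F; 3F)
  open Flags
  open Recognition
  open import Data.Bool using (Bool; true; false; not; if_then_else_; _∧_; _∨_; T)
  open import Data.Bool.Properties using (∨-zeroʳ)
  open import Data.Nat as ℕ using (ℕ; zero; suc; z≤n; s≤s)
  import Data.Nat.Properties as ℕP
  open import Data.Fin using (Fin; zero; suc; _≟_; remQuot; combine)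
  open import Data.Fin.Properties using (any?; all?; pigeonhole; injective⇒≤; combine-remQuot; ¬∀⟶∃¬; <⇒≢)
  open import Data.Vec using ([]; _∷_; lookup)
  open import Data.Product using (_×_; _,_; proj₁; proj₂; ∃-syntax)
  open import Data.Unit using (tt)
  open import Data.Empty using (⊥; ⊥-elim)
  open import Data.Sum using (_⊎_; inj₁; inj₂; [_,_]′)
  open import Function using (_∘_)
  open import Relation.Nullary using (yes; no; contradiction; ¬_; Dec; ¬?; _→-dec_)
  open import Relation.Nullary.Decidable using (decidable-stable; toWitness)
  open import Relation.Binary.PropositionalEquality
  open Listing

  ∨-elim : ∀ {x y} → x ∨ y ≡ true → x ≡ true ⊎ y ≡ true
  ∨-elim {true} _ = inj₁ refl
  ∨-elim {false} q = inj₂ q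

  ∨-introˡ : ∀ {x y} → x ≡ true → x ∨ y ≡ true
  ∨-introˡ refl = refl

  ∨-introʳ : ∀ x {y} → y ≡ true → x ∨ y ≡ true
  ∨-introʳ x refl = ∨-zeroʳ x

  anyF-intro : ∀ {n} (p : Fin n → Bool) i → p i ≡ true → anyF p ≡ true
  anyF-intro p zero q = ∨-introˡ q
  anyF-intro p (suc i) q = ∨-introʳ (p zero) (anyF-intro (p ∘ suc) i q)

  anyF-elim : ∀ {n} (p : Fin n → Bool) → anyF p ≡ true → ∃[ i ] p i ≡ true
  anyF-elim {suc n} p q = [ (λ r → zero , r) , (λ r → unpack (anyF-elim (p ∘ suc) r) (λ i s → suc i , s)) ]′ (∨-elim {p zero} q)

  module Distance {n} (Γ : Graph n) where
    infix 4 _~_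
    _~_ : Fin n → Fin n → Set
    x ~ y = adj Γ x y ≡ true

    ~-sym : ∀ {x y} → x ~ y → y ~ x
    ~-sym {x} {y} q = trans (Graph.sym Γ y x) q

    -- The records keep the distance and the two vertices visible to unification, which cannot
    -- recover them from an evaluated Boolean.
    record R (i : ℕ) (x y : Fin n) : Set where
      constructor mkR
      field isR : reach Γ i x y ≡ true
    open R public

    record At (i : ℕ) (x y : Fin n) : Set where
      constructor mkA
      field isA : distIs Γ i x y ≡ true
    open At public

    R-refl : ∀ x → R 0 x x
    R-refl x = mkR (==-refl x)

    R-suc : ∀ {i x y} → R i x y → R (suc i) x y
    R-suc r = mkR (∨-introˡ (isR r))

    R-step : ∀ {i x y z} → R i x y → y ~ z → R (suc i) x z
    R-step {i} {x} {y} {z} r e = mkR (∨-introʳ (reach Γ i x z) (anyF-intro (λ w → reach Γ i x w ∧ adj Γ w z) y (∧-both (isR r) e)))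

    R-inv : ∀ {i x z} → R (suc i) x z → R i x z ⊎ ∃[ y ] (R i x y × y ~ z)
    R-inv {i} {x} {z} r = [ (λ q → inj₁ (mkR q)) , (λ q → inj₂ (unpack (anyF-elim (λ w → reach Γ i x w ∧ adj Γ w z) q)
      (λ y s → y , mkR (proj₁ (∧-true s)) , proj₂ (∧-true {reach Γ i x y} s)))) ]′ (∨-elim {reach Γ i x z} (isR r))

    R-≤ : ∀ {i j x y} → i ℕ.≤ j → R i x y → R j x y
    R-≤ {i} {j} {x} {y} le r = subst (λ l → R l x y) (ℕP.m∸n+n≡m le) (up (j ℕ.∸ i))
      where
      up : ∀ d → R (d ℕ.+ i) x y
      up zero = r
      up (suc d) = R-suc {d ℕ.+ i} {x} {y} (up d)

    At-intro : ∀ {i x y} → R (suc i) x y → ¬ R i x y → At (suc i) x y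
    At-intro {i} {x} {y} r nr = mkA (∧-both (isR r) (neg (reach Γ i x y) (λ t → nr (mkR t))))
      where
      neg : ∀ b → ¬ (b ≡ true) → not b ≡ true
      neg false _ = refl
      neg true n = contradiction refl n

    At⇒R : ∀ i {x y} → At i x y → R i x y
    At⇒R zero q = mkR (isA q)
    At⇒R (suc i) q = mkR (proj₁ (∧-true (isA q)))

    At⇒¬R : ∀ {i x y} → At (suc i) x y → ¬ R i x y
    At⇒¬R {i} {x} {y} q r = contradiction (trans (sym (cong not (isR r))) (proj₂ (∧-true {reach Γ (suc i) x y} (isA q)))) (λ ())

    At-pred : ∀ i {x z} → At (suc i) x z → ∃[ y ] (At i x y × y ~ z)
    At-pred i {x} {z} q = [ (λ r → contradiction r (At⇒¬R q)) , go i q ]′ (R-inv {i} (At⇒R (suc i) q))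
      where
      go : ∀ i → At (suc i) x z → ∃[ y ] (R i x y × y ~ z) → ∃[ y ] (At i x y × y ~ z)
      go zero _ (y , r , e) = y , mkA (isR r) , e
      go (suc i) q (y , r , e) = y , At-intro r (λ r′ → At⇒¬R q (R-step r′ e)) , e

    exact : ∀ i {x y} → R i x y → ∃[ j ] (j ℕ.≤ i × At j x y)
    exact zero r = zero , z≤n , mkA (isR r)
    exact (suc i) {x} {y} r = go (reach Γ i x y) refl
      where
      go : ∀ b → reach Γ i x y ≡ b → ∃[ j ] (j ℕ.≤ suc i × At j x y)
      go true q = unpack (exact i (mkR q)) (λ j (le , d) → j , ℕP.m≤n⇒m≤1+n le , d)
      go false q = suc i , ℕP.≤-refl , At-intro r (λ t → contradiction (trans (sym q) (isR t)) (λ ()))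

    ~⇒At : ∀ {x y} → x ~ y → At 1 x y
    ~⇒At {x} {y} e = At-intro (R-step (R-refl x) e) (λ r → contradiction (trans (sym (irrefl Γ x)) (subst (x ~_) (sym (==⇒≡ (isR r))) e)) (λ ()))

    At⇒~ : ∀ {x y} → At 1 x y → x ~ y
    At⇒~ {x} {y} q = unpack (At-pred 0 q) (λ z (r , e) → subst (_~ y) (sym (==⇒≡ (isA r))) e)

  -- The 12 common neighbours of the codes ∞ and fl 0 0 0.
  corner : Code
  corner = fl 0F 0F 0F

  common : Fin 12 → Code
  common = lookup (pt 0F 1F ∷ ln 0F 1F ∷ pt 0F 2F ∷ ln 0F 2F ∷ pt 0F 3F ∷ ln 0F 3F ∷ pt 1F 0F ∷ ln 1F 0F ∷ pt 2F 0F ∷ ln 2F 0F ∷ pt 3F 0F ∷ ln 3F 0F ∷ [])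

  common-inj : ∀ i j → common i ≡ common j → i ≡ j
  common-inj = toWitness {a? = all? λ i → all? λ j → (common i ≟C common j) →-dec (i ≟ j)} tt

  private
    commonᵇ : T (allC λ c → (adjC ∞ c ∧ adjC corner c) ⇒ᵇ anyF (λ i → common i ==C c))
    commonᵇ = tt

    closeᵇ : T (allC λ c → adjC corner c ⇒ᵇ (adjC ∞ c ∨ anyF (λ i → adjC (common i) c)))
    closeᵇ = tt

  common-∞ : ∀ i → adjC ∞ (common i) ≡ true
  common-∞ = toWitness {a? = all? λ i → adjC ∞ (common i) Data.Bool.≟ true} tt

  common-corner : ∀ i → adjC (common i) corner ≡ true
  common-corner = toWitness {a? = all? λ i → adjC (common i) corner Data.Bool.≟ true} tt

  common-all : ∀ c → adjC ∞ c ≡ true → adjC corner c ≡ true → ∃[ i ] common i ≡ c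
  common-all c p q = unpack (anyF-elim (λ i → common i ==C c) (T⇒≡ (⇒ᵇ-elim {adjC ∞ c ∧ adjC corner c}
    (allC-sound (λ c → (adjC ∞ c ∧ adjC corner c) ⇒ᵇ anyF (λ i → common i ==C c)) commonᵇ c) (≡⇒T (∧-both p q))))) (λ i r → i , ==C⇒≡ (common i) c (≡⇒T r))

  -- Every neighbour of the corner is within distance 2 of ∞ through a common neighbour.
  close : ∀ c → adjC corner c ≡ true → adjC ∞ c ≡ true ⊎ ∃[ i ] adjC (common i) c ≡ true
  close c q = [ inj₁ , (λ r → inj₂ (anyF-elim (λ i → adjC (common i) c) r)) ]′ (∨-elim {adjC ∞ c} (T⇒≡ (⇒ᵇ-elim {adjC corner c}
    (allC-sound (λ c → adjC corner c ⇒ᵇ (adjC ∞ c ∨ anyF (λ i → adjC (common i) c))) closeᵇ c) (≡⇒T q))))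

  module Antipodal {n} (Γ : Graph n) (Δ : Graph 105) (srg : IsSRG Δ 105 32 4 12) (θ : Fin n → Fin 105)
    (cover : IsAntipodalRCover 6 Γ Δ θ) (regular : DistanceRegular Γ) where
    open SRG Δ srg using (φ; φ-adj; φ-inj; φ-onto)
    open Distance Γ

    κ : Fin n → Code
    κ x = φ (θ x)

    private
      θ-onto = proj₁ (proj₁ (proj₁ cover))
      fibre-coclique = proj₁ (proj₂ (proj₁ (proj₁ cover)))
      no-edge = proj₁ (proj₂ (proj₂ (proj₁ (proj₁ cover))))
      matching = proj₁ (proj₂ (proj₂ (proj₂ (proj₁ (proj₁ cover)))))
      triangles = proj₂ (proj₂ (proj₂ (proj₂ (proj₁ (proj₁ cover)))))
      fibre-size = proj₂ (proj₁ cover)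
      D = proj₁ (proj₂ (proj₂ cover))
      diameter = proj₁ (proj₁ (proj₂ (proj₂ (proj₂ cover))))
      antipodal = proj₂ (proj₂ (proj₂ (proj₂ cover)))
      b = proj₁ (proj₂ regular)
      c = proj₁ (proj₂ (proj₂ regular))
      b-count = proj₁ (proj₂ (proj₂ (proj₂ regular)))
      c-count = proj₂ (proj₂ (proj₂ (proj₂ regular)))

      θ-adj : ∀ {x y} → x ~ y → adj Δ (θ x) (θ y) ≡ true
      θ-adj {x} {y} e = go (adj Δ (θ x) (θ y)) refl
        where
        go : ∀ t → adj Δ (θ x) (θ y) ≡ t → t ≡ true
        go true _ = refl
        go false q = decide (θ x ≟ θ y)
          where
          decide : Dec (θ x ≡ θ y) → false ≡ true
          decide (yes s) = trans (sym (fibre-coclique x y s)) e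
          decide (no ne) = trans (sym (no-edge x y ne q)) e

      one-over : ∀ x v → adj Δ (θ x) v ≡ true → count (λ y → adj Γ x y ∧ (θ y == θ x ∨ θ y == v)) ≡ 1
      one-over x v q = matching (θ x) v (≡⇒T q) x (inj₁ refl)

    κ-adj : ∀ {x y} → x ~ y → adjC (κ x) (κ y) ≡ true
    κ-adj {x} {y} e = trans (sym (φ-adj (θ x) (θ y))) (θ-adj e)

    -- By the matching, `x` has one neighbour in the union of its own fibre and the fibre over `v`;
    -- it is not in the former, which is a coclique.
    lift : ∀ x v → adjC (κ x) v ≡ true → ∃[ y ] (x ~ y × κ y ≡ v)
    lift x v q = go (φ-onto v)
      where
      go : ∃[ t ] φ t ≡ v → ∃[ y ] (x ~ y × κ y ≡ v)
      go (t , refl) = unpack (count-some (λ y → adj Γ x y ∧ (θ y == θ x ∨ θ y == t)) (λ z → contradiction (trans (sym (one-over x t (trans (φ-adj (θ x) t) q))) z) (λ ()))) (λ y r → y , proj₁ (∧-true r) , cong φ (over y (proj₁ (∧-true r)) (proj₂ (∧-true {adj Γ x y} r))))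
        where
        over : ∀ y → x ~ y → (θ y == θ x ∨ θ y == t) ≡ true → θ y ≡ t
        over y e r = [ (λ s → contradiction (trans (sym (fibre-coclique x y (sym (==⇒≡ s)))) e) (λ ())) , ==⇒≡ ]′ (∨-elim {θ y == θ x} r)

    uniq : ∀ {x y z} → x ~ y → x ~ z → κ y ≡ κ z → y ≡ z
    uniq {x} {y} {z} e f q = count-unique (λ w → adj Γ x w ∧ (θ w == θ x ∨ θ w == θ y)) (one-over x (θ y) (θ-adj e))
      (∧-both e (∨-introʳ (θ y == θ x) (==-refl (θ y))))
      (∧-both f (∨-introʳ (θ z == θ x) (subst (λ t → (θ z == t) ≡ true) (sym (φ-inj (θ y) (θ z) q)) (==-refl (θ z)))))

    adjC-irr : ∀ x → adjC (κ x) (κ x) ≢ true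
    adjC-irr x q = contradiction (trans (sym (irrefl Δ (θ x))) (trans (φ-adj (θ x) (θ x)) q)) (λ ())

    -- In the union of the three fibres `x` has just two neighbours, and they are adjacent. These
    -- must be `y` and `z`, which are distinct because their codes are adjacent.
    tri : ∀ {x y z} → x ~ y → x ~ z → adjC (κ y) (κ z) ≡ true → y ~ z
    tri {x} {y} {z} e f q = go (triangles (θ x) (θ y) (θ z) (≡⇒T (θ-adj e)) (≡⇒T yz) (≡⇒T (θ-adj f)) x (≡⇒T (∨-introˡ (==-refl (θ x)))))
      where
      yz : adj Δ (θ y) (θ z) ≡ true
      yz = trans (φ-adj (θ y) (θ z)) q
      inU : Fin n → Bool
      inU w = θ w == θ x ∨ θ w == θ y ∨ θ w == θ z
      go : ∃[ p ] ∃[ r ] (p ≢ r × T (inU p) × T (inU r) × T (adj Γ x p) × T (adj Γ x r) × T (adj Γ p r) × (∀ w → T (inU w) → T (adj Γ x w) → w ≡ p ⊎ w ≡ r)) → y ~ z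
      go (p , r , _ , _ , _ , _ , _ , pr , only) = pair (only y (≡⇒T (∨-introʳ (θ y == θ x) (∨-introˡ (==-refl (θ y))))) (≡⇒T e))
          (only z (≡⇒T (∨-introʳ (θ z == θ x) (∨-introʳ (θ z == θ y) (==-refl (θ z))))) (≡⇒T f))
        where
        y≢z : y ≢ z
        y≢z s = adjC-irr y (trans (cong (λ w → adjC (κ y) (κ w)) s) q)
        pair : y ≡ p ⊎ y ≡ r → z ≡ p ⊎ z ≡ r → y ~ z
        pair (inj₁ s) (inj₁ t) = contradiction (trans s (sym t)) y≢z
        pair (inj₂ s) (inj₂ t) = contradiction (trans s (sym t)) y≢z
        pair (inj₁ refl) (inj₂ refl) = T⇒≡ pr
        pair (inj₂ refl) (inj₁ refl) = ~-sym (T⇒≡ pr)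

    base : ∃[ x ] κ x ≡ ∞
    base = unpack (φ-onto ∞) (λ v q → unpack (θ-onto v) (λ x r → x , trans (cong φ r) q))

    -- Vertices over distinct nonadjacent flags; if they have a common neighbour, their distance is
    -- exactly 2 and `c 2` counts their common neighbours.
    Apart : Fin n → Fin n → Set
    Apart x y = adjC (κ x) (κ y) ≡ false × κ x ≢ κ y

    private
      apart-¬R₁ : ∀ {x y} → Apart x y → ¬ R 1 x y
      apart-¬R₁ {x} {y} (na , ne) r = [ (λ q → ne (cong κ (==⇒≡ (isR q)))) , (λ (z , q , e) → contradiction (trans (sym na) (κ-adj (subst (_~ y) (sym (==⇒≡ (isR q))) e))) (λ ())) ]′ (R-inv {0} r)

      at-2 : ∀ {x y z} → Apart x y → x ~ z → y ~ z → At 2 x y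
      at-2 {x} ap e f = At-intro (R-step (R-step (R-refl x) e) (~-sym f)) (apart-¬R₁ ap)

      both : Fin n → Fin n → Fin n → Bool
      both x y w = adj Γ y w ∧ distIs Γ 1 x w

      both-intro : ∀ {x y w} → x ~ w → y ~ w → both x y w ≡ true
      both-intro {x} {y} {w} e f = ∧-both f (isA (~⇒At e))

      both-elim : ∀ {x y w} → both x y w ≡ true → x ~ w × y ~ w
      both-elim {x} {y} {w} q = At⇒~ (mkA (proj₂ (∧-true {adj Γ y w} q))) , proj₁ (∧-true q)

      count-both : ∀ {x y z} → Apart x y → x ~ z → y ~ z → count (both x y) ≡ c 2
      count-both {x} {y} ap e f = c-count 1 x y (≡⇒T (isA (at-2 ap e f)))

      x₀ : Fin n
      x₀ = proj₁ base

      κx₀ : κ x₀ ≡ ∞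
      κx₀ = proj₂ base

      v₁ : ∃[ v ] φ v ≡ corner
      v₁ = φ-onto corner

      opaque
        -- The twelve paths from `∞` to `corner` are lifted to paths from `x₀` through `w i` to
        -- `y i`.
        W : ∀ i → ∃[ w ] (x₀ ~ w × κ w ≡ common i)
        W i = lift x₀ (common i) (trans (cong (λ t → adjC t (common i)) κx₀) (common-∞ i))

      w : Fin 12 → Fin n
      w i = proj₁ (W i)

      x~w : ∀ i → x₀ ~ w i
      x~w i = proj₁ (proj₂ (W i))

      κw : ∀ i → κ (w i) ≡ common i
      κw i = proj₂ (proj₂ (W i))

      opaque
        Y : ∀ i → ∃[ y ] (w i ~ y × κ y ≡ corner)
        Y i = lift (w i) corner (trans (cong (λ t → adjC t corner) (κw i)) (common-corner i))

      y : Fin 12 → Fin n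
      y i = proj₁ (Y i)

      w~y : ∀ i → w i ~ y i
      w~y i = proj₁ (proj₂ (Y i))

      κy : ∀ i → κ (y i) ≡ corner
      κy i = proj₂ (proj₂ (Y i))

      w-inj : ∀ i j → w i ≡ w j → i ≡ j
      w-inj i j q = common-inj i j (trans (sym (κw i)) (trans (cong κ q) (κw j)))

      apart : ∀ {z} → κ z ≡ corner → Apart x₀ z
      apart {z} q = trans (cong₂ adjC κx₀ q) refl , λ r → contradiction (trans (sym κx₀) (trans r q)) (λ ())

      opaque
        fibre : Listing (λ x → θ x == proj₁ v₁) 6
        fibre = listing (λ x → θ x == proj₁ v₁) 6 (fibre-size (proj₁ v₁))

      κ-fibre : ∀ s → κ (at fibre s) ≡ corner
      κ-fibre s = trans (cong φ (==⇒≡ (at-p fibre s))) (proj₂ v₁)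

      in-fibre : ∀ z → κ z ≡ corner → ∃[ s ] at fibre s ≡ z
      in-fibre z q = at-all fibre z (subst (λ t → (θ z == t) ≡ true) (φ-inj (θ z) (proj₁ v₁) (trans q (sym (proj₂ v₁)))) (==-refl (θ z)))

      via : ∀ {z t} → κ t ≡ corner → x₀ ~ z → t ~ z → ∃[ i ] w i ≡ z
      via {z} {t} q e f = unpack (common-all (κ z) (trans (cong (λ s → adjC s (κ z)) (sym κx₀)) (κ-adj e)) (trans (cong (λ s → adjC s (κ z)) (sym q)) (κ-adj f))) (λ i r → i , uniq (x~w i) e (trans (κw i) r))

      -- If the twelve paths from x₀ reach the whole fibre over the corner, each of its six vertices is reached c 2 times.
      evenly : (∀ s → ∃[ i ] y i ≡ at fibre s) → c 2 ≡ 2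
      -- Twelve paths end in six vertices, so two of them end in the same one and `c 2` is at least
      -- 2.
      evenly hit = two (atLeast (pigeonhole (s≤s (s≤s (s≤s (s≤s (s≤s (s≤s (s≤s z≤n))))))) (λ i → proj₁ (in-fibre (y i) (κy i)))))
        where
        atLeast : ∃[ i ] ∃[ j ] (i Data.Fin.< j × proj₁ (in-fibre (y i) (κy i)) ≡ proj₁ (in-fibre (y j) (κy j))) → ∃[ r ] c 2 ≡ suc (suc r)
        atLeast (i , j , i<j , q) = unpack (count≥2 (both x₀ (y i)) (both-intro (x~w i) (~-sym (w~y i))) (both-intro (x~w j) (subst (_~ w j) (sym same-y) (~-sym (w~y j)))) (λ s → <⇒≢ i<j (w-inj i j s))) (λ r s → r , trans (sym (count-both (apart (κy i)) (x~w i) (~-sym (w~y i)))) s)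
          where
          same-y : y i ≡ y j
          same-y = trans (sym (proj₂ (in-fibre (y i) (κy i)))) (trans (cong (at fibre) q) (proj₂ (in-fibre (y j) (κy j))))
        opaque
          L : ∀ s → Listing (both x₀ (at fibre s)) (c 2)
          L s = listing (both x₀ (at fibre s)) (c 2) (reached (hit s))
            where
            reached : ∃[ i ] y i ≡ at fibre s → count (both x₀ (at fibre s)) ≡ c 2
            reached (i , q) = count-both (apart (κ-fibre s)) (x~w i) (subst (_~ w i) q (~-sym (w~y i)))
          U : ∀ s t → ∃[ i ] w i ≡ at (L s) t
          U s t = via (κ-fibre s) (proj₁ (both-elim {x₀} {at fibre s} (at-p (L s) t))) (proj₂ (both-elim {x₀} {at fibre s} (at-p (L s) t)))
        -- Sends a vertex of the fibre together with one of its common neighbours with `x₀` to the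
        -- path through that neighbour. The path determines both, so 6 · `c 2` is at most 12.
        f : Fin (6 ℕ.* c 2) → Fin 12
        f k = proj₁ (U (proj₁ (remQuot {6} (c 2) k)) (proj₂ (remQuot {6} (c 2) k)))
        U-inj : ∀ s t s′ t′ → proj₁ (U s t) ≡ proj₁ (U s′ t′) → (s , t) ≡ (s′ , t′)
        U-inj s t s′ t′ q = fin s′ t′ same-s same-z
          where
          same-z : at (L s) t ≡ at (L s′) t′
          same-z = trans (sym (proj₂ (U s t))) (trans (cong w q) (proj₂ (U s′ t′)))
          same-s : s ≡ s′
          same-s = at-inj fibre s s′ (uniq (~-sym (proj₂ (both-elim {x₀} {at fibre s} (at-p (L s) t)))) (subst (_~ at fibre s′) (sym same-z) (~-sym (proj₂ (both-elim {x₀} {at fibre s′} (at-p (L s′) t′)))))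
            (trans (κ-fibre s) (sym (κ-fibre s′))))
          fin : ∀ s′ t′ → s ≡ s′ → at (L s) t ≡ at (L s′) t′ → (s , t) ≡ (s′ , t′)
          fin .s t′ refl r = cong (s ,_) (at-inj (L s) t t′ r)
        f-inj : ∀ {k l} → f k ≡ f l → k ≡ l
        f-inj {k} {l} q = trans (sym (combine-remQuot {6} (c 2) k)) (trans (cong (λ p → combine {6} {c 2} (proj₁ p) (proj₂ p)) (U-inj _ _ _ _ q)) (combine-remQuot {6} (c 2) l))
        at-most : c 2 ℕ.≤ 2
        at-most = ℕP.*-cancelˡ-≤ 6 (injective⇒≤ f-inj)
        two : ∃[ r ] c 2 ≡ suc (suc r) → c 2 ≡ 2
        two (r , q) = ℕP.≤-antisym at-most (subst (2 ℕ.≤_) (sym q) (s≤s (s≤s z≤n)))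

      unreached : ∀ s → ¬ (∃[ i ] y i ≡ at fibre s) → ⊥
      unreached s miss = [ spread , concentrated ]′ cases
        where
        t : Fin n
        t = at fibre s
        ap : Apart x₀ t
        ap = apart (κ-fibre s)
        ¬R₂ : ¬ R 2 x₀ t
        ¬R₂ r = [ apart-¬R₁ ap , (λ (z , q , e) → [ (λ q → apart-¬R₁ ap (R-step q e)) , (λ (z′ , q′ , e′) → meet (subst (_~ z) (sym (==⇒≡ (isR q′))) e′) e) ]′ (R-inv {0} q)) ]′ (R-inv {1} r)
          where
          meet : ∀ {z} → x₀ ~ z → z ~ t → ⊥
          meet {z} e f = unpack (via (κ-fibre s) e (~-sym f)) (λ i q → miss (i , uniq (w~y i) (subst (_~ t) (sym q) f) (trans (κy i) (sym (κ-fibre s)))))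
        distance : ∃[ j ] (j ℕ.≤ D × At j x₀ t)
        distance = exact D (mkR (T⇒≡ (diameter x₀ t)))
        far : ∀ {j} → At j x₀ t → 3 ℕ.≤ j
        far {j} q = ℕP.≰⇒> (λ le → ¬R₂ (R-≤ le (At⇒R j q)))
        cases : (∃[ i ] y i ≢ y zero) ⊎ (∀ i → y i ≡ y zero)
        cases = decide (any? (λ i → ¬? (y i ≟ y zero)))
          where
          decide : Dec (∃[ i ] y i ≢ y zero) → (∃[ i ] y i ≢ y zero) ⊎ (∀ i → y i ≡ y zero)
          decide (yes r) = inj₁ r
          decide (no r) = inj₂ (λ i → decidable-stable (y i ≟ y zero) (λ ne → r (i , ne)))

        -- The antipodal vertices `y zero` and `y i` are joined through `x₀` by a walk of length 4,
        -- so D is at most 4. As `t` is not antipodal to `x₀`, its distance is 3 and D = 4. The last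
        -- vertex before an antipode of `x₀` shows that b₃ is positive; then `t` has a neighbour
        -- over `∞`, although `corner` and `∞` are nonadjacent.
        spread : ∃[ i ] y i ≢ y zero → ⊥
        spread (i , ne) = go distance
          where
          R₄ : R 4 (y zero) (y i)
          R₄ = R-step (R-step (R-step (R-step (R-refl (y zero)) (~-sym (w~y zero))) (~-sym (x~w zero))) (x~w i)) (w~y i)
          opposite : At D (y zero) (y i)
          opposite = [ (λ q → contradiction (sym q) ne) , (λ z → mkA (T⇒≡ z)) ]′ (proj₂ (antipodal (y zero) (y i)) (φ-inj (θ (y zero)) (θ (y i)) (trans (κy zero) (sym (κy i)))))
          D≤4 : D ℕ.≤ 4
          D≤4 = le D opposite
            where
            le : ∀ d → At d (y zero) (y i) → d ℕ.≤ 4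
            le zero _ = z≤n
            le (suc d) q = ℕP.≮⇒≥ (λ gt → At⇒¬R q (R-≤ (s≤s⁻¹′ gt) R₄))
              where
              s≤s⁻¹′ : 5 ℕ.≤ suc d → 4 ℕ.≤ d
              s≤s⁻¹′ (s≤s p) = p
          go : ∃[ j ] (j ℕ.≤ D × At j x₀ t) → ⊥
          go (j , le , q) = at-3 j D refl q (far q) (ℕP.≤∧≢⇒< le j≢D) D≤4
            where
            j≢D : j ≢ D
            j≢D r = proj₂ ap (cong φ (proj₁ (antipodal x₀ t) (inj₂ (≡⇒T (isA (subst (λ l → At l x₀ t) r q))))))
            at-3 : ∀ j d → d ≡ D → At j x₀ t → 3 ℕ.≤ j → j ℕ.< d → d ℕ.≤ 4 → ⊥
            at-3 3 4 4≡D q _ _ _ = unpack other (λ x′ (r , ne′) → unpack (At-pred 3 (opp x′ r ne′)) (λ z (q′ , e) → step z q′ x′ e (opp x′ r ne′)))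
              where
              opp : ∀ x′ → (θ x′ == θ x₀) ≡ true → x₀ ≢ x′ → At 4 x₀ x′
              opp x′ r ne′ = subst (λ l → At l x₀ x′) (sym 4≡D) ([ (λ q → contradiction q ne′) , (λ z → mkA (T⇒≡ z)) ]′ (proj₂ (antipodal x₀ x′) (sym (==⇒≡ r))))
              other : ∃[ x′ ] ((θ x′ == θ x₀) ≡ true × x₀ ≢ x′)
              other = another (λ x → θ x == θ x₀) (fibre-size (θ x₀)) (==-refl (θ x₀))
              step : ∀ z → At 3 x₀ z → ∀ x′ → z ~ x′ → At 4 x₀ x′ → ⊥
              step z q′ x′ e o = unpack (count-some (λ v → adj Γ t v ∧ distIs Γ 4 x₀ v) (λ zero′ → count-pos (λ v → adj Γ z v ∧ distIs Γ 4 x₀ v) x′ (∧-both e (isA o))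
                    (trans (b-count 3 x₀ z (≡⇒T (isA q′))) (trans (sym (b-count 3 x₀ t (≡⇒T (isA q)))) zero′)))) (λ v r → contradiction (trans (sym (κ-adj (proj₁ (∧-true r)))) (trans (cong₂ adjC (κ-fibre s) (trans (sym (over v (mkA (proj₂ (∧-true {adj Γ t v} r))))) κx₀)) refl)) (λ ()))
                where
                over : ∀ v → At 4 x₀ v → κ x₀ ≡ κ v
                over v q = cong φ (proj₁ (antipodal x₀ v) (inj₂ (≡⇒T (isA (subst (λ l → At l x₀ v) 4≡D q)))))
            at-3 3 3 _ _ _ (s≤s (s≤s (s≤s ()))) _
            at-3 3 (suc (suc (suc (suc (suc _))))) _ _ _ _ (s≤s (s≤s (s≤s (s≤s ()))))
            at-3 3 2 _ _ _ (s≤s (s≤s ())) _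
            at-3 3 1 _ _ _ (s≤s ()) _
            at-3 0 _ _ _ () _ _
            at-3 1 _ _ _ (s≤s ()) _ _
            at-3 2 _ _ _ (s≤s (s≤s ())) _ _
            at-3 (suc (suc (suc (suc j)))) d _ _ _ lt le = contradiction (ℕP.≤-trans lt le) (λ { (s≤s (s≤s (s≤s (s≤s ())))) })

        -- By `close` and `tri` all neighbours of `y zero` are within distance 2 of `x₀`, which
        -- gives b₂ = 0; but a shortest path towards `t` passes from distance 2 to distance 3.
        concentrated : (∀ i → y i ≡ y zero) → ⊥
        concentrated same-y = unpack distance (λ j (_ , q) → climb j q (far q))
          where
          near-y : ∀ z → y zero ~ z → R 2 x₀ z
          near-y z e = [ direct , (λ (i , q) → R-step (R-step (R-refl x₀) (x~w i)) (tri (subst (_~ w i) (same-y i) (~-sym (w~y i))) e (trans (cong (λ t → adjC t (κ z)) (κw i)) q))) ]′ (close (κ z) cz)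
            where
            cz : adjC corner (κ z) ≡ true
            cz = trans (cong (λ t → adjC t (κ z)) (sym (κy zero))) (κ-adj e)
            direct : adjC ∞ (κ z) ≡ true → R 2 x₀ z
            direct q = unpack (common-all (κ z) q cz) (λ i r → R-suc (R-step (R-refl x₀) (subst (x₀ ~_) (uniq (subst (_~ w i) (same-y i) (~-sym (w~y i))) e (trans (κw i) r)) (x~w i))))
          at-3 : ∀ z → At 3 x₀ z → ⊥
          at-3 z q = unpack (At-pred 2 q) (λ v (q′ , e) → unpack (count-some (λ z → adj Γ (y zero) z ∧ distIs Γ 3 x₀ z) (λ none → count-pos (λ z → adj Γ v z ∧ distIs Γ 3 x₀ z) z (∧-both e (isA q))
                (trans (b-count 2 x₀ v (≡⇒T (isA q′))) (trans (sym (b-count 2 x₀ (y zero) (≡⇒T (isA (at-2 (apart (κy zero)) (x~w zero) (~-sym (w~y zero))))))) none)))) (λ z′ r → At⇒¬R {2} (mkA (proj₂ (∧-true {adj Γ (y zero) z′} r))) (near-y z′ (proj₁ (∧-true r)))))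
          climb : ∀ j {z} → At j x₀ z → 3 ℕ.≤ j → ⊥
          climb (suc (suc (suc zero))) {z} q _ = at-3 z q
          climb (suc (suc (suc (suc j)))) q _ = unpack (At-pred (suc (suc (suc j))) q) (λ z′ (q′ , _) → climb (suc (suc (suc j))) q′ (s≤s (s≤s (s≤s z≤n))))
          climb zero q ()
          climb (suc zero) q (s≤s ())
          climb (suc (suc zero)) q (s≤s (s≤s ()))

      c₂≡2 : c 2 ≡ 2
      c₂≡2 = decide (all? (λ s → any? (λ i → y i ≟ at fibre s)))
        where
        decide : Dec (∀ s → ∃[ i ] y i ≡ at fibre s) → c 2 ≡ 2
        decide (yes hit) = evenly hit
        decide (no miss) = ⊥-elim (unpack (¬∀⟶∃¬ 6 (λ s → ∃[ i ] y i ≡ at fibre s) (λ s → any? (λ i → y i ≟ at fibre s)) miss) (λ s ne → unreached s ne))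

    second : ∀ {x y z} → Apart x y → x ~ z → y ~ z → ∃[ w ] (x ~ w × y ~ w × z ≢ w)
    second {x} {y} ap e f = unpack (another (both x y) {0} (trans (count-both ap e f) c₂≡2) (both-intro e f)) (λ w (q , ne) → w , proj₁ (both-elim {x} {y} q) , proj₂ (both-elim {x} {y} q) , ne)

    no-third : ∀ {x y p q r} → Apart x y → x ~ p → y ~ p → x ~ q → y ~ q → x ~ r → y ~ r → p ≢ q → p ≢ r → q ≢ r → ⊥
    no-third {x} {y} {p} {q} {r} ap xp yp xq yq xr yr pq pr qr = qr (count-unique (both x y ∖ p)
      (ℕP.suc-injective (trans (sym (count-∖ (both x y) p (both-intro xp yp))) (trans (count-both ap xp yp) c₂≡2)))
      (∖-intro (both x y) (both-intro xq yq) pq) (∖-intro (both x y) (both-intro xr yr) pr))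

-- A language of local refutations of c₂ = 2, its checker and the soundness of the checker.

module Refutations where
  open PencilNames using (0F; 1F; 2F; 3F)
  open Flags
  open Recognition using (unpack; T⇒≡; ≡⇒T; ==C⇒≡; allC; allC-sound)
  open import Data.Bool using (Bool; true; false; not; if_then_else_; _∧_; _∨_; T; T?)
  open import Data.Bool.Properties using (T-∨)
  open import Data.Bool.ListAction using (all; any)
  open import Function.Bundles using (Equivalence)
  open import Data.Nat as ℕ using (ℕ; suc; _≡ᵇ_; _<ᵇ_; _<_)
  import Data.Nat.Properties as ℕP
  open import Data.Fin using (Fin)
  open import Data.List using (List; []; _∷_; filter; map; _++_; cartesianProductWith)
  open import Data.List.Membership.Propositional using (_∈_; find)
  open import Data.List.Membership.Propositional.Properties using (∈-filter⁺; ∈-filter⁻)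
  open import Data.List.Relation.Unary.Any as Any using (Any)
  open import Data.List.Relation.Unary.Any.Properties using (any⁻)
  open import Data.List.Relation.Unary.All as All using (All; []; _∷_)
  open import Data.List.Relation.Unary.All.Properties using (all⁺)
  open import Data.Product using (_×_; _,_; proj₁; proj₂; ∃-syntax)
  open import Data.Sum using ([_,_]′)
  open import Data.Unit using (tt)
  open import Data.Empty using (⊥)
  open import Relation.Nullary using (contradiction)
  open import Relation.Binary.PropositionalEquality

  -- A refutation works with vertices of the cover numbered 0, 1, 2, … whose codes are known.
  data Proof : Set
  data Alts : Set

  data Proof where
    -- a new neighbour of i over the code c
    lift : (i : ℕ) (c : Code) → Proof → Proof
    -- neighbours b, c of a over adjacent codes are adjacent
    tri : (a b c : ℕ) → Proof → Proof
    -- neighbours b, t of a over the same code are equal, so that t inherits the neighbour c of b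
    uni : (a b t c : ℕ) → Proof → Proof
    -- i and j have three common neighbours
    contra : (i j p q r : ℕ) → Proof
    -- a and b have a second common neighbour besides i
    split : (a b i : ℕ) → Alts → Proof

  data Alts where
    done : Alts
    alt : Code → Proof → Alts → Alts

  ext : ∀ {A : Set} → (ℕ → A) → ℕ → A → ℕ → A
  ext f k c i = if i ≡ᵇ k then c else f i

  hasE : List (ℕ × ℕ) → ℕ → ℕ → Bool
  hasE [] i j = false
  hasE ((p , q) ∷ es) i j = (((p ≡ᵇ i) ∧ (q ≡ᵇ j)) ∨ ((p ≡ᵇ j) ∧ (q ≡ᵇ i))) ∨ hasE es i j

  apartC : Code → Code → Bool
  apartC c d = not (adjC c d) ∧ not (c ==C d)

  among : List Code → Code → List Code
  among cs c = filter (λ d → T? (adjC c d)) cs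

  thirdᵇ : List Code → Code → Code → Bool
  thirdᵇ apexes c d = any (λ z → adjC z c ∧ not (z ==C d)) apexes

  -- The lists are the common neighbours of a and i, of b and i, and of a and b.
  secondᵇ : List Code → List Code → List Code → Code → Code → Code → (Code → Bool) → Bool
  secondᵇ apexA apexB cs ci ca cb alts = all (λ c → (c ==C ci) ∨ ((not (adjC ci c) ∧ (thirdᵇ apexA c cb ∨ thirdᵇ apexB c ca)) ∨ alts c)) cs

  -- The neighbour lists are passed as arguments, so that they are computed once and not for every
  -- candidate.
  splitᵇ : List Code → List Code → Code → Code → Code → (Code → Bool) → Bool
  splitᵇ Na Nb ci ca cb = secondᵇ (among Na ci) (among Nb ci) (among Na cb) ci ca cb

  -- The arguments are the list of all codes, the number of vertices named so far, their codes, and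
  -- the edges known among them.
  check : List Code → ℕ → (ℕ → Code) → List (ℕ × ℕ) → Proof → Bool
  checkAlts : List Code → ℕ → (ℕ → Code) → List (ℕ × ℕ) → ℕ → ℕ → Code → Alts → Bool
  check cs k f es (lift i c p) = (i <ᵇ k) ∧ (adjC (f i) c ∧ check cs (suc k) (ext f k c) ((i , k) ∷ es) p)
  check cs k f es (tri a b c p) = hasE es a b ∧ (hasE es a c ∧ (adjC (f b) (f c) ∧ check cs k f ((b , c) ∷ es) p))
  check cs k f es (uni a b t c p) = hasE es a b ∧ (hasE es a t ∧ ((f b ==C f t) ∧ (hasE es b c ∧ check cs k f ((t , c) ∷ es) p)))
  check cs k f es (contra i j p q r) = apartC (f i) (f j) ∧ ((hasE es i p ∧ hasE es j p) ∧ ((hasE es i q ∧ hasE es j q) ∧ ((hasE es i r ∧ hasE es j r) ∧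
    (not (f p ==C f q) ∧ (not (f p ==C f r) ∧ not (f q ==C f r))))))
  check cs k f es (split a b i alts) = hasE es i a ∧ (hasE es i b ∧ (apartC (f a) (f b) ∧
    splitᵇ (among cs (f a)) (among cs (f b)) (f i) (f a) (f b) (λ c → checkAlts cs k f es a b c alts)))
  -- A code that is neither excluded nor treated by an alternative makes the certificate fail.
  checkAlts cs k f es a b c done = false
  checkAlts cs k f es a b c (alt d p alts) = if c ==C d then check cs (suc k) (ext f k d) ((a , k) ∷ (b , k) ∷ es) p else checkAlts cs k f es a b c alts

  private
    not-T : ∀ {b} → T (not b) → b ≡ false
    not-T {false} _ = refl

    ==C-reflᵇ : T (allC λ c → c ==C c)
    ==C-reflᵇ = tt

    ≢-of : ∀ {c d} → T (not (c ==C d)) → c ≢ d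
    ≢-of {c} t refl = contradiction (trans (sym (not-T t)) (T⇒≡ (allC-sound (λ c → c ==C c) ==C-reflᵇ c))) (λ ())

    ext-new : ∀ {A : Set} (f : ℕ → A) k c → ext f k c k ≡ c
    ext-new f k c = cong (λ b → if b then c else f k) (T⇒≡ (ℕP.≡⇒≡ᵇ k k refl))

    ext-old : ∀ {A : Set} (f : ℕ → A) {k i} c → i < k → ext f k c i ≡ f i
    ext-old f {k} {i} c i<k = go (i ≡ᵇ k) refl
      where
      go : ∀ b → (i ≡ᵇ k) ≡ b → (if b then c else f i) ≡ f i
      go false _ = refl
      go true q = contradiction (ℕP.≡ᵇ⇒≡ i k (≡⇒T q)) (ℕP.<⇒≢ i<k)

  module Soundness {n : ℕ} (κ : Fin n → Code) (_~_ : Fin n → Fin n → Set)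
    (~-sym : ∀ {x y} → x ~ y → y ~ x)
    (κ-adj : ∀ {x y} → x ~ y → adjC (κ x) (κ y) ≡ true)
    (raise : ∀ x v → adjC (κ x) v ≡ true → ∃[ y ] (x ~ y × κ y ≡ v))
    (uniq : ∀ {x y z} → x ~ y → x ~ z → κ y ≡ κ z → y ≡ z)
    (triangle : ∀ {x y z} → x ~ y → x ~ z → adjC (κ y) (κ z) ≡ true → y ~ z)
    (irr : ∀ x → adjC (κ x) (κ x) ≢ true)
    (second : ∀ {x y z} → adjC (κ x) (κ y) ≡ false × κ x ≢ κ y → x ~ z → y ~ z → ∃[ w ] (x ~ w × y ~ w × z ≢ w))
    (no-third : ∀ {x y p q r} → adjC (κ x) (κ y) ≡ false × κ x ≢ κ y → x ~ p → y ~ p → x ~ q → y ~ q → x ~ r → y ~ r → p ≢ q → p ≢ r → q ≢ r → ⊥)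
    (cs : List Code) (cs-all : ∀ c → c ∈ cs)
    where

    -- The bounds ensure that an edge stays valid when `ext` assigns the next number `k` to a new
    -- vertex.
    Good : ℕ → (ℕ → Fin n) → ℕ × ℕ → Set
    Good k ν (i , j) = i < k × j < k × ν i ~ ν j

    flip-good : ∀ {k ν i j} → Good k ν (i , j) → Good k ν (j , i)
    flip-good (p , q , e) = q , p , ~-sym e

    hasE-sound : ∀ {k ν} es i j → All (Good k ν) es → T (hasE es i j) → Good k ν (i , j)
    hasE-sound {k} {ν} ((p , q) ∷ es) i j (g ∷ gs) t =
      [ (λ r → [ (λ r → agree p q r g) , (λ r → flip-good (agree′ p q r g)) ]′ (Equivalence.to (T-∨ {(p ≡ᵇ i) ∧ (q ≡ᵇ j)}) r)) , hasE-sound es i j gs ]′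
      (Equivalence.to (T-∨ {((p ≡ᵇ i) ∧ (q ≡ᵇ j)) ∨ ((p ≡ᵇ j) ∧ (q ≡ᵇ i))}) t)
      where
      agree : ∀ p q → T ((p ≡ᵇ i) ∧ (q ≡ᵇ j)) → Good k ν (p , q) → Good k ν (i , j)
      agree p q t g = subst₂ (λ i j → Good k ν (i , j)) (ℕP.≡ᵇ⇒≡ p i (proj₁ (∧-elim {p ≡ᵇ i} t))) (ℕP.≡ᵇ⇒≡ q j (proj₂ (∧-elim {p ≡ᵇ i} t))) g
      agree′ : ∀ p q → T ((p ≡ᵇ j) ∧ (q ≡ᵇ i)) → Good k ν (p , q) → Good k ν (j , i)
      agree′ p q t g = subst₂ (λ i j → Good k ν (i , j)) (ℕP.≡ᵇ⇒≡ p j (proj₁ (∧-elim {p ≡ᵇ j} t))) (ℕP.≡ᵇ⇒≡ q i (proj₂ (∧-elim {p ≡ᵇ j} t))) g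

    good-ext : ∀ {k ν} w {e} → Good k ν e → Good (suc k) (ext ν k w) e
    good-ext {k} {ν} w {i , j} (p , q , r) = ℕP.m<n⇒m<1+n p , ℕP.m<n⇒m<1+n q , subst₂ _~_ (sym (ext-old ν w p)) (sym (ext-old ν w q)) r

    good-new : ∀ {k ν} w {i} → i < k → ν i ~ w → Good (suc k) (ext ν k w) (i , k)
    good-new {k} {ν} w p r = ℕP.m<n⇒m<1+n p , ℕP.n<1+n k , subst₂ _~_ (sym (ext-old ν w p)) (sym (ext-new ν k w)) r

    κ-ext : ∀ {ν : ℕ → Fin n} {f : ℕ → Code} → (∀ i → κ (ν i) ≡ f i) → ∀ k {w c} → κ w ≡ c → ∀ i → κ (ext ν k w i) ≡ ext f k c i
    κ-ext {ν} {f} e k {w} {c} q i = go (i ≡ᵇ k)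
      where
      go : ∀ b → κ (if b then w else ν i) ≡ (if b then c else f i)
      go true = q
      go false = e i

    among-intro : ∀ ds c d → d ∈ ds → adjC c d ≡ true → d ∈ among ds c
    among-intro ds c d m q = ∈-filter⁺ (λ d → T? (adjC c d)) m (≡⇒T q)

    among-elim : ∀ ds c {d} → d ∈ among ds c → d ∈ ds × adjC c d ≡ true
    among-elim ds c m = unpack (∈-filter⁻ (λ d → T? (adjC c d)) {xs = ds} m) (λ p q → p , T⇒≡ q)

    apart-sound : ∀ {x y c d} → κ x ≡ c → κ y ≡ d → T (apartC c d) → adjC (κ x) (κ y) ≡ false × κ x ≢ κ y
    apart-sound {x} {y} refl refl t = not-T (proj₁ (∧-elim {not (adjC (κ x) (κ y))} t)) , ≢-of (proj₂ (∧-elim {not (adjC (κ x) (κ y))} t))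

    -- A vertex w adjacent to a and b that has with i a common neighbour z adjacent to a would give i and w three common neighbours.
    third : ∀ {i a b w} → i ~ a → i ~ b → a ~ w → b ~ w → adjC (κ a) (κ b) ≡ false → κ a ≢ κ b → adjC (κ i) (κ w) ≡ false → κ i ≢ κ w →
      T (thirdᵇ (among (among cs (κ a)) (κ i)) (κ w) (κ b)) → ⊥
    third {i} {a} {b} {w} ia ib aw bw nab ab niw iw t = go (find (any⁻ (λ z → adjC z (κ w) ∧ not (z ==C κ b)) (among (among cs (κ a)) (κ i)) t))
      where
      go : ∃[ z ] (z ∈ among (among cs (κ a)) (κ i) × T (adjC z (κ w) ∧ not (z ==C κ b))) → ⊥
      go (z , m , t) = at (raise i z (proj₂ (among-elim (among cs (κ a)) (κ i) m)))
        where
        az : adjC (κ a) z ≡ true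
        az = proj₂ (among-elim cs (κ a) (proj₁ (among-elim (among cs (κ a)) (κ i) m)))
        at : ∃[ v ] (i ~ v × κ v ≡ z) → ⊥
        at (v , iv , refl) = no-third (niw , iw) ia (~-sym aw) ib (~-sym bw) iv (~-sym vw) (λ q → ab (cong κ q))
            (λ q → irr a (trans (cong (λ y → adjC (κ a) (κ y)) q) az)) (λ q → ≢-of (proj₂ (∧-elim {adjC (κ v) (κ w)} t)) (cong κ (sym q)))
          where
          av : a ~ v
          av = triangle ia iv az
          vw : v ~ w
          vw = triangle av aw (T⇒≡ (proj₁ (∧-elim {adjC (κ v) (κ w)} t)))

    -- Here `ν` interprets the numbers as vertices of the cover. Its codes are prescribed at all
    -- numbers, also at those not yet in use, which saves a bound in every step; only edges carry
    -- bounds.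
    sound : ∀ p k ν f es → (∀ i → κ (ν i) ≡ f i) → All (Good k ν) es → T (check cs k f es p) → ⊥
    sound-alts : ∀ alts k ν f es → (∀ i → κ (ν i) ≡ f i) → All (Good k ν) es → ∀ {a b w} → a < k → b < k → ν a ~ w → ν b ~ w →
      T (checkAlts cs k f es a b (κ w) alts) → ⊥
    sound (lift i c p) k ν f es e g t = unpack (raise (ν i) c (trans (cong (λ d → adjC d c) (e i)) (T⇒≡ (proj₁ t₂)))) λ w q →
        sound p (suc k) (ext ν k w) (ext f k c) ((i , k) ∷ es) (κ-ext e k (proj₂ q))
          (good-new {k} {ν} w {i} (ℕP.<ᵇ⇒< i k (proj₁ t₁)) (proj₁ q) ∷ All.map (λ {e} → good-ext {k} {ν} w {e}) g) (proj₂ t₂)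
      where
      t₁ = ∧-elim {i <ᵇ k} t
      t₂ = ∧-elim {adjC (f i) c} (proj₂ t₁)
    sound (tri a b c p) k ν f es e g t = sound p k ν f ((b , c) ∷ es) e ((proj₁ (proj₂ ab) , proj₁ (proj₂ ac) ,
        triangle (proj₂ (proj₂ ab)) (proj₂ (proj₂ ac)) (trans (cong₂ adjC (e b) (e c)) (T⇒≡ (proj₁ t₃)))) ∷ g) (proj₂ t₃)
      where
      t₁ = ∧-elim {hasE es a b} t
      t₂ = ∧-elim {hasE es a c} (proj₂ t₁)
      t₃ = ∧-elim {adjC (f b) (f c)} (proj₂ t₂)
      ab = hasE-sound es a b g (proj₁ t₁)
      ac = hasE-sound es a c g (proj₁ t₂)
    sound (uni a b s c p) k ν f es e g t = sound p k ν f ((s , c) ∷ es) e ((proj₁ (proj₂ as) , proj₁ (proj₂ bc) ,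
        subst (_~ ν c) (uniq (proj₂ (proj₂ ab)) (proj₂ (proj₂ as)) (trans (e b) (trans (==C⇒≡ (f b) (f s) (proj₁ t₃)) (sym (e s))))) (proj₂ (proj₂ bc))) ∷ g) (proj₂ t₄)
      where
      t₁ = ∧-elim {hasE es a b} t
      t₂ = ∧-elim {hasE es a s} (proj₂ t₁)
      t₃ = ∧-elim {f b ==C f s} (proj₂ t₂)
      t₄ = ∧-elim {hasE es b c} (proj₂ t₃)
      ab = hasE-sound es a b g (proj₁ t₁)
      as = hasE-sound es a s g (proj₁ t₂)
      bc = hasE-sound es b c g (proj₁ t₄)
    sound (contra i j p q r) k ν f es e g t = no-third (apart-sound (e i) (e j) (proj₁ t₁)) (ed i p (proj₁ tp)) (ed j p (proj₂ tp))
        (ed i q (proj₁ tq)) (ed j q (proj₂ tq)) (ed i r (proj₁ tr)) (ed j r (proj₂ tr)) (ne p q (proj₁ t₅)) (ne p r (proj₁ t₆)) (ne q r (proj₂ t₆))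
      where
      t₁ = ∧-elim {apartC (f i) (f j)} t
      t₂ = ∧-elim {hasE es i p ∧ hasE es j p} (proj₂ t₁)
      t₃ = ∧-elim {hasE es i q ∧ hasE es j q} (proj₂ t₂)
      t₄ = ∧-elim {hasE es i r ∧ hasE es j r} (proj₂ t₃)
      t₅ = ∧-elim {not (f p ==C f q)} (proj₂ t₄)
      t₆ = ∧-elim {not (f p ==C f r)} (proj₂ t₅)
      tp = ∧-elim {hasE es i p} (proj₁ t₂)
      tq = ∧-elim {hasE es i q} (proj₁ t₃)
      tr = ∧-elim {hasE es i r} (proj₁ t₄)
      ed : ∀ i j → T (hasE es i j) → ν i ~ ν j
      ed i j s = proj₂ (proj₂ (hasE-sound es i j g s))
      ne : ∀ i j → T (not (f i ==C f j)) → ν i ≢ ν j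
      ne i j s q = ≢-of {f i} {f j} s (trans (sym (e i)) (trans (cong κ q) (e j)))
    sound (split a b i alts) k ν f es e g t = unpack (second apart (~-sym ia) (~-sym ib)) λ w q → other w (proj₁ q) (proj₁ (proj₂ q)) (proj₂ (proj₂ q))
      where
      t₁ = ∧-elim {hasE es i a} t
      t₂ = ∧-elim {hasE es i b} (proj₂ t₁)
      t₃ = ∧-elim {apartC (f a) (f b)} (proj₂ t₂)
      gia = hasE-sound es i a g (proj₁ t₁)
      gib = hasE-sound es i b g (proj₁ t₂)
      ia = proj₂ (proj₂ gia)
      ib = proj₂ (proj₂ gib)
      apart = apart-sound (e a) (e b) (proj₁ t₃)
      alts? : Code → Bool
      alts? c = checkAlts cs k f es a b c alts
      branch : Code → Code → Code → Code → Bool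
      branch ci ca cb c = (c ==C ci) ∨ ((not (adjC ci c) ∧ (thirdᵇ (among (among cs ca) ci) c cb ∨ thirdᵇ (among (among cs cb) ci) c ca)) ∨ alts? c)
      other : ∀ w → ν a ~ w → ν b ~ w → ν i ≢ w → ⊥
      other w aw bw ne = cases (κ (ν i)) (κ (ν a)) (κ (ν b)) refl refl refl (All.lookup (all⁺ (branch (f i) (f a) (f b)) (among (among cs (f a)) (f b)) (proj₂ t₃))
          (among-intro (among cs (f a)) (f b) (κ w) (among-intro cs (f a) (κ w) (cs-all (κ w)) (trans (cong (λ c → adjC c (κ w)) (sym (e a))) (κ-adj aw))) (trans (cong (λ c → adjC c (κ w)) (sym (e b))) (κ-adj bw))))
        where
        -- Two neighbours of the same vertex over the same code coincide, but `w` was chosen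
        -- different from the known common neighbour.
        i≢w : κ (ν i) ≢ κ w
        i≢w q = ne (uniq (~-sym ia) aw q)
        cases : ∀ ci ca cb → κ (ν i) ≡ ci → κ (ν a) ≡ ca → κ (ν b) ≡ cb → T (branch (f i) (f a) (f b) (κ w)) → ⊥
        cases .(κ (ν i)) .(κ (ν a)) .(κ (ν b)) refl refl refl s =
          [ (λ r → i≢w (sym (==C⇒≡ (κ w) (κ (ν i)) r)))
          , (λ r → [ (λ r → [ third ia ib aw bw (proj₁ apart) (proj₂ apart) (not-T (proj₁ (∧-elim {not (adjC (κ (ν i)) (κ w))} r))) i≢w
                            , third ib ia bw aw (proj₁ apart′) (proj₂ apart′) (not-T (proj₁ (∧-elim {not (adjC (κ (ν i)) (κ w))} r))) i≢w ]′
                            (Equivalence.to (T-∨ {thirdᵇ (among (among cs (κ (ν a))) (κ (ν i))) (κ w) (κ (ν b))}) (proj₂ (∧-elim {not (adjC (κ (ν i)) (κ w))} r))))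
                     , sound-alts alts k ν f es e g (proj₁ (proj₂ gia)) (proj₁ (proj₂ gib)) aw bw ]′
                     (Equivalence.to (T-∨ {not (adjC (κ (ν i)) (κ w)) ∧ (thirdᵇ (among (among cs (κ (ν a))) (κ (ν i))) (κ w) (κ (ν b)) ∨ thirdᵇ (among (among cs (κ (ν b))) (κ (ν i))) (κ w) (κ (ν a)))}) r)) ]′
          (Equivalence.to (T-∨ {κ w ==C κ (ν i)}) s′)
          where
          s′ : T (branch (κ (ν i)) (κ (ν a)) (κ (ν b)) (κ w))
          s′ = subst T (sym (trans (cong (λ c → branch c (κ (ν a)) (κ (ν b)) (κ w)) (e i)) (trans (cong (λ c → branch (f i) c (κ (ν b)) (κ w)) (e a)) (cong (λ c → branch (f i) (f a) c (κ w)) (e b))))) s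
          apart′ : adjC (κ (ν b)) (κ (ν a)) ≡ false × κ (ν b) ≢ κ (ν a)
          apart′ = back (adjC (κ (ν b)) (κ (ν a))) refl , λ q → proj₂ apart (sym q)
            where
            back : ∀ t → adjC (κ (ν b)) (κ (ν a)) ≡ t → t ≡ false
            back false _ = refl
            -- Symmetry of adjacency is borrowed from the cover: an edge over the two codes is
            -- lifted and reversed.
            back true q = unpack (raise (ν b) (κ (ν a)) q) λ v r → contradiction (trans (sym (proj₁ apart)) (trans (cong (λ c → adjC c (κ (ν b))) (sym (proj₂ r))) (κ-adj (~-sym (proj₁ r))))) (λ ())
    sound-alts (alt d p alts) k ν f es e g {a} {b} {w} a<k b<k aw bw t = go (κ w ==C d) refl t
      where
      go : ∀ v → (κ w ==C d) ≡ v → T (if v then check cs (suc k) (ext f k d) ((a , k) ∷ (b , k) ∷ es) p else checkAlts cs k f es a b (κ w) alts) → ⊥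
      go true q s = sound p (suc k) (ext ν k w) (ext f k d) ((a , k) ∷ (b , k) ∷ es) (κ-ext e k (==C⇒≡ (κ w) d (≡⇒T q)))
        (good-new {k} {ν} w {a} a<k aw ∷ good-new {k} {ν} w {b} b<k bw ∷ All.map (λ {e} → good-ext {k} {ν} w {e}) g) s
      go false _ s = sound-alts alts k ν f es e g a<k b<k aw bw s

  codes : List Code
  codes = ∞ ∷ map vt fs ++ map sl fs ++ cartesianProductWith pt fs fs ++ cartesianProductWith ln fs fs ++ cartesianProductWith (λ x f → f x) fs (cartesianProductWith (λ y m x → fl x y m) fs fs)
    where
    fs : List (Fin 4)
    fs = 0F ∷ 1F ∷ 2F ∷ 3F ∷ []

  private
    codesᵇ : T (allC λ c → any (_==C c) codes)
    codesᵇ = tt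

  ∈-codes : ∀ c → c ∈ codes
  ∈-codes c = Any.map (λ {d} t → sym (==C⇒≡ d c t)) (any⁻ (_==C c) codes (allC-sound (λ c → any (_==C c) codes) codesᵇ c))

-- The case distinction for c₂ = 2, starting from a triangle.

module Certificate where
  open PencilNames using (0F; 1F; 2F; 3F)
  open Flags
  open Refutations
  open import Data.Bool using (T)
  open import Data.Nat using (ℕ; _+_)
  open import Data.List using (List; []; _∷_)
  open import Data.Product using (_×_; _,_)
  open import Data.Unit using (tt)
  open import Function using (_$_)

  -- Vertices 0, 1, 2 lie over (P∞, L∞), (Af 0 0, V 0) and (S 0, N 0 0). The edge from 0 to 1 lies
  -- over the K₄,₄ of the flags (P∞, l) with l ≠ V 0 and (p, V 0) with p ≠ P∞. The neighbours of 1
  -- over the first side are 0 and the lifts numbered 3, 5, 7 plus `o`. Any two of these have a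
  -- second common neighbour, necessarily over `pt 0F y` with y ≠ 0: a colour of the pair. Pairs
  -- sharing a vertex have different colours, for otherwise 1 and another vertex would have three
  -- common neighbours. The six arguments continue the six proper colourings of K₄; nine vertices
  -- are added, numbered from 3 plus `o`.
  K₁ : ℕ → (k₁ k₂ k₃ k₄ k₅ k₆ : Proof) → Proof
  K₁ o k₁ k₂ k₃ k₄ k₅ k₆ =
    lift 1 (vt 1F) $ split 0 (3 + o) 1 (alt (pt 0F 1F) (lift 1 (vt 2F) $ split 0 (5 + o) 1 (alt (pt 0F 1F) (uni 0 (6 + o) (4 + o) (5 + o) $ contra (4 +
      o) 1 0 (3 + o) (5 + o)) $ alt (pt 0F 2F) (lift 1 (vt 3F) $ split 0 (7 + o) 1 (alt (pt 0F 1F) (uni 0 (8 + o) (4 + o) (7 + o) $ contra (4 + o) 1 0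
      (3 + o) (7 + o)) $ alt (pt 0F 2F) (uni 0 (8 + o) (6 + o) (7 + o) $ contra (6 + o) 1 0 (5 + o) (7 + o)) $ alt (pt 0F 3F) (split (3 + o) (5 + o) 1
      (alt (pt 0F 1F) (uni (3 + o) (9 + o) (4 + o) (5 + o) $ contra (4 + o) 1 0 (3 + o) (5 + o)) $ alt (pt 0F 2F) (uni (5 + o) (6 + o) (9 + o) 0 $
      contra (3 + o) 0 1 (4 + o) (9 + o)) $ alt (pt 0F 3F) (split (3 + o) (7 + o) 1 (alt (pt 0F 1F) (uni (3 + o) (10 + o) (4 + o) (7 + o) $ contra (4 +
      o) 1 0 (3 + o) (7 + o)) $ alt (pt 0F 2F) (split (5 + o) (7 + o) 1 (alt (pt 0F 1F) (k₁) $ alt (pt 0F 2F) (uni (5 + o) (11 + o) (6 + o) (7 + o) $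
      uni (7 + o) (6 + o) (10 + o) 0 $ contra (3 + o) 0 1 (4 + o) (10 + o)) $ alt (pt 0F 3F) (uni (5 + o) (11 + o) (9 + o) (7 + o) $ uni (7 + o) (8 + o)
      (9 + o) 0 $ contra (3 + o) 0 1 (4 + o) (9 + o)) $ done)) $ alt (pt 0F 3F) (uni (3 + o) (10 + o) (9 + o) (7 + o) $ uni (7 + o) (8 + o) (9 + o) 0 $
      contra (3 + o) 0 1 (4 + o) (9 + o)) $ done)) $ done)) $ done)) $ alt (pt 0F 3F) (lift 1 (vt 3F) $ split 0 (7 + o) 1 (alt (pt 0F 1F) (uni 0 (8 + o)
      (4 + o) (7 + o) $ contra (4 + o) 1 0 (3 + o) (7 + o)) $ alt (pt 0F 2F) (split (3 + o) (5 + o) 1 (alt (pt 0F 1F) (uni (3 + o) (9 + o) (4 + o) (5 +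
      o) $ contra (4 + o) 1 0 (3 + o) (5 + o)) $ alt (pt 0F 2F) (split (3 + o) (7 + o) 1 (alt (pt 0F 1F) (uni (3 + o) (10 + o) (4 + o) (7 + o) $ contra
      (4 + o) 1 0 (3 + o) (7 + o)) $ alt (pt 0F 2F) (uni (3 + o) (10 + o) (9 + o) (7 + o) $ uni (7 + o) (8 + o) (9 + o) 0 $ contra (3 + o) 0 1 (4 + o)
      (9 + o)) $ alt (pt 0F 3F) (split (5 + o) (7 + o) 1 (alt (pt 0F 1F) (k₂) $ alt (pt 0F 2F) (uni (5 + o) (11 + o) (9 + o) (7 + o) $ uni (7 + o) (8 +
      o) (9 + o) 0 $ contra (3 + o) 0 1 (4 + o) (9 + o)) $ alt (pt 0F 3F) (uni (5 + o) (11 + o) (6 + o) (7 + o) $ uni (7 + o) (6 + o) (10 + o) 0 $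
      contra (3 + o) 0 1 (4 + o) (10 + o)) $ done)) $ done)) $ alt (pt 0F 3F) (uni (5 + o) (6 + o) (9 + o) 0 $ contra (3 + o) 0 1 (4 + o) (9 + o)) $
      done)) $ alt (pt 0F 3F) (uni 0 (8 + o) (6 + o) (7 + o) $ contra (6 + o) 1 0 (5 + o) (7 + o)) $ done)) $ done)) $ alt (pt 0F 2F) (lift 1 (vt 2F) $
      split 0 (5 + o) 1 (alt (pt 0F 1F) (lift 1 (vt 3F) $ split 0 (7 + o) 1 (alt (pt 0F 1F) (uni 0 (8 + o) (6 + o) (7 + o) $ contra (6 + o) 1 0 (5 + o)
      (7 + o)) $ alt (pt 0F 2F) (uni 0 (8 + o) (4 + o) (7 + o) $ contra (4 + o) 1 0 (3 + o) (7 + o)) $ alt (pt 0F 3F) (split (3 + o) (5 + o) 1 (alt (pt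
      0F 1F) (uni (5 + o) (6 + o) (9 + o) 0 $ contra (3 + o) 0 1 (4 + o) (9 + o)) $ alt (pt 0F 2F) (uni (3 + o) (9 + o) (4 + o) (5 + o) $ contra (4 + o)
      1 0 (3 + o) (5 + o)) $ alt (pt 0F 3F) (split (3 + o) (7 + o) 1 (alt (pt 0F 1F) (split (5 + o) (7 + o) 1 (alt (pt 0F 1F) (uni (5 + o) (11 + o) (6 +
      o) (7 + o) $ uni (7 + o) (6 + o) (10 + o) 0 $ contra (3 + o) 0 1 (4 + o) (10 + o)) $ alt (pt 0F 2F) (k₃) $ alt (pt 0F 3F) (uni (5 + o) (11 + o) (9
      + o) (7 + o) $ uni (7 + o) (8 + o) (9 + o) 0 $ contra (3 + o) 0 1 (4 + o) (9 + o)) $ done)) $ alt (pt 0F 2F) (uni (3 + o) (10 + o) (4 + o) (7 + o)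
      $ contra (4 + o) 1 0 (3 + o) (7 + o)) $ alt (pt 0F 3F) (uni (3 + o) (10 + o) (9 + o) (7 + o) $ uni (7 + o) (8 + o) (9 + o) 0 $ contra (3 + o) 0 1
      (4 + o) (9 + o)) $ done)) $ done)) $ done)) $ alt (pt 0F 2F) (uni 0 (6 + o) (4 + o) (5 + o) $ contra (4 + o) 1 0 (3 + o) (5 + o)) $ alt (pt 0F 3F)
      (lift 1 (vt 3F) $ split 0 (7 + o) 1 (alt (pt 0F 1F) (split (3 + o) (5 + o) 1 (alt (pt 0F 1F) (split (3 + o) (7 + o) 1 (alt (pt 0F 1F) (uni (3 + o)
      (10 + o) (9 + o) (7 + o) $ uni (7 + o) (8 + o) (9 + o) 0 $ contra (3 + o) 0 1 (4 + o) (9 + o)) $ alt (pt 0F 2F) (uni (3 + o) (10 + o) (4 + o) (7 +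
      o) $ contra (4 + o) 1 0 (3 + o) (7 + o)) $ alt (pt 0F 3F) (split (5 + o) (7 + o) 1 (alt (pt 0F 1F) (uni (5 + o) (11 + o) (9 + o) (7 + o) $ uni (7
      + o) (8 + o) (9 + o) 0 $ contra (3 + o) 0 1 (4 + o) (9 + o)) $ alt (pt 0F 2F) (k₄) $ alt (pt 0F 3F) (uni (5 + o) (11 + o) (6 + o) (7 + o) $ uni (7
      + o) (6 + o) (10 + o) 0 $ contra (3 + o) 0 1 (4 + o) (10 + o)) $ done)) $ done)) $ alt (pt 0F 2F) (uni (3 + o) (9 + o) (4 + o) (5 + o) $ contra (4
      + o) 1 0 (3 + o) (5 + o)) $ alt (pt 0F 3F) (uni (5 + o) (6 + o) (9 + o) 0 $ contra (3 + o) 0 1 (4 + o) (9 + o)) $ done)) $ alt (pt 0F 2F) (uni 0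
      (8 + o) (4 + o) (7 + o) $ contra (4 + o) 1 0 (3 + o) (7 + o)) $ alt (pt 0F 3F) (uni 0 (8 + o) (6 + o) (7 + o) $ contra (6 + o) 1 0 (5 + o) (7 +
      o)) $ done)) $ done)) $ alt (pt 0F 3F) (lift 1 (vt 2F) $ split 0 (5 + o) 1 (alt (pt 0F 1F) (lift 1 (vt 3F) $ split 0 (7 + o) 1 (alt (pt 0F 1F)
      (uni 0 (8 + o) (6 + o) (7 + o) $ contra (6 + o) 1 0 (5 + o) (7 + o)) $ alt (pt 0F 2F) (split (3 + o) (5 + o) 1 (alt (pt 0F 1F) (uni (5 + o) (6 +
      o) (9 + o) 0 $ contra (3 + o) 0 1 (4 + o) (9 + o)) $ alt (pt 0F 2F) (split (3 + o) (7 + o) 1 (alt (pt 0F 1F) (split (5 + o) (7 + o) 1 (alt (pt 0F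
      1F) (uni (5 + o) (11 + o) (6 + o) (7 + o) $ uni (7 + o) (6 + o) (10 + o) 0 $ contra (3 + o) 0 1 (4 + o) (10 + o)) $ alt (pt 0F 2F) (uni (5 + o)
      (11 + o) (9 + o) (7 + o) $ uni (7 + o) (8 + o) (9 + o) 0 $ contra (3 + o) 0 1 (4 + o) (9 + o)) $ alt (pt 0F 3F) (k₅) $ done)) $ alt (pt 0F 2F)
      (uni (3 + o) (10 + o) (9 + o) (7 + o) $ uni (7 + o) (8 + o) (9 + o) 0 $ contra (3 + o) 0 1 (4 + o) (9 + o)) $ alt (pt 0F 3F) (uni (3 + o) (10 + o)
      (4 + o) (7 + o) $ contra (4 + o) 1 0 (3 + o) (7 + o)) $ done)) $ alt (pt 0F 3F) (uni (3 + o) (9 + o) (4 + o) (5 + o) $ contra (4 + o) 1 0 (3 + o)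
      (5 + o)) $ done)) $ alt (pt 0F 3F) (uni 0 (8 + o) (4 + o) (7 + o) $ contra (4 + o) 1 0 (3 + o) (7 + o)) $ done)) $ alt (pt 0F 2F) (lift 1 (vt 3F)
      $ split 0 (7 + o) 1 (alt (pt 0F 1F) (split (3 + o) (5 + o) 1 (alt (pt 0F 1F) (split (3 + o) (7 + o) 1 (alt (pt 0F 1F) (uni (3 + o) (10 + o) (9 +
      o) (7 + o) $ uni (7 + o) (8 + o) (9 + o) 0 $ contra (3 + o) 0 1 (4 + o) (9 + o)) $ alt (pt 0F 2F) (split (5 + o) (7 + o) 1 (alt (pt 0F 1F) (uni (5
      + o) (11 + o) (9 + o) (7 + o) $ uni (7 + o) (8 + o) (9 + o) 0 $ contra (3 + o) 0 1 (4 + o) (9 + o)) $ alt (pt 0F 2F) (uni (5 + o) (11 + o) (6 + o)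
      (7 + o) $ uni (7 + o) (6 + o) (10 + o) 0 $ contra (3 + o) 0 1 (4 + o) (10 + o)) $ alt (pt 0F 3F) (k₆) $ done)) $ alt (pt 0F 3F) (uni (3 + o) (10 +
      o) (4 + o) (7 + o) $ contra (4 + o) 1 0 (3 + o) (7 + o)) $ done)) $ alt (pt 0F 2F) (uni (5 + o) (6 + o) (9 + o) 0 $ contra (3 + o) 0 1 (4 + o) (9
      + o)) $ alt (pt 0F 3F) (uni (3 + o) (9 + o) (4 + o) (5 + o) $ contra (4 + o) 1 0 (3 + o) (5 + o)) $ done)) $ alt (pt 0F 2F) (uni 0 (8 + o) (6 + o)
      (7 + o) $ contra (6 + o) 1 0 (5 + o) (7 + o)) $ alt (pt 0F 3F) (uni 0 (8 + o) (4 + o) (7 + o) $ contra (4 + o) 1 0 (3 + o) (7 + o)) $ done)) $ alt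
      (pt 0F 3F) (uni 0 (6 + o) (4 + o) (5 + o) $ contra (4 + o) 1 0 (3 + o) (5 + o)) $ done)) $ done)

  -- The analogue of `K₁` for the edge from 1 to 2 and the flag (Af 0 0, N 0 0): the coloured
  -- vertices are 2 and the neighbours of 1 over `fl x 0F 0F`, the colours are the flags
  -- `fl 0F 0F m`, with x, m ≠ 0.
  K₂ : ℕ → (k₁ k₂ k₃ k₄ k₅ k₆ : Proof) → Proof
  K₂ o k₁ k₂ k₃ k₄ k₅ k₆ =
    lift 1 (fl 1F 0F 0F) $ split 2 (3 + o) 1 (alt (fl 0F 0F 1F) (lift 1 (fl 3F 0F 0F) $ split 2 (5 + o) 1 (alt (fl 0F 0F 1F) (uni 2 (6 + o) (4 + o) (5 +
      o) $ contra (4 + o) 1 2 (3 + o) (5 + o)) $ alt (fl 0F 0F 3F) (lift 1 (fl 2F 0F 0F) $ split 2 (7 + o) 1 (alt (fl 0F 0F 1F) (uni 2 (8 + o) (4 + o)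
      (7 + o) $ contra (4 + o) 1 2 (3 + o) (7 + o)) $ alt (fl 0F 0F 3F) (uni 2 (8 + o) (6 + o) (7 + o) $ contra (6 + o) 1 2 (5 + o) (7 + o)) $ alt (fl
      0F 0F 2F) (split (3 + o) (5 + o) 1 (alt (fl 0F 0F 1F) (uni (3 + o) (9 + o) (4 + o) (5 + o) $ contra (4 + o) 1 2 (3 + o) (5 + o)) $ alt (fl 0F 0F
      3F) (uni (5 + o) (6 + o) (9 + o) 2 $ contra (3 + o) 2 1 (4 + o) (9 + o)) $ alt (fl 0F 0F 2F) (split (3 + o) (7 + o) 1 (alt (fl 0F 0F 1F) (uni (3 +
      o) (10 + o) (4 + o) (7 + o) $ contra (4 + o) 1 2 (3 + o) (7 + o)) $ alt (fl 0F 0F 3F) (split (5 + o) (7 + o) 1 (alt (fl 0F 0F 1F) (k₁) $ alt (fl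
      0F 0F 3F) (uni (5 + o) (11 + o) (6 + o) (7 + o) $ uni (7 + o) (6 + o) (10 + o) 2 $ contra (3 + o) 2 1 (4 + o) (10 + o)) $ alt (fl 0F 0F 2F) (uni
      (5 + o) (11 + o) (9 + o) (7 + o) $ uni (7 + o) (8 + o) (9 + o) 2 $ contra (3 + o) 2 1 (4 + o) (9 + o)) $ done)) $ alt (fl 0F 0F 2F) (uni (3 + o)
      (10 + o) (9 + o) (7 + o) $ uni (7 + o) (8 + o) (9 + o) 2 $ contra (3 + o) 2 1 (4 + o) (9 + o)) $ done)) $ done)) $ done)) $ alt (fl 0F 0F 2F)
      (lift 1 (fl 2F 0F 0F) $ split 2 (7 + o) 1 (alt (fl 0F 0F 1F) (uni 2 (8 + o) (4 + o) (7 + o) $ contra (4 + o) 1 2 (3 + o) (7 + o)) $ alt (fl 0F 0F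
      3F) (split (3 + o) (5 + o) 1 (alt (fl 0F 0F 1F) (uni (3 + o) (9 + o) (4 + o) (5 + o) $ contra (4 + o) 1 2 (3 + o) (5 + o)) $ alt (fl 0F 0F 3F)
      (split (3 + o) (7 + o) 1 (alt (fl 0F 0F 1F) (uni (3 + o) (10 + o) (4 + o) (7 + o) $ contra (4 + o) 1 2 (3 + o) (7 + o)) $ alt (fl 0F 0F 3F) (uni
      (3 + o) (10 + o) (9 + o) (7 + o) $ uni (7 + o) (8 + o) (9 + o) 2 $ contra (3 + o) 2 1 (4 + o) (9 + o)) $ alt (fl 0F 0F 2F) (split (5 + o) (7 + o)
      1 (alt (fl 0F 0F 1F) (k₂) $ alt (fl 0F 0F 3F) (uni (5 + o) (11 + o) (9 + o) (7 + o) $ uni (7 + o) (8 + o) (9 + o) 2 $ contra (3 + o) 2 1 (4 + o)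
      (9 + o)) $ alt (fl 0F 0F 2F) (uni (5 + o) (11 + o) (6 + o) (7 + o) $ uni (7 + o) (6 + o) (10 + o) 2 $ contra (3 + o) 2 1 (4 + o) (10 + o)) $
      done)) $ done)) $ alt (fl 0F 0F 2F) (uni (5 + o) (6 + o) (9 + o) 2 $ contra (3 + o) 2 1 (4 + o) (9 + o)) $ done)) $ alt (fl 0F 0F 2F) (uni 2 (8 +
      o) (6 + o) (7 + o) $ contra (6 + o) 1 2 (5 + o) (7 + o)) $ done)) $ done)) $ alt (fl 0F 0F 3F) (lift 1 (fl 3F 0F 0F) $ split 2 (5 + o) 1 (alt (fl
      0F 0F 1F) (lift 1 (fl 2F 0F 0F) $ split 2 (7 + o) 1 (alt (fl 0F 0F 1F) (uni 2 (8 + o) (6 + o) (7 + o) $ contra (6 + o) 1 2 (5 + o) (7 + o)) $ alt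
      (fl 0F 0F 3F) (uni 2 (8 + o) (4 + o) (7 + o) $ contra (4 + o) 1 2 (3 + o) (7 + o)) $ alt (fl 0F 0F 2F) (split (3 + o) (5 + o) 1 (alt (fl 0F 0F 1F)
      (uni (5 + o) (6 + o) (9 + o) 2 $ contra (3 + o) 2 1 (4 + o) (9 + o)) $ alt (fl 0F 0F 3F) (uni (3 + o) (9 + o) (4 + o) (5 + o) $ contra (4 + o) 1 2
      (3 + o) (5 + o)) $ alt (fl 0F 0F 2F) (split (3 + o) (7 + o) 1 (alt (fl 0F 0F 1F) (split (5 + o) (7 + o) 1 (alt (fl 0F 0F 1F) (uni (5 + o) (11 + o)
      (6 + o) (7 + o) $ uni (7 + o) (6 + o) (10 + o) 2 $ contra (3 + o) 2 1 (4 + o) (10 + o)) $ alt (fl 0F 0F 3F) (k₃) $ alt (fl 0F 0F 2F) (uni (5 + o)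
      (11 + o) (9 + o) (7 + o) $ uni (7 + o) (8 + o) (9 + o) 2 $ contra (3 + o) 2 1 (4 + o) (9 + o)) $ done)) $ alt (fl 0F 0F 3F) (uni (3 + o) (10 + o)
      (4 + o) (7 + o) $ contra (4 + o) 1 2 (3 + o) (7 + o)) $ alt (fl 0F 0F 2F) (uni (3 + o) (10 + o) (9 + o) (7 + o) $ uni (7 + o) (8 + o) (9 + o) 2 $
      contra (3 + o) 2 1 (4 + o) (9 + o)) $ done)) $ done)) $ done)) $ alt (fl 0F 0F 3F) (uni 2 (6 + o) (4 + o) (5 + o) $ contra (4 + o) 1 2 (3 + o) (5
      + o)) $ alt (fl 0F 0F 2F) (lift 1 (fl 2F 0F 0F) $ split 2 (7 + o) 1 (alt (fl 0F 0F 1F) (split (3 + o) (5 + o) 1 (alt (fl 0F 0F 1F) (split (3 + o)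
      (7 + o) 1 (alt (fl 0F 0F 1F) (uni (3 + o) (10 + o) (9 + o) (7 + o) $ uni (7 + o) (8 + o) (9 + o) 2 $ contra (3 + o) 2 1 (4 + o) (9 + o)) $ alt (fl
      0F 0F 3F) (uni (3 + o) (10 + o) (4 + o) (7 + o) $ contra (4 + o) 1 2 (3 + o) (7 + o)) $ alt (fl 0F 0F 2F) (split (5 + o) (7 + o) 1 (alt (fl 0F 0F
      1F) (uni (5 + o) (11 + o) (9 + o) (7 + o) $ uni (7 + o) (8 + o) (9 + o) 2 $ contra (3 + o) 2 1 (4 + o) (9 + o)) $ alt (fl 0F 0F 3F) (k₄) $ alt (fl
      0F 0F 2F) (uni (5 + o) (11 + o) (6 + o) (7 + o) $ uni (7 + o) (6 + o) (10 + o) 2 $ contra (3 + o) 2 1 (4 + o) (10 + o)) $ done)) $ done)) $ alt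
      (fl 0F 0F 3F) (uni (3 + o) (9 + o) (4 + o) (5 + o) $ contra (4 + o) 1 2 (3 + o) (5 + o)) $ alt (fl 0F 0F 2F) (uni (5 + o) (6 + o) (9 + o) 2 $
      contra (3 + o) 2 1 (4 + o) (9 + o)) $ done)) $ alt (fl 0F 0F 3F) (uni 2 (8 + o) (4 + o) (7 + o) $ contra (4 + o) 1 2 (3 + o) (7 + o)) $ alt (fl 0F
      0F 2F) (uni 2 (8 + o) (6 + o) (7 + o) $ contra (6 + o) 1 2 (5 + o) (7 + o)) $ done)) $ done)) $ alt (fl 0F 0F 2F) (lift 1 (fl 3F 0F 0F) $ split 2
      (5 + o) 1 (alt (fl 0F 0F 1F) (lift 1 (fl 2F 0F 0F) $ split 2 (7 + o) 1 (alt (fl 0F 0F 1F) (uni 2 (8 + o) (6 + o) (7 + o) $ contra (6 + o) 1 2 (5 +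
      o) (7 + o)) $ alt (fl 0F 0F 3F) (split (3 + o) (5 + o) 1 (alt (fl 0F 0F 1F) (uni (5 + o) (6 + o) (9 + o) 2 $ contra (3 + o) 2 1 (4 + o) (9 + o)) $
      alt (fl 0F 0F 3F) (split (3 + o) (7 + o) 1 (alt (fl 0F 0F 1F) (split (5 + o) (7 + o) 1 (alt (fl 0F 0F 1F) (uni (5 + o) (11 + o) (6 + o) (7 + o) $
      uni (7 + o) (6 + o) (10 + o) 2 $ contra (3 + o) 2 1 (4 + o) (10 + o)) $ alt (fl 0F 0F 3F) (uni (5 + o) (11 + o) (9 + o) (7 + o) $ uni (7 + o) (8 +
      o) (9 + o) 2 $ contra (3 + o) 2 1 (4 + o) (9 + o)) $ alt (fl 0F 0F 2F) (k₅) $ done)) $ alt (fl 0F 0F 3F) (uni (3 + o) (10 + o) (9 + o) (7 + o) $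
      uni (7 + o) (8 + o) (9 + o) 2 $ contra (3 + o) 2 1 (4 + o) (9 + o)) $ alt (fl 0F 0F 2F) (uni (3 + o) (10 + o) (4 + o) (7 + o) $ contra (4 + o) 1 2
      (3 + o) (7 + o)) $ done)) $ alt (fl 0F 0F 2F) (uni (3 + o) (9 + o) (4 + o) (5 + o) $ contra (4 + o) 1 2 (3 + o) (5 + o)) $ done)) $ alt (fl 0F 0F
      2F) (uni 2 (8 + o) (4 + o) (7 + o) $ contra (4 + o) 1 2 (3 + o) (7 + o)) $ done)) $ alt (fl 0F 0F 3F) (lift 1 (fl 2F 0F 0F) $ split 2 (7 + o) 1
      (alt (fl 0F 0F 1F) (split (3 + o) (5 + o) 1 (alt (fl 0F 0F 1F) (split (3 + o) (7 + o) 1 (alt (fl 0F 0F 1F) (uni (3 + o) (10 + o) (9 + o) (7 + o) $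
      uni (7 + o) (8 + o) (9 + o) 2 $ contra (3 + o) 2 1 (4 + o) (9 + o)) $ alt (fl 0F 0F 3F) (split (5 + o) (7 + o) 1 (alt (fl 0F 0F 1F) (uni (5 + o)
      (11 + o) (9 + o) (7 + o) $ uni (7 + o) (8 + o) (9 + o) 2 $ contra (3 + o) 2 1 (4 + o) (9 + o)) $ alt (fl 0F 0F 3F) (uni (5 + o) (11 + o) (6 + o)
      (7 + o) $ uni (7 + o) (6 + o) (10 + o) 2 $ contra (3 + o) 2 1 (4 + o) (10 + o)) $ alt (fl 0F 0F 2F) (k₆) $ done)) $ alt (fl 0F 0F 2F) (uni (3 + o)
      (10 + o) (4 + o) (7 + o) $ contra (4 + o) 1 2 (3 + o) (7 + o)) $ done)) $ alt (fl 0F 0F 3F) (uni (5 + o) (6 + o) (9 + o) 2 $ contra (3 + o) 2 1 (4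
      + o) (9 + o)) $ alt (fl 0F 0F 2F) (uni (3 + o) (9 + o) (4 + o) (5 + o) $ contra (4 + o) 1 2 (3 + o) (5 + o)) $ done)) $ alt (fl 0F 0F 3F) (uni 2
      (8 + o) (6 + o) (7 + o) $ contra (6 + o) 1 2 (5 + o) (7 + o)) $ alt (fl 0F 0F 2F) (uni 2 (8 + o) (4 + o) (7 + o) $ contra (4 + o) 1 2 (3 + o) (7 +
      o)) $ done)) $ alt (fl 0F 0F 2F) (uni 2 (6 + o) (4 + o) (5 + o) $ contra (4 + o) 1 2 (3 + o) (5 + o)) $ done)) $ done)

  -- The analogue of `K₁` for the edge from 2 to 0 and the flag (S 0, L∞): the coloured vertices are
  -- 0 and the neighbours of 2 over `sl m`, the colours are the flags `ln 0F c`, with m, c ≠ 0.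
  K₃ : ℕ → (k₁ k₂ k₃ k₄ k₅ k₆ : Proof) → Proof
  K₃ o k₁ k₂ k₃ k₄ k₅ k₆ =
    lift 2 (sl 1F) $ split 0 (3 + o) 2 (alt (ln 0F 1F) (lift 2 (sl 2F) $ split 0 (5 + o) 2 (alt (ln 0F 1F) (uni 0 (6 + o) (4 + o) (5 + o) $ contra (4 +
      o) 2 0 (3 + o) (5 + o)) $ alt (ln 0F 3F) (lift 2 (sl 3F) $ split 0 (7 + o) 2 (alt (ln 0F 1F) (uni 0 (8 + o) (4 + o) (7 + o) $ contra (4 + o) 2 0
      (3 + o) (7 + o)) $ alt (ln 0F 3F) (uni 0 (8 + o) (6 + o) (7 + o) $ contra (6 + o) 2 0 (5 + o) (7 + o)) $ alt (ln 0F 2F) (split (3 + o) (5 + o) 2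
      (alt (ln 0F 1F) (uni (3 + o) (9 + o) (4 + o) (5 + o) $ contra (4 + o) 2 0 (3 + o) (5 + o)) $ alt (ln 0F 3F) (uni (5 + o) (6 + o) (9 + o) 0 $
      contra (3 + o) 0 2 (4 + o) (9 + o)) $ alt (ln 0F 2F) (split (3 + o) (7 + o) 2 (alt (ln 0F 1F) (uni (3 + o) (10 + o) (4 + o) (7 + o) $ contra (4 +
      o) 2 0 (3 + o) (7 + o)) $ alt (ln 0F 3F) (split (5 + o) (7 + o) 2 (alt (ln 0F 1F) (k₁) $ alt (ln 0F 3F) (uni (5 + o) (11 + o) (6 + o) (7 + o) $
      uni (7 + o) (6 + o) (10 + o) 0 $ contra (3 + o) 0 2 (4 + o) (10 + o)) $ alt (ln 0F 2F) (uni (5 + o) (11 + o) (9 + o) (7 + o) $ uni (7 + o) (8 + o)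
      (9 + o) 0 $ contra (3 + o) 0 2 (4 + o) (9 + o)) $ done)) $ alt (ln 0F 2F) (uni (3 + o) (10 + o) (9 + o) (7 + o) $ uni (7 + o) (8 + o) (9 + o) 0 $
      contra (3 + o) 0 2 (4 + o) (9 + o)) $ done)) $ done)) $ done)) $ alt (ln 0F 2F) (lift 2 (sl 3F) $ split 0 (7 + o) 2 (alt (ln 0F 1F) (uni 0 (8 + o)
      (4 + o) (7 + o) $ contra (4 + o) 2 0 (3 + o) (7 + o)) $ alt (ln 0F 3F) (split (3 + o) (5 + o) 2 (alt (ln 0F 1F) (uni (3 + o) (9 + o) (4 + o) (5 +
      o) $ contra (4 + o) 2 0 (3 + o) (5 + o)) $ alt (ln 0F 3F) (split (3 + o) (7 + o) 2 (alt (ln 0F 1F) (uni (3 + o) (10 + o) (4 + o) (7 + o) $ contra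
      (4 + o) 2 0 (3 + o) (7 + o)) $ alt (ln 0F 3F) (uni (3 + o) (10 + o) (9 + o) (7 + o) $ uni (7 + o) (8 + o) (9 + o) 0 $ contra (3 + o) 0 2 (4 + o)
      (9 + o)) $ alt (ln 0F 2F) (split (5 + o) (7 + o) 2 (alt (ln 0F 1F) (k₂) $ alt (ln 0F 3F) (uni (5 + o) (11 + o) (9 + o) (7 + o) $ uni (7 + o) (8 +
      o) (9 + o) 0 $ contra (3 + o) 0 2 (4 + o) (9 + o)) $ alt (ln 0F 2F) (uni (5 + o) (11 + o) (6 + o) (7 + o) $ uni (7 + o) (6 + o) (10 + o) 0 $
      contra (3 + o) 0 2 (4 + o) (10 + o)) $ done)) $ done)) $ alt (ln 0F 2F) (uni (5 + o) (6 + o) (9 + o) 0 $ contra (3 + o) 0 2 (4 + o) (9 + o)) $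
      done)) $ alt (ln 0F 2F) (uni 0 (8 + o) (6 + o) (7 + o) $ contra (6 + o) 2 0 (5 + o) (7 + o)) $ done)) $ done)) $ alt (ln 0F 3F) (lift 2 (sl 2F) $
      split 0 (5 + o) 2 (alt (ln 0F 1F) (lift 2 (sl 3F) $ split 0 (7 + o) 2 (alt (ln 0F 1F) (uni 0 (8 + o) (6 + o) (7 + o) $ contra (6 + o) 2 0 (5 + o)
      (7 + o)) $ alt (ln 0F 3F) (uni 0 (8 + o) (4 + o) (7 + o) $ contra (4 + o) 2 0 (3 + o) (7 + o)) $ alt (ln 0F 2F) (split (3 + o) (5 + o) 2 (alt (ln
      0F 1F) (uni (5 + o) (6 + o) (9 + o) 0 $ contra (3 + o) 0 2 (4 + o) (9 + o)) $ alt (ln 0F 3F) (uni (3 + o) (9 + o) (4 + o) (5 + o) $ contra (4 + o)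
      2 0 (3 + o) (5 + o)) $ alt (ln 0F 2F) (split (3 + o) (7 + o) 2 (alt (ln 0F 1F) (split (5 + o) (7 + o) 2 (alt (ln 0F 1F) (uni (5 + o) (11 + o) (6 +
      o) (7 + o) $ uni (7 + o) (6 + o) (10 + o) 0 $ contra (3 + o) 0 2 (4 + o) (10 + o)) $ alt (ln 0F 3F) (k₃) $ alt (ln 0F 2F) (uni (5 + o) (11 + o) (9
      + o) (7 + o) $ uni (7 + o) (8 + o) (9 + o) 0 $ contra (3 + o) 0 2 (4 + o) (9 + o)) $ done)) $ alt (ln 0F 3F) (uni (3 + o) (10 + o) (4 + o) (7 + o)
      $ contra (4 + o) 2 0 (3 + o) (7 + o)) $ alt (ln 0F 2F) (uni (3 + o) (10 + o) (9 + o) (7 + o) $ uni (7 + o) (8 + o) (9 + o) 0 $ contra (3 + o) 0 2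
      (4 + o) (9 + o)) $ done)) $ done)) $ done)) $ alt (ln 0F 3F) (uni 0 (6 + o) (4 + o) (5 + o) $ contra (4 + o) 2 0 (3 + o) (5 + o)) $ alt (ln 0F 2F)
      (lift 2 (sl 3F) $ split 0 (7 + o) 2 (alt (ln 0F 1F) (split (3 + o) (5 + o) 2 (alt (ln 0F 1F) (split (3 + o) (7 + o) 2 (alt (ln 0F 1F) (uni (3 + o)
      (10 + o) (9 + o) (7 + o) $ uni (7 + o) (8 + o) (9 + o) 0 $ contra (3 + o) 0 2 (4 + o) (9 + o)) $ alt (ln 0F 3F) (uni (3 + o) (10 + o) (4 + o) (7 +
      o) $ contra (4 + o) 2 0 (3 + o) (7 + o)) $ alt (ln 0F 2F) (split (5 + o) (7 + o) 2 (alt (ln 0F 1F) (uni (5 + o) (11 + o) (9 + o) (7 + o) $ uni (7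
      + o) (8 + o) (9 + o) 0 $ contra (3 + o) 0 2 (4 + o) (9 + o)) $ alt (ln 0F 3F) (k₄) $ alt (ln 0F 2F) (uni (5 + o) (11 + o) (6 + o) (7 + o) $ uni (7
      + o) (6 + o) (10 + o) 0 $ contra (3 + o) 0 2 (4 + o) (10 + o)) $ done)) $ done)) $ alt (ln 0F 3F) (uni (3 + o) (9 + o) (4 + o) (5 + o) $ contra (4
      + o) 2 0 (3 + o) (5 + o)) $ alt (ln 0F 2F) (uni (5 + o) (6 + o) (9 + o) 0 $ contra (3 + o) 0 2 (4 + o) (9 + o)) $ done)) $ alt (ln 0F 3F) (uni 0
      (8 + o) (4 + o) (7 + o) $ contra (4 + o) 2 0 (3 + o) (7 + o)) $ alt (ln 0F 2F) (uni 0 (8 + o) (6 + o) (7 + o) $ contra (6 + o) 2 0 (5 + o) (7 +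
      o)) $ done)) $ done)) $ alt (ln 0F 2F) (lift 2 (sl 2F) $ split 0 (5 + o) 2 (alt (ln 0F 1F) (lift 2 (sl 3F) $ split 0 (7 + o) 2 (alt (ln 0F 1F)
      (uni 0 (8 + o) (6 + o) (7 + o) $ contra (6 + o) 2 0 (5 + o) (7 + o)) $ alt (ln 0F 3F) (split (3 + o) (5 + o) 2 (alt (ln 0F 1F) (uni (5 + o) (6 +
      o) (9 + o) 0 $ contra (3 + o) 0 2 (4 + o) (9 + o)) $ alt (ln 0F 3F) (split (3 + o) (7 + o) 2 (alt (ln 0F 1F) (split (5 + o) (7 + o) 2 (alt (ln 0F
      1F) (uni (5 + o) (11 + o) (6 + o) (7 + o) $ uni (7 + o) (6 + o) (10 + o) 0 $ contra (3 + o) 0 2 (4 + o) (10 + o)) $ alt (ln 0F 3F) (uni (5 + o)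
      (11 + o) (9 + o) (7 + o) $ uni (7 + o) (8 + o) (9 + o) 0 $ contra (3 + o) 0 2 (4 + o) (9 + o)) $ alt (ln 0F 2F) (k₅) $ done)) $ alt (ln 0F 3F)
      (uni (3 + o) (10 + o) (9 + o) (7 + o) $ uni (7 + o) (8 + o) (9 + o) 0 $ contra (3 + o) 0 2 (4 + o) (9 + o)) $ alt (ln 0F 2F) (uni (3 + o) (10 + o)
      (4 + o) (7 + o) $ contra (4 + o) 2 0 (3 + o) (7 + o)) $ done)) $ alt (ln 0F 2F) (uni (3 + o) (9 + o) (4 + o) (5 + o) $ contra (4 + o) 2 0 (3 + o)
      (5 + o)) $ done)) $ alt (ln 0F 2F) (uni 0 (8 + o) (4 + o) (7 + o) $ contra (4 + o) 2 0 (3 + o) (7 + o)) $ done)) $ alt (ln 0F 3F) (lift 2 (sl 3F)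
      $ split 0 (7 + o) 2 (alt (ln 0F 1F) (split (3 + o) (5 + o) 2 (alt (ln 0F 1F) (split (3 + o) (7 + o) 2 (alt (ln 0F 1F) (uni (3 + o) (10 + o) (9 +
      o) (7 + o) $ uni (7 + o) (8 + o) (9 + o) 0 $ contra (3 + o) 0 2 (4 + o) (9 + o)) $ alt (ln 0F 3F) (split (5 + o) (7 + o) 2 (alt (ln 0F 1F) (uni (5
      + o) (11 + o) (9 + o) (7 + o) $ uni (7 + o) (8 + o) (9 + o) 0 $ contra (3 + o) 0 2 (4 + o) (9 + o)) $ alt (ln 0F 3F) (uni (5 + o) (11 + o) (6 + o)
      (7 + o) $ uni (7 + o) (6 + o) (10 + o) 0 $ contra (3 + o) 0 2 (4 + o) (10 + o)) $ alt (ln 0F 2F) (k₆) $ done)) $ alt (ln 0F 2F) (uni (3 + o) (10 +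
      o) (4 + o) (7 + o) $ contra (4 + o) 2 0 (3 + o) (7 + o)) $ done)) $ alt (ln 0F 3F) (uni (5 + o) (6 + o) (9 + o) 0 $ contra (3 + o) 0 2 (4 + o) (9
      + o)) $ alt (ln 0F 2F) (uni (3 + o) (9 + o) (4 + o) (5 + o) $ contra (4 + o) 2 0 (3 + o) (5 + o)) $ done)) $ alt (ln 0F 3F) (uni 0 (8 + o) (6 + o)
      (7 + o) $ contra (6 + o) 2 0 (5 + o) (7 + o)) $ alt (ln 0F 2F) (uni 0 (8 + o) (4 + o) (7 + o) $ contra (4 + o) 2 0 (3 + o) (7 + o)) $ done)) $ alt
      (ln 0F 2F) (uni 0 (6 + o) (4 + o) (5 + o) $ contra (4 + o) 2 0 (3 + o) (5 + o)) $ done)) $ done)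

  -- The offset 9 skips the vertices added by `K₁`. The colourings of `leaf₁`, `leaf₄` and `leaf₅`
  -- differ by cyclic permutations of the colours; each of them contradicts all six colourings of
  -- `K₂` after a single further `split`.
  leaf₁ : Proof
  leaf₁ = K₂ 9
    (split 0 14 1 (alt (ln 1F 3F) (tri 1 14 7 $ tri 0 21 8 $ tri 14 21 20 $ tri 21 8 20 $ contra 14 8 7 20 21) $ alt (ln 2F 1F) (lift 18 (fl 2F 3F 1F) $
      tri 1 12 3 $ tri 0 21 4 $ tri 14 21 18 $ tri 21 4 18 $ tri 18 22 12 $ tri 18 22 4 $ contra 12 4 3 18 22) $ alt (ln 3F 2F) (tri 14 21 15 $ tri 0 21
      6 $ tri 21 6 15 $ contra 15 0 2 21 6) $ done))
    (split 5 14 1 (alt (fl 2F 3F 3F) (lift 15 (fl 1F 2F 0F) $ tri 5 21 6 $ tri 14 21 15 $ tri 21 6 15 $ tri 15 22 6 $ tri 15 22 2 $ contra 6 2 0 15 22)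
      $ alt (fl 2F 1F 1F) (lift 18 (ln 3F 3F) $ tri 1 12 3 $ tri 5 21 9 $ tri 14 21 18 $ tri 21 9 18 $ tri 18 22 12 $ tri 18 22 9 $ contra 12 9 3 18 22)
      $ alt (fl 2F 2F 2F) (tri 1 14 7 $ tri 5 21 11 $ tri 14 21 20 $ tri 21 11 20 $ contra 14 11 7 20 21) $ done))
    (split 3 16 1 (alt (fl 1F 2F 3F) (lift 17 (fl 3F 1F 0F) $ tri 3 21 4 $ tri 16 21 17 $ tri 21 4 17 $ tri 17 22 4 $ tri 17 22 2 $ contra 4 2 0 17 22)
      $ alt (fl 1F 1F 2F) (tri 1 16 5 $ tri 3 21 9 $ tri 16 21 19 $ tri 21 9 19 $ contra 16 9 5 19 21) $ alt (fl 1F 3F 1F) (lift 20 (ln 3F 2F) $ tri 1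
      14 7 $ tri 3 21 10 $ tri 16 21 20 $ tri 21 10 20 $ tri 20 22 14 $ tri 20 22 10 $ contra 14 10 7 20 22) $ done))
    (split 0 12 1 (alt (ln 1F 1F) (tri 1 12 3 $ tri 0 21 4 $ tri 12 21 18 $ tri 21 4 18 $ contra 12 4 3 18 21) $ alt (ln 2F 2F) (lift 19 (fl 3F 1F 1F) $
      tri 1 16 5 $ tri 0 21 6 $ tri 12 21 19 $ tri 21 6 19 $ tri 19 22 16 $ tri 19 22 6 $ contra 16 6 5 19 22) $ alt (ln 3F 3F) (tri 12 21 13 $ tri 0 21
      8 $ tri 21 8 13 $ contra 13 0 2 21 8) $ done))
    (split 0 12 1 (alt (ln 1F 1F) (tri 1 12 3 $ tri 0 21 4 $ tri 12 21 19 $ tri 21 4 19 $ contra 12 4 3 19 21) $ alt (ln 2F 2F) (tri 12 21 13 $ tri 0 21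
      6 $ tri 21 6 13 $ contra 13 0 2 21 6) $ alt (ln 3F 3F) (lift 18 (fl 2F 1F 1F) $ tri 1 14 7 $ tri 0 21 8 $ tri 12 21 18 $ tri 21 8 18 $ tri 18 22
      14 $ tri 18 22 8 $ contra 14 8 7 18 22) $ done))
    (split 3 14 1 (alt (fl 1F 3F 2F) (lift 15 (fl 2F 1F 0F) $ tri 3 21 4 $ tri 14 21 15 $ tri 21 4 15 $ tri 15 22 4 $ tri 15 22 2 $ contra 4 2 0 15 22)
      $ alt (fl 1F 1F 3F) (tri 1 14 7 $ tri 3 21 10 $ tri 14 21 18 $ tri 21 10 18 $ contra 14 10 7 18 21) $ alt (fl 1F 2F 1F) (lift 20 (ln 2F 3F) $ tri
      1 16 5 $ tri 3 21 9 $ tri 14 21 20 $ tri 21 9 20 $ tri 20 22 16 $ tri 20 22 9 $ contra 16 9 5 20 22) $ done))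

  -- The colourings of `leaf₂`, `leaf₃` and `leaf₆` arise from that of `leaf₁` by transpositions of
  -- colours. In each case four colourings of `K₂` are refuted directly, and the other two only
  -- together with the colourings of the third edge; the offset 18 skips the vertices of `K₁` and
  -- `K₂`.
  leaf₂ : Proof
  leaf₂ = K₂ 9
    (split 3 14 1 (alt (fl 1F 3F 2F) (lift 15 (fl 2F 1F 0F) $ tri 3 21 4 $ tri 14 21 15 $ tri 21 4 15 $ tri 15 22 4 $ tri 15 22 2 $ contra 4 2 0 15 22)
      $ alt (fl 1F 1F 3F) (lift 20 (ln 1F 2F) $ tri 1 16 5 $ tri 3 21 9 $ tri 14 21 20 $ tri 21 9 20 $ tri 20 22 16 $ tri 20 22 9 $ contra 16 9 5 20 22)
      $ alt (fl 1F 2F 1F) (tri 1 14 7 $ tri 3 21 10 $ tri 14 21 18 $ tri 21 10 18 $ contra 14 10 7 18 21) $ done))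
    (split 0 14 1 (alt (ln 1F 3F) (lift 20 (fl 1F 1F 2F) $ tri 1 16 5 $ tri 0 21 6 $ tri 14 21 20 $ tri 21 6 20 $ tri 20 22 16 $ tri 20 22 6 $ contra 16
      6 5 20 22) $ alt (ln 2F 1F) (tri 14 21 15 $ tri 0 21 4 $ tri 21 4 15 $ contra 15 0 2 21 4) $ alt (ln 3F 2F) (tri 1 14 7 $ tri 0 21 8 $ tri 14 21
      18 $ tri 21 8 18 $ contra 14 8 7 18 21) $ done))
    (split 0 12 1 (alt (ln 1F 1F) (tri 1 12 3 $ tri 0 21 4 $ tri 12 21 19 $ tri 21 4 19 $ contra 12 4 3 19 21) $ alt (ln 2F 2F) (lift 18 (fl 2F 3F 3F) $
      tri 1 14 7 $ tri 0 21 8 $ tri 12 21 18 $ tri 21 8 18 $ tri 18 22 14 $ tri 18 22 8 $ contra 14 8 7 18 22) $ alt (ln 3F 3F) (tri 12 21 13 $ tri 0 21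
      6 $ tri 21 6 13 $ contra 13 0 2 21 6) $ done))
    (K₃ 18
      (split 1 21 2 (alt (fl 0F 1F 1F) (tri 21 30 22 $ tri 1 30 12 $ tri 30 12 22 $ contra 22 1 0 30 12) $ alt (fl 0F 2F 1F) (tri 2 21 17 $ tri 1 30 16
        $ tri 21 30 27 $ tri 30 16 27 $ contra 21 16 17 27 30) $ alt (fl 0F 3F 1F) (split 3 2 1 (alt (fl 1F 1F 0F) (tri 3 31 4 $ tri 2 31 17 $ tri 31 4
        17 $ contra 4 2 0 31 17) $ alt (fl 1F 2F 0F) (lift 11 (fl 2F 0F 3F) $ lift 9 (fl 2F 3F 3F) $ tri 3 31 9 $ tri 2 31 15 $ tri 31 9 15 $ tri 9 33
        15 $ tri 15 33 14 $ tri 1 30 14 $ tri 21 30 28 $ tri 30 14 28 $ tri 14 33 28 $ tri 28 33 25 $ tri 9 33 5 $ tri 33 25 5 $ tri 11 32 5 $ tri 5 32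
        25 $ tri 25 32 2 $ contra 5 2 1 25 32) $ alt (fl 1F 3F 0F) (tri 1 12 3 $ tri 2 31 13 $ tri 3 31 10 $ tri 31 10 13 $ contra 13 3 12 31 10) $
        done)) $ done))
      (split 1 21 2 (alt (fl 0F 1F 1F) (tri 21 30 22 $ tri 1 30 12 $ tri 30 12 22 $ contra 22 1 0 30 12) $ alt (fl 0F 2F 1F) (tri 2 21 17 $ tri 1 30 16
        $ tri 21 30 28 $ tri 30 16 28 $ contra 21 16 17 28 30) $ alt (fl 0F 3F 1F) (lift 20 (fl 1F 3F 2F) $ tri 2 23 15 $ tri 1 30 14 $ tri 21 30 27 $
        tri 30 14 27 $ tri 20 31 14 $ tri 14 31 27 $ tri 27 31 23 $ contra 23 14 15 27 31) $ done))
      (split 1 21 2 (alt (fl 0F 1F 1F) (lift 19 (fl 3F 1F 3F) $ tri 2 25 13 $ tri 1 30 12 $ tri 21 30 28 $ tri 30 12 28 $ tri 19 31 12 $ tri 12 31 28 $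
        tri 28 31 25 $ contra 25 12 13 28 31) $ alt (fl 0F 2F 1F) (tri 2 21 17 $ tri 1 30 16 $ tri 21 30 27 $ tri 30 16 27 $ contra 21 16 17 27 30) $
        alt (fl 0F 3F 1F) (tri 21 30 22 $ tri 1 30 14 $ tri 30 14 22 $ contra 22 1 0 30 14) $ done))
      (split 1 21 2 (alt (fl 0F 2F 1F) (tri 2 21 17 $ tri 1 30 16 $ tri 21 30 28 $ tri 30 16 28 $ contra 21 16 17 28 30) $ alt (fl 0F 3F 1F) (tri 21 30
        22 $ tri 1 30 14 $ tri 30 14 22 $ contra 22 1 0 30 14) $ alt (fl 0F 1F 1F) (split 5 2 1 (alt (fl 2F 1F 0F) (lift 21 (fl 3F 0F 1F) $ lift 5 (fl
        2F 3F 2F) $ lift 2 (fl 0F 3F 0F) $ lift 30 (ln 2F 1F) $ lift 31 (pt 3F 1F) $ tri 21 32 2 $ tri 2 32 34 $ tri 5 33 1 $ tri 2 34 1 $ tri 1 33 34 $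
        tri 30 35 21 $ tri 21 35 32 $ tri 1 33 30 $ tri 30 35 33 $ tri 2 32 31 $ tri 31 36 32 $ tri 31 36 5 $ tri 5 36 33 $ contra 32 33 34 35 36) $ alt
        (fl 2F 2F 0F) (tri 1 16 5 $ tri 2 31 17 $ tri 5 31 9 $ tri 31 9 17 $ contra 17 5 16 31 9) $ alt (fl 2F 3F 0F) (tri 5 31 6 $ tri 2 31 15 $ tri 31
        6 15 $ contra 6 2 0 31 15) $ done)) $ done))
      (split 1 21 2 (alt (fl 0F 1F 1F) (lift 19 (fl 3F 1F 3F) $ tri 2 25 13 $ tri 1 30 12 $ tri 21 30 28 $ tri 30 12 28 $ tri 19 31 12 $ tri 12 31 28 $
        tri 28 31 25 $ contra 25 12 13 28 31) $ alt (fl 0F 2F 1F) (tri 2 21 17 $ tri 1 30 16 $ tri 21 30 22 $ tri 30 16 22 $ contra 21 16 17 22 30) $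
        alt (fl 0F 3F 1F) (lift 20 (fl 1F 3F 2F) $ tri 2 23 15 $ tri 1 30 14 $ tri 21 30 27 $ tri 30 14 27 $ tri 20 31 14 $ tri 14 31 27 $ tri 27 31 23
        $ contra 23 14 15 27 31) $ done))
      (split 1 23 2 (alt (fl 0F 1F 2F) (tri 2 23 15 $ tri 1 30 14 $ tri 23 30 27 $ tri 30 14 27 $ contra 23 14 15 27 30) $ alt (fl 0F 2F 2F) (lift 18
        (fl 2F 2F 3F) $ tri 2 25 13 $ tri 1 30 12 $ tri 23 30 29 $ tri 30 12 29 $ tri 18 31 12 $ tri 12 31 29 $ tri 29 31 25 $ contra 25 12 13 29 31) $
        alt (fl 0F 3F 2F) (tri 23 30 24 $ tri 1 30 16 $ tri 30 16 24 $ contra 24 1 0 30 16) $ done)))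
    (K₃ 18
      (split 1 21 2 (alt (fl 0F 1F 1F) (tri 21 30 22 $ tri 1 30 12 $ tri 30 12 22 $ contra 22 1 0 30 12) $ alt (fl 0F 3F 1F) (tri 2 21 15 $ tri 1 30 14
        $ tri 21 30 28 $ tri 30 14 28 $ contra 21 14 15 28 30) $ alt (fl 0F 2F 1F) (split 3 2 1 (alt (fl 1F 1F 0F) (tri 3 31 4 $ tri 2 31 15 $ tri 31 4
        15 $ contra 4 2 0 31 15) $ alt (fl 1F 2F 0F) (tri 1 12 3 $ tri 2 31 13 $ tri 3 31 9 $ tri 31 9 13 $ contra 13 3 12 31 9) $ alt (fl 1F 3F 0F)
        (lift 11 (fl 3F 0F 2F) $ lift 10 (fl 3F 2F 2F) $ tri 3 31 10 $ tri 2 31 17 $ tri 31 10 17 $ tri 10 33 17 $ tri 17 33 16 $ tri 1 30 16 $ tri 21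
        30 27 $ tri 30 16 27 $ tri 16 33 27 $ tri 27 33 23 $ tri 10 33 7 $ tri 33 23 7 $ tri 11 32 7 $ tri 7 32 23 $ tri 23 32 2 $ contra 7 2 1 23 32) $
        done)) $ done))
      (split 1 21 2 (alt (fl 0F 1F 1F) (tri 21 30 22 $ tri 1 30 12 $ tri 30 12 22 $ contra 22 1 0 30 12) $ alt (fl 0F 2F 1F) (lift 20 (fl 1F 2F 3F) $
        tri 2 25 17 $ tri 1 30 16 $ tri 21 30 28 $ tri 30 16 28 $ tri 20 31 16 $ tri 16 31 28 $ tri 28 31 25 $ contra 25 16 17 28 31) $ alt (fl 0F 3F
        1F) (tri 2 21 15 $ tri 1 30 14 $ tri 21 30 27 $ tri 30 14 27 $ contra 21 14 15 27 30) $ done))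
      (split 1 23 2 (alt (fl 0F 1F 2F) (tri 23 30 24 $ tri 1 30 14 $ tri 30 14 24 $ contra 24 1 0 30 14) $ alt (fl 0F 2F 2F) (tri 2 23 13 $ tri 1 30 12
        $ tri 23 30 27 $ tri 30 12 27 $ contra 23 12 13 27 30) $ alt (fl 0F 3F 2F) (lift 19 (fl 3F 3F 3F) $ tri 2 25 17 $ tri 1 30 16 $ tri 23 30 29 $
        tri 30 16 29 $ tri 19 31 16 $ tri 16 31 29 $ tri 29 31 25 $ contra 25 16 17 29 31) $ done))
      (split 1 21 2 (alt (fl 0F 1F 1F) (lift 18 (fl 2F 1F 2F) $ tri 2 23 13 $ tri 1 30 12 $ tri 21 30 27 $ tri 30 12 27 $ tri 18 31 12 $ tri 12 31 27 $
        tri 27 31 23 $ contra 23 12 13 27 31) $ alt (fl 0F 2F 1F) (lift 20 (fl 1F 2F 3F) $ tri 2 25 17 $ tri 1 30 16 $ tri 21 30 28 $ tri 30 16 28 $ tri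
        20 31 16 $ tri 16 31 28 $ tri 28 31 25 $ contra 25 16 17 28 31) $ alt (fl 0F 3F 1F) (tri 2 21 15 $ tri 1 30 14 $ tri 21 30 22 $ tri 30 14 22 $
        contra 21 14 15 22 30) $ done))
      (split 1 21 2 (alt (fl 0F 2F 1F) (tri 21 30 22 $ tri 1 30 16 $ tri 30 16 22 $ contra 22 1 0 30 16) $ alt (fl 0F 3F 1F) (tri 2 21 15 $ tri 1 30 14
        $ tri 21 30 27 $ tri 30 14 27 $ contra 21 14 15 27 30) $ alt (fl 0F 1F 1F) (split 7 2 1 (alt (fl 3F 3F 0F) (tri 1 14 7 $ tri 2 31 15 $ tri 7 31
        10 $ tri 31 10 15 $ contra 15 7 14 31 10) $ alt (fl 3F 1F 0F) (lift 21 (fl 2F 0F 1F) $ lift 7 (fl 3F 2F 3F) $ lift 2 (fl 0F 2F 0F) $ lift 30 (ln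
        3F 1F) $ lift 31 (pt 2F 1F) $ tri 21 32 2 $ tri 2 32 34 $ tri 7 33 1 $ tri 2 34 1 $ tri 1 33 34 $ tri 30 35 21 $ tri 21 35 32 $ tri 1 33 30 $
        tri 30 35 33 $ tri 2 32 31 $ tri 31 36 32 $ tri 31 36 7 $ tri 7 36 33 $ contra 32 33 34 35 36) $ alt (fl 3F 2F 0F) (tri 7 31 8 $ tri 2 31 17 $
        tri 31 8 17 $ contra 8 2 0 31 17) $ done)) $ done))
      (split 1 21 2 (alt (fl 0F 1F 1F) (lift 18 (fl 2F 1F 2F) $ tri 2 23 13 $ tri 1 30 12 $ tri 21 30 27 $ tri 30 12 27 $ tri 18 31 12 $ tri 12 31 27 $
        tri 27 31 23 $ contra 23 12 13 27 31) $ alt (fl 0F 2F 1F) (tri 21 30 22 $ tri 1 30 16 $ tri 30 16 22 $ contra 22 1 0 30 16) $ alt (fl 0F 3F 1F)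
        (tri 2 21 15 $ tri 1 30 14 $ tri 21 30 28 $ tri 30 14 28 $ contra 21 14 15 28 30) $ done)))
    (split 0 12 1 (alt (ln 1F 1F) (tri 1 12 3 $ tri 0 21 4 $ tri 12 21 18 $ tri 21 4 18 $ contra 12 4 3 18 21) $ alt (ln 2F 2F) (tri 12 21 13 $ tri 0 21
      8 $ tri 21 8 13 $ contra 13 0 2 21 8) $ alt (ln 3F 3F) (lift 19 (fl 3F 2F 2F) $ tri 1 16 5 $ tri 0 21 6 $ tri 12 21 19 $ tri 21 6 19 $ tri 19 22
      16 $ tri 19 22 6 $ contra 16 6 5 19 22) $ done))

  leaf₃ : Proof
  leaf₃ = K₂ 9
    (K₃ 18
      (split 1 21 2 (alt (fl 0F 1F 1F) (tri 2 21 13 $ tri 1 30 12 $ tri 21 30 22 $ tri 30 12 22 $ contra 21 12 13 22 30) $ alt (fl 0F 2F 1F) (lift 19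
        (fl 3F 2F 2F) $ tri 2 23 17 $ tri 1 30 16 $ tri 21 30 27 $ tri 30 16 27 $ tri 19 31 16 $ tri 16 31 27 $ tri 27 31 23 $ contra 23 16 17 27 31) $
        alt (fl 0F 3F 1F) (lift 18 (fl 2F 3F 3F) $ tri 2 25 15 $ tri 1 30 14 $ tri 21 30 28 $ tri 30 14 28 $ tri 18 31 14 $ tri 14 31 28 $ tri 28 31 25
        $ contra 25 14 15 28 31) $ done))
      (split 1 23 2 (alt (fl 0F 1F 2F) (lift 20 (fl 1F 1F 3F) $ tri 2 25 15 $ tri 1 30 14 $ tri 23 30 29 $ tri 30 14 29 $ tri 20 31 14 $ tri 14 31 29 $
        tri 29 31 25 $ contra 25 14 15 29 31) $ alt (fl 0F 2F 2F) (tri 23 30 24 $ tri 1 30 12 $ tri 30 12 24 $ contra 24 1 0 30 12) $ alt (fl 0F 3F 2F)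
        (tri 2 23 17 $ tri 1 30 16 $ tri 23 30 27 $ tri 30 16 27 $ contra 23 16 17 27 30) $ done))
      (split 1 21 2 (alt (fl 0F 1F 1F) (tri 2 21 13 $ tri 1 30 12 $ tri 21 30 28 $ tri 30 12 28 $ contra 21 12 13 28 30) $ alt (fl 0F 2F 1F) (lift 19
        (fl 3F 2F 2F) $ tri 2 23 17 $ tri 1 30 16 $ tri 21 30 27 $ tri 30 16 27 $ tri 19 31 16 $ tri 16 31 27 $ tri 27 31 23 $ contra 23 16 17 27 31) $
        alt (fl 0F 3F 1F) (tri 21 30 22 $ tri 1 30 14 $ tri 30 14 22 $ contra 22 1 0 30 14) $ done))
      (split 1 21 2 (alt (fl 0F 1F 1F) (tri 2 21 13 $ tri 1 30 12 $ tri 21 30 27 $ tri 30 12 27 $ contra 21 12 13 27 30) $ alt (fl 0F 3F 1F) (tri 21 30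
        22 $ tri 1 30 14 $ tri 30 14 22 $ contra 22 1 0 30 14) $ alt (fl 0F 2F 1F) (split 3 16 1 (alt (fl 1F 2F 3F) (lift 9 (fl 1F 0F 3F) $ tri 1 30 16
        $ tri 21 30 28 $ tri 30 16 28 $ tri 16 31 28 $ tri 28 31 25 $ tri 31 25 3 $ tri 9 32 3 $ tri 3 32 25 $ tri 25 32 2 $ contra 3 2 1 25 32) $ alt
        (fl 1F 1F 2F) (tri 1 16 5 $ tri 3 31 9 $ tri 16 31 20 $ tri 31 9 20 $ contra 16 9 5 20 31) $ alt (fl 1F 3F 1F) (tri 1 12 3 $ tri 16 31 19 $ tri
        3 31 4 $ tri 31 4 19 $ contra 19 3 12 31 4) $ done)) $ done))
      (split 1 21 2 (alt (fl 0F 1F 1F) (tri 2 21 13 $ tri 1 30 12 $ tri 21 30 28 $ tri 30 12 28 $ contra 21 12 13 28 30) $ alt (fl 0F 2F 1F) (tri 21 30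
        22 $ tri 1 30 16 $ tri 30 16 22 $ contra 22 1 0 30 16) $ alt (fl 0F 3F 1F) (split 3 2 1 (alt (fl 1F 1F 0F) (tri 1 12 3 $ tri 2 31 13 $ tri 3 31
        10 $ tri 31 10 13 $ contra 13 3 12 31 10) $ alt (fl 1F 2F 0F) (tri 3 31 4 $ tri 2 31 17 $ tri 31 4 17 $ contra 4 2 0 31 17) $ alt (fl 1F 3F 0F)
        (lift 21 (fl 2F 0F 1F) $ lift 3 (fl 1F 2F 2F) $ lift 2 (fl 0F 2F 0F) $ lift 30 (ln 2F 3F) $ lift 31 (pt 2F 3F) $ tri 21 32 2 $ tri 2 32 34 $ tri
        3 33 1 $ tri 2 34 1 $ tri 1 33 34 $ tri 30 35 21 $ tri 21 35 32 $ tri 1 33 30 $ tri 30 35 33 $ tri 2 32 31 $ tri 31 36 32 $ tri 31 36 3 $ tri 3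
        36 33 $ contra 32 33 34 35 36) $ done)) $ done))
      (split 1 21 2 (alt (fl 0F 1F 1F) (tri 2 21 13 $ tri 1 30 12 $ tri 21 30 27 $ tri 30 12 27 $ contra 21 12 13 27 30) $ alt (fl 0F 2F 1F) (tri 21 30
        22 $ tri 1 30 16 $ tri 30 16 22 $ contra 22 1 0 30 16) $ alt (fl 0F 3F 1F) (lift 18 (fl 2F 3F 3F) $ tri 2 25 15 $ tri 1 30 14 $ tri 21 30 28 $
        tri 30 14 28 $ tri 18 31 14 $ tri 14 31 28 $ tri 28 31 25 $ contra 25 14 15 28 31) $ done)))
    (split 0 12 1 (alt (ln 1F 1F) (tri 12 21 13 $ tri 0 21 6 $ tri 21 6 13 $ contra 13 0 2 21 6) $ alt (ln 2F 2F) (tri 1 12 3 $ tri 0 21 4 $ tri 12 21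
      19 $ tri 21 4 19 $ contra 12 4 3 19 21) $ alt (ln 3F 3F) (lift 18 (fl 2F 1F 1F) $ tri 1 14 7 $ tri 0 21 8 $ tri 12 21 18 $ tri 21 8 18 $ tri 18 22
      14 $ tri 18 22 8 $ contra 14 8 7 18 22) $ done))
    (split 0 12 1 (alt (ln 1F 1F) (lift 19 (fl 3F 3F 3F) $ tri 1 16 5 $ tri 0 21 6 $ tri 12 21 19 $ tri 21 6 19 $ tri 19 22 16 $ tri 19 22 6 $ contra 16
      6 5 19 22) $ alt (ln 2F 2F) (tri 1 12 3 $ tri 0 21 4 $ tri 12 21 18 $ tri 21 4 18 $ contra 12 4 3 18 21) $ alt (ln 3F 3F) (tri 12 21 13 $ tri 0 21
      8 $ tri 21 8 13 $ contra 13 0 2 21 8) $ done))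
    (K₃ 18
      (split 1 21 2 (alt (fl 0F 1F 1F) (tri 21 30 22 $ tri 1 30 12 $ tri 30 12 22 $ contra 22 1 0 30 12) $ alt (fl 0F 2F 1F) (tri 2 21 17 $ tri 1 30 16
        $ tri 21 30 27 $ tri 30 16 27 $ contra 21 16 17 27 30) $ alt (fl 0F 3F 1F) (split 5 2 1 (alt (fl 2F 1F 0F) (tri 5 31 6 $ tri 2 31 13 $ tri 31 6
        13 $ contra 6 2 0 31 13) $ alt (fl 2F 2F 0F) (tri 1 16 5 $ tri 2 31 17 $ tri 5 31 11 $ tri 31 11 17 $ contra 17 5 16 31 11) $ alt (fl 2F 3F 0F)
        (lift 21 (fl 1F 0F 1F) $ lift 5 (fl 2F 1F 3F) $ lift 2 (fl 0F 1F 0F) $ lift 30 (ln 3F 3F) $ lift 31 (pt 1F 3F) $ tri 21 32 2 $ tri 2 32 34 $ tri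
        5 33 1 $ tri 2 34 1 $ tri 1 33 34 $ tri 30 35 21 $ tri 21 35 32 $ tri 1 33 30 $ tri 30 35 33 $ tri 2 32 31 $ tri 31 36 32 $ tri 31 36 5 $ tri 5
        36 33 $ contra 32 33 34 35 36) $ done)) $ done))
      (split 1 21 2 (alt (fl 0F 1F 1F) (tri 21 30 22 $ tri 1 30 12 $ tri 30 12 22 $ contra 22 1 0 30 12) $ alt (fl 0F 2F 1F) (tri 2 21 17 $ tri 1 30 16
        $ tri 21 30 28 $ tri 30 16 28 $ contra 21 16 17 28 30) $ alt (fl 0F 3F 1F) (lift 20 (fl 1F 3F 2F) $ tri 2 23 15 $ tri 1 30 14 $ tri 21 30 27 $
        tri 30 14 27 $ tri 20 31 14 $ tri 14 31 27 $ tri 27 31 23 $ contra 23 14 15 27 31) $ done))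
      (split 1 21 2 (alt (fl 0F 1F 1F) (lift 19 (fl 3F 1F 3F) $ tri 2 25 13 $ tri 1 30 12 $ tri 21 30 28 $ tri 30 12 28 $ tri 19 31 12 $ tri 12 31 28 $
        tri 28 31 25 $ contra 25 12 13 28 31) $ alt (fl 0F 2F 1F) (tri 2 21 17 $ tri 1 30 16 $ tri 21 30 27 $ tri 30 16 27 $ contra 21 16 17 27 30) $
        alt (fl 0F 3F 1F) (tri 21 30 22 $ tri 1 30 14 $ tri 30 14 22 $ contra 22 1 0 30 14) $ done))
      (split 1 21 2 (alt (fl 0F 2F 1F) (tri 2 21 17 $ tri 1 30 16 $ tri 21 30 28 $ tri 30 16 28 $ contra 21 16 17 28 30) $ alt (fl 0F 3F 1F) (tri 21 30
        22 $ tri 1 30 14 $ tri 30 14 22 $ contra 22 1 0 30 14) $ alt (fl 0F 1F 1F) (split 5 12 1 (alt (fl 2F 3F 1F) (tri 1 16 5 $ tri 12 31 19 $ tri 5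
        31 6 $ tri 31 6 19 $ contra 19 5 16 31 6) $ alt (fl 2F 1F 2F) (lift 9 (fl 2F 0F 2F) $ tri 1 30 12 $ tri 21 30 27 $ tri 30 12 27 $ tri 12 31 27 $
        tri 27 31 23 $ tri 31 23 5 $ tri 9 32 5 $ tri 5 32 23 $ tri 23 32 2 $ contra 5 2 1 23 32) $ alt (fl 2F 2F 3F) (tri 1 12 3 $ tri 5 31 9 $ tri 12
        31 18 $ tri 31 9 18 $ contra 12 9 3 18 31) $ done)) $ done))
      (split 1 21 2 (alt (fl 0F 1F 1F) (lift 19 (fl 3F 1F 3F) $ tri 2 25 13 $ tri 1 30 12 $ tri 21 30 28 $ tri 30 12 28 $ tri 19 31 12 $ tri 12 31 28 $
        tri 28 31 25 $ contra 25 12 13 28 31) $ alt (fl 0F 2F 1F) (tri 2 21 17 $ tri 1 30 16 $ tri 21 30 22 $ tri 30 16 22 $ contra 21 16 17 22 30) $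
        alt (fl 0F 3F 1F) (lift 20 (fl 1F 3F 2F) $ tri 2 23 15 $ tri 1 30 14 $ tri 21 30 27 $ tri 30 14 27 $ tri 20 31 14 $ tri 14 31 27 $ tri 27 31 23
        $ contra 23 14 15 27 31) $ done))
      (split 1 23 2 (alt (fl 0F 1F 2F) (tri 2 23 15 $ tri 1 30 14 $ tri 23 30 27 $ tri 30 14 27 $ contra 23 14 15 27 30) $ alt (fl 0F 2F 2F) (lift 18
        (fl 2F 2F 3F) $ tri 2 25 13 $ tri 1 30 12 $ tri 23 30 29 $ tri 30 12 29 $ tri 18 31 12 $ tri 12 31 29 $ tri 29 31 25 $ contra 25 12 13 29 31) $
        alt (fl 0F 3F 2F) (tri 23 30 24 $ tri 1 30 16 $ tri 30 16 24 $ contra 24 1 0 30 16) $ done)))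
    (split 3 14 1 (alt (fl 1F 3F 2F) (tri 1 14 7 $ tri 3 21 10 $ tri 14 21 18 $ tri 21 10 18 $ contra 14 10 7 18 21) $ alt (fl 1F 1F 3F) (lift 15 (fl 2F
      2F 0F) $ tri 3 21 4 $ tri 14 21 15 $ tri 21 4 15 $ tri 15 22 4 $ tri 15 22 2 $ contra 4 2 0 15 22) $ alt (fl 1F 2F 1F) (lift 20 (ln 2F 3F) $ tri 1
      16 5 $ tri 3 21 9 $ tri 14 21 20 $ tri 21 9 20 $ tri 20 22 16 $ tri 20 22 9 $ contra 16 9 5 20 22) $ done))
    (split 0 14 1 (alt (ln 1F 3F) (tri 1 14 7 $ tri 0 21 8 $ tri 14 21 18 $ tri 21 8 18 $ contra 14 8 7 18 21) $ alt (ln 2F 1F) (lift 20 (fl 1F 2F 3F) $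
      tri 1 16 5 $ tri 0 21 6 $ tri 14 21 20 $ tri 21 6 20 $ tri 20 22 16 $ tri 20 22 6 $ contra 16 6 5 20 22) $ alt (ln 3F 2F) (tri 14 21 15 $ tri 0 21
      4 $ tri 21 4 15 $ contra 15 0 2 21 4) $ done))

  leaf₄ : Proof
  leaf₄ = K₂ 9
    (split 0 12 1 (alt (ln 1F 1F) (tri 12 21 13 $ tri 0 21 8 $ tri 21 8 13 $ contra 13 0 2 21 8) $ alt (ln 2F 2F) (tri 1 12 3 $ tri 0 21 4 $ tri 12 21
      18 $ tri 21 4 18 $ contra 12 4 3 18 21) $ alt (ln 3F 3F) (lift 19 (fl 3F 2F 2F) $ tri 1 16 5 $ tri 0 21 6 $ tri 12 21 19 $ tri 21 6 19 $ tri 19 22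
      16 $ tri 19 22 6 $ contra 16 6 5 19 22) $ done))
    (split 3 16 1 (alt (fl 1F 2F 3F) (tri 1 16 5 $ tri 3 21 9 $ tri 16 21 19 $ tri 21 9 19 $ contra 16 9 5 19 21) $ alt (fl 1F 1F 2F) (lift 20 (ln 1F
      3F) $ tri 1 14 7 $ tri 3 21 10 $ tri 16 21 20 $ tri 21 10 20 $ tri 20 22 14 $ tri 20 22 10 $ contra 14 10 7 20 22) $ alt (fl 1F 3F 1F) (lift 17
      (fl 3F 2F 0F) $ tri 3 21 4 $ tri 16 21 17 $ tri 21 4 17 $ tri 17 22 4 $ tri 17 22 2 $ contra 4 2 0 17 22) $ done))
    (split 3 14 1 (alt (fl 1F 3F 2F) (lift 20 (ln 3F 1F) $ tri 1 16 5 $ tri 3 21 9 $ tri 14 21 20 $ tri 21 9 20 $ tri 20 22 16 $ tri 20 22 9 $ contra 16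
      9 5 20 22) $ alt (fl 1F 1F 3F) (lift 15 (fl 2F 2F 0F) $ tri 3 21 4 $ tri 14 21 15 $ tri 21 4 15 $ tri 15 22 4 $ tri 15 22 2 $ contra 4 2 0 15 22)
      $ alt (fl 1F 2F 1F) (tri 1 14 7 $ tri 3 21 10 $ tri 14 21 18 $ tri 21 10 18 $ contra 14 10 7 18 21) $ done))
    (split 0 12 1 (alt (ln 1F 1F) (lift 18 (fl 2F 2F 2F) $ tri 1 14 7 $ tri 0 21 8 $ tri 12 21 18 $ tri 21 8 18 $ tri 18 22 14 $ tri 18 22 8 $ contra 14
      8 7 18 22) $ alt (ln 2F 2F) (tri 1 12 3 $ tri 0 21 4 $ tri 12 21 19 $ tri 21 4 19 $ contra 12 4 3 19 21) $ alt (ln 3F 3F) (tri 12 21 13 $ tri 0 21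
      6 $ tri 21 6 13 $ contra 13 0 2 21 6) $ done))
    (split 0 14 1 (alt (ln 1F 3F) (tri 14 21 15 $ tri 0 21 6 $ tri 21 6 15 $ contra 15 0 2 21 6) $ alt (ln 2F 1F) (tri 1 14 7 $ tri 0 21 8 $ tri 14 21
      20 $ tri 21 8 20 $ contra 14 8 7 20 21) $ alt (ln 3F 2F) (lift 18 (fl 2F 1F 2F) $ tri 1 12 3 $ tri 0 21 4 $ tri 14 21 18 $ tri 21 4 18 $ tri 18 22
      12 $ tri 18 22 4 $ contra 12 4 3 18 22) $ done))
    (split 5 14 1 (alt (fl 2F 3F 3F) (tri 1 14 7 $ tri 5 21 11 $ tri 14 21 20 $ tri 21 11 20 $ contra 14 11 7 20 21) $ alt (fl 2F 1F 1F) (lift 15 (fl 1F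
      3F 0F) $ tri 5 21 6 $ tri 14 21 15 $ tri 21 6 15 $ tri 15 22 6 $ tri 15 22 2 $ contra 6 2 0 15 22) $ alt (fl 2F 2F 2F) (lift 18 (ln 1F 1F) $ tri 1
      12 3 $ tri 5 21 9 $ tri 14 21 18 $ tri 21 9 18 $ tri 18 22 12 $ tri 18 22 9 $ contra 12 9 3 18 22) $ done))

  leaf₅ : Proof
  leaf₅ = K₂ 9
    (split 0 12 1 (alt (ln 1F 1F) (tri 12 21 13 $ tri 0 21 6 $ tri 21 6 13 $ contra 13 0 2 21 6) $ alt (ln 2F 2F) (lift 18 (fl 2F 3F 3F) $ tri 1 14 7 $
      tri 0 21 8 $ tri 12 21 18 $ tri 21 8 18 $ tri 18 22 14 $ tri 18 22 8 $ contra 14 8 7 18 22) $ alt (ln 3F 3F) (tri 1 12 3 $ tri 0 21 4 $ tri 12 21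
      19 $ tri 21 4 19 $ contra 12 4 3 19 21) $ done))
    (split 3 14 1 (alt (fl 1F 3F 2F) (tri 1 14 7 $ tri 3 21 10 $ tri 14 21 18 $ tri 21 10 18 $ contra 14 10 7 18 21) $ alt (fl 1F 1F 3F) (lift 20 (ln 1F
      2F) $ tri 1 16 5 $ tri 3 21 9 $ tri 14 21 20 $ tri 21 9 20 $ tri 20 22 16 $ tri 20 22 9 $ contra 16 9 5 20 22) $ alt (fl 1F 2F 1F) (lift 15 (fl 2F
      3F 0F) $ tri 3 21 4 $ tri 14 21 15 $ tri 21 4 15 $ tri 15 22 4 $ tri 15 22 2 $ contra 4 2 0 15 22) $ done))
    (split 5 14 1 (alt (fl 2F 3F 3F) (lift 18 (ln 2F 2F) $ tri 1 12 3 $ tri 5 21 9 $ tri 14 21 18 $ tri 21 9 18 $ tri 18 22 12 $ tri 18 22 9 $ contra 12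
      9 3 18 22) $ alt (fl 2F 1F 1F) (tri 1 14 7 $ tri 5 21 11 $ tri 14 21 20 $ tri 21 11 20 $ contra 14 11 7 20 21) $ alt (fl 2F 2F 2F) (lift 15 (fl 1F
      1F 0F) $ tri 5 21 6 $ tri 14 21 15 $ tri 21 6 15 $ tri 15 22 6 $ tri 15 22 2 $ contra 6 2 0 15 22) $ done))
    (split 0 14 1 (alt (ln 1F 3F) (lift 18 (fl 2F 2F 3F) $ tri 1 12 3 $ tri 0 21 4 $ tri 14 21 18 $ tri 21 4 18 $ tri 18 22 12 $ tri 18 22 4 $ contra 12
      4 3 18 22) $ alt (ln 2F 1F) (tri 14 21 15 $ tri 0 21 6 $ tri 21 6 15 $ contra 15 0 2 21 6) $ alt (ln 3F 2F) (tri 1 14 7 $ tri 0 21 8 $ tri 14 21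
      20 $ tri 21 8 20 $ contra 14 8 7 20 21) $ done))
    (split 0 12 1 (alt (ln 1F 1F) (lift 19 (fl 3F 3F 3F) $ tri 1 16 5 $ tri 0 21 6 $ tri 12 21 19 $ tri 21 6 19 $ tri 19 22 16 $ tri 19 22 6 $ contra 16
      6 5 19 22) $ alt (ln 2F 2F) (tri 12 21 13 $ tri 0 21 8 $ tri 21 8 13 $ contra 13 0 2 21 8) $ alt (ln 3F 3F) (tri 1 12 3 $ tri 0 21 4 $ tri 12 21
      18 $ tri 21 4 18 $ contra 12 4 3 18 21) $ done))
    (split 3 16 1 (alt (fl 1F 2F 3F) (lift 20 (ln 2F 1F) $ tri 1 14 7 $ tri 3 21 10 $ tri 16 21 20 $ tri 21 10 20 $ tri 20 22 14 $ tri 20 22 10 $ contra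
      14 10 7 20 22) $ alt (fl 1F 1F 2F) (lift 17 (fl 3F 3F 0F) $ tri 3 21 4 $ tri 16 21 17 $ tri 21 4 17 $ tri 17 22 4 $ tri 17 22 2 $ contra 4 2 0 17
      22) $ alt (fl 1F 3F 1F) (tri 1 16 5 $ tri 3 21 9 $ tri 16 21 19 $ tri 21 9 19 $ contra 16 9 5 19 21) $ done))

  leaf₆ : Proof
  leaf₆ = K₂ 9
    (K₃ 18
      (split 1 21 2 (alt (fl 0F 1F 1F) (tri 2 21 13 $ tri 1 30 12 $ tri 21 30 22 $ tri 30 12 22 $ contra 21 12 13 22 30) $ alt (fl 0F 2F 1F) (lift 19
        (fl 3F 2F 2F) $ tri 2 23 17 $ tri 1 30 16 $ tri 21 30 27 $ tri 30 16 27 $ tri 19 31 16 $ tri 16 31 27 $ tri 27 31 23 $ contra 23 16 17 27 31) $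
        alt (fl 0F 3F 1F) (lift 18 (fl 2F 3F 3F) $ tri 2 25 15 $ tri 1 30 14 $ tri 21 30 28 $ tri 30 14 28 $ tri 18 31 14 $ tri 14 31 28 $ tri 28 31 25
        $ contra 25 14 15 28 31) $ done))
      (split 1 23 2 (alt (fl 0F 1F 2F) (lift 20 (fl 1F 1F 3F) $ tri 2 25 15 $ tri 1 30 14 $ tri 23 30 29 $ tri 30 14 29 $ tri 20 31 14 $ tri 14 31 29 $
        tri 29 31 25 $ contra 25 14 15 29 31) $ alt (fl 0F 2F 2F) (tri 23 30 24 $ tri 1 30 12 $ tri 30 12 24 $ contra 24 1 0 30 12) $ alt (fl 0F 3F 2F)
        (tri 2 23 17 $ tri 1 30 16 $ tri 23 30 27 $ tri 30 16 27 $ contra 23 16 17 27 30) $ done))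
      (split 1 21 2 (alt (fl 0F 1F 1F) (tri 2 21 13 $ tri 1 30 12 $ tri 21 30 28 $ tri 30 12 28 $ contra 21 12 13 28 30) $ alt (fl 0F 2F 1F) (lift 19
        (fl 3F 2F 2F) $ tri 2 23 17 $ tri 1 30 16 $ tri 21 30 27 $ tri 30 16 27 $ tri 19 31 16 $ tri 16 31 27 $ tri 27 31 23 $ contra 23 16 17 27 31) $
        alt (fl 0F 3F 1F) (tri 21 30 22 $ tri 1 30 14 $ tri 30 14 22 $ contra 22 1 0 30 14) $ done))
      (split 1 21 2 (alt (fl 0F 1F 1F) (tri 2 21 13 $ tri 1 30 12 $ tri 21 30 27 $ tri 30 12 27 $ contra 21 12 13 27 30) $ alt (fl 0F 3F 1F) (tri 21 30
        22 $ tri 1 30 14 $ tri 30 14 22 $ contra 22 1 0 30 14) $ alt (fl 0F 2F 1F) (split 3 2 1 (alt (fl 1F 1F 0F) (tri 1 12 3 $ tri 2 31 13 $ tri 3 31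
        9 $ tri 31 9 13 $ contra 13 3 12 31 9) $ alt (fl 1F 2F 0F) (lift 21 (fl 3F 0F 1F) $ lift 3 (fl 1F 3F 3F) $ lift 2 (fl 0F 3F 0F) $ lift 30 (ln 3F
        2F) $ lift 31 (pt 3F 2F) $ tri 21 32 2 $ tri 2 32 34 $ tri 3 33 1 $ tri 2 34 1 $ tri 1 33 34 $ tri 30 35 21 $ tri 21 35 32 $ tri 1 33 30 $ tri
        30 35 33 $ tri 2 32 31 $ tri 31 36 32 $ tri 31 36 3 $ tri 3 36 33 $ contra 32 33 34 35 36) $ alt (fl 1F 3F 0F) (tri 3 31 4 $ tri 2 31 15 $ tri
        31 4 15 $ contra 4 2 0 31 15) $ done)) $ done))
      (split 1 21 2 (alt (fl 0F 1F 1F) (tri 2 21 13 $ tri 1 30 12 $ tri 21 30 28 $ tri 30 12 28 $ contra 21 12 13 28 30) $ alt (fl 0F 2F 1F) (tri 21 30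
        22 $ tri 1 30 16 $ tri 30 16 22 $ contra 22 1 0 30 16) $ alt (fl 0F 3F 1F) (split 3 14 1 (alt (fl 1F 3F 2F) (lift 10 (fl 1F 0F 2F) $ tri 1 30 14
        $ tri 21 30 27 $ tri 30 14 27 $ tri 14 31 27 $ tri 27 31 23 $ tri 31 23 3 $ tri 10 32 3 $ tri 3 32 23 $ tri 23 32 2 $ contra 3 2 1 23 32) $ alt
        (fl 1F 1F 3F) (tri 1 14 7 $ tri 3 31 10 $ tri 14 31 20 $ tri 31 10 20 $ contra 14 10 7 20 31) $ alt (fl 1F 2F 1F) (tri 1 12 3 $ tri 14 31 18 $
        tri 3 31 4 $ tri 31 4 18 $ contra 18 3 12 31 4) $ done)) $ done))
      (split 1 21 2 (alt (fl 0F 1F 1F) (tri 2 21 13 $ tri 1 30 12 $ tri 21 30 27 $ tri 30 12 27 $ contra 21 12 13 27 30) $ alt (fl 0F 2F 1F) (tri 21 30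
        22 $ tri 1 30 16 $ tri 30 16 22 $ contra 22 1 0 30 16) $ alt (fl 0F 3F 1F) (lift 18 (fl 2F 3F 3F) $ tri 2 25 15 $ tri 1 30 14 $ tri 21 30 28 $
        tri 30 14 28 $ tri 18 31 14 $ tri 14 31 28 $ tri 28 31 25 $ contra 25 14 15 28 31) $ done)))
    (split 0 12 1 (alt (ln 1F 1F) (tri 12 21 13 $ tri 0 21 8 $ tri 21 8 13 $ contra 13 0 2 21 8) $ alt (ln 2F 2F) (lift 19 (fl 3F 1F 1F) $ tri 1 16 5 $
      tri 0 21 6 $ tri 12 21 19 $ tri 21 6 19 $ tri 19 22 16 $ tri 19 22 6 $ contra 16 6 5 19 22) $ alt (ln 3F 3F) (tri 1 12 3 $ tri 0 21 4 $ tri 12 21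
      18 $ tri 21 4 18 $ contra 12 4 3 18 21) $ done))
    (split 0 14 1 (alt (ln 1F 3F) (tri 14 21 15 $ tri 0 21 4 $ tri 21 4 15 $ contra 15 0 2 21 4) $ alt (ln 2F 1F) (tri 1 14 7 $ tri 0 21 8 $ tri 14 21
      18 $ tri 21 8 18 $ contra 14 8 7 18 21) $ alt (ln 3F 2F) (lift 20 (fl 1F 3F 1F) $ tri 1 16 5 $ tri 0 21 6 $ tri 14 21 20 $ tri 21 6 20 $ tri 20 22
      16 $ tri 20 22 6 $ contra 16 6 5 20 22) $ done))
    (split 3 14 1 (alt (fl 1F 3F 2F) (lift 20 (ln 3F 1F) $ tri 1 16 5 $ tri 3 21 9 $ tri 14 21 20 $ tri 21 9 20 $ tri 20 22 16 $ tri 20 22 9 $ contra 16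
      9 5 20 22) $ alt (fl 1F 1F 3F) (tri 1 14 7 $ tri 3 21 10 $ tri 14 21 18 $ tri 21 10 18 $ contra 14 10 7 18 21) $ alt (fl 1F 2F 1F) (lift 15 (fl 2F
      3F 0F) $ tri 3 21 4 $ tri 14 21 15 $ tri 21 4 15 $ tri 15 22 4 $ tri 15 22 2 $ contra 4 2 0 15 22) $ done))
    (K₃ 18
      (split 1 21 2 (alt (fl 0F 1F 1F) (tri 21 30 22 $ tri 1 30 12 $ tri 30 12 22 $ contra 22 1 0 30 12) $ alt (fl 0F 3F 1F) (tri 2 21 15 $ tri 1 30 14
        $ tri 21 30 28 $ tri 30 14 28 $ contra 21 14 15 28 30) $ alt (fl 0F 2F 1F) (split 7 2 1 (alt (fl 3F 3F 0F) (tri 1 14 7 $ tri 2 31 15 $ tri 7 31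
        11 $ tri 31 11 15 $ contra 15 7 14 31 11) $ alt (fl 3F 1F 0F) (tri 7 31 8 $ tri 2 31 13 $ tri 31 8 13 $ contra 8 2 0 31 13) $ alt (fl 3F 2F 0F)
        (lift 21 (fl 1F 0F 1F) $ lift 7 (fl 3F 1F 2F) $ lift 2 (fl 0F 1F 0F) $ lift 30 (ln 2F 2F) $ lift 31 (pt 1F 2F) $ tri 21 32 2 $ tri 2 32 34 $ tri
        7 33 1 $ tri 2 34 1 $ tri 1 33 34 $ tri 30 35 21 $ tri 21 35 32 $ tri 1 33 30 $ tri 30 35 33 $ tri 2 32 31 $ tri 31 36 32 $ tri 31 36 7 $ tri 7
        36 33 $ contra 32 33 34 35 36) $ done)) $ done))
      (split 1 21 2 (alt (fl 0F 1F 1F) (tri 21 30 22 $ tri 1 30 12 $ tri 30 12 22 $ contra 22 1 0 30 12) $ alt (fl 0F 2F 1F) (lift 20 (fl 1F 2F 3F) $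
        tri 2 25 17 $ tri 1 30 16 $ tri 21 30 28 $ tri 30 16 28 $ tri 20 31 16 $ tri 16 31 28 $ tri 28 31 25 $ contra 25 16 17 28 31) $ alt (fl 0F 3F
        1F) (tri 2 21 15 $ tri 1 30 14 $ tri 21 30 27 $ tri 30 14 27 $ contra 21 14 15 27 30) $ done))
      (split 1 23 2 (alt (fl 0F 1F 2F) (tri 23 30 24 $ tri 1 30 14 $ tri 30 14 24 $ contra 24 1 0 30 14) $ alt (fl 0F 2F 2F) (tri 2 23 13 $ tri 1 30 12
        $ tri 23 30 27 $ tri 30 12 27 $ contra 23 12 13 27 30) $ alt (fl 0F 3F 2F) (lift 19 (fl 3F 3F 3F) $ tri 2 25 17 $ tri 1 30 16 $ tri 23 30 29 $
        tri 30 16 29 $ tri 19 31 16 $ tri 16 31 29 $ tri 29 31 25 $ contra 25 16 17 29 31) $ done))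
      (split 1 21 2 (alt (fl 0F 1F 1F) (lift 18 (fl 2F 1F 2F) $ tri 2 23 13 $ tri 1 30 12 $ tri 21 30 27 $ tri 30 12 27 $ tri 18 31 12 $ tri 12 31 27 $
        tri 27 31 23 $ contra 23 12 13 27 31) $ alt (fl 0F 2F 1F) (lift 20 (fl 1F 2F 3F) $ tri 2 25 17 $ tri 1 30 16 $ tri 21 30 28 $ tri 30 16 28 $ tri
        20 31 16 $ tri 16 31 28 $ tri 28 31 25 $ contra 25 16 17 28 31) $ alt (fl 0F 3F 1F) (tri 2 21 15 $ tri 1 30 14 $ tri 21 30 22 $ tri 30 14 22 $
        contra 21 14 15 22 30) $ done))
      (split 1 21 2 (alt (fl 0F 2F 1F) (tri 21 30 22 $ tri 1 30 16 $ tri 30 16 22 $ contra 22 1 0 30 16) $ alt (fl 0F 3F 1F) (tri 2 21 15 $ tri 1 30 14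
        $ tri 21 30 27 $ tri 30 14 27 $ contra 21 14 15 27 30) $ alt (fl 0F 1F 1F) (split 5 2 1 (alt (fl 2F 1F 0F) (tri 1 16 5 $ tri 2 31 17 $ tri 5 31
        9 $ tri 31 9 17 $ contra 17 5 16 31 9) $ alt (fl 2F 2F 0F) (tri 5 31 6 $ tri 2 31 15 $ tri 31 6 15 $ contra 6 2 0 31 15) $ alt (fl 2F 3F 0F)
        (lift 10 (fl 3F 0F 3F) $ tri 10 32 7 $ lift 11 (fl 3F 1F 3F) $ tri 5 31 11 $ tri 2 31 13 $ tri 31 11 13 $ tri 11 33 13 $ tri 13 33 12 $ tri 1 30
        12 $ tri 21 30 28 $ tri 30 12 28 $ tri 12 33 28 $ tri 28 33 25 $ tri 11 33 7 $ tri 33 25 7 $ tri 7 25 32 $ tri 25 32 2 $ contra 7 2 1 32 25) $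
        done)) $ done))
      (split 1 21 2 (alt (fl 0F 1F 1F) (lift 18 (fl 2F 1F 2F) $ tri 2 23 13 $ tri 1 30 12 $ tri 21 30 27 $ tri 30 12 27 $ tri 18 31 12 $ tri 12 31 27 $
        tri 27 31 23 $ contra 23 12 13 27 31) $ alt (fl 0F 2F 1F) (tri 21 30 22 $ tri 1 30 16 $ tri 30 16 22 $ contra 22 1 0 30 16) $ alt (fl 0F 3F 1F)
        (tri 2 21 15 $ tri 1 30 14 $ tri 21 30 28 $ tri 30 14 28 $ contra 21 14 15 28 30) $ done)))
    (split 0 12 1 (alt (ln 1F 1F) (lift 18 (fl 2F 2F 2F) $ tri 1 14 7 $ tri 0 21 8 $ tri 12 21 18 $ tri 21 8 18 $ tri 18 22 14 $ tri 18 22 8 $ contra 14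
      8 7 18 22) $ alt (ln 2F 2F) (tri 12 21 13 $ tri 0 21 6 $ tri 21 6 13 $ contra 13 0 2 21 6) $ alt (ln 3F 3F) (tri 1 12 3 $ tri 0 21 4 $ tri 12 21
      19 $ tri 21 4 19 $ contra 12 4 3 19 21) $ done))



  -- Number 0 and all numbers not yet assigned have the code `∞`, in accordance with the default
  -- vertex `x₀` in the final application.
  startCode : ℕ → Code
  startCode 1 = pt 0F 0F
  startCode 2 = ln 0F 0F
  startCode _ = ∞

  startEdges : List (ℕ × ℕ)
  startEdges = (0 , 1) ∷ (0 , 2) ∷ (1 , 2) ∷ []

  -- Opaque, lest the check be repeated where it is used.
  opaque
    refutation : Proof
    refutation = K₁ 0 leaf₁ leaf₂ leaf₃ leaf₄ leaf₅ leaf₆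

    refuted : T (check codes 3 startCode startEdges refutation)
    refuted = tt

-- Nonexistence of distance-regular antipodal 6-covers of Δ.

open import Defs
open import Data.Nat using (ℕ; zero; suc; z≤n; s≤s)
open import Data.Fin using (Fin)
open import Data.Product using (Σ; _×_; _,_; proj₁; proj₂; ∃-syntax)
open import Data.Empty using (⊥)
open import Data.List.Relation.Unary.All using ([]; _∷_)
open import Function using (_∘_)
open import Relation.Nullary using (¬_)
open import Relation.Binary.PropositionalEquality using (_≡_; refl; trans; cong; cong₂)
open PencilNames using (0F)
open Flags using (Code; ∞; pt; ln; adjC)

open Covers using (module Distance; module Antipodal)
open Refutations using (module Soundness; codes; ∈-codes)
open Certificate using (startCode; startEdges; refutation; refuted)

no-6-cover : ∀ {n} (Γ : Graph n) (Δ : Graph 105) → IsSRG Δ 105 32 4 12 → (θ : Fin n → Fin 105) →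
  IsAntipodalRCover 6 Γ Δ θ → DistanceRegular Γ → ⊥
no-6-cover {n} Γ Δ srg θ cover regular = triangle₀
    (lift x₀ (pt 0F 0F) (trans (cong (λ c → adjC c (pt 0F 0F)) κx₀) refl)) (lift x₀ (ln 0F 0F) (trans (cong (λ c → adjC c (ln 0F 0F)) κx₀) refl))
  where
  open Distance Γ
  open Antipodal Γ Δ srg θ cover regular
  open Soundness κ _~_ ~-sym κ-adj lift uniq tri adjC-irr second no-third codes ∈-codes
  x₀ : Fin n
  x₀ = proj₁ base
  κx₀ : κ x₀ ≡ ∞
  κx₀ = proj₂ base
  triangle₀ : ∃[ y ] (x₀ ~ y × κ y ≡ pt 0F 0F) → ∃[ z ] (x₀ ~ z × κ z ≡ ln 0F 0F) → ⊥
  triangle₀ (y , xy , κy) (z , xz , κz) = sound refutation 3 ν startCode startEdges ν-code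
      ((s≤s z≤n , s≤s (s≤s z≤n) , xy) ∷ (s≤s z≤n , s≤s (s≤s (s≤s z≤n)) , xz) ∷ (s≤s (s≤s z≤n) , s≤s (s≤s (s≤s z≤n)) , tri xy xz (trans (cong₂ adjC κy κz) refl)) ∷ [])
      refuted
    where
    ν : ℕ → Fin n
    ν 0 = x₀
    ν 1 = y
    ν 2 = z
    ν (suc (suc (suc _))) = x₀
    ν-code : ∀ i → κ (ν i) ≡ startCode i
    ν-code 0 = κx₀
    ν-code 1 = κy
    ν-code 2 = κz
    ν-code (suc (suc (suc _))) = κx₀

theorem4p9 : (Δ : Graph 105) → IsSRG Δ 105 32 4 12 →
    (m : ℕ) (Δ̂ : Graph m) (θ₁ : Fin m → Fin 105) →
    IsRCover 3 Δ̂ Δ θ₁ → Connected Δ̂ → DistanceRegular Δ̂ →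
    ¬ (Σ ℕ λ k → Σ (Graph k) λ Γ → Σ (Fin k → Fin m) λ θ₂ →
    IsRCover 2 Γ Δ̂ θ₂ × IsAntipodalRCover 6 Γ Δ (θ₁ ∘ θ₂) × DistanceRegular Γ)
theorem4p9 Δ srg m Δ̂ θ₁ _ _ _ (k , Γ , θ₂ , _ , cover , regular) = no-6-cover Γ Δ srg (θ₁ ∘ θ₂) cover regular
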